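{- (1) The triple $(\mathcal{T}_\bullet,\overline{\ast},\hat{\delta})$ is a graded connected cocommutative Hopf algebra (with unit the empty set composition and counit the projection onto $\mathcal{T}_0$). (2) The triple $(\mathcal{T}_\bullet,\hat{\ast},\overline{\delta})$ is a graded connected Hopf algebra, and it is isomorphic to the graded dual $\mathsf{NCQsym}^*$ of the Hopf algebra $\mathsf{NCQsym}$ of quasi-symmetric functions in non-commuting variables; an isomorphism is given by sending each set composition $P$ to the element $W_P$ of the basis of $\mathsf{NCQsym}^*$ dual to the basis $(M_P)$ of $\mathsf{NCQsym}$.
   Context: For a finite set $S\subset\mathbb{N}$, a set composition of $S$ is a tuple $(P_1,\ldots,P_k)$ of pairwise disjoint non-empty subsets of $S$ with union $S$; $\mathsf{Comp}_n$ is the set of set compositions of $[n]=\{1,\ldots,n\}$ ($[0]=\emptyset$, $\mathsf{Comp}_0$ consists of the empty tuple). $\mathcal{T}_n$ is the free $\mathbb{Z}$-module on $\mathsf{Comp}_n$ and $\mathcal{T}_\bullet=\bigoplus_{n\ge0}\mathcal{T}_n$, graded by $n$. For finite $S,T\subset\mathbb{N}$ with $|S|=|T|$, $\mathsf{is}_{S,T}$ maps a set composition of $S$ to a set composition of $T$ by applying the unique order-preserving bijection $S\to T$ to each block; $\mathsf{is}_S=\mathsf{is}_{S,[|S|]}$. For $P=(P_1,\ldots,P_k)\in\mathsf{Comp}_n$ and $A\subseteq[n]$, $P|_A=\mathsf{is}_A((P_1\cap A,\ldots,P_k\cap A)^\#)$, where $^\#$ deletes empty entries. For set compositions $P$ of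 $S$ and $Q$ of $T$ with $S\cap T=\emptyset$, $P\ast Q$ is the concatenated tuple. Write $p+X=\{p+x:x\in X\}$. Products and coproducts (extended linearly): for $P=(P_1,\ldots,P_k)\in\mathsf{Comp}_p$, $Q=(Q_1,\ldots,Q_l)\in\mathsf{Comp}_q$: $P\,\overline{\ast}\,Q=(P_1,\ldots,P_k,p+Q_1,\ldots,p+Q_l)$; $P\,\hat{\ast}\,Q=\sum \mathsf{is}_{[p],A}(P)\ast\mathsf{is}_{[q],B}(Q)$, summed over all ordered pairs $(A,B)$ with $A\sqcup B=[p+q]$, $|A|=p$, $|B|=q$. For $P\in\mathsf{Comp}_n$: $\hat{\delta}(P)=\sum_{A\sqcup B=[n]}P|_A\otimes P|_B$ (over ordered pairs, $A$ or $B$ possibly empty) and $\overline{\delta}(P)=\sum_{p+q=n}P|_{[p]}\otimes P|_{\{p+1,\ldots,p+q\}}$. $\mathsf{NCQsym}$: in the algebra of formal power series in non-commuting variables $x_1,x_2,\ldots$, for $P=(P_1,\ldots,P_k)\in\mathsf{Comp}_n$ let $M_P=\sum x_{i_1}\cdots x_{i_n}$, summed over all words with $i_j=i_{j'}$ iff $j,j'$ lie in the same block and $i_j<i_{j'}$ whenever $j\in P_r$, $j'\in P_s$, $r<s$. $\mathsf{NCQsym}$ is the graded span of the $M_P$, with the product of series and the coproduct $\Delta(M_P)=\sum_{i=0}^k M_{\mathsf{is}(P_1,\ldots,P_i)}\otimes M_{\mathsf{is}(P_{i+1},\ldots,P_k)}$ ($\mathsf{is}$ standardizing the ground set to an initial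 segment); $\mathsf{NCQsym}^*$ is its graded dual with dual basis $(W_P)$. -}

module Defs where

open import Algebra.Bundles using (CommutativeRing)
open import Algebra.Core using (Op₂)
open import Algebra.Module.Bundles using (Module)
open import Algebra.Module.Construct.TensorUnit using (⟨module⟩)
open import Algebra.Module.Core using (Opₗ)
open import Algebra.Module.Morphism.Structures using (IsModuleHomomorphism; IsModuleIsomorphism)
open import Algebra.Module.Structures using (IsLeftSemimodule)
open import Algebra.Module.Structures.Biased using (module IsModuleFromLeft)
open import Algebra.Structures using (IsRing)
open import Data.Bool using (if_then_else_)
open import Data.Fin.Base using (Fin; toℕ; cast)
open import Data.Fin.Properties using (all?)
open import Data.Fin.Subset
  using (Subset; inside; outside; ⊤; ⊥; _∈_; _∩_; _∪_; ∁; ⋃; ∣_∣; Nonempty)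
open import Data.Fin.Subset.Properties
  using (_∈?_; nonempty?; Empty-unique; ∉⊥; x∈p∩q⁺; x∈p∩q⁻; p∩q⊆p; p⊆p∪q; q⊆p∪q;
         ∪-identityˡ; ∪-identityʳ; ∪-assoc; ∪-inverseʳ; ∩-inverseʳ; ∩-zeroˡ; ∩-identityˡ;
         ∩-distribʳ-∪)
open import Data.Integer.Base using (ℤ; 0ℤ; 1ℤ; -1ℤ)
open import Data.Integer.Properties using (+-*-commutativeRing)
open import Data.List.Base
  using (List; []; _∷_; _++_; foldr; length; lookup; map; filter; take; drop; upTo)
open import Data.List.Relation.Unary.All as All using (All; []; _∷_)
open import Data.List.Relation.Unary.AllPairs as AllPairs using (AllPairs; []; _∷_)
open import Data.List.Relation.Unary.Any using (Any; any?)
open import Data.Nat.Base as ℕ using (ℕ; zero; suc; _<_; _≤_)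
open import Data.Nat.Properties using (_≟_; _<?_; m≤m⊔n; m≤n⊔m; ≤-trans)
open import Data.Product.Base using (Σ; Σ-syntax; ∃; ∃-syntax; _×_; _,_; proj₁; proj₂)
open import Data.Vec.Base as Vec using ([]; _∷_; here; there)
open import Function.Base using (id; _∘_)
open import Level using (0ℓ)
open import Relation.Binary.Core using (Rel)
open import Relation.Binary.PropositionalEquality
  using (_≡_; _≢_; refl; sym; trans; cong; cong₂; subst)
open import Relation.Nullary using (Dec; yes; no; does)
open import Relation.Nullary.Decidable using (_×-dec_; _→-dec_)
open import Relation.Unary using (Pred; Decidable)

import Data.List.Relation.Unary.All.Properties as AllP
import Data.List.Relation.Unary.AllPairs.Properties as AllPairsP

ℤ-Module : Set₁
ℤ-Module = Module +-*-commutativeRing 0ℓ 0ℓ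

∣_∣ᴹ : ℤ-Module → Set
∣ M ∣ᴹ = Module.Carrierᴹ M

module ℤR = CommutativeRing +-*-commutativeRing

ℤᴹ : ℤ-Module
ℤᴹ = ⟨module⟩

Linear : (M N : ℤ-Module) → (∣ M ∣ᴹ → ∣ N ∣ᴹ) → Set
Linear M N = IsModuleHomomorphism (Module.rawModule M) (Module.rawModule N)

∑ : (M : ℤ-Module) {A : Set} → List A → (A → ∣ M ∣ᴹ) → ∣ M ∣ᴹ
∑ M as f = foldr (λ a s → f a +ᴹ s) 0ᴹ as
  where open Module M

syntax ∑ M as (λ a → e) = ∑[ a ∈ as ] e In M

fromSemimodule : {C : Set} {_≈_ : Rel C 0ℓ} {_+_ : Op₂ C} {0# : C} {_·_ : Opₗ ℤ C} →
                 IsLeftSemimodule ℤR.semiring _≈_ _+_ 0# _·_ → ℤ-Module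
fromSemimodule {C} {_≈_} {_+_} {0#} {_·_} isL = record
  { -ᴹ_ = -1ℤ ·_
  ; isModule = IsModuleFromLeft.isModule {commutativeRing = +-*-commutativeRing} record
    { isLeftModule = record
      { isLeftSemimodule = isL
      ; -ᴹ‿cong = L.*ₗ-congˡ
      ; -ᴹ‿inverse = inverseˡ , λ x → L.≈ᴹ-trans (L.+ᴹ-comm x _) (inverseˡ x)
      }
    }
  }
  where
  module L = IsLeftSemimodule isL
  inverseˡ : ∀ x → ((-1ℤ · x) + x) ≈ 0#
  inverseˡ x =
    L.≈ᴹ-trans (L.+ᴹ-congˡ (L.≈ᴹ-sym (L.*ₗ-identityˡ x)))
    (L.≈ᴹ-trans (L.≈ᴹ-sym (L.*ₗ-distribʳ x -1ℤ 1ℤ)) (L.*ₗ-zeroˡ x))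

module _ (M N : ℤ-Module) where
  private
    module M = Module M
    module N = Module N

  linear-intro : {f : ∣ M ∣ᴹ → ∣ N ∣ᴹ} →
    (∀ {x y} → x M.≈ᴹ y → f x N.≈ᴹ f y) →
    (∀ x y → f (x M.+ᴹ y) N.≈ᴹ (f x N.+ᴹ f y)) →
    (∀ r x → f (r M.*ₗ x) N.≈ᴹ (r N.*ₗ f x)) →
    Linear M N f
  linear-intro {f} f-cong f-+ f-· = record { isBimoduleHomomorphism = record
    { +ᴹ-isGroupHomomorphism = record
      { isMonoidHomomorphism = record
        { isMagmaHomomorphism = record
          { isRelHomomorphism = record { cong = f-cong }
          ; homo = f-+
          }
        ; ε-homo = f-0
        }
      ; ⁻¹-homo = f-neg
      }
    ; *ₗ-homo = f-·
    ; *ᵣ-homo = λ r x →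
        N.≈ᴹ-trans (f-cong (M.≈ᴹ-sym (M.*ₗ-*ᵣ-coincident r x)))
        (N.≈ᴹ-trans (f-· r x) (N.*ₗ-*ᵣ-coincident r (f x)))
    } }
    where
    f-0 : f M.0ᴹ N.≈ᴹ N.0ᴹ
    f-0 = N.≈ᴹ-trans (f-cong (M.≈ᴹ-sym (M.*ₗ-zeroˡ M.0ᴹ)))
          (N.≈ᴹ-trans (f-· 0ℤ M.0ᴹ) (N.*ₗ-zeroˡ (f M.0ᴹ)))
    f-neg : ∀ x → f (M.-ᴹ x) N.≈ᴹ (N.-ᴹ f x)
    f-neg x =
      N.≈ᴹ-trans (N.≈ᴹ-sym (N.+ᴹ-identityʳ _))
      (N.≈ᴹ-trans (N.+ᴹ-congˡ (N.≈ᴹ-sym (N.-ᴹ‿inverseʳ (f x))))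
      (N.≈ᴹ-trans (N.≈ᴹ-sym (N.+ᴹ-assoc _ _ _))
      (N.≈ᴹ-trans (N.+ᴹ-congʳ
        (N.≈ᴹ-trans (N.≈ᴹ-sym (f-+ (M.-ᴹ x) x))
        (N.≈ᴹ-trans (f-cong (M.-ᴹ‿inverseˡ x)) f-0)))
      (N.+ᴹ-identityˡ _))))

infixl 6 _⊞_
infixr 7 _·_

data Lin (G : Set) : Set where
  gen  : G → Lin G
  𝟎    : Lin G
  _⊞_  : Lin G → Lin G → Lin G
  _·_  : ℤ → Lin G → Lin G

-- The least ℤ-module congruence on formal combinations containing R.
data Congruence {G : Set} (R : Rel (Lin G) 0ℓ) : Rel (Lin G) 0ℓ where
  rel        : ∀ {s t} → R s t → Congruence R s t
  ≈-refl     : ∀ {s} → Congruence R s s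
  ≈-sym      : ∀ {s t} → Congruence R s t → Congruence R t s
  ≈-trans    : ∀ {s t u} → Congruence R s t → Congruence R t u → Congruence R s u
  ⊞-cong     : ∀ {s s′ t t′} → Congruence R s s′ → Congruence R t t′ →
               Congruence R (s ⊞ t) (s′ ⊞ t′)
  ·-cong     : ∀ r {s t} → Congruence R s t → Congruence R (r · s) (r · t)
  ⊞-assoc    : ∀ s t u → Congruence R ((s ⊞ t) ⊞ u) (s ⊞ (t ⊞ u))
  ⊞-comm     : ∀ s t → Congruence R (s ⊞ t) (t ⊞ s)
  ⊞-identity : ∀ s → Congruence R (𝟎 ⊞ s) s
  ·-distribˡ : ∀ r s t → Congruence R (r · (s ⊞ t)) (r · s ⊞ r · t)
  ·-distribʳ : ∀ s q r → Congruence R ((q ℤR.+ r) · s) (q · s ⊞ r · s)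
  ·-assoc    : ∀ q r s → Congruence R ((q ℤR.* r) · s) (q · (r · s))
  ·-identity : ∀ s → Congruence R (1ℤ · s) s
  ·-zero     : ∀ s → Congruence R (0ℤ · s) 𝟎

presented : (G : Set) → Rel (Lin G) 0ℓ → ℤ-Module
presented G R = fromSemimodule {_≈_ = Congruence R} {_⊞_} {𝟎} {_·_} record
  { +ᴹ-isCommutativeMonoid = record
    { isMonoid = record
      { isSemigroup = record
        { isMagma = record
          { isEquivalence = record { refl = ≈-refl ; sym = ≈-sym ; trans = ≈-trans }
          ; ∙-cong = ⊞-cong
          }
        ; assoc = ⊞-assoc
        }
      ; identity = ⊞-identity , λ s → ≈-trans (⊞-comm s 𝟎) (⊞-identity s)
      }
    ; comm = ⊞-comm
    }
  ; isPreleftSemimodule = record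
    { *ₗ-cong = ·-cong₂
    ; *ₗ-zeroˡ = ·-zero
    ; *ₗ-distribʳ = ·-distribʳ
    ; *ₗ-identityˡ = ·-identity
    ; *ₗ-assoc = ·-assoc
    ; *ₗ-zeroʳ = λ r → ≈-trans (·-cong r (≈-sym (·-zero 𝟎)))
        (≈-trans (≈-sym (·-assoc r 0ℤ 𝟎))
        (≈-trans (≈-reflexive (cong (_· 𝟎) (ℤR.zeroʳ r))) (·-zero 𝟎)))
    ; *ₗ-distribˡ = ·-distribˡ
    }
  }
  where
  ·-cong₂ : ∀ {q r s t} → q ≡ r → Congruence R s t → Congruence R (q · s) (r · t)
  ·-cong₂ {q} refl = ·-cong q
  ≈-reflexive : ∀ {s t} → s ≡ t → Congruence R s t
  ≈-reflexive refl = ≈-refl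

data NoRelation {G : Set} : Rel (Lin G) 0ℓ where

free : Set → ℤ-Module
free G = presented G NoRelation

module _ (M N : ℤ-Module) where
  private
    module M = Module M
    module N = Module N

  data Bilinear : Rel (Lin (∣ M ∣ᴹ × ∣ N ∣ᴹ)) 0ℓ where
    ⊗-cong : ∀ {x x′ y y′} → x M.≈ᴹ x′ → y N.≈ᴹ y′ → Bilinear (gen (x , y)) (gen (x′ , y′))
    +-⊗    : ∀ x x′ y → Bilinear (gen (x M.+ᴹ x′ , y)) (gen (x , y) ⊞ gen (x′ , y))
    ⊗-+    : ∀ x y y′ → Bilinear (gen (x , y N.+ᴹ y′)) (gen (x , y) ⊞ gen (x , y′))
    ·-⊗    : ∀ r x y → Bilinear (gen (r M.*ₗ x , y)) (r · gen (x , y))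
    ⊗-·    : ∀ r x y → Bilinear (gen (x , r N.*ₗ y)) (r · gen (x , y))

infixr 7 _⊗ᴹ_ _⊗_

_⊗ᴹ_ : ℤ-Module → ℤ-Module → ℤ-Module
M ⊗ᴹ N = presented (∣ M ∣ᴹ × ∣ N ∣ᴹ) (Bilinear M N)

_⊗_ : {X Y : Set} → X → Y → Lin (X × Y)
x ⊗ y = gen (x , y)

-- Linear extension.  On a tensor product M ⊗ᴹ N it respects the module
-- equality whenever f is bilinear; for the Hopf operations below this is
-- part of the axioms.
extend : (L : ℤ-Module) {G : Set} → (G → ∣ L ∣ᴹ) → Lin G → ∣ L ∣ᴹ
extend L f (gen g)  = f g
extend L f 𝟎        = Module.0ᴹ L
extend L f (s ⊞ t)  = Module._+ᴹ_ L (extend L f s) (extend L f t)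
extend L f (r · s)  = Module._*ₗ_ L r (extend L f s)

bilinearExtend : (L : ℤ-Module) {G H : Set} → (G → H → ∣ L ∣ᴹ) → Lin G → Lin H → ∣ L ∣ᴹ
bilinearExtend L f s t = extend L (λ g → extend L (f g) t) s

tensor : (M N : ℤ-Module) {X Y : Set} → (X → ∣ M ∣ᴹ) → (Y → ∣ N ∣ᴹ) →
         Lin (X × Y) → ∣ M ⊗ᴹ N ∣ᴹ
tensor M N f g = extend (M ⊗ᴹ N) λ (x , y) → f x ⊗ g y

swap : (M N : ℤ-Module) → ∣ M ⊗ᴹ N ∣ᴹ → ∣ N ⊗ᴹ M ∣ᴹ
swap M N = extend (N ⊗ᴹ M) λ (x , y) → y ⊗ x

assocʳ : (M N L : ℤ-Module) → ∣ (M ⊗ᴹ N) ⊗ᴹ L ∣ᴹ → ∣ M ⊗ᴹ (N ⊗ᴹ L) ∣ᴹ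
assocʳ M N L =
  extend (M ⊗ᴹ (N ⊗ᴹ L)) λ (t , z) → extend (M ⊗ᴹ (N ⊗ᴹ L)) (λ (x , y) → x ⊗ (y ⊗ z)) t

data Span (M : ℤ-Module) (P : Pred ∣ M ∣ᴹ 0ℓ) : Pred ∣ M ∣ᴹ 0ℓ where
  span-gen  : ∀ {x} → P x → Span M P x
  span-0    : Span M P (Module.0ᴹ M)
  span-+    : ∀ {x y} → Span M P x → Span M P y → Span M P (Module._+ᴹ_ M x y)
  span-·    : ∀ r {x} → Span M P x → Span M P (Module._*ₗ_ M r x)
  span-resp : ∀ {x y} → Module._≈ᴹ_ M x y → Span M P x → Span M P y

spanModule : (M : ℤ-Module) → Pred ∣ M ∣ᴹ 0ℓ → ℤ-Module
spanModule M P = fromSemimodule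
  {∃ (Span M P)} {λ x y → proj₁ x ≈ᴹ proj₁ y} {λ (x , p) (y , q) → x +ᴹ y , span-+ p q}
  {0ᴹ , span-0} {λ r (x , p) → r *ₗ x , span-· r p} record
  { +ᴹ-isCommutativeMonoid = record
    { isMonoid = record
      { isSemigroup = record
        { isMagma = record
          { isEquivalence = record { refl = ≈ᴹ-refl ; sym = ≈ᴹ-sym ; trans = ≈ᴹ-trans }
          ; ∙-cong = +ᴹ-cong
          }
        ; assoc = λ _ _ _ → +ᴹ-assoc _ _ _
        }
      ; identity = (λ _ → +ᴹ-identityˡ _) , (λ _ → +ᴹ-identityʳ _)
      }
    ; comm = λ _ _ → +ᴹ-comm _ _
    }
  ; isPreleftSemimodule = record
    { *ₗ-cong = *ₗ-cong
    ; *ₗ-zeroˡ = λ _ → *ₗ-zeroˡ _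
    ; *ₗ-distribʳ = λ _ _ _ → *ₗ-distribʳ _ _ _
    ; *ₗ-identityˡ = λ _ → *ₗ-identityˡ _
    ; *ₗ-assoc = λ _ _ _ → *ₗ-assoc _ _ _
    ; *ₗ-zeroʳ = *ₗ-zeroʳ
    ; *ₗ-distribˡ = λ _ _ _ → *ₗ-distribˡ _ _ _
    }
  }
  where open Module M

record GradedModule : Set₁ where
  field
    module′ : ℤ-Module
    Deg     : ℕ → Pred ∣ module′ ∣ᴹ 0ℓ

  open Module module′ public

-- The underlying module is the internal direct sum of the Deg n.
record IsGrading (G : GradedModule) : Set where
  open GradedModule G
  field
    deg-resp    : ∀ {n x y} → x ≈ᴹ y → Deg n x → Deg n y
    deg-0       : ∀ {n} → Deg n 0ᴹ
    deg-+       : ∀ {n x y} → Deg n x → Deg n y → Deg n (x +ᴹ y)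
    deg-·       : ∀ {n} r {x} → Deg n x → Deg n (r *ₗ x)
    decompose   : ∀ x → Σ[ N ∈ ℕ ] Σ[ c ∈ (ℕ → Carrierᴹ) ]
                  (∀ n → Deg n (c n)) × x ≈ᴹ (∑[ n ∈ upTo N ] c n In module′)
    independent : ∀ N (c : ℕ → Carrierᴹ) → (∀ n → Deg n (c n)) →
                  (∑[ n ∈ upTo N ] c n In module′) ≈ᴹ 0ᴹ → ∀ n → n < N → c n ≈ᴹ 0ᴹ

record HopfOperations (G : GradedModule) : Set where
  open GradedModule G
  infixl 7 _∙_
  field
    _∙_ : Op₂ Carrierᴹ
    1#  : Carrierᴹ
    δ   : Carrierᴹ → ∣ module′ ⊗ᴹ module′ ∣ᴹ
    ε   : Carrierᴹ → ℤ

module _ {G : GradedModule} (A : HopfOperations G) where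
  open GradedModule G renaming (module′ to H)
  open HopfOperations A

  private
    module H² = Module (H ⊗ᴹ H)
    module H³ = Module (H ⊗ᴹ (H ⊗ᴹ H))

  record IsAlgebra : Set where
    field
      isRing : IsRing _≈ᴹ_ _+ᴹ_ _∙_ -ᴹ_ 0ᴹ 1#
      ·-∙    : ∀ r x y → ((r *ₗ x) ∙ y) ≈ᴹ (r *ₗ (x ∙ y))
      ∙-·    : ∀ r x y → (x ∙ (r *ₗ y)) ≈ᴹ (r *ₗ (x ∙ y))

  record IsCoalgebra : Set where
    field
      δ-linear : Linear H (H ⊗ᴹ H) δ
      ε-linear : Linear H ℤᴹ ε
      coassoc  : ∀ x → assocʳ H H H (tensor (H ⊗ᴹ H) H δ id (δ x)) H³.≈ᴹ
                       tensor H (H ⊗ᴹ H) id δ (δ x)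
      counitˡ  : ∀ x → extend H (λ (y , z) → ε y *ₗ z) (δ x) ≈ᴹ x
      counitʳ  : ∀ x → extend H (λ (y , z) → ε z *ₗ y) (δ x) ≈ᴹ x

  _∙²_ : Op₂ ∣ H ⊗ᴹ H ∣ᴹ
  _∙²_ = bilinearExtend (H ⊗ᴹ H) λ (x , y) (x′ , y′) → (x ∙ x′) ⊗ (y ∙ y′)

  record IsBialgebra : Set where
    field
      isAlgebra   : IsAlgebra
      isCoalgebra : IsCoalgebra
      δ-∙         : ∀ x y → δ (x ∙ y) H².≈ᴹ (δ x ∙² δ y)
      δ-1         : δ 1# H².≈ᴹ (1# ⊗ 1#)
      ε-∙         : ∀ x y → ε (x ∙ y) ≡ ε x ℤR.* ε y
      ε-1         : ε 1# ≡ 1ℤ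

  record IsAntipode (S : Carrierᴹ → Carrierᴹ) : Set where
    field
      S-linear  : Linear H H S
      antipodeˡ : ∀ x → extend H (λ (y , z) → S y ∙ z) (δ x) ≈ᴹ (ε x *ₗ 1#)
      antipodeʳ : ∀ x → extend H (λ (y , z) → y ∙ S z) (δ x) ≈ᴹ (ε x *ₗ 1#)
      S-deg     : ∀ n {x} → Deg n x → Deg n (S x)

  -- The degree-n part ⨁_{p+q=n} H_p ⊗ H_q of H ⊗ H.
  Deg² : ℕ → Pred ∣ H ⊗ᴹ H ∣ᴹ 0ℓ
  Deg² n = Span (H ⊗ᴹ H) λ t →
    ∃[ p ] ∃[ q ] ∃[ x ] ∃[ y ] p ℕ.+ q ≡ n × Deg p x × Deg q y × t ≡ x ⊗ y

  record IsGradedConnectedHopfAlgebra : Set where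
    field
      isBialgebra : IsBialgebra
      antipode    : ∃ IsAntipode
      isGrading   : IsGrading G
      ∙-deg       : ∀ p q {x y} → Deg p x → Deg q y → Deg (p ℕ.+ q) (x ∙ y)
      1-deg       : Deg 0 1#
      δ-deg       : ∀ n {x} → Deg n x → Deg² n (δ x)
      ε-deg       : ∀ n {x} → n ≢ 0 → Deg n x → ε x ≡ 0ℤ
      -- Connectedness: the unit r ↦ r·1 is an isomorphism from ℤ onto H₀.
      unit-onto   : ∀ x → Deg 0 x → ∃[ r ] x ≈ᴹ (r *ₗ 1#)
      unit-inj    : ∀ r s → (r *ₗ 1#) ≈ᴹ (s *ₗ 1#) → r ≡ s

  IsCocommutative : Set
  IsCocommutative = ∀ x → swap H H (δ x) H².≈ᴹ δ x

module _ {G G′ : GradedModule} (A : HopfOperations G) (A′ : HopfOperations G′) where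
  private
    module A where
      open GradedModule G public
      open HopfOperations A public
    module A′ where
      open GradedModule G′ public
      open HopfOperations A′ public

  -- Such a map between Hopf algebras automatically commutes with the
  -- antipodes, since convolution inverses are unique.
  record IsHopfIsomorphism (f : A.Carrierᴹ → A′.Carrierᴹ) : Set where
    field
      isModuleIsomorphism : IsModuleIsomorphism A.rawModule A′.rawModule f
      deg-homo : ∀ n {x} → A.Deg n x → A′.Deg n (f x)
      ∙-homo   : ∀ x y → f (x A.∙ y) A′.≈ᴹ (f x A′.∙ f y)
      1-homo   : f A.1# A′.≈ᴹ A′.1#
      δ-homo   : ∀ x → Module._≈ᴹ_ (A′.module′ ⊗ᴹ A′.module′)
                   (tensor A′.module′ A′.module′ f f (A.δ x)) (A′.δ (f x))
      ε-homo   : ∀ x → A′.ε (f x) ≡ A.ε x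

-- ⨁ₙ Hom(Hₙ, ℤ), as the linear functionals on H vanishing in all large
-- degrees.
record Functional (G : GradedModule) : Set where
  constructor functional
  open GradedModule G
  field
    _⟨_⟩     : Carrierᴹ → ℤ
    isLinear : Linear module′ ℤᴹ _⟨_⟩
    bounded  : ∃[ N ] (∀ n → N ≤ n → ∀ x → Deg n x → _⟨_⟩ x ≡ 0ℤ)

open Functional public using (_⟨_⟩)

module _ (G : GradedModule) where
  open GradedModule G

  private
    module Hom {f} (l : Linear module′ ℤᴹ f) = IsModuleHomomorphism l

    interchange : ∀ a b c d → (a ℤR.+ b) ℤR.+ (c ℤR.+ d) ≡ (a ℤR.+ c) ℤR.+ (b ℤR.+ d)
    interchange a b c d =
      trans (ℤR.+-assoc a b _) (trans (cong (a ℤR.+_)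
        (trans (sym (ℤR.+-assoc b c d)) (trans (cong (ℤR._+ d) (ℤR.+-comm b c))
          (ℤR.+-assoc c b d)))) (sym (ℤR.+-assoc a c _)))

    exchange : ∀ a b c → a ℤR.* (b ℤR.* c) ≡ b ℤR.* (a ℤR.* c)
    exchange a b c = trans (sym (ℤR.*-assoc a b c))
      (trans (cong (ℤR._* c) (ℤR.*-comm a b)) (ℤR.*-assoc b a c))

  0ᶠ : Functional G
  0ᶠ = functional (λ _ → 0ℤ)
    (linear-intro module′ ℤᴹ (λ _ → refl) (λ _ _ → refl) (λ r _ → sym (ℤR.zeroʳ r)))
    (0 , λ _ _ _ _ → refl)

  infixl 6 _+ᶠ_
  infixr 7 _·ᶠ_

  _+ᶠ_ : Op₂ (Functional G)
  functional f lf (M , bf) +ᶠ functional g lg (N , bg) = functional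
    (λ x → f x ℤR.+ g x)
    (linear-intro module′ ℤᴹ
      (λ x≈y → cong₂ ℤR._+_ (F.⟦⟧-cong x≈y) (K.⟦⟧-cong x≈y))
      (λ x y → trans (cong₂ ℤR._+_ (F.+ᴹ-homo x y) (K.+ᴹ-homo x y))
                     (interchange (f x) (f y) (g x) (g y)))
      (λ r x → trans (cong₂ ℤR._+_ (F.*ₗ-homo r x) (K.*ₗ-homo r x))
                     (sym (ℤR.distribˡ r (f x) (g x)))))
    (M ℕ.⊔ N , λ n le x x∈ → cong₂ ℤR._+_
      (bf n (≤-trans (m≤m⊔n M N) le) x x∈) (bg n (≤-trans (m≤n⊔m M N) le) x x∈))
    where
    module F = Hom lf
    module K = Hom lg

  _·ᶠ_ : ℤ → Functional G → Functional G
  r ·ᶠ functional f lf (N , bf) = functional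
    (λ x → r ℤR.* f x)
    (linear-intro module′ ℤᴹ
      (λ x≈y → cong (r ℤR.*_) (F.⟦⟧-cong x≈y))
      (λ x y → trans (cong (r ℤR.*_) (F.+ᴹ-homo x y)) (ℤR.distribˡ r (f x) (f y)))
      (λ s x → trans (cong (r ℤR.*_) (F.*ₗ-homo s x)) (exchange r s (f x))))
    (N , λ n le x x∈ → trans (cong (r ℤR.*_) (bf n le x x∈)) (ℤR.zeroʳ r))
    where module F = Hom lf

  dualModule : ℤ-Module
  dualModule = fromSemimodule
    {Functional G} {λ φ ψ → ∀ x → φ ⟨ x ⟩ ≡ ψ ⟨ x ⟩} {_+ᶠ_} {0ᶠ} {_·ᶠ_} record
    { +ᴹ-isCommutativeMonoid = record
      { isMonoid = record
        { isSemigroup = record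
          { isMagma = record
            { isEquivalence = record
              { refl = λ _ → refl
              ; sym = λ e x → sym (e x)
              ; trans = λ e e′ x → trans (e x) (e′ x)
              }
            ; ∙-cong = λ e e′ x → cong₂ ℤR._+_ (e x) (e′ x)
            }
          ; assoc = λ φ ψ χ x → ℤR.+-assoc (φ ⟨ x ⟩) (ψ ⟨ x ⟩) (χ ⟨ x ⟩)
          }
        ; identity = (λ φ x → ℤR.+-identityˡ (φ ⟨ x ⟩)) , (λ φ x → ℤR.+-identityʳ (φ ⟨ x ⟩))
        }
      ; comm = λ φ ψ x → ℤR.+-comm (φ ⟨ x ⟩) (ψ ⟨ x ⟩)
      }
    ; isPreleftSemimodule = record
      { *ₗ-cong = λ r≡s e x → cong₂ ℤR._*_ r≡s (e x)
      ; *ₗ-zeroˡ = λ φ x → refl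
      ; *ₗ-distribʳ = λ φ r s x → ℤR.distribʳ (φ ⟨ x ⟩) r s
      ; *ₗ-identityˡ = λ φ x → ℤR.*-identityˡ (φ ⟨ x ⟩)
      ; *ₗ-assoc = λ r s φ x → ℤR.*-assoc r s (φ ⟨ x ⟩)
      ; *ₗ-zeroʳ = λ r x → ℤR.zeroʳ r
      ; *ₗ-distribˡ = λ r φ ψ x → ℤR.distribˡ r (φ ⟨ x ⟩) (ψ ⟨ x ⟩)
      }
    }

  gradedDual : GradedModule
  gradedDual = record
    { module′ = dualModule
    ; Deg     = λ n φ → ∀ m → m ≢ n → ∀ x → Deg m x → φ ⟨ x ⟩ ≡ 0ℤ
    }

-- The operations of D are the transposes of those of A, for the pairing
-- ⟨φ ⊗ ψ , x ⊗ y⟩ = φ(x) ψ(y).  When G is free of finite rank in each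
-- degree this pairing is non-degenerate, so D is determined by A.
record IsGradedDual {G : GradedModule} (A : HopfOperations G)
                    (D : HopfOperations (gradedDual G)) : Set where
  open GradedModule G
  private
    module A = HopfOperations A
    module D = HopfOperations D
  field
    ∙-transpose : ∀ φ ψ x → (φ D.∙ ψ) ⟨ x ⟩ ≡
                  extend ℤᴹ (λ (y , z) → φ ⟨ y ⟩ ℤR.* ψ ⟨ z ⟩) (A.δ x)
    δ-transpose : ∀ φ x y → extend ℤᴹ (λ (ψ , χ) → ψ ⟨ x ⟩ ℤR.* χ ⟨ y ⟩) (D.δ φ) ≡
                  φ ⟨ x A.∙ y ⟩
    1-transpose : ∀ x → D.1# ⟨ x ⟩ ≡ A.ε x
    ε-transpose : ∀ φ → D.ε φ ≡ φ ⟨ A.1# ⟩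

-- Finite sets of natural numbers are represented as subsets of some
-- [n], with i ∈ Fin n standing for the natural number toℕ i + 1.

Disjoint : ∀ {n} → Rel (Subset n) 0ℓ
Disjoint X Y = X ∩ Y ≡ ⊥

-- The proofs are irrelevant, so set compositions of S are equal as soon
-- as their tuples of blocks are.
record SetComposition {n} (S : Subset n) : Set where
  constructor composition
  field
    blocks    : List (Subset n)
    .nonempty : All Nonempty blocks
    .disjoint : AllPairs Disjoint blocks
    .covering : ⋃ blocks ≡ S

open SetComposition public using (blocks)

Comp : ℕ → Set
Comp n = SetComposition (⊤ {n})

-- collapse S X is the image of X ∩ S under the order-preserving bijection
-- S → [ ∣S∣ ], and uncollapse S X the image of X under its inverse.
collapse : ∀ {n} (S : Subset n) → Subset n → Subset ∣ S ∣
collapse []            []      = []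
collapse (inside  ∷ S) (x ∷ X) = x ∷ collapse S X
collapse (outside ∷ S) (x ∷ X) = collapse S X

uncollapse : ∀ {n} (S : Subset n) → Subset ∣ S ∣ → Subset n
uncollapse []            []      = []
uncollapse (inside  ∷ S) (x ∷ X) = x ∷ uncollapse S X
uncollapse (outside ∷ S) X       = outside ∷ uncollapse S X

_⊑_ : ∀ {n} → Rel (Subset n) 0ℓ
X ⊑ Y = ∀ x → x ∈ X → x ∈ Y

record IsRelabelling {m n} (S : Subset m) (T : Subset n) (h : Subset m → Subset n) : Set where
  field
    h-∩ : ∀ X Y → h (X ∩ Y) ≡ h X ∩ h Y
    h-∪ : ∀ X Y → h (X ∪ Y) ≡ h X ∪ h Y
    h-⊥ : h ⊥ ≡ ⊥
    h-S : h S ≡ T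
    h-nonempty : ∀ {X} → X ⊑ S → Nonempty X → Nonempty (h X)

⋃-upper : ∀ {n} (Xs : List (Subset n)) → All (_⊑ ⋃ Xs) Xs
⋃-upper []       = []
⋃-upper (X ∷ Xs) =
  (λ _ → p⊆p∪q (⋃ Xs)) ∷ All.map (λ Y⊑ y y∈ → q⊆p∪q X (⋃ Xs) (Y⊑ y y∈)) (⋃-upper Xs)

module _ {m n} {S : Subset m} {T : Subset n} {h} (r : IsRelabelling S T h) where
  open IsRelabelling r

  relabel-⋃ : ∀ Xs → ⋃ (map h Xs) ≡ h (⋃ Xs)
  relabel-⋃ []       = sym h-⊥
  relabel-⋃ (X ∷ Xs) = trans (cong (h X ∪_) (relabel-⋃ Xs)) (sym (h-∪ X (⋃ Xs)))

  relabel-nonempty : ∀ {Xs} → All Nonempty Xs → ⋃ Xs ≡ S → All Nonempty (map h Xs)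
  relabel-nonempty {Xs} ne refl =
    AllP.map⁺ (All.zipWith (λ (X⊑ , X≠∅) → h-nonempty X⊑ X≠∅) (⋃-upper Xs , ne))

  relabel-disjoint : ∀ {Xs} → AllPairs Disjoint Xs → AllPairs Disjoint (map h Xs)
  relabel-disjoint d = AllPairsP.map⁺
    (AllPairs.map (λ {X} {Y} e → trans (sym (h-∩ X Y)) (trans (cong h e) h-⊥)) d)

  relabel : SetComposition S → SetComposition T
  relabel (composition Xs ne dj cv) = composition (map h Xs) (relabel-nonempty ne cv)
    (relabel-disjoint dj) (trans (relabel-⋃ Xs) (trans (cong h cv) h-S))

collapse-isRelabelling : ∀ {n} (S : Subset n) → IsRelabelling S ⊤ (collapse S)
collapse-isRelabelling S = record
  { h-∩ = h-∩ S ; h-∪ = h-∪ S ; h-⊥ = h-⊥ S ; h-S = h-S S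
  ; h-nonempty = λ X⊑S (_ , x∈X) → h-∈ (X⊑S _ x∈X) x∈X
  }
  where
  h-∩ : ∀ {n} (S X Y : Subset n) → collapse S (X ∩ Y) ≡ collapse S X ∩ collapse S Y
  h-∩ []            []      []      = refl
  h-∩ (inside  ∷ S) (_ ∷ X) (_ ∷ Y) = cong (_ ∷_) (h-∩ S X Y)
  h-∩ (outside ∷ S) (_ ∷ X) (_ ∷ Y) = h-∩ S X Y
  h-∪ : ∀ {n} (S X Y : Subset n) → collapse S (X ∪ Y) ≡ collapse S X ∪ collapse S Y
  h-∪ []            []      []      = refl
  h-∪ (inside  ∷ S) (_ ∷ X) (_ ∷ Y) = cong (_ ∷_) (h-∪ S X Y)
  h-∪ (outside ∷ S) (_ ∷ X) (_ ∷ Y) = h-∪ S X Y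
  h-⊥ : ∀ {n} (S : Subset n) → collapse S ⊥ ≡ ⊥
  h-⊥ []            = refl
  h-⊥ (inside  ∷ S) = cong (outside ∷_) (h-⊥ S)
  h-⊥ (outside ∷ S) = h-⊥ S
  h-S : ∀ {n} (S : Subset n) → collapse S S ≡ ⊤
  h-S []            = refl
  h-S (inside  ∷ S) = cong (inside ∷_) (h-S S)
  h-S (outside ∷ S) = h-S S
  h-∈ : ∀ {n} {S X : Subset n} {x} → x ∈ S → x ∈ X → Nonempty (collapse S X)
  h-∈ here here = _ , here
  h-∈ {S = inside  ∷ S} (there p) (there q) with h-∈ p q
  ... | _ , r = _ , there r
  h-∈ {S = outside ∷ S} (there p) (there q) = h-∈ p q

uncollapse-isRelabelling : ∀ {n} (S : Subset n) → IsRelabelling ⊤ S (uncollapse S)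
uncollapse-isRelabelling S = record
  { h-∩ = h-∩ S ; h-∪ = h-∪ S ; h-⊥ = h-⊥ S ; h-S = h-S S
  ; h-nonempty = λ _ (_ , x∈X) → h-∈ S x∈X
  }
  where
  h-∩ : ∀ {n} (S : Subset n) X Y → uncollapse S (X ∩ Y) ≡ uncollapse S X ∩ uncollapse S Y
  h-∩ []            []      []      = refl
  h-∩ (inside  ∷ S) (_ ∷ X) (_ ∷ Y) = cong (_ ∷_) (h-∩ S X Y)
  h-∩ (outside ∷ S) X       Y       = cong (outside ∷_) (h-∩ S X Y)
  h-∪ : ∀ {n} (S : Subset n) X Y → uncollapse S (X ∪ Y) ≡ uncollapse S X ∪ uncollapse S Y
  h-∪ []            []      []      = refl
  h-∪ (inside  ∷ S) (_ ∷ X) (_ ∷ Y) = cong (_ ∷_) (h-∪ S X Y)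
  h-∪ (outside ∷ S) X       Y       = cong (outside ∷_) (h-∪ S X Y)
  h-⊥ : ∀ {n} (S : Subset n) → uncollapse S ⊥ ≡ ⊥
  h-⊥ []            = refl
  h-⊥ (inside  ∷ S) = cong (outside ∷_) (h-⊥ S)
  h-⊥ (outside ∷ S) = cong (outside ∷_) (h-⊥ S)
  h-S : ∀ {n} (S : Subset n) → uncollapse S ⊤ ≡ S
  h-S []            = refl
  h-S (inside  ∷ S) = cong (inside ∷_) (h-S S)
  h-S (outside ∷ S) = cong (outside ∷_) (h-S S)
  h-∈ : ∀ {n} (S : Subset n) {X x} → x ∈ X → Nonempty (uncollapse S X)
  h-∈ (inside  ∷ S) here = _ , here
  h-∈ (inside  ∷ S) {_ ∷ X} (there p) with h-∈ S {X} p
  ... | _ , r = _ , there r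
  h-∈ (outside ∷ S) {X} p with h-∈ S {X} p
  ... | _ , r = _ , there r

-- X ↦ X and X ↦ p + X, from subsets of [p] and [q] to subsets of [p + q].

++-∩ : ∀ {p q} (X Y : Subset p) (U V : Subset q) →
       (X ∩ Y) Vec.++ (U ∩ V) ≡ (X Vec.++ U) ∩ (Y Vec.++ V)
++-∩ []      []      U V = refl
++-∩ (x ∷ X) (y ∷ Y) U V = cong (_ ∷_) (++-∩ X Y U V)

++-∪ : ∀ {p q} (X Y : Subset p) (U V : Subset q) →
       (X ∪ Y) Vec.++ (U ∪ V) ≡ (X Vec.++ U) ∪ (Y Vec.++ V)
++-∪ []      []      U V = refl
++-∪ (x ∷ X) (y ∷ Y) U V = cong (_ ∷_) (++-∪ X Y U V)

++-⊥ : ∀ p {q} → ⊥ {p} Vec.++ ⊥ {q} ≡ ⊥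
++-⊥ zero    = refl
++-⊥ (suc p) = cong (outside ∷_) (++-⊥ p)

++-⊤ : ∀ p {q} → ⊤ {p} Vec.++ ⊤ {q} ≡ ⊤
++-⊤ zero    = refl
++-⊤ (suc p) = cong (inside ∷_) (++-⊤ p)

left-isRelabelling : ∀ p q → IsRelabelling (⊤ {p}) (⊤ {p} Vec.++ ⊥ {q}) (Vec._++ ⊥ {q})
left-isRelabelling p q = record
  { h-∩ = λ X Y → trans (cong ((X ∩ Y) Vec.++_) (sym (∩-zeroˡ ⊥))) (++-∩ X Y ⊥ ⊥)
  ; h-∪ = λ X Y → trans (cong ((X ∪ Y) Vec.++_) (sym (∪-identityˡ ⊥))) (++-∪ X Y ⊥ ⊥)
  ; h-⊥ = ++-⊥ p
  ; h-S = refl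
  ; h-nonempty = λ _ (_ , x∈X) → ∈ˡ x∈X
  }
  where
  ∈ˡ : ∀ {p q} {X : Subset p} {x} → x ∈ X → Nonempty (X Vec.++ ⊥ {q})
  ∈ˡ here = _ , here
  ∈ˡ {q = q} (there x∈) with ∈ˡ {q = q} x∈
  ... | _ , r = _ , there r

right-isRelabelling : ∀ p q → IsRelabelling (⊤ {q}) (⊥ {p} Vec.++ ⊤ {q}) (⊥ {p} Vec.++_)
right-isRelabelling p q = record
  { h-∩ = λ X Y → trans (cong (Vec._++ (X ∩ Y)) (sym (∩-zeroˡ ⊥))) (++-∩ (⊥ {p}) ⊥ X Y)
  ; h-∪ = λ X Y → trans (cong (Vec._++ (X ∪ Y)) (sym (∪-identityˡ ⊥))) (++-∪ (⊥ {p}) ⊥ X Y)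
  ; h-⊥ = ++-⊥ p
  ; h-S = refl
  ; h-nonempty = λ _ (_ , x∈X) → ∈ʳ p x∈X
  }
  where
  ∈ʳ : ∀ p {q} {X : Subset q} {x} → x ∈ X → Nonempty (⊥ {p} Vec.++ X)
  ∈ʳ zero    x∈ = _ , x∈
  ∈ʳ (suc p) x∈ with ∈ʳ p x∈
  ... | _ , r = _ , there r

⋃-∩ : ∀ {n} (A : Subset n) Xs → ⋃ (map (_∩ A) Xs) ≡ ⋃ Xs ∩ A
⋃-∩ A []       = sym (∩-zeroˡ A)
⋃-∩ A (X ∷ Xs) = trans (cong ((X ∩ A) ∪_) (⋃-∩ A Xs)) (sym (∩-distribʳ-∪ A X (⋃ Xs)))

⋃-filter : ∀ {n} (Xs : List (Subset n)) → ⋃ (filter nonempty? Xs) ≡ ⋃ Xs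
⋃-filter []       = refl
⋃-filter (X ∷ Xs) with nonempty? X
... | yes _  = cong (X ∪_) (⋃-filter Xs)
... | no X=∅ = trans (⋃-filter Xs)
  (sym (trans (cong (_∪ ⋃ Xs) (Empty-unique X=∅)) (∪-identityˡ (⋃ Xs))))

⋃-++ : ∀ {n} (Xs Ys : List (Subset n)) → ⋃ (Xs ++ Ys) ≡ ⋃ Xs ∪ ⋃ Ys
⋃-++ []       Ys = sym (∪-identityˡ _)
⋃-++ (X ∷ Xs) Ys = trans (cong (X ∪_) (⋃-++ Xs Ys)) (sym (∪-assoc X (⋃ Xs) (⋃ Ys)))

disjoint-⊑ : ∀ {n} {S T X Y : Subset n} → Disjoint S T → X ⊑ S → Y ⊑ T → Disjoint X Y
disjoint-⊑ {X = X} {Y} S∩T X⊑S Y⊑T = Empty-unique λ (x , x∈) →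
  ∉⊥ (subst (x ∈_) S∩T
    (x∈p∩q⁺ (X⊑S x (proj₁ (x∈p∩q⁻ X Y x∈)) , Y⊑T x (proj₂ (x∈p∩q⁻ X Y x∈)))))

-- Standardization of the ground set along the order-preserving S → [ ∣S∣ ].
is : ∀ {n} {S : Subset n} → SetComposition S → Comp ∣ S ∣
is {S = S} = relabel (collapse-isRelabelling S)

is⁻¹ : ∀ {n} (S : Subset n) → Comp ∣ S ∣ → SetComposition S
is⁻¹ S = relabel (uncollapse-isRelabelling S)

infixr 5 _∗[_]_

_∗[_]_ : ∀ {n} {S T : Subset n} →
         SetComposition S → .(Disjoint S T) → SetComposition T → SetComposition (S ∪ T)
composition Xs ne dj cv ∗[ S∩T ] composition Ys ne′ dj′ cv′ = composition (Xs ++ Ys)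
  (AllP.++⁺ ne ne′)
  (AllPairsP.++⁺ dj dj′ (cross Xs Ys cv cv′ S∩T))
  (trans (⋃-++ Xs Ys) (cong₂ _∪_ cv cv′))
  where
  cross : ∀ {n} {S T : Subset n} Xs Ys → ⋃ Xs ≡ S → ⋃ Ys ≡ T → Disjoint S T →
          All (λ X → All (Disjoint X) Ys) Xs
  cross Xs Ys refl refl S∩T = All.map
    (λ X⊑S → All.map (λ Y⊑T → disjoint-⊑ S∩T X⊑S Y⊑T) (⋃-upper Ys)) (⋃-upper Xs)

onGround : ∀ {n} {S T : Subset n} → .(S ≡ T) → SetComposition S → SetComposition T
onGround S≡T (composition Xs ne dj cv) = composition Xs ne dj (trans cv S≡T)

-- (P₁ ∩ A , … , Pₖ ∩ A)^#
_∩♯_ : ∀ {n} → Comp n → (A : Subset n) → SetComposition A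
composition Xs ne dj cv ∩♯ A = composition (filter nonempty? (map (_∩ A) Xs))
  (AllP.all-filter nonempty? (map (_∩ A) Xs))
  (AllPairsP.filter⁺ nonempty? (AllPairsP.map⁺ (AllPairs.map
    (λ {X} {Y} X∩Y → disjoint-⊑ X∩Y (λ _ → p∩q⊆p X A) (λ _ → p∩q⊆p Y A)) dj)))
  (trans (⋃-filter (map (_∩ A) Xs)) (trans (⋃-∩ A Xs) (trans (cong (_∩ A) cv) (∩-identityˡ A))))

_∣_ : ∀ {n} → Comp n → (A : Subset n) → Comp ∣ A ∣
P ∣ A = is (P ∩♯ A)

takeBlocks : ∀ {n} {S : Subset n} (i : ℕ) (P : SetComposition S) →
             SetComposition (⋃ (take i (blocks P)))
takeBlocks i (composition Xs ne dj _) =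
  composition (take i Xs) (AllP.take⁺ i ne) (AllPairsP.take⁺ i dj) refl

dropBlocks : ∀ {n} {S : Subset n} (i : ℕ) (P : SetComposition S) →
             SetComposition (⋃ (drop i (blocks P)))
dropBlocks i (composition Xs ne dj _) =
  composition (drop i Xs) (AllP.drop⁺ i ne) (AllPairsP.drop⁺ i dj) refl

Basis : Set
Basis = ∃ Comp

𝒯ᴹ : ℤ-Module
𝒯ᴹ = free Basis

𝒯 : GradedModule
𝒯 = record
  { module′ = 𝒯ᴹ
  ; Deg     = λ n → Span 𝒯ᴹ λ x → ∃[ P ] x ≡ gen (n , P)
  }

allSubsets : ∀ n → List (Subset n)
allSubsets zero    = [] ∷ []
allSubsets (suc n) = map (inside ∷_) (allSubsets n) ++ map (outside ∷_) (allSubsets n)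

-- {1, …, p}
initial : ∀ n → ℕ → Subset n
initial n p = Vec.tabulate λ i → does (toℕ i <? p)

_∗̄_ : Basis → Basis → ∣ 𝒯ᴹ ∣ᴹ
(p , P) ∗̄ (q , Q) = gen (p ℕ.+ q , onGround ground
  (relabel (left-isRelabelling p q) P ∗[ separate ] relabel (right-isRelabelling p q) Q))
  where
  separate : Disjoint (⊤ {p} Vec.++ ⊥ {q}) (⊥ {p} Vec.++ ⊤ {q})
  separate = trans (sym (++-∩ (⊤ {p}) ⊥ ⊥ (⊤ {q})))
    (trans (cong₂ Vec._++_ (∩-identityˡ (⊥ {p})) (∩-zeroˡ (⊤ {q}))) (++-⊥ p))
  ground : (⊤ {p} Vec.++ ⊥ {q}) ∪ (⊥ {p} Vec.++ ⊤ {q}) ≡ ⊤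
  ground = trans (sym (++-∪ (⊤ {p}) ⊥ ⊥ (⊤ {q})))
    (trans (cong₂ Vec._++_ (∪-identityʳ (⊤ {p})) (∪-identityˡ (⊤ {q}))) (++-⊤ p))

shuffleTerm : (b c : Basis) (A : Subset (proj₁ b ℕ.+ proj₁ c)) →
              Dec (∣ A ∣ ≡ proj₁ b) → Dec (∣ ∁ A ∣ ≡ proj₁ c) → ∣ 𝒯ᴹ ∣ᴹ
shuffleTerm (p , P) (q , Q) A (yes ∣A∣≡p) (yes ∣B∣≡q) = gen (p ℕ.+ q , onGround (∪-inverseʳ A)
  (is⁻¹ A (subst Comp (sym ∣A∣≡p) P) ∗[ ∩-inverseʳ A ] is⁻¹ (∁ A) (subst Comp (sym ∣B∣≡q) Q)))
shuffleTerm _ _ _ _ _ = 𝟎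

-- The ordered pairs with A ⊔ B = [p + q] are indexed by A, with B = ∁ A;
-- those with ∣A∣ ≠ p or ∣B∣ ≠ q contribute zero.
_∗̂_ : Basis → Basis → ∣ 𝒯ᴹ ∣ᴹ
b@(p , _) ∗̂ c@(q , _) =
  ∑[ A ∈ allSubsets (p ℕ.+ q) ] shuffleTerm b c A (∣ A ∣ ≟ p) (∣ ∁ A ∣ ≟ q) In 𝒯ᴹ

δ̂ : Basis → ∣ 𝒯ᴹ ⊗ᴹ 𝒯ᴹ ∣ᴹ
δ̂ (n , P) = ∑[ A ∈ allSubsets n ]
  gen (∣ A ∣ , P ∣ A) ⊗ gen (∣ ∁ A ∣ , P ∣ ∁ A) In (𝒯ᴹ ⊗ᴹ 𝒯ᴹ)

δ̄ : Basis → ∣ 𝒯ᴹ ⊗ᴹ 𝒯ᴹ ∣ᴹ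
δ̄ (n , P) = ∑[ p ∈ upTo (suc n) ]
  (let A = initial n p in gen (∣ A ∣ , P ∣ A) ⊗ gen (∣ ∁ A ∣ , P ∣ ∁ A)) In (𝒯ᴹ ⊗ᴹ 𝒯ᴹ)

∅ : Comp 0
∅ = composition [] [] [] refl

projection₀ : Basis → ℤ
projection₀ (zero  , _) = 1ℤ
projection₀ (suc _ , _) = 0ℤ

𝒯-concat : HopfOperations 𝒯
𝒯-concat = record
  { _∙_ = bilinearExtend 𝒯ᴹ _∗̄_
  ; 1#  = gen (0 , ∅)
  ; δ   = extend (𝒯ᴹ ⊗ᴹ 𝒯ᴹ) δ̂
  ; ε   = extend ℤᴹ projection₀
  }

𝒯-shuffle : HopfOperations 𝒯
𝒯-shuffle = record
  { _∙_ = bilinearExtend 𝒯ᴹ _∗̂_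
  ; 1#  = gen (0 , ∅)
  ; δ   = extend (𝒯ᴹ ⊗ᴹ 𝒯ᴹ) δ̄
  ; ε   = extend ℤᴹ projection₀
  }

-- Formal power series in non-commuting variables: the coefficient of each
-- word.  The letter i stands for the variable x_{i+1}.
Series : Set
Series = List ℕ → ℤ

seriesModule : ℤ-Module
seriesModule = fromSemimodule
  {Series} {λ f g → ∀ w → f w ≡ g w} {λ f g w → f w ℤR.+ g w} {λ _ → 0ℤ}
  {λ r f w → r ℤR.* f w} record
  { +ᴹ-isCommutativeMonoid = record
    { isMonoid = record
      { isSemigroup = record
        { isMagma = record
          { isEquivalence = record
            { refl = λ _ → refl
            ; sym = λ e w → sym (e w)
            ; trans = λ e e′ w → trans (e w) (e′ w)
            }
          ; ∙-cong = λ e e′ w → cong₂ ℤR._+_ (e w) (e′ w)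
          }
        ; assoc = λ f g h w → ℤR.+-assoc (f w) (g w) (h w)
        }
      ; identity = (λ f w → ℤR.+-identityˡ (f w)) , (λ f w → ℤR.+-identityʳ (f w))
      }
    ; comm = λ f g w → ℤR.+-comm (f w) (g w)
    }
  ; isPreleftSemimodule = record
    { *ₗ-cong = λ r≡s e w → cong₂ ℤR._*_ r≡s (e w)
    ; *ₗ-zeroˡ = λ f w → refl
    ; *ₗ-distribʳ = λ f r s w → ℤR.distribʳ (f w) r s
    ; *ₗ-identityˡ = λ f w → ℤR.*-identityˡ (f w)
    ; *ₗ-assoc = λ r s f w → ℤR.*-assoc r s (f w)
    ; *ₗ-zeroʳ = λ r w → ℤR.zeroʳ r
    ; *ₗ-distribˡ = λ r f g w → ℤR.distribˡ r (f w) (g w)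
    }
  }

infixl 7 _⋆_

_⋆_ : Op₂ Series
(f ⋆ g) w = ∑[ i ∈ upTo (suc (length w)) ] f (take i w) ℤR.* g (drop i w) In ℤᴹ

module _ {n} (P : Comp n) where

  SameBlock : Rel (Fin n) 0ℓ
  SameBlock j j′ = Any (λ X → j ∈ X × j′ ∈ X) (blocks P)

  Increasing : (Fin n → ℕ) → Rel (Subset n) 0ℓ
  Increasing i X Y = ∀ j j′ → j ∈ X → j′ ∈ Y → i j < i j′

  -- The words x_{i_1} ⋯ x_{i_n} occurring in M_P.
  Admissible : (Fin n → ℕ) → Set
  Admissible i =
    (∀ j j′ → (i j ≡ i j′ → SameBlock j j′) × (SameBlock j j′ → i j ≡ i j′)) ×
    AllPairs (Increasing i) (blocks P)

  admissible? : Decidable Admissible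
  admissible? i =
    all? (λ j → all? λ j′ →
      ((i j ≟ i j′) →-dec sameBlock? j j′) ×-dec (sameBlock? j j′ →-dec (i j ≟ i j′)))
    ×-dec AllPairs.allPairs? increasing? (blocks P)
    where
    sameBlock? : ∀ j j′ → Dec (SameBlock j j′)
    sameBlock? j j′ = any? (λ X → (j ∈? X) ×-dec (j′ ∈? X)) (blocks P)
    increasing? : ∀ X Y → Dec (Increasing i X Y)
    increasing? X Y = all? λ j → all? λ j′ →
      (j ∈? X) →-dec ((j′ ∈? Y) →-dec (i j <? i j′))

  M : Series
  M w with length w ≟ n
  ... | yes |w|≡n = if does (admissible? (lookup w ∘ cast (sym |w|≡n))) then 1ℤ else 0ℤ
  ... | no  _     = 0ℤ

IsMonomial : Pred Series 0ℓ
IsMonomial f = ∃[ n ] Σ[ P ∈ Comp n ] f ≡ M P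

NCQsymᴹ : ℤ-Module
NCQsymᴹ = spanModule seriesModule IsMonomial

NCQsym : GradedModule
NCQsym = record
  { module′ = NCQsymᴹ
  ; Deg     = λ n (f , _) → Span seriesModule (λ g → Σ[ P ∈ Comp n ] g ≡ M P) f
  }

monomial : Basis → ∣ NCQsymᴹ ∣ᴹ
monomial (n , P) = M P , span-gen (n , P , refl)

-- In the presence of the Hopf algebra axioms these two conditions
-- determine all the operations.
record IsNCQsym (A : HopfOperations NCQsym) : Set where
  open HopfOperations A
  field
    product   : ∀ x y → Module._≈ᴹ_ seriesModule (proj₁ (x ∙ y)) (proj₁ x ⋆ proj₁ y)
    coproduct : ∀ {n} (P : Comp n) → Module._≈ᴹ_ (NCQsymᴹ ⊗ᴹ NCQsymᴹ)
      (δ (monomial (n , P)))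
      (∑[ i ∈ upTo (suc (length (blocks P))) ]
        monomial (_ , is (takeBlocks i P)) ⊗ monomial (_ , is (dropBlocks i P))
        In (NCQsymᴹ ⊗ᴹ NCQsymᴹ))

IsDualBasis : (Basis → Functional NCQsym) → Set
IsDualBasis W =
  (∀ P → W P ⟨ monomial P ⟩ ≡ 1ℤ) × (∀ P Q → P ≢ Q → W P ⟨ monomial Q ⟩ ≡ 0ℤ)

-- A bialgebra on the span of the set compositions whose structure constants are multiplicities
-- amounts to identities between multisets, which are tested by summing functions over them; being
-- graded and connected, it has an antipode by Takeuchi's formula.  For (∗̄ , δ̂) the identities
-- compare ways of splitting [n] into two, three or two times two parts, for (∗̂ , δ̄) ways of
-- cutting lattice paths.
--
-- R occurs in P ∗̂ Q exactly when (P , Q) is a deconcatenation of R.  Each word w occurs in M_R for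
-- exactly one R, obtained by packing w, and packing commutes with passing to prefixes and suffixes,
-- so M_P M_Q is the sum of the M_R for which P ⊗ Q occurs in δ̄(R).  Hence NCQsym has the transposed
-- structure constants of (∗̂ , δ̄) and inherits the bialgebra axioms by duality.  The functional W_P
-- is the evaluation of a series at the word listing the block index of each position of P.

module Submission where

open import Defs
open import Algebra.Module.Bundles using (Module)
open import Algebra.Module.Morphism.Structures using (IsModuleHomomorphism)
open import Data.Bool.Base using (Bool; true; false; if_then_else_; not; _∨_)
open import Data.Bool.ListAction using (or)
open import Data.Empty using (⊥-elim) renaming (⊥ to Absurd)
open import Data.Empty.Irrelevant using () renaming (⊥-elim to ⊥-elim-irr)
open import Data.Fin.Base as Fin using (Fin)
open import Data.Fin.Subset using (Nonempty; ⊤; ⊥; ⋃; Subset; ∣_∣; ∁; _∩_; _∈_; inside; outside)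
open import Data.Fin.Subset.Properties
  using (nonempty?; Empty-unique; ⊆-antisym; ⊆⊤; ∈⊤; ∉⊥; x∈p∪q⁻; x∈p∩q⁺; x∈p∩q⁻; x∉p⇒x∈∁p;
         x∈∁p⇒x∉p)
open import Data.Integer.Base as ℤ using (ℤ; 0ℤ; 1ℤ; -1ℤ)
open import Data.List.Base
  using (List; []; _∷_; _++_; map; concatMap; filter; foldr; replicate; applyUpTo; upTo;
         take; drop; length; lookup; tabulate; deduplicate)
open import Data.List.Membership.Propositional using (find; lose) renaming (_∈_ to _∈ˡ_)
open import Data.List.Membership.Propositional.Properties
  using (∈-++⁺ˡ; ∈-++⁺ʳ; ∈-map⁺; ∈-map⁻; ∈-upTo⁺; ∈-upTo⁻; ∈-filter⁺; ∈-filter⁻;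
         ∈-concatMap⁺; ∈-concatMap⁻; ∈-lookup; ∈-deduplicate⁺)
open import Data.List.Relation.Unary.All as All using (All; []; _∷_)
open import Data.List.Relation.Unary.AllPairs as AllPairs using (AllPairs; []; _∷_)
open import Data.List.Relation.Unary.Any as Any using (Any; here; there)
open import Data.List.Relation.Unary.Unique.Propositional using (Unique)
open import Data.Nat.Base as ℕ using (ℕ; zero; suc; _≤_; _<_; z≤n; s≤s)
open import Data.Product.Base using (Σ-syntax; ∃-syntax; _×_; _,_; proj₁; proj₂)
open import Data.Sum.Base using (_⊎_; inj₁; inj₂)
open import Function.Base using (id; _∘_; case_of_)
open import Level using (0ℓ)
open import Relation.Binary.Core using (Rel)
open import Relation.Binary.Definitions using (DecidableEquality)
open import Relation.Binary.PropositionalEquality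
  using (_≡_; _≢_; refl; sym; trans; cong; cong₂; subst; subst₂; module ≡-Reasoning)
open import Relation.Nullary using (Dec; yes; no; does; ¬_; contradiction)
open import Relation.Nullary.Decidable using (map′; _×-dec_; recompute)
open import Relation.Unary using (Pred)

import Data.Bool.Properties as Boolₚ
import Data.Fin.Properties as Finₚ
import Data.Integer.Properties as ℤₚ
import Data.List.Properties as Listₚ
import Data.List.Relation.Unary.All.Properties as Allₚ
import Data.List.Relation.Unary.AllPairs.Properties as AllPairsₚ
import Data.List.Relation.Unary.Any.Properties as Anyₚ
import Data.List.Relation.Unary.Unique.DecPropositional.Properties as UniqueDec
import Data.List.Relation.Unary.Unique.Propositional.Properties as Uniqueₚ
import Data.Nat.Properties as ℕₚ
import Data.Vec.Base as Vec
import Data.Vec.Properties as Vecₚ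
import Relation.Binary.Reasoning.Setoid as SetoidReasoning

-- Linear maps, sums and tensor products

-- Equality in `free G` and in `M ⊗ᴹ N` is a generated congruence, so an identity there cannot be
-- checked entry by entry. Integer tests suffice because `Basis` has decidable equality:
-- coefficients then separate the elements of the free module on it, and a sum in an arbitrary
-- module is the image of a formal sum.
--
-- The test functions see only the codes of set compositions. Degrees such as `∣ A ∣ + ∣ ∁ A ∣` and
-- `n` agree only propositionally, so set compositions that arise in different ways live in
-- different types, while their lists of membership tables can be compared without transport.
--
-- The product of two series in the span of the monomials does not visibly lie in that span. The
-- operations of `NCQsym` are therefore built from structure constants on the basis, and compared
-- with `⋆` afterwards. The graded dual is treated in the same way, so that all four Hopf algebras
-- are instances of one construction.

module Mod (M : ℤ-Module) where
  open Module M public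

  ≈-reflexive : ∀ {x y} → x ≡ y → x ≈ᴹ y
  ≈-reflexive refl = ≈ᴹ-refl

  interchange : ∀ a b c d → ((a +ᴹ b) +ᴹ (c +ᴹ d)) ≈ᴹ ((a +ᴹ c) +ᴹ (b +ᴹ d))
  interchange a b c d =
    ≈ᴹ-trans (+ᴹ-assoc a b _) (≈ᴹ-trans (+ᴹ-congˡ
      (≈ᴹ-trans (≈ᴹ-sym (+ᴹ-assoc b c d)) (≈ᴹ-trans (+ᴹ-congʳ (+ᴹ-comm b c)) (+ᴹ-assoc c b d))))
      (≈ᴹ-sym (+ᴹ-assoc a c _)))

  *ₗ-exchange : ∀ r s x → (r *ₗ s *ₗ x) ≈ᴹ (s *ₗ r *ₗ x)
  *ₗ-exchange r s x = ≈ᴹ-trans (≈ᴹ-sym (*ₗ-assoc r s x))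
    (≈ᴹ-trans (*ₗ-cong (ℤₚ.*-comm r s) ≈ᴹ-refl) (*ₗ-assoc s r x))

-- The laws from which `linear-intro` derives the zero, negation and right-action laws of `Linear`;
-- only these have to be checked for the maps constructed below.
record IsLinear (M N : ℤ-Module) (f : ∣ M ∣ᴹ → ∣ N ∣ᴹ) : Set where
  private
    module M = Mod M
    module N = Mod N
  field
    ≈-homo : ∀ {x y} → x M.≈ᴹ y → f x N.≈ᴹ f y
    +-homo : ∀ x y → f (x M.+ᴹ y) N.≈ᴹ (f x N.+ᴹ f y)
    ·-homo : ∀ r x → f (r M.*ₗ x) N.≈ᴹ (r N.*ₗ f x)

  0-homo : f M.0ᴹ N.≈ᴹ N.0ᴹ
  0-homo = N.≈ᴹ-trans (≈-homo (M.≈ᴹ-sym (M.*ₗ-zeroˡ M.0ᴹ)))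
    (N.≈ᴹ-trans (·-homo 0ℤ M.0ᴹ) (N.*ₗ-zeroˡ (f M.0ᴹ)))

  linear : Linear M N f
  linear = linear-intro M N ≈-homo +-homo ·-homo

fromLinear : ∀ M N {f} → Linear M N f → IsLinear M N f
fromLinear M N l = record
  { ≈-homo = L.⟦⟧-cong ; +-homo = L.+ᴹ-homo ; ·-homo = L.*ₗ-homo }
  where module L = IsModuleHomomorphism l

infix 1 _⟶_
infixr 9 _∘ₗ_
infixl 6 _+ₗ_

record _⟶_ (M N : ℤ-Module) : Set where
  constructor lin
  field
    to       : ∣ M ∣ᴹ → ∣ N ∣ᴹ
    isLinear : IsLinear M N to
  open IsLinear isLinear public

open _⟶_ using (to)
module Hom = _⟶_

idₗ : ∀ {M} → M ⟶ M
idₗ {M} = lin id record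
  { ≈-homo = id ; +-homo = λ _ _ → ≈ᴹ-refl ; ·-homo = λ _ _ → ≈ᴹ-refl }
  where open Mod M

_∘ₗ_ : ∀ {M N L} → N ⟶ L → M ⟶ N → M ⟶ L
_∘ₗ_ {L = L} g f = lin (to g ∘ to f) record
  { ≈-homo  = Hom.≈-homo g ∘ Hom.≈-homo f
  ; +-homo = λ x y → ≈ᴹ-trans (Hom.≈-homo g (Hom.+-homo f x y)) (Hom.+-homo g _ _)
  ; ·-homo = λ r x → ≈ᴹ-trans (Hom.≈-homo g (Hom.·-homo f r x)) (Hom.·-homo g _ _)
  }
  where open Mod L

0ₗ : ∀ {M N} → M ⟶ N
0ₗ {N = N} = lin (λ _ → 0ᴹ) record
  { ≈-homo = λ _ → ≈ᴹ-refl
  ; +-homo = λ _ _ → ≈ᴹ-sym (+ᴹ-identityˡ 0ᴹ)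
  ; ·-homo = λ r _ → ≈ᴹ-sym (*ₗ-zeroʳ r)
  }
  where open Mod N

_+ₗ_ : ∀ {M N} → M ⟶ N → M ⟶ N → M ⟶ N
_+ₗ_ {N = N} f g = lin (λ x → to f x +ᴹ to g x) record
  { ≈-homo = λ e → +ᴹ-cong (Hom.≈-homo f e) (Hom.≈-homo g e)
  ; +-homo = λ x y → ≈ᴹ-trans (+ᴹ-cong (Hom.+-homo f x y) (Hom.+-homo g x y)) (interchange _ _ _ _)
  ; ·-homo = λ r x → ≈ᴹ-trans (+ᴹ-cong (Hom.·-homo f r x) (Hom.·-homo g r x))
                              (≈ᴹ-sym (*ₗ-distribˡ r _ _))
  }
  where open Mod N

infixr 7 _·ₗ_

_·ₗ_ : ∀ {M N} → ℤ → M ⟶ N → M ⟶ N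
_·ₗ_ {N = N} s f = lin (λ x → s *ₗ to f x) record
  { ≈-homo = λ e → *ₗ-cong refl (Hom.≈-homo f e)
  ; +-homo = λ x y → ≈ᴹ-trans (*ₗ-cong refl (Hom.+-homo f x y)) (*ₗ-distribˡ s _ _)
  ; ·-homo = λ r x → ≈ᴹ-trans (*ₗ-cong refl (Hom.·-homo f r x)) (*ₗ-exchange s r _)
  }
  where open Mod N

scalar : ∀ M → ∣ M ∣ᴹ → ℤᴹ ⟶ M
scalar M x = lin (λ r → r *ₗ x) record
  { ≈-homo = λ e → *ₗ-cong e ≈ᴹ-refl
  ; +-homo = λ r s → *ₗ-distribʳ x r s
  ; ·-homo = λ r s → *ₗ-assoc r s x
  }
  where open Mod M

module _ (M : ℤ-Module) where
  open Mod M

  ∑-cong : {A : Set} (as : List A) {f g : A → ∣ M ∣ᴹ} →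
           (∀ a → a ∈ˡ as → f a ≈ᴹ g a) → ∑ M as f ≈ᴹ ∑ M as g
  ∑-cong []       e = ≈ᴹ-refl
  ∑-cong (a ∷ as) e = +ᴹ-cong (e a (here refl)) (∑-cong as (λ b → e b ∘ there))

  ∑-ext : {A : Set} (as : List A) {f g : A → ∣ M ∣ᴹ} →
          (∀ a → f a ≈ᴹ g a) → ∑ M as f ≈ᴹ ∑ M as g
  ∑-ext as e = ∑-cong as λ a _ → e a

  ∑-++ : {A : Set} (as bs : List A) (f : A → ∣ M ∣ᴹ) →
         ∑ M (as ++ bs) f ≈ᴹ (∑ M as f +ᴹ ∑ M bs f)
  ∑-++ []       bs f = ≈ᴹ-sym (+ᴹ-identityˡ _)
  ∑-++ (a ∷ as) bs f = ≈ᴹ-trans (+ᴹ-congˡ (∑-++ as bs f)) (≈ᴹ-sym (+ᴹ-assoc _ _ _))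

  ∑-map : {A B : Set} (h : A → B) (as : List A) (f : B → ∣ M ∣ᴹ) →
          ∑ M (map h as) f ≈ᴹ ∑ M as (f ∘ h)
  ∑-map h []       f = ≈ᴹ-refl
  ∑-map h (a ∷ as) f = +ᴹ-congˡ (∑-map h as f)

  ∑-concatMap : {A B : Set} (h : A → List B) (as : List A) (f : B → ∣ M ∣ᴹ) →
                ∑ M (concatMap h as) f ≈ᴹ ∑ M as (λ a → ∑ M (h a) f)
  ∑-concatMap h []       f = ≈ᴹ-refl
  ∑-concatMap h (a ∷ as) f = ≈ᴹ-trans (∑-++ (h a) _ f) (+ᴹ-congˡ (∑-concatMap h as f))

  ∑-zero : {A : Set} (as : List A) {f : A → ∣ M ∣ᴹ} →
           (∀ a → a ∈ˡ as → f a ≈ᴹ 0ᴹ) → ∑ M as f ≈ᴹ 0ᴹ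
  ∑-zero []       e = ≈ᴹ-refl
  ∑-zero (a ∷ as) e =
    ≈ᴹ-trans (+ᴹ-cong (e a (here refl)) (∑-zero as (λ b → e b ∘ there))) (+ᴹ-identityˡ _)

  ∑-+ : {A : Set} (as : List A) (f g : A → ∣ M ∣ᴹ) →
        ∑ M as (λ a → f a +ᴹ g a) ≈ᴹ (∑ M as f +ᴹ ∑ M as g)
  ∑-+ []       f g = ≈ᴹ-sym (+ᴹ-identityˡ _)
  ∑-+ (a ∷ as) f g = ≈ᴹ-trans (+ᴹ-congˡ (∑-+ as f g)) (interchange _ _ _ _)

  ∑-pick : {A : Set} {as : List A} {f : A → ∣ M ∣ᴹ} {x : A} → Unique as → x ∈ˡ as →
           (∀ a → a ≢ x → f a ≈ᴹ 0ᴹ) → ∑ M as f ≈ᴹ f x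
  ∑-pick {as = a ∷ as} (a∉ ∷ u) (here refl) z =
    ≈ᴹ-trans (+ᴹ-congˡ (∑-zero as λ b b∈ → z b λ { refl → All.lookup a∉ b∈ refl }))
             (+ᴹ-identityʳ _)
  ∑-pick {as = a ∷ as} (a∉ ∷ u) (there x∈) z =
    ≈ᴹ-trans (+ᴹ-cong (z a λ { refl → All.lookup a∉ x∈ refl }) (∑-pick u x∈ z))
             (+ᴹ-identityˡ _)

∑-hom : ∀ {M N} (φ : M ⟶ N) {A : Set} (as : List A) (f : A → ∣ M ∣ᴹ) →
        Module._≈ᴹ_ N (to φ (∑ M as f)) (∑ N as (to φ ∘ f))
∑-hom         φ []       f = Hom.0-homo φ
∑-hom {N = N} φ (a ∷ as) f = ≈ᴹ-trans (Hom.+-homo φ _ _) (+ᴹ-congˡ (∑-hom φ as f))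
  where open Mod N

module _ {G : Set} (L : ℤ-Module) where
  open Mod L

  extend-cong : {f g : G → ∣ L ∣ᴹ} → (∀ x → f x ≈ᴹ g x) → ∀ s → extend L f s ≈ᴹ extend L g s
  extend-cong e (gen x)  = e x
  extend-cong e 𝟎        = ≈ᴹ-refl
  extend-cong e (s ⊞ t)  = +ᴹ-cong (extend-cong e s) (extend-cong e t)
  extend-cong e (r · s)  = *ₗ-cong refl (extend-cong e s)

  extend-+ : (f g : G → ∣ L ∣ᴹ) → ∀ s →
             extend L (λ x → f x +ᴹ g x) s ≈ᴹ (extend L f s +ᴹ extend L g s)
  extend-+ f g (gen x)  = ≈ᴹ-refl
  extend-+ f g 𝟎        = ≈ᴹ-sym (+ᴹ-identityˡ 0ᴹ)
  extend-+ f g (s ⊞ t)  = ≈ᴹ-trans (+ᴹ-cong (extend-+ f g s) (extend-+ f g t)) (interchange _ _ _ _)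
  extend-+ f g (r · s)  = ≈ᴹ-trans (*ₗ-cong refl (extend-+ f g s)) (*ₗ-distribˡ r _ _)

  extend-· : (c : ℤ) (f : G → ∣ L ∣ᴹ) → ∀ s →
             extend L (λ x → c *ₗ f x) s ≈ᴹ (c *ₗ extend L f s)
  extend-· c f (gen x)  = ≈ᴹ-refl
  extend-· c f 𝟎        = ≈ᴹ-sym (*ₗ-zeroʳ c)
  extend-· c f (s ⊞ t)  =
    ≈ᴹ-trans (+ᴹ-cong (extend-· c f s) (extend-· c f t)) (≈ᴹ-sym (*ₗ-distribˡ c _ _))
  extend-· c f (r · s)  = ≈ᴹ-trans (*ₗ-cong refl (extend-· c f s)) (*ₗ-exchange r c _)

  module _ {R : Rel (Lin G) 0ℓ} (f : G → ∣ L ∣ᴹ)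
           (resp : ∀ {s t} → R s t → extend L f s ≈ᴹ extend L f t) where

    private
      ⟪_⟫ : Lin G → ∣ L ∣ᴹ
      ⟪_⟫ = extend L f

    extend-resp : ∀ {s t} → Congruence R s t → ⟪ s ⟫ ≈ᴹ ⟪ t ⟫
    extend-resp (rel r)            = resp r
    extend-resp ≈-refl             = ≈ᴹ-refl
    extend-resp (≈-sym p)          = ≈ᴹ-sym (extend-resp p)
    extend-resp (≈-trans p q)      = ≈ᴹ-trans (extend-resp p) (extend-resp q)
    extend-resp (⊞-cong p q)       = +ᴹ-cong (extend-resp p) (extend-resp q)
    extend-resp (·-cong r p)       = *ₗ-cong refl (extend-resp p)
    extend-resp (⊞-assoc s t u)    = +ᴹ-assoc _ _ _
    extend-resp (⊞-comm s t)       = +ᴹ-comm _ _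
    extend-resp (⊞-identity s)     = +ᴹ-identityˡ _
    extend-resp (·-distribˡ r s t) = *ₗ-distribˡ r _ _
    extend-resp (·-distribʳ s q r) = *ₗ-distribʳ _ q r
    extend-resp (·-assoc q r s)    = *ₗ-assoc q r _
    extend-resp (·-identity s)     = *ₗ-identityˡ _
    extend-resp (·-zero s)         = *ₗ-zeroˡ _

    extendₗ : presented G R ⟶ L
    extendₗ = lin ⟪_⟫ record
      { ≈-homo = extend-resp ; +-homo = λ _ _ → ≈ᴹ-refl ; ·-homo = λ _ _ → ≈ᴹ-refl }

  freeₗ : (G → ∣ L ∣ᴹ) → free G ⟶ L
  freeₗ f = extendₗ f λ ()

-- Elements of a presented module are syntax trees over the generators, so structural induction
-- takes the place of an argument about generating sets.
presented-ext : ∀ {G R L} (φ ψ : presented G R ⟶ L) →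
                (∀ x → Module._≈ᴹ_ L (to φ (gen x)) (to ψ (gen x))) →
                ∀ s → Module._≈ᴹ_ L (to φ s) (to ψ s)
presented-ext {L = L} φ ψ e = go
  where
  open Mod L
  go : ∀ s → to φ s ≈ᴹ to ψ s
  go (gen x)  = e x
  go 𝟎        = ≈ᴹ-trans (Hom.0-homo φ) (≈ᴹ-sym (Hom.0-homo ψ))
  go (s ⊞ t)  = ≈ᴹ-trans (Hom.+-homo φ s t)
    (≈ᴹ-trans (+ᴹ-cong (go s) (go t)) (≈ᴹ-sym (Hom.+-homo ψ s t)))
  go (r · s)  = ≈ᴹ-trans (Hom.·-homo φ r s)
    (≈ᴹ-trans (*ₗ-cong refl (go s)) (≈ᴹ-sym (Hom.·-homo ψ r s)))

record IsBilinear (M N L : ℤ-Module) (β : ∣ M ∣ᴹ → ∣ N ∣ᴹ → ∣ L ∣ᴹ) : Set where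
  field
    linˡ : ∀ y → IsLinear M L (λ x → β x y)
    linʳ : ∀ x → IsLinear N L (β x)

  _ˡ : ∣ N ∣ᴹ → M ⟶ L
  y ˡ = lin _ (linˡ y)

  _ʳ : ∣ M ∣ᴹ → N ⟶ L
  x ʳ = lin _ (linʳ x)

  cong₂′ : ∀ {x x′ y y′} → Module._≈ᴹ_ M x x′ → Module._≈ᴹ_ N y y′ →
           Module._≈ᴹ_ L (β x y) (β x′ y′)
  cong₂′ {x′ = x′} {y = y} p q =
    Module.≈ᴹ-trans L (Hom.≈-homo (y ˡ) p) (Hom.≈-homo (x′ ʳ) q)

  ∑∑ : {A B : Set} (as : List A) (bs : List B) (f : A → ∣ M ∣ᴹ) (g : B → ∣ N ∣ᴹ) →
       Module._≈ᴹ_ L (β (∑ M as f) (∑ N bs g)) (∑ L as (λ a → ∑ L bs (λ b → β (f a) (g b))))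
  ∑∑ as bs f g = Module.≈ᴹ-trans L (∑-hom (_ ˡ) as f) (∑-ext L as λ a → ∑-hom (f a ʳ) bs g)

  ⊗-elim : (M ⊗ᴹ N) ⟶ L
  ⊗-elim = extendₗ L (λ (x , y) → β x y) λ
    { (⊗-cong p q)   → cong₂′ p q
    ; (+-⊗ x x′ y)   → Hom.+-homo (y ˡ) x x′
    ; (⊗-+ x y y′)   → Hom.+-homo (x ʳ) y y′
    ; (·-⊗ r x y)    → Hom.·-homo (y ˡ) r x
    ; (⊗-· r x y)    → Hom.·-homo (x ʳ) r y
    }

⊗-bilinear : ∀ M N → IsBilinear M N (M ⊗ᴹ N) _⊗_
⊗-bilinear M N = record
  { linˡ = λ y → record
    { ≈-homo = λ p → rel (⊗-cong p (Module.≈ᴹ-refl N))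
    ; +-homo = λ x x′ → rel (+-⊗ x x′ y) ; ·-homo = λ r x → rel (·-⊗ r x y) }
  ; linʳ = λ x → record
    { ≈-homo = λ p → rel (⊗-cong (Module.≈ᴹ-refl M) p)
    ; +-homo = λ y y′ → rel (⊗-+ x y y′) ; ·-homo = λ r y → rel (⊗-· r x y) }
  }

module _ {M N L M′ N′ L′ : ℤ-Module} {β : ∣ M ∣ᴹ → ∣ N ∣ᴹ → ∣ L ∣ᴹ} where

  bilinear-∘ : (φ : L ⟶ L′) → IsBilinear M N L β → (f : M′ ⟶ M) (g : N′ ⟶ N) →
               IsBilinear M′ N′ L′ (λ x y → to φ (β (to f x) (to g y)))
  bilinear-∘ φ b f g = record
    { linˡ = λ y → Hom.isLinear (φ ∘ₗ (to g y ˡ) ∘ₗ f)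
    ; linʳ = λ x → Hom.isLinear (φ ∘ₗ (to f x ʳ) ∘ₗ g)
    }
    where open IsBilinear b

tensorₗ : ∀ {M N M′ N′} → M′ ⟶ M → N′ ⟶ N → (M′ ⊗ᴹ N′) ⟶ (M ⊗ᴹ N)
tensorₗ f g = IsBilinear.⊗-elim (bilinear-∘ idₗ (⊗-bilinear _ _) f g)

bilinear-flip : ∀ {M N L β} → IsBilinear M N L β → IsBilinear N M L (λ y x → β x y)
bilinear-flip b = record { linˡ = IsBilinear.linʳ b ; linʳ = IsBilinear.linˡ b }

*ₗ-bilinear : ∀ M → IsBilinear ℤᴹ M M (Module._*ₗ_ M)
*ₗ-bilinear M = record
  { linˡ = λ x → Hom.isLinear (scalar M x)
  ; linʳ = λ r → Hom.isLinear (r ·ₗ idₗ {M})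
  }

-- Linearity in the formal combination is the extension property, for which `R` must be respected;
-- linearity in the parameter passes from the generators to all combinations by induction. Maps
-- defined by nested extensions, such as `assocʳ` and `_∙²_`, are shown to be well defined in this
-- way.
extend-bilinear : ∀ {G M L} {R : Rel (Lin G) 0ℓ} (f : ∣ M ∣ᴹ → G → ∣ L ∣ᴹ) →
  (∀ x {s t} → R s t → Module._≈ᴹ_ L (extend L (f x) s) (extend L (f x) t)) →
  (∀ g → IsLinear M L (λ x → f x g)) →
  IsBilinear M (presented G R) L (λ x s → extend L (f x) s)
extend-bilinear {L = L} f resp l = record
  { linʳ = λ x → Hom.isLinear (extendₗ L (f x) (resp x))
  ; linˡ = λ s → record
    { ≈-homo = λ e → extend-cong L (λ g → IsLinear.≈-homo (l g) e) s
    ; +-homo = λ x y → ≈ᴹ-trans (extend-cong L (λ g → IsLinear.+-homo (l g) x y) s)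
                                (extend-+ L _ _ s)
    ; ·-homo = λ r x → ≈ᴹ-trans (extend-cong L (λ g → IsLinear.·-homo (l g) r x) s)
                                (extend-· L r _ s)
    }
  }
  where open Mod L

-- Indicators, coefficients in free modules and integer sums

𝟙[_] : ∀ {p} {P : Set p} → Dec P → ℤ
𝟙[ d ] = if does d then 1ℤ else 0ℤ

module _ {p} {P : Set p} where
  𝟙-yes : (d : Dec P) → P → 𝟙[ d ] ≡ 1ℤ
  𝟙-yes (yes _) _ = refl
  𝟙-yes (no ¬p) p = contradiction p ¬p

  𝟙-no : (d : Dec P) → ¬ P → 𝟙[ d ] ≡ 0ℤ
  𝟙-no (yes p) ¬p = contradiction p ¬p
  𝟙-no (no _)  _  = refl

𝟙-⇔ : ∀ {p q} {P : Set p} {Q : Set q} (d : Dec P) (e : Dec Q) →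
      (P → Q) → (Q → P) → 𝟙[ d ] ≡ 𝟙[ e ]
𝟙-⇔ (yes p) e f g = sym (𝟙-yes e (f p))
𝟙-⇔ (no ¬p) e f g = sym (𝟙-no e (¬p ∘ g))

module Coefficients {X : Set} (_≟_ : DecidableEquality X) where

  coef : X → free X ⟶ ℤᴹ
  coef x = freeₗ ℤᴹ (λ y → 𝟙[ x ≟ y ])

  -- Cancellation and zero scalars are ignored: the list only has to contain every generator with a
  -- nonzero coefficient.
  support : Lin X → List X
  support (gen x) = x ∷ []
  support 𝟎       = []
  support (s ⊞ t) = support s ++ support t
  support (r · s) = support s

  open Mod (free X)

  private
    𝟙ʳ : ∀ x → 𝟙[ x ≟ x ] ≡ 1ℤ
    𝟙ʳ x = 𝟙-yes (x ≟ x) refl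

  -- The list is arbitrary as long as it covers the support, so that two combinations can be
  -- expanded over one and the same list.
  expandOver : ∀ {bs} → Unique bs → ∀ s → (∀ {x} → x ∈ˡ support s → x ∈ˡ bs) →
               s ≈ᴹ ∑ (free X) bs (λ b → to (coef b) s · gen b)
  expandOver {bs} u (gen x) ⊆ = ≈ᴹ-sym (≈ᴹ-trans
    (∑-pick (free X) {f = λ b → 𝟙[ b ≟ x ] · gen b} u (⊆ (here refl)) λ b b≢x →
      ≈ᴹ-trans (≈-reflexive (cong (_· gen b) (𝟙-no (b ≟ x) b≢x))) (·-zero _))
    (≈ᴹ-trans (≈-reflexive (cong (_· gen x) (𝟙ʳ x))) (·-identity _)))
  expandOver {bs} u 𝟎 ⊆ = ≈ᴹ-sym (∑-zero (free X) bs λ b _ → ·-zero _)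
  expandOver {bs} u (s ⊞ t) ⊆ = ≈ᴹ-trans
    (⊞-cong (expandOver u s (⊆ ∘ ∈-++⁺ˡ)) (expandOver u t (⊆ ∘ ∈-++⁺ʳ (support s))))
    (≈ᴹ-trans (≈ᴹ-sym (∑-+ (free X) bs _ _))
      (∑-ext (free X) bs λ b → ≈ᴹ-sym (·-distribʳ _ _ _)))
  expandOver {bs} u (r · s) ⊆ = ≈ᴹ-trans (·-cong r (expandOver u s ⊆))
    (≈ᴹ-trans (∑-hom (r ·ₗ idₗ {free X}) bs _)
      (∑-ext (free X) bs λ b → ≈ᴹ-sym (·-assoc _ _ _)))

  -- Both combinations expand over the deduplicated union of their supports, where equal
  -- coefficients give equal summands.
  coef-separates : ∀ s t → (∀ x → to (coef x) s ≡ to (coef x) t) → s ≈ᴹ t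
  coef-separates s t e = ≈ᴹ-trans
    (expandOver u s (∈-deduplicate⁺ _≟_ ∘ ∈-++⁺ˡ))
    (≈ᴹ-trans (∑-ext (free X) bs λ b → ≈-reflexive (cong (_· gen b) (e b)))
      (≈ᴹ-sym (expandOver u t (∈-deduplicate⁺ _≟_ ∘ ∈-++⁺ʳ (support s)))))
    where
    bs : List X
    bs = deduplicate _≟_ (support s ++ support t)
    u : Unique bs
    u = UniqueDec.deduplicate-! _≟_ (support s ++ support t)

-- Equal to ∑ ℤᴹ; unlike there, the summand can be inferred from a sum.
∑ℤ : {A : Set} → List A → (A → ℤ) → ℤ
∑ℤ []       f = 0ℤ
∑ℤ (a ∷ as) f = f a ℤ.+ ∑ℤ as f

∑ℤ-≡ : {A : Set} (as : List A) {f : A → ℤ} → ∑ ℤᴹ as f ≡ ∑ℤ as f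
∑ℤ-≡ []           = refl
∑ℤ-≡ (a ∷ as) {f} = cong (λ z → f a ℤ.+ z) (∑ℤ-≡ as)

∑ℤ-cong : {A : Set} (as : List A) {f g : A → ℤ} → (∀ a → a ∈ˡ as → f a ≡ g a) → ∑ℤ as f ≡ ∑ℤ as g
∑ℤ-cong []       e = refl
∑ℤ-cong (a ∷ as) e = cong₂ ℤ._+_ (e a (here refl)) (∑ℤ-cong as λ b → e b ∘ there)

∑ℤ-ext : {A : Set} (as : List A) {f g : A → ℤ} → (∀ a → f a ≡ g a) → ∑ℤ as f ≡ ∑ℤ as g
∑ℤ-ext as e = ∑ℤ-cong as λ a _ → e a

∑ℤ-++ : {A : Set} (as bs : List A) (f : A → ℤ) → ∑ℤ (as ++ bs) f ≡ ∑ℤ as f ℤ.+ ∑ℤ bs f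
∑ℤ-++ as bs f = trans (sym (∑ℤ-≡ (as ++ bs) {f}))
  (trans (∑-++ ℤᴹ as bs f) (cong₂ ℤ._+_ (∑ℤ-≡ as {f}) (∑ℤ-≡ bs {f})))

∑ℤ-map : {A B : Set} (h : B → A) (bs : List B) (f : A → ℤ) → ∑ℤ (map h bs) f ≡ ∑ℤ bs (f ∘ h)
∑ℤ-map h bs f = trans (sym (∑ℤ-≡ (map h bs) {f})) (trans (∑-map ℤᴹ h bs f) (∑ℤ-≡ bs {f ∘ h}))

∑ℤ-concatMap : {A B : Set} (h : B → List A) (bs : List B) (f : A → ℤ) →
               ∑ℤ (concatMap h bs) f ≡ ∑ℤ bs (λ b → ∑ℤ (h b) f)
∑ℤ-concatMap h bs f = trans (sym (∑ℤ-≡ (concatMap h bs) {f})) (trans (∑-concatMap ℤᴹ h bs f)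
  (trans (∑ℤ-≡ bs {λ b → ∑ ℤᴹ (h b) f}) (∑ℤ-ext bs λ b → ∑ℤ-≡ (h b) {f})))

∑ℤ-zero : {A : Set} (as : List A) {f : A → ℤ} → (∀ a → a ∈ˡ as → f a ≡ 0ℤ) → ∑ℤ as f ≡ 0ℤ
∑ℤ-zero as {f} e = trans (sym (∑ℤ-≡ as {f})) (∑-zero ℤᴹ as e)

∑ℤ-+ : {A : Set} (as : List A) (f g : A → ℤ) → ∑ℤ as (λ a → f a ℤ.+ g a) ≡ ∑ℤ as f ℤ.+ ∑ℤ as g
∑ℤ-+ as f g = trans (sym (∑ℤ-≡ as {λ a → f a ℤ.+ g a}))
  (trans (∑-+ ℤᴹ as f g) (cong₂ ℤ._+_ (∑ℤ-≡ as {f}) (∑ℤ-≡ as {g})))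

∑ℤ-pick : {A : Set} {as : List A} {f : A → ℤ} {x : A} → Unique as → x ∈ˡ as →
          (∀ a → a ≢ x → f a ≡ 0ℤ) → ∑ℤ as f ≡ f x
∑ℤ-pick {as = as} {f} u x∈ z = trans (sym (∑ℤ-≡ as {f})) (∑-pick ℤᴹ u x∈ z)

∑ℤ-*ˡ : {A : Set} (c : ℤ) (as : List A) (f : A → ℤ) → c ℤ.* ∑ℤ as f ≡ ∑ℤ as (λ a → c ℤ.* f a)
∑ℤ-*ˡ c []       f = ℤₚ.*-zeroʳ c
∑ℤ-*ˡ c (a ∷ as) f = trans (ℤₚ.*-distribˡ-+ c (f a) _) (cong (λ z → c ℤ.* f a ℤ.+ z) (∑ℤ-*ˡ c as f))

∑ℤ-*ʳ : {A : Set} (c : ℤ) (as : List A) (f : A → ℤ) → ∑ℤ as f ℤ.* c ≡ ∑ℤ as (λ a → f a ℤ.* c)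
∑ℤ-*ʳ c as f = trans (ℤₚ.*-comm (∑ℤ as f) c)
  (trans (∑ℤ-*ˡ c as f) (∑ℤ-ext as λ a → ℤₚ.*-comm c (f a)))

∑ℤ-swap : {A B : Set} (as : List A) (bs : List B) (f : A → B → ℤ) →
          ∑ℤ as (λ a → ∑ℤ bs (f a)) ≡ ∑ℤ bs (λ b → ∑ℤ as (λ a → f a b))
∑ℤ-swap []       bs f = sym (∑ℤ-zero bs λ _ _ → refl)
∑ℤ-swap (a ∷ as) bs f = trans (cong (λ z → ∑ℤ bs (f a) ℤ.+ z) (∑ℤ-swap as bs f))
  (sym (∑ℤ-+ bs (f a) _))

∑ℤ-hom : ∀ {M} (φ : M ⟶ ℤᴹ) {A : Set} (as : List A) (f : A → ∣ M ∣ᴹ) →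
         to φ (∑ M as f) ≡ ∑ℤ as (to φ ∘ f)
∑ℤ-hom φ as f = trans (∑-hom φ as f) (∑ℤ-≡ as)

∑ℤ-single : {A : Set} (f : A → ℤ) (x : A) → ∑ℤ (x ∷ []) f ≡ f x
∑ℤ-single f x = ℤₚ.+-identityʳ (f x)

-- Set compositions as a graded basis

Bits : Set
Bits = List Bool

-- A set composition is determined by the membership tables of its blocks;
-- passing to lists makes set compositions of different [n] comparable.
code : Basis → List Bits
code (n , P) = map Vec.toList (blocks P)

deg : Basis → ℕ
deg = proj₁

𝟏 : Basis
𝟏 = 0 , ∅

toList-inj : ∀ {n} {X Y : Subset n} → Vec.toList X ≡ Vec.toList Y → X ≡ Y
toList-inj {X = X} {Y} e = trans (sym (Vecₚ.cast-is-id refl X)) (Vecₚ.toList-injective refl X Y e)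

length-toList : ∀ {n} {A : Set} (X : Vec.Vec A n) → length (Vec.toList X) ≡ n
length-toList Vec.[]      = refl
length-toList (x Vec.∷ X) = cong suc (length-toList X)

comp-≡ : ∀ {n} {S : Subset n} {P Q : SetComposition S} → blocks P ≡ blocks Q → P ≡ Q
comp-≡ refl = refl

-- If there is a block, the length of its table reveals the degree. An empty tuple covers `[n]` only
-- for `n = 0`; the contradiction in the mixed cases is drawn from the irrelevant covering proof.
code-injective : ∀ {b c} → code b ≡ code c → b ≡ c
code-injective {zero , composition [] _ _ _} {zero , composition [] _ _ _} _ = refl
code-injective {suc _ , composition [] _ _ cv} {_} _ =
  ⊥-elim-irr (case cv of λ ())
code-injective {_ , composition [] _ _ _} {suc _ , composition [] _ _ cv} _ =
  ⊥-elim-irr (case cv of λ ())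
code-injective {m , composition (X ∷ Xs) _ _ _} {n , composition (Y ∷ Ys) _ _ _} e
  with trans (sym (length-toList X)) (trans (cong length (Listₚ.∷-injectiveˡ e)) (length-toList Y))
... | refl = cong (m ,_) (comp-≡ (Listₚ.map-injective toList-inj e))

_≟ᶜ_ : DecidableEquality (List Bits)
_≟ᶜ_ = Listₚ.≡-dec (Listₚ.≡-dec Boolₚ._≟_)

_≟_ : DecidableEquality Basis
b ≟ c = map′ code-injective (cong code) (code b ≟ᶜ code c)

pairwise : {X Y : Set} → DecidableEquality X → DecidableEquality Y → DecidableEquality (X × Y)
pairwise d d′ (x , y) (x′ , y′) =
  map′ (λ { (refl , refl) → refl }) (λ { refl → refl , refl }) (d x x′ ×-dec d′ y y′)

deg-0 : ∀ b → deg b ≡ 0 → b ≡ 𝟏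
deg-0 (_ , composition [] _ _ _) refl = refl
deg-0 (_ , composition (X ∷ Xs) ne _ _) refl = ⊥-elim-irr (no-element ne)
  where
  no-element : All Nonempty (X ∷ Xs) → Absurd
  no-element ((() , _) ∷ _)

projection₀-0 : ∀ b → deg b ≡ 0 → projection₀ b ≡ 1ℤ
projection₀-0 (_ , _) refl = refl

projection₀-≢0 : ∀ b → deg b ≢ 0 → projection₀ b ≡ 0ℤ
projection₀-≢0 (zero  , _) n≢0 = contradiction refl n≢0
projection₀-≢0 (suc _ , _) _   = refl

-- A bialgebra with basis Basis whose structure constants are multiplicities.
-- Identities between multisets are stated by summing integer-valued functions.
record Combinatorial : Set where
  field
    mul       : Basis → Basis → List Basis
    comul     : Basis → List (Basis × Basis)
    mul-deg   : ∀ b c x → x ∈ˡ mul b c → deg x ≡ deg b ℕ.+ deg c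
    comul-deg : ∀ b x y → (x , y) ∈ˡ comul b → deg x ℕ.+ deg y ≡ deg b
    unitˡ     : ∀ b (f : List Bits → ℤ) → ∑ℤ (mul 𝟏 b) (f ∘ code) ≡ f (code b)
    unitʳ     : ∀ b (f : List Bits → ℤ) → ∑ℤ (mul b 𝟏) (f ∘ code) ≡ f (code b)
    assoc     : ∀ a b c (f : List Bits → ℤ) →
      ∑ℤ (mul a b) (λ x → ∑ℤ (mul x c) (f ∘ code)) ≡
      ∑ℤ (mul b c) (λ x → ∑ℤ (mul a x) (f ∘ code))
    counitˡ   : ∀ b (f : List Bits → ℤ) →
      ∑ℤ (comul b) (λ (x , y) → projection₀ x ℤ.* f (code y)) ≡ f (code b)
    counitʳ   : ∀ b (f : List Bits → ℤ) →
      ∑ℤ (comul b) (λ (x , y) → projection₀ y ℤ.* f (code x)) ≡ f (code b)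
    coassoc   : ∀ b (f : List Bits → List Bits → List Bits → ℤ) →
      ∑ℤ (comul b) (λ (x , y) → ∑ℤ (comul x) λ (u , v) → f (code u) (code v) (code y)) ≡
      ∑ℤ (comul b) (λ (x , y) → ∑ℤ (comul y) λ (u , v) → f (code x) (code u) (code v))
    comul-𝟏   : ∀ (f : List Bits → List Bits → ℤ) →
      ∑ℤ (comul 𝟏) (λ (x , y) → f (code x) (code y)) ≡ f [] []
    compat    : ∀ a b (f : List Bits → List Bits → ℤ) →
      ∑ℤ (mul a b) (λ x → ∑ℤ (comul x) λ (u , v) → f (code u) (code v)) ≡
      ∑ℤ (comul a) λ (a₁ , a₂) → ∑ℤ (comul b) λ (b₁ , b₂) →
        ∑ℤ (mul a₁ b₁) λ u → ∑ℤ (mul a₂ b₂) λ v → f (code u) (code v)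

∑∑-hom : ∀ {M N} (φ : M ⟶ N) {A B : Set} (as : List A) (bs : A → List B) (f : A → B → ∣ M ∣ᴹ) →
         Module._≈ᴹ_ N (to φ (∑ M as λ a → ∑ M (bs a) (f a)))
                       (∑ N as λ a → ∑ N (bs a) (to φ ∘ f a))
∑∑-hom {N = N} φ as bs f =
  Module.≈ᴹ-trans N (∑-hom φ as _) (∑-ext N as λ a → ∑-hom φ (bs a) (f a))

module Separation {X : Set} (d : DecidableEquality X) (M : ℤ-Module) (F : X → ∣ M ∣ᴹ) where
  open Mod M
  open Coefficients d

  module _ {A B : Set} (as : List A) (bs : List B) {h : A → Lin X} {k : B → Lin X} where
    -- Both sums are images under `freeₗ M F` of formal sums in `free X`, and those are equal by
    -- `coef-separates`. The values of `h` and `k` are combinations rather than generators, to allow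
    -- for the scalars in the counit laws.
    sums-agree : (∀ x → ∑ℤ as (to (coef x) ∘ h) ≡ ∑ℤ bs (to (coef x) ∘ k)) →
                 ∑ M as (extend M F ∘ h) ≈ᴹ ∑ M bs (extend M F ∘ k)
    sums-agree e = ≈ᴹ-trans (≈ᴹ-sym (∑-hom (freeₗ M F) as h))
      (≈ᴹ-trans (Hom.≈-homo (freeₗ M F) (coef-separates (∑ (free X) as h) (∑ (free X) bs k) λ x →
          trans (∑ℤ-hom (coef x) as h) (trans (e x) (sym (∑ℤ-hom (coef x) bs k)))))
        (∑-hom (freeₗ M F) bs k))

  module _ {A B C D : Set} (as : List A) (as′ : A → List C) (bs : List B) (bs′ : B → List D)
           {h : A → C → X} {k : B → D → X} where
    double-sums-agree :
      (∀ x → ∑ℤ as (λ a → ∑ℤ (as′ a) λ c → 𝟙[ d x (h a c) ]) ≡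
             ∑ℤ bs (λ b → ∑ℤ (bs′ b) λ c → 𝟙[ d x (k b c) ])) →
      ∑ M as (λ a → ∑ M (as′ a) (F ∘ h a)) ≈ᴹ ∑ M bs (λ b → ∑ M (bs′ b) (F ∘ k b))
    double-sums-agree e = ≈ᴹ-trans
      (∑-ext M as λ a → ≈ᴹ-sym (∑-hom (freeₗ M F) (as′ a) (gen ∘ h a)))
      (≈ᴹ-trans (sums-agree as bs {λ a → ∑ (free X) (as′ a) (gen ∘ h a)}
                                  {λ b → ∑ (free X) (bs′ b) (gen ∘ k b)} λ x →
                                      trans (∑ℤ-ext as λ a → ∑ℤ-hom (coef x) (as′ a) (gen ∘ h a))
          (trans (e x) (∑ℤ-ext bs λ b → sym (∑ℤ-hom (coef x) (bs′ b) (gen ∘ k b)))))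
        (∑-ext M bs λ b → ∑-hom (freeₗ M F) (bs′ b) (gen ∘ k b)))

module Universal (C : Combinatorial) (M : ℤ-Module) where
  open Combinatorial C
  open Mod M

  private
    -- At `code y` this is definitionally `𝟙[ p ≟ y ]`, the coefficient of `p` in `gen y`, since
    -- `_≟_` is decided on codes. Coefficients are thus among the test functions of `Combinatorial`.
    kronecker₁ : Basis → List Bits → ℤ
    kronecker₁ p u = 𝟙[ code p ≟ᶜ u ]

    _≟²_ : DecidableEquality (Basis × Basis)
    _≟²_ = pairwise _≟_ _≟_

    _≟³_ : DecidableEquality (Basis × Basis × Basis)
    _≟³_ = pairwise _≟_ _≟²_

    single : {X : Set} (F : X → ∣ M ∣ᴹ) (x : X) → ∑ M (x ∷ []) F ≈ᴹ F x
    single F x = +ᴹ-identityʳ (F x)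

  module _ (F : Basis → ∣ M ∣ᴹ) where
    open Separation _≟_ M F

    unitˡᵘ : ∀ b → ∑ M (mul 𝟏 b) F ≈ᴹ F b
    unitˡᵘ b = ≈ᴹ-trans (sums-agree (mul 𝟏 b) (b ∷ []) {gen} {gen} λ x →
      trans (unitˡ b (kronecker₁ x)) (sym (ℤₚ.+-identityʳ (kronecker₁ x (code b))))) (single F b)

    unitʳᵘ : ∀ b → ∑ M (mul b 𝟏) F ≈ᴹ F b
    unitʳᵘ b = ≈ᴹ-trans (sums-agree (mul b 𝟏) (b ∷ []) {gen} {gen} λ x →
      trans (unitʳ b (kronecker₁ x)) (sym (ℤₚ.+-identityʳ (kronecker₁ x (code b))))) (single F b)

    assocᵘ : ∀ a b c → ∑ M (mul a b) (λ x → ∑ M (mul x c) F) ≈ᴹ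
                       ∑ M (mul b c) (λ x → ∑ M (mul a x) F)
    assocᵘ a b c = double-sums-agree (mul a b) (λ x → mul x c) (mul b c) (mul a)
      {λ _ → id} {λ _ → id} λ x →
      assoc a b c (kronecker₁ x)

    counitˡᵘ : ∀ b → ∑ M (comul b) (λ (x , y) → projection₀ x *ₗ F y) ≈ᴹ F b
    counitˡᵘ b = ≈ᴹ-trans
      (sums-agree (comul b) (b ∷ []) {λ (x , y) → projection₀ x · gen y} {gen} λ x →
        trans (counitˡ b (kronecker₁ x)) (sym (ℤₚ.+-identityʳ (kronecker₁ x (code b)))))
            (single F b)

    counitʳᵘ : ∀ b → ∑ M (comul b) (λ (x , y) → projection₀ y *ₗ F x) ≈ᴹ F b
    counitʳᵘ b = ≈ᴹ-trans
      (sums-agree (comul b) (b ∷ []) {λ (x , y) → projection₀ y · gen x} {gen} λ x →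
        trans (counitʳ b (kronecker₁ x)) (sym (ℤₚ.+-identityʳ (kronecker₁ x (code b)))))
            (single F b)

  coassocᵘ : (F : Basis → Basis → Basis → ∣ M ∣ᴹ) → ∀ b →
    ∑ M (comul b) (λ (x , y) → ∑ M (comul x) λ (u , v) → F u v y) ≈ᴹ
    ∑ M (comul b) (λ (x , y) → ∑ M (comul y) λ (u , v) → F x u v)
  coassocᵘ F b = Separation.double-sums-agree _≟³_ M (λ (u , v , w) → F u v w)
    (comul b) (λ (x , y) → comul x) (comul b) (λ (x , y) → comul y)
    {h = λ (_ , y) (u , v) → u , v , y} {k = λ (x , _) (u , v) → x , u , v} λ (p , q , r) →
    -- The decisions are nested as in `_≟³_`, which makes this definitionally the coefficient at
    -- `(p , q , r)`.
    coassoc b λ u v w → if does ((code p ≟ᶜ u) ×-dec ((code q ≟ᶜ v) ×-dec (code r ≟ᶜ w)))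
                        then 1ℤ else 0ℤ

  module _ (F : Basis → Basis → ∣ M ∣ᴹ) where
    open Separation _≟²_ M (λ (u , v) → F u v)

    private
      kronecker : Basis × Basis → List Bits → List Bits → ℤ
      kronecker (p , q) u v = if does ((code p ≟ᶜ u) ×-dec (code q ≟ᶜ v)) then 1ℤ else 0ℤ

    comul-𝟏ᵘ : ∑ M (comul 𝟏) (λ (x , y) → F x y) ≈ᴹ F 𝟏 𝟏
    comul-𝟏ᵘ = ≈ᴹ-trans (sums-agree (comul 𝟏) ((𝟏 , 𝟏) ∷ []) {gen} {gen} λ p →
      trans (comul-𝟏 (kronecker p)) (sym (ℤₚ.+-identityʳ (kronecker p [] []))))
          (single (λ (u , v) → F u v) (𝟏 , 𝟏))

    compatᵘ : ∀ a b →
      ∑ M (mul a b) (λ x → ∑ M (comul x) λ (u , v) → F u v) ≈ᴹ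
      ∑ M (comul a) λ (a₁ , a₂) → ∑ M (comul b) λ (b₁ , b₂) →
        ∑ M (mul a₁ b₁) λ u → ∑ M (mul a₂ b₂) λ v → F u v
    compatᵘ a b = ≈ᴹ-trans
      (∑-ext M (mul a b) λ x → ≈ᴹ-sym (∑-hom F̂ (comul x) gen))
      (≈ᴹ-trans (sums-agree (mul a b) (comul a)
        {h = λ x → ∑ (free _) (comul x) gen}
        {k = λ (a₁ , a₂) → ∑ (free _) (comul b) λ (b₁ , b₂) →
               ∑ (free _) (mul a₁ b₁) λ u → ∑ (free _) (mul a₂ b₂) λ v → gen (u , v)}
        λ p → trans (∑ℤ-ext (mul a b) λ x → ∑ℤ-hom (Coefficients.coef _≟²_ p) (comul x) gen)
          (trans (compat a b (kronecker p))
            (∑ℤ-ext (comul a) λ (a₁ , a₂) → sym (expandℤ (Coefficients.coef _≟²_ p) a₁ a₂))))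
        (∑-ext M (comul a) λ (a₁ , a₂) → expand₄ F̂ a₁ a₂))
      where
      F̂ : free (Basis × Basis) ⟶ M
      F̂ = freeₗ M (λ (u , v) → F u v)
      expand₄ : ∀ {N} (φ : free (Basis × Basis) ⟶ N) a₁ a₂ → Module._≈ᴹ_ N
        (to φ (∑ (free _) (comul b) λ (b₁ , b₂) →
          ∑ (free _) (mul a₁ b₁) λ u → ∑ (free _) (mul a₂ b₂) λ v → gen (u , v)))
        (∑ N (comul b) λ (b₁ , b₂) →
          ∑ N (mul a₁ b₁) λ u → ∑ N (mul a₂ b₂) λ v → to φ (gen (u , v)))
      expand₄ {N} φ a₁ a₂ = Module.≈ᴹ-trans N (∑-hom φ (comul b) _)
        (∑-ext N (comul b) λ (b₁ , b₂) → ∑∑-hom φ (mul a₁ b₁) (λ _ → mul a₂ b₂) λ u v → gen (u , v))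
      expandℤ : ∀ (φ : free (Basis × Basis) ⟶ ℤᴹ) a₁ a₂ →
        to φ (∑ (free _) (comul b) λ (b₁ , b₂) →
          ∑ (free _) (mul a₁ b₁) λ u → ∑ (free _) (mul a₂ b₂) λ v → gen (u , v)) ≡
        ∑ℤ (comul b) λ (b₁ , b₂) →
          ∑ℤ (mul a₁ b₁) λ u → ∑ℤ (mul a₂ b₂) λ v → to φ (gen (u , v))
      expandℤ φ a₁ a₂ = trans (∑ℤ-hom φ (comul b) _) (∑ℤ-ext (comul b) λ (b₁ , b₂) →
        trans (∑ℤ-hom φ (mul a₁ b₁) _) (∑ℤ-ext (mul a₁ b₁) λ u → ∑ℤ-hom φ (mul a₂ b₂) _))

-- Graded modules with a basis

record Closed (M : ℤ-Module) (P : Pred ∣ M ∣ᴹ 0ℓ) : Set where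
  open Module M
  field
    ≈-in : ∀ {x y} → x ≈ᴹ y → P x → P y
    0-in : P 0ᴹ
    +-in : ∀ {x y} → P x → P y → P (x +ᴹ y)
    ·-in : ∀ r {x} → P x → P (r *ₗ x)

  ∑-in : {A : Set} (as : List A) {f : A → ∣ M ∣ᴹ} → (∀ a → a ∈ˡ as → P (f a)) → P (∑ M as f)
  ∑-in []       p = 0-in
  ∑-in (a ∷ as) p = +-in (p a (here refl)) (∑-in as λ b → p b ∘ there)

span-closed : ∀ M P → Closed M (Span M P)
span-closed M P = record
  { ≈-in = span-resp ; 0-in = span-0 ; +-in = span-+ ; ·-in = span-· }

open Coefficients _≟_ using (coef; coef-separates)

-- The decision is an argument so that proofs can match on it without unfolding `degreePart`.
keep : ∀ {p} {P : Set p} → Dec P → Basis → Lin Basis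
keep (yes _) b = gen b
keep (no _)  b = 𝟎

degreePart : ℕ → Basis → Lin Basis
degreePart n b = keep (deg b ℕₚ.≟ n) b

degreePartₗ : ℕ → 𝒯ᴹ ⟶ 𝒯ᴹ
degreePartₗ n = freeₗ 𝒯ᴹ (degreePart n)

coef-degreePart : ∀ b s → to (coef b) (to (degreePartₗ (deg b)) s) ≡ to (coef b) s
coef-degreePart b = presented-ext (coef b ∘ₗ degreePartₗ (deg b)) (coef b) onGen
  where
  kept : ∀ c (d : Dec (deg c ≡ deg b)) → to (coef b) (keep d c) ≡ 𝟙[ b ≟ c ]
  kept c (yes _) = refl
  kept c (no ≢)  = sym (𝟙-no (b ≟ c) λ { refl → ≢ refl })
  onGen : ∀ c → to (coef b) (degreePart (deg b) c) ≡ 𝟙[ b ≟ c ]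
  onGen c = kept c (deg c ℕₚ.≟ deg b)

coef-degreePart-≢ : ∀ {n} b → deg b ≢ n → ∀ s → to (coef b) (to (degreePartₗ n) s) ≡ 0ℤ
coef-degreePart-≢ {n} b b≢n = presented-ext (coef b ∘ₗ degreePartₗ n) 0ₗ onGen
  where
  kept : ∀ c (d : Dec (deg c ≡ n)) → to (coef b) (keep d c) ≡ 0ℤ
  kept c (yes c≡n) = 𝟙-no (b ≟ c) λ { refl → b≢n c≡n }
  kept c (no _)    = refl
  onGen : ∀ c → to (coef b) (degreePart n c) ≡ 0ℤ
  onGen c = kept c (deg c ℕₚ.≟ n)

-- Covers `𝒯`, `NCQsym` and its graded dual at once. `expand` works on representatives; its
-- linearity and its compatibility with equality are derived from the coordinates.
record Based (G : GradedModule) : Set where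
  open GradedModule G
  field
    e          : Basis → Carrierᴹ
    coord      : Basis → module′ ⟶ ℤᴹ
    coord-e    : ∀ b c → to (coord b) (e c) ≡ 𝟙[ b ≟ c ]
    expand     : Carrierᴹ → Lin Basis
    expand-≈   : ∀ x → x ≈ᴹ extend module′ e (expand x)
    deg-closed : ∀ n → Closed module′ (Deg n)
    deg-e      : ∀ b → Deg (deg b) (e b)
    deg-coord  : ∀ {n x} → Deg n x → ∀ b → deg b ≢ n → to (coord b) x ≡ 0ℤ

  eₗ : 𝒯ᴹ ⟶ module′
  eₗ = freeₗ module′ e

  coord-eₗ : ∀ b s → to (coord b) (to eₗ s) ≡ to (coef b) s
  coord-eₗ b = presented-ext (coord b ∘ₗ eₗ) (coef b) (coord-e b)

  coef-expand : ∀ b x → to (coef b) (expand x) ≡ to (coord b) x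
  coef-expand b x = trans (sym (coord-eₗ b (expand x))) (Hom.≈-homo (coord b) (≈ᴹ-sym (expand-≈ x)))

  coord-separates : ∀ x y → (∀ b → to (coord b) x ≡ to (coord b) y) → x ≈ᴹ y
  coord-separates x y h = ≈ᴹ-trans (expand-≈ x) (≈ᴹ-trans
    (Hom.≈-homo eₗ (coef-separates (expand x) (expand y) λ b →
      trans (coef-expand b x) (trans (h b) (sym (coef-expand b y)))))
    (≈ᴹ-sym (expand-≈ y)))

  -- The coefficients of `expand x` are the coordinates of `x`, which depend linearly on `x`, and
  -- coefficients separate formal combinations.
  expandₗ : module′ ⟶ 𝒯ᴹ
  expandₗ = lin expand record
    { ≈-homo = λ {x} {y} p → coef-separates _ _ λ b →
        trans (coef-expand b x) (trans (Hom.≈-homo (coord b) p) (sym (coef-expand b y)))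
    ; +-homo = λ x y → coef-separates _ _ λ b →
        trans (coef-expand b _) (trans (Hom.+-homo (coord b) x y)
          (sym (cong₂ ℤ._+_ (coef-expand b x) (coef-expand b y))))
    ; ·-homo = λ r x → coef-separates _ _ λ b →
        trans (coef-expand b _) (trans (Hom.·-homo (coord b) r x)
          (sym (cong (r ℤ.*_) (coef-expand b x))))
    }

  expand-e : ∀ b → Module._≈ᴹ_ 𝒯ᴹ (expand (e b)) (gen b)
  expand-e b = coef-separates _ _ λ c → trans (coef-expand c (e b)) (coord-e c b)

  basis-ext : ∀ {M} (φ ψ : module′ ⟶ M) → (∀ b → Module._≈ᴹ_ M (to φ (e b)) (to ψ (e b))) →
              ∀ x → Module._≈ᴹ_ M (to φ x) (to ψ x)
  basis-ext {M} φ ψ h x = Module.≈ᴹ-trans M (Hom.≈-homo φ (expand-≈ x))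
    (Module.≈ᴹ-trans M (presented-ext (φ ∘ₗ eₗ) (ψ ∘ₗ eₗ) h (expand x))
      (Hom.≈-homo ψ (≈ᴹ-sym (expand-≈ x))))

  -- Compared by coordinates: at basis elements of degree `n` the projection changes nothing, at all
  -- others `deg-coord` makes the coordinates of `x` vanish.
  degree-part-≈ : ∀ {n x} → Deg n x → x ≈ᴹ to eₗ (to (degreePartₗ n) (expand x))
  degree-part-≈ {n} {x} x∈ = coord-separates _ _ λ b → sym (trans (coord-eₗ b (to (degreePartₗ n)
      (expand x))) (part b))
    where
    part : ∀ b → to (coef b) (to (degreePartₗ n) (expand x)) ≡ to (coord b) x
    part b with deg b ℕₚ.≟ n
    ... | yes refl = trans (coef-degreePart b (expand x)) (coef-expand b x)
    ... | no b≢n   = trans (coef-degreePart-≢ b b≢n (expand x)) (sym (deg-coord x∈ b b≢n))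

  -- `Deg n` is an arbitrary predicate here, with no constructors to induct on; a homogeneous
  -- element is first replaced by a combination of basis elements of its degree.
  deg-ind : ∀ {N P} → Closed N P → (φ : module′ ⟶ N) → ∀ {n} →
            (∀ b → deg b ≡ n → P (to φ (e b))) → ∀ {x} → Deg n x → P (to φ x)
  deg-ind {N} {P} cl φ {n} h {x} x∈ =
    ≈-in (Module.≈ᴹ-sym N (Hom.≈-homo φ (degree-part-≈ x∈))) (go (expand x))
    where
    open Closed cl
    go : ∀ s → P (to φ (to eₗ (to (degreePartₗ n) s)))
    go (gen b) = kept (deg b ℕₚ.≟ n)
      where
      kept : ∀ d → P (to φ (to eₗ (keep d b)))
      kept (yes b≡n) = h b b≡n
      kept (no _)    = ≈-in (Module.≈ᴹ-sym N (Hom.0-homo φ)) 0-in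
    go 𝟎       = ≈-in (Module.≈ᴹ-sym N (Hom.0-homo φ)) 0-in
    go (s ⊞ t) = ≈-in (Module.≈ᴹ-sym N (Hom.+-homo φ _ _)) (+-in (go s) (go t))
    go (r · s) = ≈-in (Module.≈ᴹ-sym N (Hom.·-homo φ r _)) (·-in r (go s))

  isGrading : IsGrading G
  isGrading = record
    { deg-resp    = λ {n} → Closed.≈-in (deg-closed n)
    ; deg-0       = λ {n} → Closed.0-in (deg-closed n)
    ; deg-+       = λ {n} → Closed.+-in (deg-closed n)
    ; deg-·       = λ {n} → Closed.·-in (deg-closed n)
    ; decompose   = decompose
    ; independent = independent
    }
    where
    partSum : ∀ N → Lin Basis → Lin Basis
    partSum N s = ∑ 𝒯ᴹ (upTo N) (λ n → to (degreePartₗ n) s)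

    open Mod 𝒯ᴹ using () renaming (_≈ᴹ_ to _≋_)

    -- The claim is made for all larger bounds too, which lets the bounds of the two summands of
    -- `s ⊞ t` be raised to a common one.
    parts : ∀ s → Σ[ N ∈ ℕ ] (∀ N′ → N ≤ N′ → s ≋ partSum N′ s)
    parts (gen b) = suc (deg b) , λ N′ b<N′ → ≈-sym (≈-trans
      (∑-pick 𝒯ᴹ (Uniqueₚ.upTo⁺ N′) (∈-upTo⁺ b<N′) λ n n≢ → Mod.≈-reflexive 𝒯ᴹ
        (otherPart n (n≢ ∘ sym)))
      (Mod.≈-reflexive 𝒯ᴹ ownPart))
      where
      kept : ∀ {n} (d : Dec (deg b ≡ n)) → deg b ≡ n → keep d b ≡ gen b
      kept (yes _) _ = refl
      kept (no ≢)  ≡n = contradiction ≡n ≢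
      ownPart : degreePart (deg b) b ≡ gen b
      ownPart = kept (deg b ℕₚ.≟ deg b) refl
      dropped : ∀ {n} (d : Dec (deg b ≡ n)) → deg b ≢ n → keep d b ≡ 𝟎
      dropped (yes ≡n) ≢ = contradiction ≡n ≢
      dropped (no _)   _ = refl
      otherPart : ∀ n → deg b ≢ n → degreePart n b ≡ 𝟎
      otherPart n = dropped (deg b ℕₚ.≟ n)
    parts 𝟎       = 0 , λ N′ _ → ≈-sym (∑-zero 𝒯ᴹ (upTo N′) λ _ _ → ≈-refl)
    parts (s ⊞ t) with parts s | parts t
    ... | N₁ , h₁ | N₂ , h₂ = N₁ ℕ.⊔ N₂ , λ N′ le → ≈-trans
      (⊞-cong (h₁ N′ (ℕₚ.≤-trans (ℕₚ.m≤m⊔n N₁ N₂) le)) (h₂ N′ (ℕₚ.≤-trans (ℕₚ.m≤n⊔m N₁ N₂) le)))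
      (≈-sym (∑-+ 𝒯ᴹ (upTo N′) _ _))
    parts (r · s) with parts s
    ... | N , h = N , λ N′ le → ≈-trans (·-cong r (h N′ le)) (∑-hom (r ·ₗ idₗ {𝒯ᴹ}) (upTo N′) _)

    decompose : ∀ x → Σ[ N ∈ ℕ ] Σ[ c ∈ (ℕ → Carrierᴹ) ]
                (∀ n → Deg n (c n)) × x ≈ᴹ (∑[ n ∈ upTo N ] c n In module′)
    decompose x with parts (expand x)
    ... | N , h = N , (λ n → to eₗ (to (degreePartₗ n) (expand x))) , inDegree (expand x) ,
      ≈ᴹ-trans (expand-≈ x) (≈ᴹ-trans (Hom.≈-homo eₗ (h N ℕₚ.≤-refl)) (∑-hom eₗ (upTo N) _))
      where
      inDegree : ∀ s n → Deg n (to eₗ (to (degreePartₗ n) s))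
      inDegree (gen b) n = kept (deg b ℕₚ.≟ n)
        where
        kept : ∀ d → Deg n (to eₗ (keep d b))
        kept (yes refl) = deg-e b
        kept (no _)     = Closed.0-in (deg-closed n)
      inDegree 𝟎       n = Closed.0-in (deg-closed n)
      inDegree (s ⊞ t) n = Closed.+-in (deg-closed n) (inDegree s n) (inDegree t n)
      inDegree (r · s) n = Closed.·-in (deg-closed n) r (inDegree s n)

    -- The coordinate at `b` annihilates every summand except the one of degree `deg b`, so a
    -- vanishing sum forces each coordinate of `c n` to vanish.
    independent : ∀ N (c : ℕ → Carrierᴹ) → (∀ n → Deg n (c n)) →
                  (∑[ n ∈ upTo N ] c n In module′) ≈ᴹ 0ᴹ → ∀ n → n < N → c n ≈ᴹ 0ᴹ
    independent N c c∈ ∑≈0 n n<N = coord-separates _ _ λ b → trans (vanish b)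
        (sym (Hom.0-homo (coord b)))
      where
      vanish : ∀ b → to (coord b) (c n) ≡ 0ℤ
      vanish b with deg b ℕₚ.≟ n
      ... | no b≢n   = deg-coord (c∈ n) b b≢n
      ... | yes refl = trans
        (sym (∑-pick ℤᴹ (Uniqueₚ.upTo⁺ N) (∈-upTo⁺ n<N) λ m m≢ → deg-coord (c∈ m) b (m≢ ∘ sym)))
        (trans (sym (∑-hom (coord b) (upTo N) c))
          (trans (Hom.≈-homo (coord b) ∑≈0) (Hom.0-homo (coord b))))

-- Hopf algebras from multiset identities

open GradedModule using () renaming (module′ to _ᴹ)

module _ {G : GradedModule} where
  -- The operations are described up to equality and by their values on the basis. This fits the
  -- prescribed operations of `𝒯` as well as the operations constructed on the other two modules.
  record Realizes (B : Based G) (C : Combinatorial) (A : HopfOperations G) : Set where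
    open Based B
    open Combinatorial C
    open HopfOperations A
    field
      ∙-bilinear : IsBilinear (G ᴹ) (G ᴹ) (G ᴹ) _∙_
      ∙-e        : ∀ b c → Module._≈ᴹ_ (G ᴹ) (e b ∙ e c) (∑ (G ᴹ) (mul b c) e)
      1-e        : Module._≈ᴹ_ (G ᴹ) 1# (e 𝟏)
      δ-linear   : IsLinear (G ᴹ) (G ᴹ ⊗ᴹ G ᴹ) δ
      δ-e        : ∀ b → Module._≈ᴹ_ (G ᴹ ⊗ᴹ G ᴹ) (δ (e b))
                     (∑ (G ᴹ ⊗ᴹ G ᴹ) (comul b) λ (x , y) → e x ⊗ e y)
      ε-linear   : IsLinear (G ᴹ) ℤᴹ ε
      ε-e        : ∀ b → ε (e b) ≡ projection₀ b

module _ (M N L : ℤ-Module) where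
  private
    module MN = IsBilinear (⊗-bilinear M (N ⊗ᴹ L))
    module NL = IsBilinear (⊗-bilinear N L)

  -- `assocʳ` nests two extensions. The inner one is well defined for each fixed `z`, and the
  -- dependence on `z` has to be linear for the outer one to be well defined.
  assocʳ-inner : IsBilinear L (M ⊗ᴹ N) (M ⊗ᴹ (N ⊗ᴹ L))
    (λ z t → extend (M ⊗ᴹ (N ⊗ᴹ L)) (λ (x , y) → x ⊗ (y ⊗ z)) t)
  assocʳ-inner = extend-bilinear {M = L} {L = M ⊗ᴹ (N ⊗ᴹ L)} {R = Bilinear M N}
    (λ z (x , y) → x ⊗ (y ⊗ z))
    (λ z {s} {t} r → Hom.≈-homo
      (IsBilinear.⊗-elim (bilinear-∘ {M′ = M} {N′ = N} idₗ (⊗-bilinear M (N ⊗ᴹ L)) idₗ (z NL.ˡ)))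
      {s} {t} (rel r))
    λ (x , y) → Hom.isLinear (_∘ₗ_ {L} {N ⊗ᴹ L} {M ⊗ᴹ (N ⊗ᴹ L)} (x MN.ʳ) (y NL.ʳ))

  assocʳₗ : ((M ⊗ᴹ N) ⊗ᴹ L) ⟶ (M ⊗ᴹ (N ⊗ᴹ L))
  assocʳₗ = IsBilinear.⊗-elim (bilinear-flip assocʳ-inner)

module HopfAlgebra {G : GradedModule}
                   {B : Based G} {C : Combinatorial} {A : HopfOperations G}
                   (R : Realizes B C A) where
  open GradedModule G using (Deg)
  open Based B
  open Combinatorial C
  open HopfOperations A
  open Realizes R
  private
    module H = Mod (G ᴹ)
    module H² = Mod (G ᴹ ⊗ᴹ G ᴹ)
    module H³ = Mod (G ᴹ ⊗ᴹ (G ᴹ ⊗ᴹ G ᴹ))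
    module U = Universal C
    module ∙ = IsBilinear ∙-bilinear
    module ⊗² = IsBilinear (⊗-bilinear (G ᴹ) (G ᴹ))
    module ⊗³ = IsBilinear (⊗-bilinear (G ᴹ) (G ᴹ ⊗ᴹ G ᴹ))
    open H using (_≈ᴹ_; _+ᴹ_; _*ₗ_; 0ᴹ)

  δₗ : G ᴹ ⟶ (G ᴹ ⊗ᴹ G ᴹ)
  δₗ = lin δ δ-linear

  εₗ : G ᴹ ⟶ ℤᴹ
  εₗ = lin ε ε-linear

  ∙-assoc : ∀ x y z → ((x ∙ y) ∙ z) ≈ᴹ (x ∙ (y ∙ z))
  ∙-assoc x y z = basis-ext ((z ∙.ˡ) ∘ₗ (y ∙.ˡ)) ((y ∙ z) ∙.ˡ) (λ a →
    basis-ext ((z ∙.ˡ) ∘ₗ (e a ∙.ʳ)) ((e a ∙.ʳ) ∘ₗ (z ∙.ˡ)) (λ b →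
    basis-ext ((e a ∙ e b) ∙.ʳ) ((e a ∙.ʳ) ∘ₗ (e b ∙.ʳ)) (λ c → onBasis a b c) z) y) x
    where
    onBasis : ∀ a b c → ((e a ∙ e b) ∙ e c) ≈ᴹ (e a ∙ (e b ∙ e c))
    onBasis a b c = begin
      (e a ∙ e b) ∙ e c                         ≈⟨ Hom.≈-homo (e c ∙.ˡ) (∙-e a b) ⟩
      ∑ (G ᴹ) (mul a b) e ∙ e c                     ≈⟨ ∑-hom (e c ∙.ˡ) (mul a b) e ⟩
      ∑ (G ᴹ) (mul a b) (λ x → e x ∙ e c)           ≈⟨ ∑-ext (G ᴹ) (mul a b) (λ x → ∙-e x c) ⟩
      ∑ (G ᴹ) (mul a b) (λ x → ∑ (G ᴹ) (mul x c) e)     ≈⟨ U.assocᵘ (G ᴹ) e a b c ⟩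
      ∑ (G ᴹ) (mul b c) (λ x → ∑ (G ᴹ) (mul a x) e)     ≈⟨ ∑-ext (G ᴹ) (mul b c) (λ x → ∙-e a x) ⟨
      ∑ (G ᴹ) (mul b c) (λ x → e a ∙ e x)           ≈⟨ ∑-hom (e a ∙.ʳ) (mul b c) e ⟨
      e a ∙ ∑ (G ᴹ) (mul b c) e                     ≈⟨ Hom.≈-homo (e a ∙.ʳ) (∙-e b c) ⟨
      e a ∙ (e b ∙ e c)                         ∎
      where open SetoidReasoning H.≈ᴹ-setoid

  ∙-identityˡ : ∀ x → (1# ∙ x) ≈ᴹ x
  ∙-identityˡ = basis-ext (1# ∙.ʳ) idₗ λ b →
    H.≈ᴹ-trans (Hom.≈-homo (e b ∙.ˡ) 1-e) (H.≈ᴹ-trans (∙-e 𝟏 b) (U.unitˡᵘ (G ᴹ) e b))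

  ∙-identityʳ : ∀ x → (x ∙ 1#) ≈ᴹ x
  ∙-identityʳ = basis-ext (1# ∙.ˡ) idₗ λ b →
    H.≈ᴹ-trans (Hom.≈-homo (e b ∙.ʳ) 1-e) (H.≈ᴹ-trans (∙-e b 𝟏) (U.unitʳᵘ (G ᴹ) e b))

  isAlgebra : IsAlgebra A
  isAlgebra = record
    { isRing = record
      { +-isAbelianGroup = H.+ᴹ-isAbelianGroup
      ; *-cong           = ∙.cong₂′
      ; *-assoc          = ∙-assoc
      ; *-identity       = ∙-identityˡ , ∙-identityʳ
      ; distrib          = (λ x → Hom.+-homo (x ∙.ʳ)) , (λ x → Hom.+-homo (x ∙.ˡ))
      }
    ; ·-∙ = λ r x y → Hom.·-homo (y ∙.ˡ) r x
    ; ∙-· = λ r x y → Hom.·-homo (x ∙.ʳ) r y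
    }

  ⊗-elim-δ : ∀ {M β} (b : IsBilinear (G ᴹ) (G ᴹ) M β) → ∀ x → Module._≈ᴹ_ M
             (to (IsBilinear.⊗-elim b) (δ (e x))) (∑ M (comul x) λ (y , z) → β (e y) (e z))
  ⊗-elim-δ {M} b x = Module.≈ᴹ-trans M (Hom.≈-homo (IsBilinear.⊗-elim b) (δ-e x))
    (∑-hom (IsBilinear.⊗-elim b) (comul x) (λ (y , z) → e y ⊗ e z))

  module _ {N : ℤ-Module} where
    private
      module N = Mod N

    -- `φ` stands for a map that applies `δ` to the first factor, and `ψ y` for what it does
    -- afterwards with the second factor `e y` already inserted.
    doubleδˡ : ∀ {φ : (G ᴹ ⊗ᴹ G ᴹ) ⟶ N} {ψ : Basis → (G ᴹ ⊗ᴹ G ᴹ) ⟶ N} →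
      (∀ x y → to φ (e x ⊗ e y) N.≈ᴹ to (ψ y) (δ (e x))) →
      ∀ b → to φ (δ (e b)) N.≈ᴹ
            ∑ N (comul b) (λ (x , y) → ∑ N (comul x) λ (u , v) → to (ψ y) (e u ⊗ e v))
    doubleδˡ {φ} {ψ} h b = N.≈ᴹ-trans (Hom.≈-homo φ (δ-e b))
      (N.≈ᴹ-trans (∑-hom φ (comul b) (λ (x , y) → e x ⊗ e y))
        (∑-ext N (comul b) λ (x , y) → N.≈ᴹ-trans (h x y)
          (N.≈ᴹ-trans (Hom.≈-homo (ψ y) (δ-e x)) (∑-hom (ψ y) (comul x) (λ (u , v) → e u ⊗ e v)))))

    doubleδʳ : ∀ {φ : (G ᴹ ⊗ᴹ G ᴹ) ⟶ N} {ψ : Basis → (G ᴹ ⊗ᴹ G ᴹ) ⟶ N} →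
      (∀ x y → to φ (e x ⊗ e y) N.≈ᴹ to (ψ x) (δ (e y))) →
      ∀ b → to φ (δ (e b)) N.≈ᴹ
            ∑ N (comul b) (λ (x , y) → ∑ N (comul y) λ (u , v) → to (ψ x) (e u ⊗ e v))
    doubleδʳ {φ} {ψ} h b = N.≈ᴹ-trans (Hom.≈-homo φ (δ-e b))
      (N.≈ᴹ-trans (∑-hom φ (comul b) (λ (x , y) → e x ⊗ e y))
        (∑-ext N (comul b) λ (x , y) → N.≈ᴹ-trans (h x y)
          (N.≈ᴹ-trans (Hom.≈-homo (ψ x) (δ-e y)) (∑-hom (ψ x) (comul y) (λ (u , v) → e u ⊗ e v)))))

  private
    δ⊗id : (G ᴹ ⊗ᴹ G ᴹ) ⟶ ((G ᴹ ⊗ᴹ G ᴹ) ⊗ᴹ G ᴹ)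
    δ⊗id = tensorₗ {G ᴹ ⊗ᴹ G ᴹ} {G ᴹ} {G ᴹ} {G ᴹ} δₗ idₗ

    left₂ : (G ᴹ ⊗ᴹ G ᴹ) ⟶ (G ᴹ ⊗ᴹ (G ᴹ ⊗ᴹ G ᴹ))
    left₂ = assocʳₗ (G ᴹ) (G ᴹ) (G ᴹ) ∘ₗ δ⊗id

    right₂ : (G ᴹ ⊗ᴹ G ᴹ) ⟶ (G ᴹ ⊗ᴹ (G ᴹ ⊗ᴹ G ᴹ))
    right₂ = tensorₗ {G ᴹ} {G ᴹ ⊗ᴹ G ᴹ} {G ᴹ} {G ᴹ} idₗ δₗ

    leftᵉ : Basis → (G ᴹ ⊗ᴹ G ᴹ) ⟶ (G ᴹ ⊗ᴹ (G ᴹ ⊗ᴹ G ᴹ))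
    leftᵉ y = IsBilinear._ʳ (assocʳ-inner (G ᴹ) (G ᴹ) (G ᴹ)) (e y)

    rightᵉ : Basis → (G ᴹ ⊗ᴹ G ᴹ) ⟶ (G ᴹ ⊗ᴹ (G ᴹ ⊗ᴹ G ᴹ))
    rightᵉ x = e x ⊗³.ʳ

    left₂-e : ∀ x y → to left₂ (e x ⊗ e y) H³.≈ᴹ to (leftᵉ y) (δ (e x))
    left₂-e x y = H³.≈ᴹ-refl

    right₂-e : ∀ x y → to right₂ (e x ⊗ e y) H³.≈ᴹ to (rightᵉ x) (δ (e y))
    right₂-e x y = H³.≈ᴹ-refl

    left right : G ᴹ ⟶ (G ᴹ ⊗ᴹ (G ᴹ ⊗ᴹ G ᴹ))
    left = left₂ ∘ₗ δₗ
    right = right₂ ∘ₗ δₗ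

    left-e : ∀ b → to left (e b) H³.≈ᴹ ∑ (G ᴹ ⊗ᴹ (G ᴹ ⊗ᴹ G ᴹ)) (comul b) (λ (x , y) →
      ∑ (G ᴹ ⊗ᴹ (G ᴹ ⊗ᴹ G ᴹ)) (comul x) λ (u , v) → to (leftᵉ y) (e u ⊗ e v))
    left-e = doubleδˡ {G ᴹ ⊗ᴹ (G ᴹ ⊗ᴹ G ᴹ)} {left₂} {leftᵉ} left₂-e

    right-e : ∀ b → to right (e b) H³.≈ᴹ ∑ (G ᴹ ⊗ᴹ (G ᴹ ⊗ᴹ G ᴹ)) (comul b) (λ (x , y) →
      ∑ (G ᴹ ⊗ᴹ (G ᴹ ⊗ᴹ G ᴹ)) (comul y) λ (u , v) → to (rightᵉ x) (e u ⊗ e v))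
    right-e = doubleδʳ {G ᴹ ⊗ᴹ (G ᴹ ⊗ᴹ G ᴹ)} {right₂} {rightᵉ} right₂-e

    left≈right : ∀ b → to left (e b) H³.≈ᴹ to right (e b)
    left≈right b = H³.≈ᴹ-trans (left-e b)
      (H³.≈ᴹ-trans (U.coassocᵘ (G ᴹ ⊗ᴹ (G ᴹ ⊗ᴹ G ᴹ)) (λ u v w → e u ⊗ (e v ⊗ e w)) b)
        (H³.≈ᴹ-sym (right-e b)))

    δ-coassoc : ∀ x → to left x H³.≈ᴹ to right x
    δ-coassoc = basis-ext left right left≈right

  ε*-bilinear : IsBilinear (G ᴹ) (G ᴹ) (G ᴹ) (λ y z → ε y *ₗ z)
  ε*-bilinear = bilinear-∘ idₗ (*ₗ-bilinear (G ᴹ)) εₗ idₗ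

  isCoalgebra : IsCoalgebra A
  isCoalgebra = record
    { δ-linear = Hom.linear δₗ
    ; ε-linear = Hom.linear εₗ
    ; coassoc  = δ-coassoc
    ; counitˡ  = basis-ext (IsBilinear.⊗-elim ε*-bilinear ∘ₗ δₗ) idₗ λ b →
        H.≈ᴹ-trans (⊗-elim-δ ε*-bilinear b) (H.≈ᴹ-trans
          (∑-ext (G ᴹ) (comul b) λ (y , z) → H.*ₗ-cong (ε-e y) H.≈ᴹ-refl) (U.counitˡᵘ (G ᴹ) e b))
    ; counitʳ  = basis-ext (IsBilinear.⊗-elim (bilinear-flip ε*-bilinear) ∘ₗ δₗ) idₗ λ b →
        H.≈ᴹ-trans (⊗-elim-δ (bilinear-flip ε*-bilinear) b) (H.≈ᴹ-trans
          (∑-ext (G ᴹ) (comul b) λ (y , z) → H.*ₗ-cong (ε-e z) H.≈ᴹ-refl) (U.counitʳᵘ (G ᴹ) e b))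
    }

  private
    ∙²-inner : ∀ x y → IsBilinear (G ᴹ) (G ᴹ) (G ᴹ ⊗ᴹ G ᴹ) (λ x′ y′ → (x ∙ x′) ⊗ (y ∙ y′))
    ∙²-inner x y = bilinear-∘ idₗ (⊗-bilinear (G ᴹ) (G ᴹ)) (x ∙.ʳ) (y ∙.ʳ)

    ∙²-outer : ∀ t → IsBilinear (G ᴹ) (G ᴹ) (G ᴹ ⊗ᴹ G ᴹ)
      (λ x y → extend (G ᴹ ⊗ᴹ G ᴹ) (λ (x′ , y′) → (x ∙ x′) ⊗ (y ∙ y′)) t)
    ∙²-outer t = record
      { linˡ = λ y → IsBilinear.linˡ (extend-bilinear {L = G ᴹ ⊗ᴹ G ᴹ} {R = Bilinear (G ᴹ) (G ᴹ)}
          (λ x (x′ , y′) → (x ∙ x′) ⊗ (y ∙ y′))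
          (λ x {s} {s′} r → Hom.≈-homo (IsBilinear.⊗-elim (∙²-inner x y)) {s} {s′} (rel r))
          λ (x′ , y′) → Hom.isLinear (((y ∙ y′) ⊗².ˡ) ∘ₗ (x′ ∙.ˡ))) t
      ; linʳ = λ x → IsBilinear.linˡ (extend-bilinear {L = G ᴹ ⊗ᴹ G ᴹ} {R = Bilinear (G ᴹ) (G ᴹ)}
          (λ y (x′ , y′) → (x ∙ x′) ⊗ (y ∙ y′))
          (λ y {s} {s′} r → Hom.≈-homo (IsBilinear.⊗-elim (∙²-inner x y)) {s} {s′} (rel r))
          λ (x′ , y′) → Hom.isLinear (((x ∙ x′) ⊗².ʳ) ∘ₗ (y′ ∙.ˡ))) t
      }

    infixl 7 _∙∙_
    _∙∙_ : ∣ G ᴹ ⊗ᴹ G ᴹ ∣ᴹ → ∣ G ᴹ ⊗ᴹ G ᴹ ∣ᴹ → ∣ G ᴹ ⊗ᴹ G ᴹ ∣ᴹ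
    _∙∙_ = _∙²_ A

  ∙²-bilinear : IsBilinear (G ᴹ ⊗ᴹ G ᴹ) (G ᴹ ⊗ᴹ G ᴹ) (G ᴹ ⊗ᴹ G ᴹ) _∙∙_
  ∙²-bilinear = record
    { linˡ = λ t → Hom.isLinear (IsBilinear.⊗-elim (∙²-outer t))
    ; linʳ = λ s → IsBilinear.linˡ (extend-bilinear {M = G ᴹ ⊗ᴹ G ᴹ} {L = G ᴹ ⊗ᴹ G ᴹ}
        {R = Bilinear (G ᴹ) (G ᴹ)}
        (λ t (x , y) → extend (G ᴹ ⊗ᴹ G ᴹ) (λ (x′ , y′) → (x ∙ x′) ⊗ (y ∙ y′)) t)
        (λ t {s} {s′} r → Hom.≈-homo (IsBilinear.⊗-elim (∙²-outer t)) {s} {s′} (rel r))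
        λ (x , y) → Hom.isLinear (IsBilinear.⊗-elim (∙²-inner x y))) s
    }

  private
    module ∙² = IsBilinear ∙²-bilinear

  δ-∙-homo : ∀ x y → δ (x ∙ y) H².≈ᴹ (δ x ∙∙ δ y)
  δ-∙-homo x y = basis-ext (δₗ ∘ₗ (y ∙.ˡ)) ((δ y ∙².ˡ) ∘ₗ δₗ) (λ a →
    basis-ext (δₗ ∘ₗ (e a ∙.ʳ)) ((δ (e a) ∙².ʳ) ∘ₗ δₗ) (onBasis a) y) x
    where
    onBasis : ∀ a b → δ (e a ∙ e b) H².≈ᴹ (δ (e a) ∙∙ δ (e b))
    onBasis a b = begin
      δ (e a ∙ e b)
        ≈⟨ Hom.≈-homo δₗ (∙-e a b) ⟩
      δ (∑ (G ᴹ) (mul a b) e)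
        ≈⟨ ∑-hom δₗ (mul a b) e ⟩
      ∑ (G ᴹ ⊗ᴹ G ᴹ) (mul a b) (λ x → δ (e x))
        ≈⟨ ∑-ext (G ᴹ ⊗ᴹ G ᴹ) (mul a b) δ-e ⟩
      ∑ (G ᴹ ⊗ᴹ G ᴹ) (mul a b) (λ x → ∑ (G ᴹ ⊗ᴹ G ᴹ) (comul x) λ (u , v) → e u ⊗ e v)
        ≈⟨ U.compatᵘ (G ᴹ ⊗ᴹ G ᴹ) (λ u v → e u ⊗ e v) a b ⟩
      ∑ (G ᴹ ⊗ᴹ G ᴹ) (comul a) (λ (a₁ , a₂) → ∑ (G ᴹ ⊗ᴹ G ᴹ) (comul b) λ (b₁ , b₂) →
        ∑ (G ᴹ ⊗ᴹ G ᴹ) (mul a₁ b₁) λ u → ∑ (G ᴹ ⊗ᴹ G ᴹ) (mul a₂ b₂) λ v → e u ⊗ e v)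
        ≈⟨ ∑-ext (G ᴹ ⊗ᴹ G ᴹ) (comul a) (λ (a₁ , a₂) → ∑-ext (G ᴹ ⊗ᴹ G ᴹ) (comul b) λ (b₁ , b₂) →
             H².≈ᴹ-trans (⊗².cong₂′ (∙-e a₁ b₁) (∙-e a₂ b₂))
                         (⊗².∑∑ (mul a₁ b₁) (mul a₂ b₂) e e)) ⟨
      ∑ (G ᴹ ⊗ᴹ G ᴹ) (comul a) (λ (a₁ , a₂) → ∑ (G ᴹ ⊗ᴹ G ᴹ) (comul b) λ (b₁ , b₂) →
        (e a₁ ∙ e b₁) ⊗ (e a₂ ∙ e b₂))
        ≈⟨ ∙².∑∑ (comul a) (comul b) (λ (a₁ , a₂) → e a₁ ⊗ e a₂) (λ (b₁ , b₂) → e b₁ ⊗ e b₂) ⟨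
      (∑ (G ᴹ ⊗ᴹ G ᴹ) (comul a) λ (a₁ , a₂) → e a₁ ⊗ e a₂) ∙∙
      (∑ (G ᴹ ⊗ᴹ G ᴹ) (comul b) λ (b₁ , b₂) → e b₁ ⊗ e b₂)
        ≈⟨ ∙².cong₂′ (δ-e a) (δ-e b) ⟨
      δ (e a) ∙∙ δ (e b) ∎
      where open SetoidReasoning H².≈ᴹ-setoid

  ε-∙-homo : ∀ x y → ε (x ∙ y) ≡ ε x ℤ.* ε y
  ε-∙-homo x y = basis-ext (εₗ ∘ₗ (y ∙.ˡ)) ((ε y ℤ*.ˡ) ∘ₗ εₗ) (λ a →
    basis-ext (εₗ ∘ₗ (e a ∙.ʳ)) ((ε (e a) ℤ*.ʳ) ∘ₗ εₗ) (onBasis a) y) x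
    where
    module ℤ* = IsBilinear (*ₗ-bilinear ℤᴹ)
    -- Degrees add in a product, so terms of degree 0 occur only if both factors are `𝟏`; the unit
    -- law for the constant function 1 then counts the terms.
    counit-mul : ∀ a b → ∑ℤ (mul a b) projection₀ ≡ projection₀ a ℤ.* projection₀ b
    counit-mul a b with deg a ℕₚ.≟ 0 | deg b ℕₚ.≟ 0
    ... | yes a≡0 | yes b≡0 rewrite deg-0 a a≡0 | deg-0 b b≡0 = trans
      (∑ℤ-cong (mul 𝟏 𝟏) (λ x x∈ → projection₀-0 x (mul-deg 𝟏 𝟏 x x∈))) (unitˡ 𝟏 (λ _ → 1ℤ))
    ... | no a≢0 | _ rewrite projection₀-≢0 a a≢0 = ∑ℤ-zero (mul a b) λ x x∈ →
      projection₀-≢0 x λ x≡0 → a≢0 (ℕₚ.m+n≡0⇒m≡0 _ (trans (sym (mul-deg a b x x∈)) x≡0))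
    ... | yes _ | no b≢0 rewrite projection₀-≢0 b b≢0 | ℤₚ.*-zeroʳ (projection₀ a) =
      ∑ℤ-zero (mul a b) λ x x∈ →
        projection₀-≢0 x λ x≡0 → b≢0 (ℕₚ.m+n≡0⇒n≡0 (deg a) (trans (sym (mul-deg a b x x∈)) x≡0))
    onBasis : ∀ a b → ε (e a ∙ e b) ≡ ε (e a) ℤ.* ε (e b)
    onBasis a b = trans (Hom.≈-homo εₗ (∙-e a b)) (trans (∑ℤ-hom εₗ (mul a b) e)
      (trans (∑ℤ-ext (mul a b) ε-e) (trans (counit-mul a b)
        (sym (cong₂ ℤ._*_ (ε-e a) (ε-e b))))))

  isBialgebra : IsBialgebra A
  isBialgebra = record
    { isAlgebra   = isAlgebra
    ; isCoalgebra = isCoalgebra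
    ; δ-∙         = δ-∙-homo
    ; δ-1         = H².≈ᴹ-trans (Hom.≈-homo δₗ 1-e) (H².≈ᴹ-trans (δ-e 𝟏)
        (H².≈ᴹ-trans (U.comul-𝟏ᵘ (G ᴹ ⊗ᴹ G ᴹ) (λ x y → e x ⊗ e y)) (H².≈ᴹ-sym (⊗².cong₂′ 1-e 1-e))))
    ; ε-∙         = ε-∙-homo
    ; ε-1         = trans (Hom.≈-homo εₗ 1-e) (ε-e 𝟏)
    }

  -- Convolution and the antipode

  infixl 7 _⋆ₗ_
  _⋆ₗ_ : (f g : G ᴹ ⟶ G ᴹ) → G ᴹ ⟶ G ᴹ
  f ⋆ₗ g = IsBilinear.⊗-elim (bilinear-∘ idₗ ∙-bilinear f g) ∘ₗ δₗ

  infixl 6 _−ₗ_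
  _−ₗ_ : (f g : G ᴹ ⟶ G ᴹ) → G ᴹ ⟶ G ᴹ
  f −ₗ g = f +ₗ (-1ℤ ·ₗ g)

  infixl 6 _−_
  _−_ : H.Carrierᴹ → H.Carrierᴹ → H.Carrierᴹ
  x − y = x +ᴹ (-1ℤ *ₗ y)

  −-cong : ∀ {x x′ y y′} → x ≈ᴹ x′ → y ≈ᴹ y′ → (x − y) ≈ᴹ (x′ − y′)
  −-cong p q = H.+ᴹ-cong p (H.*ₗ-cong refl q)

  −-+ : ∀ x y → ((x − y) +ᴹ y) ≈ᴹ x
  −-+ x y = begin
    (x − y) +ᴹ y                     ≈⟨ H.+ᴹ-assoc x _ y ⟩
    x +ᴹ ((-1ℤ *ₗ y) +ᴹ y)           ≈⟨ H.+ᴹ-congˡ (H.+ᴹ-congˡ (H.*ₗ-identityˡ y)) ⟨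
    x +ᴹ ((-1ℤ *ₗ y) +ᴹ (1ℤ *ₗ y))   ≈⟨ H.+ᴹ-congˡ (H.*ₗ-distribʳ y -1ℤ 1ℤ) ⟨
    x +ᴹ (0ℤ *ₗ y)                   ≈⟨ H.+ᴹ-congˡ (H.*ₗ-zeroˡ y) ⟩
    x +ᴹ 0ᴹ                          ≈⟨ H.+ᴹ-identityʳ x ⟩
    x                                ∎
    where open SetoidReasoning H.≈ᴹ-setoid

  −-self : ∀ {x y} → x ≈ᴹ y → (x − y) ≈ᴹ 0ᴹ
  −-self {x} {y} p = begin
    x − y                            ≈⟨ H.+ᴹ-identityʳ _ ⟨
    (x − y) +ᴹ 0ᴹ                    ≈⟨ H.+ᴹ-congˡ (H.-ᴹ‿inverseʳ y) ⟨
    (x − y) +ᴹ (y +ᴹ (H.-ᴹ y))       ≈⟨ H.+ᴹ-assoc _ y _ ⟨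
    ((x − y) +ᴹ y) +ᴹ (H.-ᴹ y)       ≈⟨ H.+ᴹ-congʳ (−-+ x y) ⟩
    x +ᴹ (H.-ᴹ y)                    ≈⟨ H.+ᴹ-congʳ p ⟩
    y +ᴹ (H.-ᴹ y)                    ≈⟨ H.-ᴹ‿inverseʳ y ⟩
    0ᴹ                               ∎
    where open SetoidReasoning H.≈ᴹ-setoid

  -- Applied with `u` the value of `ηε`, `s` that of a partial sum `S` and `c` that of `S ⋆ id` or
  -- `id ⋆ S`: once stable, the recursion for `S` reads `s = u − (c − s)`, and `c = u` is the
  -- antipode law.
  −-cancel : ∀ u c s → s ≈ᴹ (u − (c − s)) → c ≈ᴹ u
  −-cancel u c s p = begin
    c                                ≈⟨ −-+ c s ⟨
    (c − s) +ᴹ s                     ≈⟨ H.+ᴹ-congˡ p ⟩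
    (c − s) +ᴹ (u − (c − s))         ≈⟨ H.+ᴹ-comm _ _ ⟩
    (u − (c − s)) +ᴹ (c − s)         ≈⟨ −-+ u (c − s) ⟩
    u                                ∎
    where open SetoidReasoning H.≈ᴹ-setoid

  ⋆-e : ∀ f g b → to (f ⋆ₗ g) (e b) ≈ᴹ ∑ (G ᴹ) (comul b) (λ (x , y) → to f (e x) ∙ to g (e y))
  ⋆-e f g = ⊗-elim-δ (bilinear-∘ idₗ ∙-bilinear f g)

  ⋆-cong : ∀ {f f′ g g′ : G ᴹ ⟶ G ᴹ} → (∀ x → to f x ≈ᴹ to f′ x) → (∀ x → to g x ≈ᴹ to g′ x) →
           ∀ x → to (f ⋆ₗ g) x ≈ᴹ to (f′ ⋆ₗ g′) x
  ⋆-cong p q x = extend-cong (G ᴹ) (λ (y , z) → ∙.cong₂′ (p y) (q z)) (δ x)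

  ⋆-subˡ : ∀ f g h x → to ((f −ₗ g) ⋆ₗ h) x ≈ᴹ (to (f ⋆ₗ h) x − to (g ⋆ₗ h) x)
  ⋆-subˡ f g h x = H.≈ᴹ-trans
    (extend-cong (G ᴹ) (λ (y , z) → H.≈ᴹ-trans (Hom.+-homo (to h z ∙.ˡ) _ _)
      (H.+ᴹ-congˡ (Hom.·-homo (to h z ∙.ˡ) -1ℤ _))) (δ x))
    (H.≈ᴹ-trans (extend-+ (G ᴹ) _ _ (δ x)) (H.+ᴹ-congˡ (extend-· (G ᴹ) -1ℤ _ (δ x))))

  ⋆-subʳ : ∀ f g h x → to (f ⋆ₗ (g −ₗ h)) x ≈ᴹ (to (f ⋆ₗ g) x − to (f ⋆ₗ h) x)
  ⋆-subʳ f g h x = H.≈ᴹ-trans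
    (extend-cong (G ᴹ) (λ (y , z) → H.≈ᴹ-trans (Hom.+-homo (to f y ∙.ʳ) _ _)
      (H.+ᴹ-congˡ (Hom.·-homo (to f y ∙.ʳ) -1ℤ _))) (δ x))
    (H.≈ᴹ-trans (extend-+ (G ᴹ) _ _ (δ x)) (H.+ᴹ-congˡ (extend-· (G ᴹ) -1ℤ _ (δ x))))

  ⋆-assoc : ∀ f g h x → to ((f ⋆ₗ g) ⋆ₗ h) x ≈ᴹ to (f ⋆ₗ (g ⋆ₗ h)) x
  ⋆-assoc f g h = basis-ext ((f ⋆ₗ g) ⋆ₗ h) (f ⋆ₗ (g ⋆ₗ h)) λ b → begin
    to ((f ⋆ₗ g) ⋆ₗ h) (e b)
      ≈⟨ ⋆-e (f ⋆ₗ g) h b ⟩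
    ∑ (G ᴹ) (comul b) (λ (x , y) → to (f ⋆ₗ g) (e x) ∙ to h (e y))
      ≈⟨ ∑-ext (G ᴹ) (comul b) (λ (x , y) → H.≈ᴹ-trans
           (Hom.≈-homo (to h (e y) ∙.ˡ) (⋆-e f g x))
           (∑-hom (to h (e y) ∙.ˡ) (comul x) (λ (u , v) → to f (e u) ∙ to g (e v)))) ⟩
    ∑ (G ᴹ) (comul b) (λ (x , y) → ∑ (G ᴹ) (comul x) λ (u , v) → (to f (e u) ∙ to g (e v)) ∙ to h (e y))
      ≈⟨ U.coassocᵘ (G ᴹ) (λ u v w → (to f (e u) ∙ to g (e v)) ∙ to h (e w)) b ⟩
    ∑ (G ᴹ) (comul b) (λ (x , y) → ∑ (G ᴹ) (comul y) λ (u , v) → (to f (e x) ∙ to g (e u)) ∙ to h (e v))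
      ≈⟨ ∑-ext (G ᴹ) (comul b) (λ (x , y) → ∑-ext (G ᴹ) (comul y) λ (u , v) → ∙-assoc _ _ _) ⟩
    ∑ (G ᴹ) (comul b) (λ (x , y) → ∑ (G ᴹ) (comul y) λ (u , v) → to f (e x) ∙ (to g (e u) ∙ to h (e v)))
      ≈⟨ ∑-ext (G ᴹ) (comul b) (λ (x , y) → H.≈ᴹ-trans
           (Hom.≈-homo (to f (e x) ∙.ʳ) (⋆-e g h y))
           (∑-hom (to f (e x) ∙.ʳ) (comul y) (λ (u , v) → to g (e u) ∙ to h (e v)))) ⟨
    ∑ (G ᴹ) (comul b) (λ (x , y) → to f (e x) ∙ to (g ⋆ₗ h) (e y))
      ≈⟨ ⋆-e f (g ⋆ₗ h) b ⟨
    to (f ⋆ₗ (g ⋆ₗ h)) (e b) ∎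
    where open SetoidReasoning H.≈ᴹ-setoid

  ηε : G ᴹ ⟶ G ᴹ
  ηε = scalar (G ᴹ) 1# ∘ₗ εₗ

  private
    ε1∙ : ∀ b x → (to ηε (e b) ∙ x) ≈ᴹ (projection₀ b *ₗ x)
    ε1∙ b x = H.≈ᴹ-trans (Hom.·-homo (x ∙.ˡ) (ε (e b)) 1#) (H.*ₗ-cong (ε-e b) (∙-identityˡ x))

    ∙ε1 : ∀ b x → (x ∙ to ηε (e b)) ≈ᴹ (projection₀ b *ₗ x)
    ∙ε1 b x = H.≈ᴹ-trans (Hom.·-homo (x ∙.ʳ) (ε (e b)) 1#) (H.*ₗ-cong (ε-e b) (∙-identityʳ x))

  ⋆-identityˡ : ∀ g x → to (ηε ⋆ₗ g) x ≈ᴹ to g x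
  ⋆-identityˡ g = basis-ext (ηε ⋆ₗ g) g λ b → H.≈ᴹ-trans (⋆-e ηε g b)
    (H.≈ᴹ-trans (∑-ext (G ᴹ) (comul b) λ (x , y) → ε1∙ x _) (U.counitˡᵘ (G ᴹ) (to g ∘ e) b))

  ⋆-identityʳ : ∀ g x → to (g ⋆ₗ ηε) x ≈ᴹ to g x
  ⋆-identityʳ g = basis-ext (g ⋆ₗ ηε) g λ b → H.≈ᴹ-trans (⋆-e g ηε b)
    (H.≈ᴹ-trans (∑-ext (G ᴹ) (comul b) λ (x , y) → ∙ε1 y _) (U.counitʳᵘ (G ᴹ) (to g ∘ e) b))

  id−ηε : G ᴹ ⟶ G ᴹ
  id−ηε = idₗ −ₗ ηε

  -- The partial sums ∑_{j<k} (−1)ʲ (id − ηε)^⋆ʲ of Takeuchi's formula for the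
  -- antipode; on degree n they are constant from k = n + 1 on.
  partialAntipode : ℕ → G ᴹ ⟶ G ᴹ
  partialAntipode zero    = 0ₗ
  partialAntipode (suc k) = ηε −ₗ (id−ηε ⋆ₗ partialAntipode k)

  private
    f = id−ηε
    S = partialAntipode

  -- Every partial sum is a convolution polynomial in `f`. The recursion multiplies by `f` on the
  -- left, whereas the left antipode law needs `f` on the right.
  partialAntipode-commutes : ∀ k x → to (f ⋆ₗ S k) x ≈ᴹ to (S k ⋆ₗ f) x
  partialAntipode-commutes zero x = H.≈ᴹ-trans
    (∑-zero′ (f ⋆ₗ 0ₗ) λ b → H.≈ᴹ-trans (⋆-e f 0ₗ b)
      (∑-zero (G ᴹ) (comul b) λ (y , z) _ → Hom.0-homo (to f (e y) ∙.ʳ)))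
    (H.≈ᴹ-sym (∑-zero′ (0ₗ ⋆ₗ f) λ b → H.≈ᴹ-trans (⋆-e 0ₗ f b)
      (∑-zero (G ᴹ) (comul b) λ (y , z) _ → Hom.0-homo (to f (e z) ∙.ˡ))))
    where
    ∑-zero′ : (φ : G ᴹ ⟶ G ᴹ) → (∀ b → to φ (e b) ≈ᴹ 0ᴹ) → to φ x ≈ᴹ 0ᴹ
    ∑-zero′ φ h = basis-ext φ 0ₗ h x
  partialAntipode-commutes (suc k) x = begin
    to (f ⋆ₗ S (suc k)) x                    ≈⟨ ⋆-subʳ f ηε (f ⋆ₗ S k) x ⟩
    to (f ⋆ₗ ηε) x − to (f ⋆ₗ (f ⋆ₗ S k)) x
      ≈⟨ −-cong (H.≈ᴹ-trans (⋆-identityʳ f x) (H.≈ᴹ-sym (⋆-identityˡ f x)))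
                (⋆-cong {f} {f} {f ⋆ₗ S k} {S k ⋆ₗ f} (λ _ → H.≈ᴹ-refl) (partialAntipode-commutes k) x) ⟩
    to (ηε ⋆ₗ f) x − to (f ⋆ₗ (S k ⋆ₗ f)) x  ≈⟨ −-cong H.≈ᴹ-refl (⋆-assoc f (S k) f x) ⟨
    to (ηε ⋆ₗ f) x − to ((f ⋆ₗ S k) ⋆ₗ f) x  ≈⟨ ⋆-subˡ ηε (f ⋆ₗ S k) f x ⟨
    to (S (suc k) ⋆ₗ f) x                    ∎
    where open SetoidReasoning H.≈ᴹ-setoid

  id−ηε-degree0 : ∀ b → deg b ≡ 0 → to f (e b) ≈ᴹ 0ᴹ
  id−ηε-degree0 b b≡0 = −-self (H.≈ᴹ-sym (H.≈ᴹ-trans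
    (H.*ₗ-cong (trans (ε-e b) (projection₀-0 b b≡0)) H.≈ᴹ-refl)
    (H.≈ᴹ-trans (H.*ₗ-identityˡ 1#) (H.≈ᴹ-trans 1-e (H.≈-reflexive (cong e (sym (deg-0 b b≡0))))))))

  -- `f` kills degree 0, so only those terms of the coproduct survive whose first factor has
  -- positive degree; their second factor has smaller degree than `b`, and induction applies.
  partialAntipode-stable : ∀ k b → deg b < k → to (S (suc k)) (e b) ≈ᴹ to (S k) (e b)
  partialAntipode-stable (suc k) b (s≤s b≤k) = −-cong H.≈ᴹ-refl (H.≈ᴹ-trans (⋆-e f (S (suc k)) b)
    (H.≈ᴹ-trans (∑-cong (G ᴹ) (comul b) term) (H.≈ᴹ-sym (⋆-e f (S k) b))))
    where
    term : ∀ p → p ∈ˡ comul b → (to f (e (proj₁ p)) ∙ to (S (suc k)) (e (proj₂ p))) ≈ᴹ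
                               (to f (e (proj₁ p)) ∙ to (S k) (e (proj₂ p)))
    term (x , y) xy∈ with deg x ℕₚ.≟ 0
    ... | yes x≡0 = H.≈ᴹ-trans (vanish (S (suc k))) (H.≈ᴹ-sym (vanish (S k)))
      where
      vanish : ∀ g → (to f (e x) ∙ to g (e y)) ≈ᴹ 0ᴹ
      vanish g = H.≈ᴹ-trans (Hom.≈-homo (_ ∙.ˡ) (id−ηε-degree0 x x≡0)) (Hom.0-homo (to g (e y) ∙.ˡ))
    ... | no x≢0  = Hom.≈-homo (to f (e x) ∙.ʳ) (partialAntipode-stable k y
      (ℕₚ.<-≤-trans (ℕₚ.m<n+m (deg y) (ℕₚ.n≢0⇒n>0 x≢0))
        (ℕₚ.≤-trans (ℕₚ.≤-reflexive (comul-deg b x y xy∈)) b≤k)))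

  partialAntipode-limit : ∀ k b → deg b < k → to (S k) (e b) ≈ᴹ to (S (suc (deg b))) (e b)
  partialAntipode-limit (suc k) b (s≤s b≤k) with ℕₚ.m≤n⇒m<n∨m≡n b≤k
  ... | inj₁ b<k  = H.≈ᴹ-trans (partialAntipode-stable k b b<k) (partialAntipode-limit k b b<k)
  ... | inj₂ refl = H.≈ᴹ-refl

  antipodeₗ : G ᴹ ⟶ G ᴹ
  antipodeₗ = freeₗ (G ᴹ) (λ b → to (S (suc (deg b))) (e b)) ∘ₗ expandₗ

  antipode-e : ∀ k b → deg b < k → to antipodeₗ (e b) ≈ᴹ to (S k) (e b)
  antipode-e k b b<k = H.≈ᴹ-trans
    (Hom.≈-homo (freeₗ (G ᴹ) λ b → to (S (suc (deg b))) (e b)) (expand-e b))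
    (H.≈ᴹ-sym (partialAntipode-limit k b b<k))

  -- No factor in the coproduct of `e b` exceeds the degree of `b`, so the index `k = deg b + 1`
  -- serves for all of them, and the antipode may be replaced by the single partial sum `S k`.
  ⋆-antipodeˡ : ∀ x → to (antipodeₗ ⋆ₗ idₗ) x ≈ᴹ to ηε x
  ⋆-antipodeˡ = basis-ext (antipodeₗ ⋆ₗ idₗ) ηε λ b → let k = suc (deg b) in
    H.≈ᴹ-trans (⋆-e antipodeₗ idₗ b) (H.≈ᴹ-trans
      (∑-cong (G ᴹ) (comul b) λ (x , y) xy∈ → Hom.≈-homo (e y ∙.ˡ) (antipode-e k x
        (s≤s (ℕₚ.≤-trans (ℕₚ.m≤m+n _ _) (ℕₚ.≤-reflexive (comul-deg b x y xy∈))))))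
      (H.≈ᴹ-trans (H.≈ᴹ-sym (⋆-e (S k) idₗ b))
        (−-cancel _ _ (to (S k) (e b)) (begin
          to (S k) (e b)                            ≈⟨ partialAntipode-stable k b ℕₚ.≤-refl ⟨
          to ηε (e b) − to (f ⋆ₗ S k) (e b)         ≈⟨ −-cong H.≈ᴹ-refl (partialAntipode-commutes
              k (e b)) ⟩
          to ηε (e b) − to (S k ⋆ₗ f) (e b)         ≈⟨ −-cong H.≈ᴹ-refl (⋆-subʳ (S k) idₗ ηε
              (e b)) ⟩
          to ηε (e b) − (to (S k ⋆ₗ idₗ) (e b) − to (S k ⋆ₗ ηε) (e b))
            ≈⟨ −-cong H.≈ᴹ-refl (−-cong H.≈ᴹ-refl (⋆-identityʳ (S k) (e b))) ⟩
          to ηε (e b) − (to (S k ⋆ₗ idₗ) (e b) − to (S k) (e b)) ∎))))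
    where open SetoidReasoning H.≈ᴹ-setoid

  ⋆-antipodeʳ : ∀ x → to (idₗ ⋆ₗ antipodeₗ) x ≈ᴹ to ηε x
  ⋆-antipodeʳ = basis-ext (idₗ ⋆ₗ antipodeₗ) ηε λ b → let k = suc (deg b) in
    H.≈ᴹ-trans (⋆-e idₗ antipodeₗ b) (H.≈ᴹ-trans
      (∑-cong (G ᴹ) (comul b) λ (x , y) xy∈ → Hom.≈-homo (e x ∙.ʳ) (antipode-e k y
        (s≤s (ℕₚ.≤-trans (ℕₚ.m≤n+m _ _) (ℕₚ.≤-reflexive (comul-deg b x y xy∈))))))
      (H.≈ᴹ-trans (H.≈ᴹ-sym (⋆-e idₗ (S k) b))
        (−-cancel _ _ (to (S k) (e b)) (begin
          to (S k) (e b)                            ≈⟨ partialAntipode-stable k b ℕₚ.≤-refl ⟨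
          to ηε (e b) − to (f ⋆ₗ S k) (e b)         ≈⟨ −-cong H.≈ᴹ-refl (⋆-subˡ idₗ ηε (S k)
              (e b)) ⟩
          to ηε (e b) − (to (idₗ ⋆ₗ S k) (e b) − to (ηε ⋆ₗ S k) (e b))
            ≈⟨ −-cong H.≈ᴹ-refl (−-cong H.≈ᴹ-refl (⋆-identityˡ (S k) (e b))) ⟩
          to ηε (e b) − (to (idₗ ⋆ₗ S k) (e b) − to (S k) (e b)) ∎))))
    where open SetoidReasoning H.≈ᴹ-setoid

  ∙-degree : ∀ p q {x y} → Deg p x → Deg q y → Deg (p ℕ.+ q) (x ∙ y)
  ∙-degree p q {x} {y} x∈ y∈ = deg-ind (deg-closed (p ℕ.+ q)) (y ∙.ˡ) (λ { a refl →
    deg-ind (deg-closed (p ℕ.+ q)) (e a ∙.ʳ) (λ { b refl →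
      Closed.≈-in (deg-closed _) (H.≈ᴹ-sym (∙-e a b)) (Closed.∑-in (deg-closed _) (mul a b)
        λ c c∈ → subst (λ n → Deg n (e c)) (mul-deg a b c c∈) (deg-e c)) }) y∈ }) x∈

  1-degree : Deg 0 1#
  1-degree = Closed.≈-in (deg-closed 0) (H.≈ᴹ-sym 1-e) (deg-e 𝟏)

  ε-degree : ∀ n {x} → n ≢ 0 → Deg n x → ε x ≡ 0ℤ
  ε-degree n n≢0 = deg-ind {N = ℤᴹ} {P = _≡ 0ℤ} record
    { ≈-in = λ { refl → id } ; 0-in = refl ; +-in = cong₂ ℤ._+_
    ; ·-in = λ r p → trans (cong (r ℤ.*_) p) (ℤₚ.*-zeroʳ r) }
    εₗ λ { b refl → trans (ε-e b) (projection₀-≢0 b n≢0) }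

  PreservesDegree : (G ᴹ ⟶ G ᴹ) → Set
  PreservesDegree g = ∀ b → Deg (deg b) (to g (e b))

  ηε-degree : PreservesDegree ηε
  ηε-degree b with deg b ℕₚ.≟ 0
  ... | yes b≡0 = Closed.·-in (deg-closed _) _ (subst (λ n → Deg n 1#) (sym b≡0) 1-degree)
  ... | no b≢0  = Closed.≈-in (deg-closed _) (H.≈ᴹ-sym (H.≈ᴹ-trans
    (H.*ₗ-cong (trans (ε-e b) (projection₀-≢0 b b≢0)) H.≈ᴹ-refl) (H.*ₗ-zeroˡ 1#)))
    (Closed.0-in (deg-closed _))

  −ₗ-degree : ∀ {g h} → PreservesDegree g → PreservesDegree h → PreservesDegree (g −ₗ h)
  −ₗ-degree p q b = Closed.+-in (deg-closed _) (p b) (Closed.·-in (deg-closed _) -1ℤ (q b))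

  ⋆-degree : ∀ {g h} → PreservesDegree g → PreservesDegree h → PreservesDegree (g ⋆ₗ h)
  ⋆-degree {g} {h} p q b = Closed.≈-in (deg-closed _) (H.≈ᴹ-sym (⋆-e g h b))
    (Closed.∑-in (deg-closed _) (comul b) λ (x , y) xy∈ →
      subst (λ n → Deg n (to g (e x) ∙ to h (e y))) (comul-deg b x y xy∈)
        (∙-degree (deg x) (deg y) (p x) (q y)))

  partialAntipode-degree : ∀ k → PreservesDegree (S k)
  partialAntipode-degree zero    b = Closed.0-in (deg-closed _)
  partialAntipode-degree (suc k) = −ₗ-degree {ηε} {f ⋆ₗ S k} ηε-degree
    (⋆-degree {f} {S k} (−ₗ-degree {idₗ} {ηε} deg-e ηε-degree) (partialAntipode-degree k))

  antipode-degree : ∀ n {x} → Deg n x → Deg n (to antipodeₗ x)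
  antipode-degree n = deg-ind (deg-closed n) antipodeₗ λ { b refl →
    Closed.≈-in (deg-closed _) (H.≈ᴹ-sym (antipode-e _ b ℕₚ.≤-refl))
      (partialAntipode-degree (suc (deg b)) b) }

  isGradedConnectedHopfAlgebra : IsGradedConnectedHopfAlgebra A
  isGradedConnectedHopfAlgebra = record
    { isBialgebra = isBialgebra
    ; antipode    = to antipodeₗ , record
      { S-linear  = Hom.linear antipodeₗ
      ; antipodeˡ = ⋆-antipodeˡ
      ; antipodeʳ = ⋆-antipodeʳ
      ; S-deg     = antipode-degree
      }
    ; isGrading   = isGrading
    ; ∙-deg       = ∙-degree
    ; 1-deg       = 1-degree
    ; δ-deg       = λ n → deg-ind (span-closed (G ᴹ ⊗ᴹ G ᴹ) _) δₗ λ { b refl →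
        Closed.≈-in (span-closed (G ᴹ ⊗ᴹ G ᴹ) _) (H².≈ᴹ-sym (δ-e b))
          (Closed.∑-in (span-closed (G ᴹ ⊗ᴹ G ᴹ) _) (comul b) λ (x , y) xy∈ →
            span-gen (deg x , deg y , e x , e y , comul-deg b x y xy∈ , deg-e x , deg-e y , refl)) }
    ; ε-deg       = ε-degree
    ; unit-onto   = λ x → deg-ind {P = λ x → ∃[ r ] x ≈ᴹ (r *ₗ 1#)} multiples idₗ λ b b≡0 →
        1ℤ , H.≈ᴹ-trans (H.≈-reflexive (cong e (deg-0 b b≡0)))
          (H.≈ᴹ-sym (H.≈ᴹ-trans (H.*ₗ-identityˡ 1#) 1-e))
    ; unit-inj    = λ r s p → trans (sym (unit-coord r))
        (trans (Hom.≈-homo (coord 𝟏) p) (unit-coord s))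
    }
    where
    multiples : Closed (G ᴹ) (λ x → ∃[ r ] x ≈ᴹ (r *ₗ 1#))
    multiples = record
      { ≈-in = λ p (r , q) → r , H.≈ᴹ-trans (H.≈ᴹ-sym p) q
      ; 0-in = 0ℤ , H.≈ᴹ-sym (H.*ₗ-zeroˡ 1#)
      ; +-in = λ (r , p) (s , q) → r ℤ.+ s , H.≈ᴹ-trans (H.+ᴹ-cong p q)
          (H.≈ᴹ-sym (H.*ₗ-distribʳ 1# r s))
      ; ·-in = λ t (r , p) → t ℤ.* r , H.≈ᴹ-trans (H.*ₗ-cong refl p) (H.≈ᴹ-sym (H.*ₗ-assoc t r 1#))
      }
    unit-coord : ∀ r → to (coord 𝟏) (r *ₗ 1#) ≡ r
    unit-coord r = trans (Hom.·-homo (coord 𝟏) r 1#) (trans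
      (cong (r ℤ.*_) (trans (Hom.≈-homo (coord 𝟏) 1-e) (coord-e 𝟏 𝟏))) (ℤₚ.*-identityʳ r))

-- Membership tables

card : Bits → ℕ
card []          = 0
card (true  ∷ A) = suc (card A)
card (false ∷ A) = card A

compl : Bits → Bits
compl = map not

sub : Bits → Bits → Bits
sub []          X       = []
sub (a     ∷ A) []      = []
sub (true  ∷ A) (x ∷ X) = x ∷ sub A X
sub (false ∷ A) (x ∷ X) = sub A X

-- Where `X` is too short for `A` it is padded with `false`, so that `sub-sub`, `unsub-unsub`,
-- `take-unsub` and `drop-unsub` hold without length hypotheses.
unsub : Bits → Bits → Bits
unsub []          X       = []
unsub (true  ∷ A) (x ∷ X) = x ∷ unsub A X
unsub (true  ∷ A) []      = false ∷ unsub A []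
unsub (false ∷ A) X       = false ∷ unsub A X

trues falses : ℕ → Bits
trues n  = replicate n true
falses n = replicate n false

allBits : ℕ → List Bits
allBits zero    = [] ∷ []
allBits (suc n) = map (true ∷_) (allBits n) ++ map (false ∷_) (allBits n)

consIf : Bool → Bits → List Bits → List Bits
consIf true  X Xs = X ∷ Xs
consIf false X Xs = Xs

dropEmpty : List Bits → List Bits
dropEmpty []       = []
dropEmpty (X ∷ Xs) = consIf (or X) X (dropEmpty Xs)

restrict : Bits → List Bits → List Bits
restrict A Xs = dropEmpty (map (sub A) Xs)

juxtapose : ℕ → ℕ → List Bits → List Bits → List Bits
juxtapose p q Xs Ys = map (_++ falses q) Xs ++ map (falses p ++_) Ys

AllLength : ℕ → List Bits → Set
AllLength n = All (λ X → length X ≡ n)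

dropEmpty-++ : ∀ Xs Ys → dropEmpty (Xs ++ Ys) ≡ dropEmpty Xs ++ dropEmpty Ys
dropEmpty-++ []       Ys = refl
dropEmpty-++ (X ∷ Xs) Ys with or X
... | true  = cong (X ∷_) (dropEmpty-++ Xs Ys)
... | false = dropEmpty-++ Xs Ys

-- An empty set stays empty under `f`, so it may be deleted before or after `f` is applied.
dropEmpty-map-dropEmpty : ∀ f → (∀ X → or X ≡ false → or (f X) ≡ false) →
  ∀ Xs → dropEmpty (map f (dropEmpty Xs)) ≡ dropEmpty (map f Xs)
dropEmpty-map-dropEmpty f h []       = refl
dropEmpty-map-dropEmpty f h (X ∷ Xs) with or X in eq
... | true  = cong (consIf (or (f X)) (f X)) (dropEmpty-map-dropEmpty f h Xs)
... | false rewrite h X eq = dropEmpty-map-dropEmpty f h Xs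

dropEmpty-map : ∀ f {Xs} → All (λ X → or (f X) ≡ or X) Xs →
                dropEmpty (map f Xs) ≡ map f (dropEmpty Xs)
dropEmpty-map f []                   = refl
dropEmpty-map f (_∷_ {X} {Xs} h hs) rewrite h with or X
... | true  = cong (f X ∷_) (dropEmpty-map f hs)
... | false = dropEmpty-map f hs

or-falses : ∀ n → or (falses n) ≡ false
or-falses zero    = refl
or-falses (suc n) = or-falses n

or-++-falses : ∀ n X → or (X ++ falses n) ≡ or X
or-++-falses n []          = or-falses n
or-++-falses n (true  ∷ X) = refl
or-++-falses n (false ∷ X) = or-++-falses n X

or-falses-++ : ∀ n X → or (falses n ++ X) ≡ or X
or-falses-++ zero    X = refl
or-falses-++ (suc n) X = or-falses-++ n X

or-sub : ∀ A X → or X ≡ false → or (sub A X) ≡ false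
or-sub []          X           e = refl
or-sub (a     ∷ A) []          e = refl
or-sub (true  ∷ A) (false ∷ X) e = or-sub A X e
or-sub (false ∷ A) (false ∷ X) e = or-sub A X e

sub-[] : ∀ A → sub A [] ≡ []
sub-[] []      = refl
sub-[] (_ ∷ A) = refl

sub-sub : ∀ A′ A X → sub A′ (sub A X) ≡ sub (unsub A A′) X
sub-sub A′        []          X       = sub-[] A′
sub-sub A′        (true  ∷ A) []      with A′
... | []    = refl
... | _ ∷ _ = refl
sub-sub A′        (false ∷ A) []      = sub-[] A′
sub-sub []        (true  ∷ A) (x ∷ X) = sub-sub [] A X
sub-sub (true  ∷ A′) (true  ∷ A) (x ∷ X) = cong (x ∷_) (sub-sub A′ A X)
sub-sub (false ∷ A′) (true  ∷ A) (x ∷ X) = sub-sub A′ A X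
sub-sub A′        (false ∷ A) (x ∷ X) = sub-sub A′ A X

sub-++ : ∀ A B X Y → length A ≡ length X → sub (A ++ B) (X ++ Y) ≡ sub A X ++ sub B Y
sub-++ []          B []      Y _ = refl
sub-++ (true  ∷ A) B (x ∷ X) Y e = cong (x ∷_) (sub-++ A B X Y (ℕₚ.suc-injective e))
sub-++ (false ∷ A) B (x ∷ X) Y e = sub-++ A B X Y (ℕₚ.suc-injective e)

sub-falses : ∀ A → sub A (falses (length A)) ≡ falses (card A)
sub-falses []          = refl
sub-falses (true  ∷ A) = cong (false ∷_) (sub-falses A)
sub-falses (false ∷ A) = sub-falses A

sub-trues : ∀ X → sub (trues (length X)) X ≡ X
sub-trues []      = refl
sub-trues (x ∷ X) = cong (x ∷_) (sub-trues X)

card-++ : ∀ A B → card (A ++ B) ≡ card A ℕ.+ card B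
card-++ []          B = refl
card-++ (true  ∷ A) B = cong suc (card-++ A B)
card-++ (false ∷ A) B = card-++ A B

card-compl : ∀ A → card A ℕ.+ card (compl A) ≡ length A
card-compl []          = refl
card-compl (true  ∷ A) = cong suc (card-compl A)
card-compl (false ∷ A) = trans (ℕₚ.+-suc (card A) _) (cong suc (card-compl A))

card-trues : ∀ n → card (trues n) ≡ n
card-trues zero    = refl
card-trues (suc n) = cong suc (card-trues n)

card-falses : ∀ n → card (falses n) ≡ 0
card-falses zero    = refl
card-falses (suc n) = card-falses n

compl-compl : ∀ A → compl (compl A) ≡ A
compl-compl []      = refl
compl-compl (a ∷ A) = cong₂ _∷_ (Boolₚ.not-involutive a) (compl-compl A)

compl-falses : ∀ n → compl (falses n) ≡ trues n
compl-falses zero    = refl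
compl-falses (suc n) = cong (true ∷_) (compl-falses n)

compl-trues : ∀ n → compl (trues n) ≡ falses n
compl-trues zero    = refl
compl-trues (suc n) = cong (false ∷_) (compl-trues n)

-- `unsub A A′` is the subset of the whole ground set that `A′` selects inside `A`. Iterated
-- splittings thereby become restrictions of a single set composition.
restrict-restrict : ∀ A′ A Xs → restrict A′ (restrict A Xs) ≡ restrict (unsub A A′) Xs
restrict-restrict A′ A Xs = trans (dropEmpty-map-dropEmpty (sub A′) (or-sub A′) (map (sub A) Xs))
  (cong dropEmpty (trans (sym (Listₚ.map-∘ Xs)) (Listₚ.map-cong (sub-sub A′ A) Xs)))

card-toList : ∀ {n} (A : Subset n) → card (Vec.toList A) ≡ ∣ A ∣
card-toList Vec.[]            = refl
card-toList (inside  Vec.∷ A) = cong suc (card-toList A)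
card-toList (outside Vec.∷ A) = card-toList A

toList-∁ : ∀ {n} (A : Subset n) → Vec.toList (∁ A) ≡ compl (Vec.toList A)
toList-∁ A = Vecₚ.toList-map not A

toList-collapse : ∀ {n} (A X : Subset n) →
                  Vec.toList (collapse A X) ≡ sub (Vec.toList A) (Vec.toList X)
toList-collapse Vec.[]            Vec.[]      = refl
toList-collapse (inside  Vec.∷ A) (x Vec.∷ X) = cong (x ∷_) (toList-collapse A X)
toList-collapse (outside Vec.∷ A) (x Vec.∷ X) = toList-collapse A X

toList-uncollapse : ∀ {n} (A : Subset n) (X : Subset ∣ A ∣) →
                    Vec.toList (uncollapse A X) ≡ unsub (Vec.toList A) (Vec.toList X)
toList-uncollapse Vec.[]            Vec.[]      = refl
toList-uncollapse (inside  Vec.∷ A) (x Vec.∷ X) = cong (x ∷_) (toList-uncollapse A X)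
toList-uncollapse (outside Vec.∷ A) X           = cong (false ∷_) (toList-uncollapse A X)

collapse-∩ : ∀ {n} (A X : Subset n) → collapse A (X ∩ A) ≡ collapse A X
collapse-∩ Vec.[]            Vec.[]      = refl
collapse-∩ (inside  Vec.∷ A) (x Vec.∷ X) = cong₂ Vec._∷_ (Boolₚ.∧-identityʳ x) (collapse-∩ A X)
collapse-∩ (outside Vec.∷ A) (x Vec.∷ X) = collapse-∩ A X

or-∩ : ∀ {n} (A X : Subset n) → or (Vec.toList (X ∩ A)) ≡ or (Vec.toList (collapse A X))
or-∩ Vec.[]            Vec.[]      = refl
or-∩ (inside  Vec.∷ A) (x Vec.∷ X) = cong₂ _∨_ (Boolₚ.∧-identityʳ x) (or-∩ A X)
or-∩ (outside Vec.∷ A) (x Vec.∷ X) rewrite Boolₚ.∧-zeroʳ x = or-∩ A X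

toList-replicate : ∀ {A : Set} n (x : A) → Vec.toList (Vec.replicate n x) ≡ replicate n x
toList-replicate zero    x = refl
toList-replicate (suc n) x = cong (x ∷_) (toList-replicate n x)

or-nonempty : ∀ {n} {X : Subset n} → Nonempty X → or (Vec.toList X) ≡ true
or-nonempty (_ , Vec.here) = refl
or-nonempty {X = x Vec.∷ X} (_ , Vec.there p) =
  trans (cong (x ∨_) (or-nonempty (_ , p))) (Boolₚ.∨-zeroʳ x)

or-empty : ∀ {n} {X : Subset n} → ¬ Nonempty X → or (Vec.toList X) ≡ false
or-empty {n} ¬ne rewrite Empty-unique ¬ne | toList-replicate n false = or-falses n

toList-filter : ∀ {n} (Xs : List (Subset n)) →
                map Vec.toList (filter nonempty? Xs) ≡ dropEmpty (map Vec.toList Xs)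
toList-filter []       = refl
toList-filter (X ∷ Xs) with nonempty? X
... | yes ne rewrite or-nonempty ne = cong (Vec.toList X ∷_) (toList-filter Xs)
... | no ¬ne rewrite or-empty ¬ne = toList-filter Xs

-- `∩♯` deletes empty intersections before standardization, `restrict` afterwards; the order does
-- not matter because `X ∩ A` and its collapse are empty together.
filter-map-∩ : ∀ {n} (A : Subset n) Xs →
  map Vec.toList (map (collapse A) (filter nonempty? (map (_∩ A) Xs))) ≡
  restrict (Vec.toList A) (map Vec.toList Xs)
filter-map-∩ A []       = refl
filter-map-∩ A (X ∷ Xs) with nonempty? (X ∩ A)
... | yes ne rewrite sym (toList-collapse A X) | sym (or-∩ A X) | or-nonempty ne =
  cong₂ _∷_ (cong Vec.toList (collapse-∩ A X)) (filter-map-∩ A Xs)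
... | no ¬ne rewrite sym (toList-collapse A X) | sym (or-∩ A X) | or-empty ¬ne = filter-map-∩ A Xs

code-∣ : ∀ {n} (P : Comp n) (A : Subset n) →
         code (∣ A ∣ , P ∣ A) ≡ restrict (Vec.toList A) (code (n , P))
code-∣ (composition Xs _ _ _) A = filter-map-∩ A Xs

code-length : ∀ b → AllLength (deg b) (code b)
code-length (n , P) = Allₚ.map⁺ (All.universal length-toList (blocks P))

code-nonempty : ∀ b → dropEmpty (code b) ≡ code b
-- Nonemptiness is an irrelevant field; being decidable, it can be recovered.
code-nonempty (n , composition Xs ne _ _) = go Xs (recompute (All.all? nonempty? Xs) ne)
  where
  go : ∀ Xs → All Nonempty Xs → dropEmpty (map Vec.toList Xs) ≡ map Vec.toList Xs
  go []       []         = refl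
  go (X ∷ Xs) (ne ∷ nes) rewrite or-nonempty ne = cong (Vec.toList X ∷_) (go Xs nes)

map-id-local : ∀ {f : Bits → Bits} {Xs} → All (λ X → f X ≡ X) Xs → map f Xs ≡ Xs
map-id-local []       = refl
map-id-local (e ∷ es) = cong₂ _∷_ e (map-id-local es)

map-cong-local : ∀ {A B : Set} {f g : A → B} {xs} → All (λ x → f x ≡ g x) xs → map f xs ≡ map g xs
map-cong-local []       = refl
map-cong-local (e ∷ es) = cong₂ _∷_ e (map-cong-local es)

restrict-trues : ∀ b → restrict (trues (deg b)) (code b) ≡ code b
restrict-trues b = trans
  (cong dropEmpty (map-id-local (All.map (λ { {X} refl → sub-trues X }) (code-length b))))
  (code-nonempty b)

∑-allSubsets : ∀ n (f : Bits → ℤ) → ∑ℤ (allSubsets n) (f ∘ Vec.toList) ≡ ∑ℤ (allBits n) f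
∑-allSubsets zero    f = refl
∑-allSubsets (suc n) f = trans (∑ℤ-++ (map (inside Vec.∷_) (allSubsets n)) _ _)
  (trans (cong₂ ℤ._+_ (part true) (part false)) (sym (∑ℤ-++ (map (true ∷_) (allBits n)) _ f)))
  where
  part : ∀ b → ∑ℤ (map (b Vec.∷_) (allSubsets n)) (f ∘ Vec.toList) ≡ ∑ℤ (map (b ∷_) (allBits n)) f
  part b = trans (∑ℤ-map _ (allSubsets n) _)
    (trans (∑-allSubsets n (f ∘ (b ∷_))) (sym (∑ℤ-map _ (allBits n) f)))

∑-allBits-suc : ∀ n (f : Bits → ℤ) →
  ∑ℤ (allBits (suc n)) f ≡ ∑ℤ (allBits n) (f ∘ (true ∷_)) ℤ.+ ∑ℤ (allBits n) (f ∘ (false ∷_))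
∑-allBits-suc n f = trans (∑ℤ-++ (map (true ∷_) (allBits n)) _ f)
  (cong₂ ℤ._+_ (∑ℤ-map _ (allBits n) f) (∑ℤ-map _ (allBits n) f))

length-allBits : ∀ n A → A ∈ˡ allBits n → length A ≡ n
length-allBits n A A∈ = All.lookup (go n) A∈
  where
  go : ∀ n → AllLength n (allBits n)
  go zero    = refl ∷ []
  go (suc n) = Allₚ.++⁺ (Allₚ.map⁺ (All.map (cong suc) (go n))) (Allₚ.map⁺ (All.map (cong suc)
      (go n)))

-- Both sides run over the ordered partitions of [n] into three parts.
∑-threeParts : ∀ n (g : Bits → Bits → Bits → ℤ) →
  ∑ℤ (allBits n) (λ A → ∑ℤ (allBits (card A)) λ A′ →
    g (unsub A A′) (unsub A (compl A′)) (compl A)) ≡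
  ∑ℤ (allBits n) (λ A → ∑ℤ (allBits (card (compl A))) λ B →
    g A (unsub (compl A) B) (unsub (compl A) (compl B)))
∑-threeParts zero    g = refl
∑-threeParts (suc n) g = begin
  ∑ℤ (allBits (suc n)) left
    ≡⟨ ∑-allBits-suc n left ⟩
  ∑ℤ (allBits n) (left ∘ (true ∷_)) ℤ.+ ∑ℤ (allBits n) (left ∘ (false ∷_))
    ≡⟨ cong₂ ℤ._+_ (trans (∑ℤ-ext (allBits n) λ A → ∑-allBits-suc (card A) _)
                          (∑ℤ-+ (allBits n) _ _)) (∑-threeParts n in₃) ⟩
  ∑ℤ (allBits n) left₁ ℤ.+ ∑ℤ (allBits n) left₂ ℤ.+ ∑ℤ (allBits n) right₃
    ≡⟨ cong (λ z → z ℤ.+ ∑ℤ (allBits n) right₃)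
            (cong₂ ℤ._+_ (∑-threeParts n in₁) (∑-threeParts n in₂)) ⟩
  ∑ℤ (allBits n) right₁ ℤ.+ ∑ℤ (allBits n) right₂ ℤ.+ ∑ℤ (allBits n) right₃
    ≡⟨ ℤₚ.+-assoc (∑ℤ (allBits n) right₁) _ _ ⟩
  ∑ℤ (allBits n) right₁ ℤ.+ (∑ℤ (allBits n) right₂ ℤ.+ ∑ℤ (allBits n) right₃)
    ≡⟨ cong (λ z → ∑ℤ (allBits n) right₁ ℤ.+ z) (trans
         (∑ℤ-ext (allBits n) λ A → ∑-allBits-suc (card (compl A)) _) (∑ℤ-+ (allBits n) _ _)) ⟨
  ∑ℤ (allBits n) (right ∘ (true ∷_)) ℤ.+ ∑ℤ (allBits n) (right ∘ (false ∷_))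
    ≡⟨ ∑-allBits-suc n right ⟨
  ∑ℤ (allBits (suc n)) right ∎
  where
  open ≡-Reasoning
  Three : Set
  Three = Bits → Bits → Bits → ℤ
  leftOf rightOf : Three → Bits → ℤ
  leftOf g A = ∑ℤ (allBits (card A)) λ A′ → g (unsub A A′) (unsub A (compl A′)) (compl A)
  rightOf g A = ∑ℤ (allBits (card (compl A))) λ B →
    g A (unsub (compl A) B) (unsub (compl A) (compl B))
  -- The first element lies in the first, second or third part.
  in₁ in₂ in₃ : Three
  in₁ C D E = g (true ∷ C) (false ∷ D) (false ∷ E)
  in₂ C D E = g (false ∷ C) (true ∷ D) (false ∷ E)
  in₃ C D E = g (false ∷ C) (false ∷ D) (true ∷ E)
  left right left₁ left₂ right₁ right₂ right₃ : Bits → ℤ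
  left   = leftOf g
  right  = rightOf g
  left₁  = leftOf in₁
  left₂  = leftOf in₂
  right₁ = rightOf in₁
  right₂ = rightOf in₂
  right₃ = rightOf in₃

∑-allBits-+ : ∀ p q (f : Bits → ℤ) →
  ∑ℤ (allBits (p ℕ.+ q)) f ≡ ∑ℤ (allBits p) (λ A → ∑ℤ (allBits q) λ B → f (A ++ B))
∑-allBits-+ zero    q f = sym (ℤₚ.+-identityʳ _)
∑-allBits-+ (suc p) q f = trans (∑-allBits-suc (p ℕ.+ q) f)
  (trans (cong₂ ℤ._+_ (∑-allBits-+ p q _) (∑-allBits-+ p q _)) (sym (∑-allBits-suc p _)))

∑-compl : ∀ n (f : Bits → Bits → ℤ) →
  ∑ℤ (allBits n) (λ A → f A (compl A)) ≡ ∑ℤ (allBits n) (λ A → f (compl A) A)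
∑-compl zero    f = refl
∑-compl (suc n) f = trans (∑-allBits-suc n _) (trans
  (cong₂ ℤ._+_ (∑-compl n λ A B → f (true ∷ A) (false ∷ B)) (∑-compl n λ A B → f (false ∷ A)
      (true ∷ B)))
  (trans (ℤₚ.+-comm (∑ℤ (allBits n) λ A → f (true ∷ compl A) (false ∷ A)) _)
    (sym (∑-allBits-suc n λ A → f (compl A) A))))

isZero : ℕ → ℤ
isZero zero    = 1ℤ
isZero (suc _) = 0ℤ

projection₀-isZero : ∀ b → projection₀ b ≡ isZero (deg b)
projection₀-isZero (zero  , _) = refl
projection₀-isZero (suc _ , _) = refl

∑-empty : ∀ n (f : Bits → ℤ) →
  ∑ℤ (allBits n) (λ A → isZero (card A) ℤ.* f A) ≡ f (falses n)
∑-empty zero    f = trans (ℤₚ.+-identityʳ _) (ℤₚ.*-identityˡ (f []))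
∑-empty (suc n) f = trans (∑-allBits-suc n _) (trans
  (cong₂ ℤ._+_ (∑ℤ-zero (allBits n) λ _ _ → refl) (∑-empty n (f ∘ (false ∷_))))
  (ℤₚ.+-identityˡ _))

∑-full : ∀ n (f : Bits → ℤ) →
  ∑ℤ (allBits n) (λ A → isZero (card (compl A)) ℤ.* f A) ≡ f (trues n)
∑-full n f = trans (sym (∑-compl n λ A B → isZero (card A) ℤ.* f B))
  (trans (∑-empty n (f ∘ compl)) (cong f (compl-falses n)))

-- Concatenation and unshuffling

-- Reads a set composition back from `b ∗̄ c` and from the nonzero terms of `∗̂`, which reduce to a
-- generator; the default `𝟏` only makes the function total.
theGen : Lin Basis → Basis
theGen (gen b) = b
theGen _       = 𝟏

-- The proofs in a set composition are irrelevant, so gen (concat b c) and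
-- b ∗̄ c are definitionally equal.
concat : Basis → Basis → Basis
concat b c = theGen (b ∗̄ c)

code-concat : ∀ b c → code (concat b c) ≡ juxtapose (deg b) (deg c) (code b) (code c)
code-concat (p , P) (q , Q) = trans (Listₚ.map-++ Vec.toList (map (Vec._++ ⊥) (blocks P)) _)
  (cong₂ _++_
    (trans (sym (Listₚ.map-∘ (blocks P))) (trans (Listₚ.map-cong (λ X →
      trans (Vecₚ.toList-++ X ⊥) (cong (Vec.toList X ++_) (toList-replicate q false))) (blocks P))
      (Listₚ.map-∘ (blocks P))))
    (trans (sym (Listₚ.map-∘ (blocks Q))) (trans (Listₚ.map-cong (λ X →
      trans (Vecₚ.toList-++ (⊥ {p}) X) (cong (_++ Vec.toList X) (toList-replicate p false)))
          (blocks Q))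
      (Listₚ.map-∘ (blocks Q)))))

falses-+ : ∀ p q → falses (p ℕ.+ q) ≡ falses p ++ falses q
falses-+ zero    q = refl
falses-+ (suc p) q = cong (false ∷_) (falses-+ p q)

juxtapose-assoc : ∀ p q r Xs Ys Zs →
  juxtapose (p ℕ.+ q) r (juxtapose p q Xs Ys) Zs ≡ juxtapose p (q ℕ.+ r) Xs (juxtapose q r Ys Zs)
juxtapose-assoc p q r Xs Ys Zs = begin
  map (_++ falses r) (map (_++ falses q) Xs ++ map (falses p ++_) Ys) ++ map (falses (p ℕ.+ q) ++_) Zs
    ≡⟨ cong₂ _++_ (Listₚ.map-++ _ (map (_++ falses q) Xs) _) (Listₚ.map-cong third Zs) ⟩
  (map (_++ falses r) (map (_++ falses q) Xs) ++ map (_++ falses r) (map (falses p ++_) Ys)) ++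
    map ((falses p ++_) ∘ (falses q ++_)) Zs
    ≡⟨ Listₚ.++-assoc (map (_++ falses r) (map (_++ falses q) Xs)) _ _ ⟩
  map (_++ falses r) (map (_++ falses q) Xs) ++ (map (_++ falses r) (map (falses p ++_) Ys) ++
    map ((falses p ++_) ∘ (falses q ++_)) Zs)
    ≡⟨ cong₂ _++_
         (trans (sym (Listₚ.map-∘ Xs)) (Listₚ.map-cong first Xs))
         (cong₂ _++_
           (trans (sym (Listₚ.map-∘ Ys)) (trans (Listₚ.map-cong second Ys) (Listₚ.map-∘ Ys)))
           (Listₚ.map-∘ Zs)) ⟩
  map (_++ falses (q ℕ.+ r)) Xs ++ (map (falses p ++_) (map (_++ falses r) Ys) ++
    map (falses p ++_) (map (falses q ++_) Zs))
    ≡⟨ cong (map (_++ falses (q ℕ.+ r)) Xs ++_) (Listₚ.map-++ (falses p ++_) (map (_++ falses r)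
        Ys) _) ⟨
  juxtapose p (q ℕ.+ r) Xs (juxtapose q r Ys Zs) ∎
  where
  open ≡-Reasoning
  first : ∀ X → (X ++ falses q) ++ falses r ≡ X ++ falses (q ℕ.+ r)
  first X = trans (Listₚ.++-assoc X _ _) (cong (X ++_) (sym (falses-+ q r)))
  second : ∀ X → (falses p ++ X) ++ falses r ≡ falses p ++ (X ++ falses r)
  second X = Listₚ.++-assoc (falses p) X _
  third : ∀ X → falses (p ℕ.+ q) ++ X ≡ falses p ++ (falses q ++ X)
  third X = trans (cong (_++ X) (falses-+ p q)) (Listₚ.++-assoc (falses p) _ X)

juxtapose-[]ˡ : ∀ q Ys → juxtapose 0 q [] Ys ≡ Ys
juxtapose-[]ˡ q Ys = Listₚ.map-id Ys

juxtapose-[]ʳ : ∀ p Xs → juxtapose p 0 Xs [] ≡ Xs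
juxtapose-[]ʳ p Xs = trans (Listₚ.++-identityʳ _)
  (trans (Listₚ.map-cong Listₚ.++-identityʳ Xs) (Listₚ.map-id Xs))

-- On every block one half of the subset meets only padding. Padding leaves emptiness unchanged, so
-- `dropEmpty` passes through it.
restrict-juxtapose : ∀ A B {Xs Ys} → AllLength (length A) Xs →
  restrict (A ++ B) (juxtapose (length A) (length B) Xs Ys) ≡
  juxtapose (card A) (card B) (restrict A Xs) (restrict B Ys)
restrict-juxtapose A B {Xs} {Ys} lx = begin
  dropEmpty (map (sub (A ++ B)) (map (_++ falses (length B)) Xs ++ map (falses (length A) ++_) Ys))
    ≡⟨ cong dropEmpty (Listₚ.map-++ _ (map (_++ falses (length B)) Xs) _) ⟩
  dropEmpty (map (sub (A ++ B)) (map (_++ falses (length B)) Xs) ++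
             map (sub (A ++ B)) (map (falses (length A) ++_) Ys))
    ≡⟨ dropEmpty-++ (map (sub (A ++ B)) (map (_++ falses (length B)) Xs)) _ ⟩
  dropEmpty (map (sub (A ++ B)) (map (_++ falses (length B)) Xs)) ++
  dropEmpty (map (sub (A ++ B)) (map (falses (length A) ++_) Ys))
    ≡⟨ cong₂ (λ U V → dropEmpty U ++ dropEmpty V)
         (trans (sym (Listₚ.map-∘ Xs)) (trans (map-cong-local (All.map left lx)) (Listₚ.map-∘ Xs)))
         (trans (sym (Listₚ.map-∘ Ys)) (trans (Listₚ.map-cong right Ys) (Listₚ.map-∘ Ys))) ⟩
  dropEmpty (map (_++ falses (card B)) (map (sub A) Xs)) ++
  dropEmpty (map (falses (card A) ++_) (map (sub B) Ys))
    ≡⟨ cong₂ _++_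
         (dropEmpty-map _ (All.universal (or-++-falses (card B)) (map (sub A) Xs)))
         (dropEmpty-map _ (All.universal (or-falses-++ (card A)) (map (sub B) Ys))) ⟩
  juxtapose (card A) (card B) (restrict A Xs) (restrict B Ys) ∎
  where
  open ≡-Reasoning
  left : ∀ {X} → length X ≡ length A → sub (A ++ B) (X ++ falses (length B)) ≡ sub A X ++ falses
      (card B)
  left {X} e = trans (sub-++ A B X _ (sym e)) (cong (sub A X ++_) (sub-falses B))
  right : ∀ Y → sub (A ++ B) (falses (length A) ++ Y) ≡ falses (card A) ++ sub B Y
  right Y = trans (sub-++ A B (falses (length A)) Y (sym (Listₚ.length-replicate (length A))))
    (cong (_++ sub B Y) (sub-falses A))

unshuffleTerm : (b : Basis) → Subset (deg b) → Basis × Basis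
unshuffleTerm (n , P) A = (∣ A ∣ , P ∣ A) , (∣ ∁ A ∣ , P ∣ ∁ A)

unshuffle : Basis → List (Basis × Basis)
unshuffle b = map (unshuffleTerm b) (allSubsets (deg b))

card-∁ : ∀ {n} (A : Subset n) → card (compl (Vec.toList A)) ≡ ∣ ∁ A ∣
card-∁ A = trans (cong card (sym (toList-∁ A))) (card-toList (∁ A))

∣A∣+∣∁A∣ : ∀ {n} (A : Subset n) → ∣ A ∣ ℕ.+ ∣ ∁ A ∣ ≡ n
∣A∣+∣∁A∣ A = trans (sym (cong₂ ℕ._+_ (card-toList A) (card-∁ A)))
  (trans (card-compl (Vec.toList A)) (length-toList A))

unshuffle-deg : ∀ b x y → (x , y) ∈ˡ unshuffle b → deg x ℕ.+ deg y ≡ deg b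
unshuffle-deg b x y xy∈ with ∈-map⁻ (unshuffleTerm b) xy∈
... | A , _ , refl = ∣A∣+∣∁A∣ A

-- The summand receives the degrees separately because an iterated unshuffle sums over the subsets
-- of `[deg x]`, a range that has to be tracked along with the codes.
∑-unshuffle-sizes : ∀ b (f : ℕ → ℕ → List Bits → List Bits → ℤ) →
  ∑ℤ (unshuffle b) (λ (x , y) → f (deg x) (deg y) (code x) (code y)) ≡
  ∑ℤ (allBits (deg b)) (λ A → f (card A) (card (compl A)) (restrict A (code b))
      (restrict (compl A) (code b)))
∑-unshuffle-sizes b@(n , P) f = trans (∑ℤ-map (unshuffleTerm b) (allSubsets n) _)
  (trans (∑ℤ-ext (allSubsets n) term) (∑-allSubsets n _))
  where
  term : ∀ (A : Subset n) →
    f ∣ A ∣ ∣ ∁ A ∣ (code (∣ A ∣ , P ∣ A)) (code (∣ ∁ A ∣ , P ∣ ∁ A)) ≡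
    f (card (Vec.toList A)) (card (compl (Vec.toList A)))
      (restrict (Vec.toList A) (code b)) (restrict (compl (Vec.toList A)) (code b))
  term A rewrite code-∣ P A | code-∣ P (∁ A) | toList-∁ A | card-toList A | card-∁ A = refl

∑-unshuffle : ∀ b (f : List Bits → List Bits → ℤ) →
  ∑ℤ (unshuffle b) (λ (x , y) → f (code x) (code y)) ≡
  ∑ℤ (allBits (deg b)) (λ A → f (restrict A (code b)) (restrict (compl A) (code b)))
∑-unshuffle b f = ∑-unshuffle-sizes b (λ _ _ → f)

-- By `restrict-restrict` the two sides sum the same function `g` over the two parametrizations of
-- ordered three-part partitions that `∑-threeParts` identifies.
unshuffle-coassoc : ∀ b (f : List Bits → List Bits → List Bits → ℤ) →
  ∑ℤ (unshuffle b) (λ (x , y) → ∑ℤ (unshuffle x) λ (u , v) → f (code u) (code v) (code y)) ≡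
  ∑ℤ (unshuffle b) (λ (x , y) → ∑ℤ (unshuffle y) λ (u , v) → f (code x) (code u) (code v))
unshuffle-coassoc b f = begin
  ∑ℤ (unshuffle b) (λ (x , y) → ∑ℤ (unshuffle x) λ (u , v) → f (code u) (code v) (code y))
    ≡⟨ ∑ℤ-ext (unshuffle b) (λ (x , y) → ∑-unshuffle x (λ u v → f u v (code y))) ⟩
  ∑ℤ (unshuffle b) (λ (x , y) → leftOf (deg x) (deg y) (code x) (code y))
    ≡⟨ ∑-unshuffle-sizes b leftOf ⟩
  ∑ℤ (allBits (deg b)) (λ A → leftOf (card A) (card (compl A)) (restrict A X) (restrict (compl A) X))
    ≡⟨ ∑ℤ-ext (allBits (deg b)) (λ A → ∑ℤ-ext (allBits (card A)) λ A′ →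
         cong₂ (λ u v → f u v (restrict (compl A) X))
           (restrict-restrict A′ A X) (restrict-restrict (compl A′) A X)) ⟩
  ∑ℤ (allBits (deg b)) (λ A → ∑ℤ (allBits (card A)) λ A′ →
    g (unsub A A′) (unsub A (compl A′)) (compl A))
    ≡⟨ ∑-threeParts (deg b) g ⟩
  ∑ℤ (allBits (deg b)) (λ A → ∑ℤ (allBits (card (compl A))) λ B →
    g A (unsub (compl A) B) (unsub (compl A) (compl B)))
    ≡⟨ ∑ℤ-ext (allBits (deg b)) (λ A → ∑ℤ-ext (allBits (card (compl A))) λ B →
         cong₂ (λ u v → f (restrict A X) u v)
           (restrict-restrict B (compl A) X) (restrict-restrict (compl B) (compl A) X)) ⟨
  ∑ℤ (allBits (deg b)) (λ A → rightOf (card A) (card (compl A)) (restrict A X) (restrict (compl A) X))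
    ≡⟨ ∑-unshuffle-sizes b rightOf ⟨
  ∑ℤ (unshuffle b) (λ (x , y) → rightOf (deg x) (deg y) (code x) (code y))
    ≡⟨ ∑ℤ-ext (unshuffle b) (λ (x , y) → ∑-unshuffle y (f (code x))) ⟨
  ∑ℤ (unshuffle b) (λ (x , y) → ∑ℤ (unshuffle y) λ (u , v) → f (code x) (code u) (code v)) ∎
  where
  open ≡-Reasoning
  X : List Bits
  X = code b
  g : Bits → Bits → Bits → ℤ
  g C D E = f (restrict C X) (restrict D X) (restrict E X)
  leftOf rightOf : ℕ → ℕ → List Bits → List Bits → ℤ
  leftOf p q U V = ∑ℤ (allBits p) λ A → f (restrict A U) (restrict (compl A) U) V
  rightOf p q U V = ∑ℤ (allBits q) λ B → f U (restrict B V) (restrict (compl B) V)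

restrict-concat : ∀ b c A B → length A ≡ deg b → length B ≡ deg c →
  restrict (A ++ B) (code (concat b c)) ≡
  juxtapose (card A) (card B) (restrict A (code b)) (restrict B (code c))
restrict-concat b@(p , _) c@(q , _) A B refl refl = trans
  (cong (restrict (A ++ B)) (code-concat b c))
  (restrict-juxtapose A B (code-length b))

-- A subset of `[p + q]` is a pair of subsets of the factors, and both it and its complement
-- restrict a juxtaposition factorwise. The auxiliary `k` takes all four degrees and all four codes,
-- so that `∑-unshuffle-sizes` can be applied to either factor.
unshuffle-concat : ∀ a b (f : List Bits → List Bits → ℤ) →
  ∑ℤ (concat a b ∷ []) (λ x → ∑ℤ (unshuffle x) λ (u , v) → f (code u) (code v)) ≡
  ∑ℤ (unshuffle a) λ (a₁ , a₂) → ∑ℤ (unshuffle b) λ (b₁ , b₂) →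
    ∑ℤ (concat a₁ b₁ ∷ []) λ u → ∑ℤ (concat a₂ b₂ ∷ []) λ v → f (code u) (code v)
unshuffle-concat a b f = begin
  ∑ℤ (concat a b ∷ []) (λ x → ∑ℤ (unshuffle x) λ (u , v) → f (code u) (code v))
    ≡⟨ ℤₚ.+-identityʳ _ ⟩
  ∑ℤ (unshuffle (concat a b)) (λ (u , v) → f (code u) (code v))
    ≡⟨ ∑-unshuffle (concat a b) f ⟩
  ∑ℤ (allBits (deg a ℕ.+ deg b)) (λ C → f (restrict C ab) (restrict (compl C) ab))
    ≡⟨ ∑-allBits-+ (deg a) (deg b) _ ⟩
  ∑ℤ (allBits (deg a)) (λ A → ∑ℤ (allBits (deg b)) λ B →
    f (restrict (A ++ B) ab) (restrict (compl (A ++ B)) ab))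
    ≡⟨ ∑ℤ-cong (allBits (deg a)) (λ A A∈ → ∑ℤ-cong (allBits (deg b)) λ B B∈ →
         term A B (length-allBits (deg a) A A∈) (length-allBits (deg b) B B∈)) ⟩
  ∑ℤ (allBits (deg a)) (λ A → ∑ℤ (allBits (deg b)) λ B →
    k (card A) (card (compl A)) (restrict A (code a)) (restrict (compl A) (code a))
      (card B) (card (compl B)) (restrict B (code b)) (restrict (compl B) (code b)))
    ≡⟨ ∑ℤ-ext (allBits (deg a)) (λ A → ∑-unshuffle-sizes b
         (k (card A) (card (compl A)) (restrict A (code a)) (restrict (compl A) (code a)))) ⟨
  ∑ℤ (allBits (deg a)) (λ A →
    k′ (card A) (card (compl A)) (restrict A (code a)) (restrict (compl A) (code a)))
    ≡⟨ ∑-unshuffle-sizes a k′ ⟨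
  ∑ℤ (unshuffle a) (λ (a₁ , a₂) → k′ (deg a₁) (deg a₂) (code a₁) (code a₂))
    ≡⟨ ∑ℤ-ext (unshuffle a) (λ (a₁ , a₂) → ∑ℤ-ext (unshuffle b) λ (b₁ , b₂) → trans
         (ℤₚ.+-identityʳ _) (trans (ℤₚ.+-identityʳ _)
           (cong₂ f (code-concat a₁ b₁) (code-concat a₂ b₂)))) ⟨
  ∑ℤ (unshuffle a) (λ (a₁ , a₂) → ∑ℤ (unshuffle b) λ (b₁ , b₂) →
    ∑ℤ (concat a₁ b₁ ∷ []) λ u → ∑ℤ (concat a₂ b₂ ∷ []) λ v → f (code u) (code v)) ∎
  where
  open ≡-Reasoning
  ab : List Bits
  ab = code (concat a b)
  k : ℕ → ℕ → List Bits → List Bits → ℕ → ℕ → List Bits → List Bits → ℤ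
  k p₁ p₂ X₁ X₂ q₁ q₂ Y₁ Y₂ = f (juxtapose p₁ q₁ X₁ Y₁) (juxtapose p₂ q₂ X₂ Y₂)
  k′ : ℕ → ℕ → List Bits → List Bits → ℤ
  k′ p₁ p₂ X₁ X₂ = ∑ℤ (unshuffle b) λ (b₁ , b₂) →
    k p₁ p₂ X₁ X₂ (deg b₁) (deg b₂) (code b₁) (code b₂)
  term : ∀ A B → length A ≡ deg a → length B ≡ deg b →
    f (restrict (A ++ B) ab) (restrict (compl (A ++ B)) ab) ≡
    k (card A) (card (compl A)) (restrict A (code a)) (restrict (compl A) (code a))
      (card B) (card (compl B)) (restrict B (code b)) (restrict (compl B) (code b))
  term A B ea eb = cong₂ f (restrict-concat a b A B ea eb)
    (trans (cong (λ C → restrict C ab) (Listₚ.map-++ not A B))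
      (restrict-concat a b (compl A) (compl B)
        (trans (Listₚ.length-map not A) ea) (trans (Listₚ.length-map not B) eb)))

concatBialgebra : Combinatorial
concatBialgebra = record
  { mul       = λ b c → concat b c ∷ []
  ; comul     = unshuffle
  ; mul-deg   = λ { b c _ (here refl) → refl }
  ; comul-deg = unshuffle-deg
  ; unitˡ     = λ b f → trans (∑ℤ-single (f ∘ code) (concat 𝟏 b))
      (cong f (trans (code-concat 𝟏 b) (juxtapose-[]ˡ (deg b) (code b))))
  ; unitʳ     = λ b f → trans (∑ℤ-single (f ∘ code) (concat b 𝟏))
      (cong f (trans (code-concat b 𝟏) (juxtapose-[]ʳ (deg b) (code b))))
  ; assoc     = λ a b c f → cong (ℤ._+ 0ℤ) (trans (∑ℤ-single (f ∘ code) (concat (concat a b) c))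
      (trans (cong f (concat-assoc a b c)) (sym (∑ℤ-single (f ∘ code) (concat a (concat b c))))))
  ; counitˡ   = λ b f → trans (∑ℤ-ext (unshuffle b) λ (x , y) →
        cong (ℤ._* f (code y)) (projection₀-isZero x))
      (trans (∑-unshuffle-sizes b λ p q X Y → isZero p ℤ.* f Y)
      (trans (∑-empty (deg b) (λ A → f (restrict (compl A) (code b))))
        (cong f (trans (cong (λ A → restrict A (code b)) (compl-falses (deg b)))
            (restrict-trues b)))))
  ; counitʳ   = λ b f → trans (∑ℤ-ext (unshuffle b) λ (x , y) →
        cong (ℤ._* f (code x)) (projection₀-isZero y))
      (trans (∑-unshuffle-sizes b λ p q X Y → isZero q ℤ.* f X)
      (trans (∑-full (deg b) (λ A → f (restrict A (code b)))) (cong f (restrict-trues b))))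
  ; coassoc   = unshuffle-coassoc
  ; comul-𝟏   = λ f → ∑ℤ-single (λ (x , y) → f (code x) (code y)) (𝟏 , 𝟏)
  ; compat    = unshuffle-concat
  }
  where
  concat-assoc : ∀ a b c → code (concat (concat a b) c) ≡ code (concat a (concat b c))
  concat-assoc a b c = trans (code-concat (concat a b) c)
    (trans (cong (λ X → juxtapose (deg a ℕ.+ deg b) (deg c) X (code c)) (code-concat a b))
    (trans (juxtapose-assoc (deg a) (deg b) (deg c) (code a) (code b) (code c))
    (trans (cong (juxtapose (deg a) (deg b ℕ.+ deg c) (code a)) (sym (code-concat b c)))
      (sym (code-concat a (concat b c))))))

-- Shuffling and cutting

-- The second index is the complementary one, carried along so that no truncated subtraction enters.
∑-pairs : ℕ → (ℕ → ℕ → ℤ) → ℤ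
∑-pairs zero    f = f 0 0
∑-pairs (suc n) f = f 0 (suc n) ℤ.+ ∑-pairs n (λ i j → f (suc i) j)

∑-pairs-cong : ∀ n {f g : ℕ → ℕ → ℤ} → (∀ i j → i ℕ.+ j ≡ n → f i j ≡ g i j) → ∑-pairs n f ≡
    ∑-pairs n g
∑-pairs-cong zero    e = e 0 0 refl
∑-pairs-cong (suc n) e =
  cong₂ ℤ._+_ (e 0 (suc n) refl) (∑-pairs-cong n λ i j i+j → e (suc i) j (cong suc i+j))

∑-pairs-+ : ∀ n (f g : ℕ → ℕ → ℤ) →
  ∑-pairs n (λ i j → f i j ℤ.+ g i j) ≡ ∑-pairs n f ℤ.+ ∑-pairs n g
∑-pairs-+ zero    f g = refl
∑-pairs-+ (suc n) f g = trans
  (cong (λ z → f 0 (suc n) ℤ.+ g 0 (suc n) ℤ.+ z) (∑-pairs-+ n _ _))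
  (Mod.interchange ℤᴹ (f 0 (suc n)) (g 0 (suc n)) _ _)

∑-pairs-zero : ∀ n {f : ℕ → ℕ → ℤ} → (∀ i j → f i j ≡ 0ℤ) → ∑-pairs n f ≡ 0ℤ
∑-pairs-zero zero    e = e 0 0
∑-pairs-zero (suc n) e = cong₂ ℤ._+_ (e 0 (suc n)) (∑-pairs-zero n λ i → e (suc i))

∑-upTo : ∀ n (h : ℕ → ℕ) (f : ℕ → ℤ) → ∑ℤ (applyUpTo h (suc n)) f ≡ ∑-pairs n (λ i _ → f (h i))
∑-upTo zero    h f = ℤₚ.+-identityʳ (f (h 0))
∑-upTo (suc n) h f = cong (λ z → f (h 0) ℤ.+ z) (∑-upTo n (h ∘ suc) f)

-- The triples with `a = 0` are split off; those with positive `a` are covered by the induction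
-- hypothesis for `f ∘ suc`.
∑-triples : ∀ n (f : ℕ → ℕ → ℕ → ℤ) →
  ∑-pairs n (λ i k → ∑-pairs i (λ a b → f a b k)) ≡ ∑-pairs n (λ a k → ∑-pairs k (f a))
∑-triples zero    f = refl
∑-triples (suc n) f = begin
  f 0 0 (suc n) ℤ.+ ∑-pairs n (λ i k → f 0 (suc i) k ℤ.+ ∑-pairs i (λ a b → f (suc a) b k))
    ≡⟨ cong (λ z → f 0 0 (suc n) ℤ.+ z) (∑-pairs-+ n (λ i k → f 0 (suc i) k) _) ⟩
  f 0 0 (suc n) ℤ.+ (∑-pairs n (λ i k → f 0 (suc i) k) ℤ.+
    ∑-pairs n (λ i k → ∑-pairs i (λ a b → f (suc a) b k)))
    ≡⟨ ℤₚ.+-assoc (f 0 0 (suc n)) _ _ ⟨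
  ∑-pairs (suc n) (f 0) ℤ.+ ∑-pairs n (λ i k → ∑-pairs i (λ a b → f (suc a) b k))
    ≡⟨ cong (λ z → ∑-pairs (suc n) (f 0) ℤ.+ z) (∑-triples n (f ∘ suc)) ⟩
  ∑-pairs (suc n) (f 0) ℤ.+ ∑-pairs n (λ a k → ∑-pairs k (f (suc a))) ∎
  where open ≡-Reasoning

∑-pairs-isZeroˡ : ∀ n (f : ℕ → ℕ → ℤ) → ∑-pairs n (λ i j → isZero i ℤ.* f i j) ≡ f 0 n
∑-pairs-isZeroˡ zero    f = ℤₚ.*-identityˡ (f 0 0)
∑-pairs-isZeroˡ (suc n) f = trans
  (cong₂ ℤ._+_ (ℤₚ.*-identityˡ (f 0 (suc n))) (∑-pairs-zero n λ _ _ → refl)) (ℤₚ.+-identityʳ _)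

∑-pairs-isZeroʳ : ∀ n (f : ℕ → ℕ → ℤ) → ∑-pairs n (λ i j → isZero j ℤ.* f i j) ≡ f n 0
∑-pairs-isZeroʳ zero    f = ℤₚ.*-identityˡ (f 0 0)
∑-pairs-isZeroʳ (suc n) f = trans (ℤₚ.+-identityˡ _) (∑-pairs-isZeroʳ n (f ∘ suc))

-- The sum over the words with p letters true and q letters false, read as lattice paths.
∑-paths : ℕ → ℕ → (Bits → ℤ) → ℤ
∑-paths zero    zero    f = f []
∑-paths zero    (suc q) f = ∑-paths zero q (f ∘ (false ∷_))
∑-paths (suc p) zero    f = ∑-paths p zero (f ∘ (true ∷_))
∑-paths (suc p) (suc q) f = ∑-paths p (suc q) (f ∘ (true ∷_)) ℤ.+ ∑-paths (suc p) q (f ∘ (false ∷_))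

∑-paths-cong : ∀ p q {f g : Bits → ℤ} → (∀ A → card A ≡ p → card (compl A) ≡ q → f A ≡ g A) →
               ∑-paths p q f ≡ ∑-paths p q g
∑-paths-cong zero    zero    e = e [] refl refl
∑-paths-cong zero    (suc q) e = ∑-paths-cong zero q λ A a b → e (false ∷ A) a (cong suc b)
∑-paths-cong (suc p) zero    e = ∑-paths-cong p zero λ A a b → e (true ∷ A) (cong suc a) b
∑-paths-cong (suc p) (suc q) e = cong₂ ℤ._+_
  (∑-paths-cong p (suc q) λ A a b → e (true ∷ A) (cong suc a) b)
  (∑-paths-cong (suc p) q λ A a b → e (false ∷ A) a (cong suc b))

∑-paths-+ : ∀ p q (f g : Bits → ℤ) →
  ∑-paths p q (λ A → f A ℤ.+ g A) ≡ ∑-paths p q f ℤ.+ ∑-paths p q g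
∑-paths-+ zero    zero    f g = refl
∑-paths-+ zero    (suc q) f g = ∑-paths-+ zero q _ _
∑-paths-+ (suc p) zero    f g = ∑-paths-+ p zero _ _
∑-paths-+ (suc p) (suc q) f g = trans
  (cong₂ ℤ._+_ (∑-paths-+ p (suc q) _ _) (∑-paths-+ (suc p) q _ _))
  (Mod.interchange ℤᴹ (∑-paths p (suc q) (f ∘ (true ∷_))) _ _ _)

∑-paths-0ˡ : ∀ q f → ∑-paths 0 q f ≡ f (falses q)
∑-paths-0ˡ zero    f = refl
∑-paths-0ˡ (suc q) f = ∑-paths-0ˡ q (f ∘ (false ∷_))

∑-paths-0ʳ : ∀ p f → ∑-paths p 0 f ≡ f (trues p)
∑-paths-0ʳ zero    f = refl
∑-paths-0ʳ (suc p) f = ∑-paths-0ʳ p (f ∘ (true ∷_))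

weight : ℕ → ℕ → Bits → ℤ
weight p q A = 𝟙[ card A ℕₚ.≟ p ] ℤ.* 𝟙[ card (compl A) ℕₚ.≟ q ]

-- Passes from all subsets, most of which contribute zero, to a sum that recurses on the sizes `p`
-- and `q`. The equation for `n` is a hypothesis because the recursion also lowers `q`, where
-- `p + q` does not reduce.
∑-paths-weight : ∀ n p q (f : Bits → ℤ) → n ≡ p ℕ.+ q →
  ∑ℤ (allBits n) (λ A → weight p q A ℤ.* f A) ≡ ∑-paths p q f
∑-paths-weight zero    zero    zero    f e = trans (ℤₚ.+-identityʳ _) (ℤₚ.*-identityˡ (f []))
∑-paths-weight (suc n) zero    (suc q) f e = trans (∑-allBits-suc n _) (trans
  (cong₂ ℤ._+_ (∑ℤ-zero (allBits n) λ _ _ → refl)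
    (∑-paths-weight n zero q _ (ℕₚ.suc-injective e))) (ℤₚ.+-identityˡ _))
∑-paths-weight (suc n) (suc p) zero    f e = trans (∑-allBits-suc n _) (trans
  (cong₂ ℤ._+_ (∑-paths-weight n p zero _ (ℕₚ.suc-injective e))
    (∑ℤ-zero (allBits n) λ A _ → cong (ℤ._* f (false ∷ A)) (ℤₚ.*-zeroʳ 𝟙[ card A ℕₚ.≟ suc p ])))
  (ℤₚ.+-identityʳ _))
∑-paths-weight (suc n) (suc p) (suc q) f e = trans (∑-allBits-suc n _)
  (cong₂ ℤ._+_ (∑-paths-weight n p (suc q) _ (ℕₚ.suc-injective e))
    (∑-paths-weight n (suc p) q _ (trans (ℕₚ.suc-injective e) (ℕₚ.+-suc p q))))

∑-splits : Bits → (Bits → Bits → ℤ) → ℤ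
∑-splits []      f = f [] []
∑-splits (a ∷ A) f = f [] (a ∷ A) ℤ.+ ∑-splits A (λ B C → f (a ∷ B) C)

∑-splits-pairs : ∀ A f → ∑-pairs (length A) (λ i _ → f (take i A) (drop i A)) ≡ ∑-splits A f
∑-splits-pairs []      f = refl
∑-splits-pairs (a ∷ A) f = cong (λ z → f [] (a ∷ A) ℤ.+ z) (∑-splits-pairs A (λ B C → f (a ∷ B) C))

-- A path cut at an arbitrary point is a pair of paths; f [] collects the cuts
-- before the first step, the other cuts are classified by the first step.
∑-cut-paths : ∀ p q (f : Bits → Bits → ℤ) →
  ∑-paths p q (λ A → ∑-splits A f) ≡
  ∑-pairs p (λ p₁ p₂ → ∑-pairs q λ q₁ q₂ → ∑-paths p₁ q₁ λ A₁ → ∑-paths p₂ q₂ (f A₁))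
∑-cut-paths zero    zero    f = refl
∑-cut-paths zero    (suc q) f = trans (∑-paths-+ zero q _ _)
  (cong (λ z → ∑-paths zero q (λ A → f [] (false ∷ A)) ℤ.+ z) (∑-cut-paths zero q (f ∘ (false ∷_))))
∑-cut-paths (suc p) zero    f = trans (∑-paths-+ p zero _ _)
  (cong (λ z → ∑-paths p zero (λ A → f [] (true ∷ A)) ℤ.+ z) (∑-cut-paths p zero (f ∘ (true ∷_))))
∑-cut-paths (suc p) (suc q) f = begin
  ∑-paths p (suc q) (λ A → f [] (true ∷ A) ℤ.+ ∑-splits A fᵗ) ℤ.+
  ∑-paths (suc p) q (λ A → f [] (false ∷ A) ℤ.+ ∑-splits A fᶠ)
    ≡⟨ cong₂ ℤ._+_ (∑-paths-+ p (suc q) _ _) (∑-paths-+ (suc p) q _ _) ⟩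
  (a₁ ℤ.+ ∑-paths p (suc q) (λ A → ∑-splits A fᵗ)) ℤ.+
  (a₂ ℤ.+ ∑-paths (suc p) q (λ A → ∑-splits A fᶠ))
    ≡⟨ cong₂ (λ y z → (a₁ ℤ.+ y) ℤ.+ (a₂ ℤ.+ z)) (∑-cut-paths p (suc q) fᵗ) (∑-cut-paths (suc p) q fᶠ) ⟩
  (a₁ ℤ.+ ih₁) ℤ.+ (a₂ ℤ.+ (b ℤ.+ c))
    ≡⟨ Mod.interchange ℤᴹ a₁ ih₁ a₂ (b ℤ.+ c) ⟩
  (a₁ ℤ.+ a₂) ℤ.+ (ih₁ ℤ.+ (b ℤ.+ c))
    ≡⟨ cong (λ z → (a₁ ℤ.+ a₂) ℤ.+ z) (trans (sym (ℤₚ.+-assoc ih₁ b c))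
         (trans (cong (ℤ._+ c) (ℤₚ.+-comm ih₁ b)) (ℤₚ.+-assoc b ih₁ c))) ⟩
  (a₁ ℤ.+ a₂) ℤ.+ (b ℤ.+ (ih₁ ℤ.+ c))
    ≡⟨ ℤₚ.+-assoc (a₁ ℤ.+ a₂) b _ ⟨
  ((a₁ ℤ.+ a₂) ℤ.+ b) ℤ.+ (ih₁ ℤ.+ c)
    ≡⟨ cong (λ z → ((a₁ ℤ.+ a₂) ℤ.+ b) ℤ.+ z) later ⟨
  ((a₁ ℤ.+ a₂) ℤ.+ b) ℤ.+ ∑-pairs p (λ p₁ p₂ → ∑-pairs (suc q) λ q₁ q₂ → h f (suc p₁) q₁ p₂ q₂) ∎
  where
  open ≡-Reasoning
  fᵗ fᶠ : Bits → Bits → ℤ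
  fᵗ B = f (true ∷ B)
  fᶠ B = f (false ∷ B)
  h : (Bits → Bits → ℤ) → ℕ → ℕ → ℕ → ℕ → ℤ
  h g p₁ q₁ p₂ q₂ = ∑-paths p₁ q₁ λ A₁ → ∑-paths p₂ q₂ (g A₁)
  -- Classified by the first half of the cut path: `a₁` and `a₂` collect the empty halves, `b` the
  -- nonempty halves with false steps only, `c` those that begin with false and contain a true step,
  -- and `ih₁` those that begin with true.
  a₁ a₂ b c ih₁ : ℤ
  a₁ = ∑-paths p (suc q) (λ A → f [] (true ∷ A))
  a₂ = ∑-paths (suc p) q (λ A → f [] (false ∷ A))
  b = ∑-pairs q λ q₁ q₂ → h fᶠ 0 q₁ (suc p) q₂
  c = ∑-pairs p λ p₁ p₂ → ∑-pairs q λ q₁ q₂ → h fᶠ (suc p₁) q₁ p₂ q₂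
  ih₁ = ∑-pairs p λ p₁ p₂ → ∑-pairs (suc q) λ q₁ q₂ → h fᵗ p₁ q₁ p₂ q₂
  later : ∑-pairs p (λ p₁ p₂ → ∑-pairs (suc q) λ q₁ q₂ → h f (suc p₁) q₁ p₂ q₂) ≡ ih₁ ℤ.+ c
  later = trans (∑-pairs-cong p λ p₁ p₂ _ →
    trans (cong (λ z → h fᵗ p₁ 0 p₂ (suc q) ℤ.+ z)
            (∑-pairs-+ q (λ q₁ q₂ → h fᵗ p₁ (suc q₁) p₂ q₂) (λ q₁ q₂ → h fᶠ (suc p₁) q₁ p₂ q₂)))
      (sym (ℤₚ.+-assoc (h fᵗ p₁ 0 p₂ (suc q)) _ _)))
    (∑-pairs-+ p _ _)

merge : Bits → List Bits → List Bits → List Bits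
merge A Xs Ys = map (unsub A) Xs ++ map (unsub (compl A)) Ys

shuffleTerms : (b c : Basis) (A : Subset (deg b ℕ.+ deg c)) →
               Dec (∣ A ∣ ≡ deg b) → Dec (∣ ∁ A ∣ ≡ deg c) → List Basis
shuffleTerms b c A (yes e) (yes e′) = theGen (shuffleTerm b c A (yes e) (yes e′)) ∷ []
shuffleTerms b c A _       _        = []

shuffleAt : (b c : Basis) → Subset (deg b ℕ.+ deg c) → List Basis
shuffleAt b c A = shuffleTerms b c A (∣ A ∣ ℕₚ.≟ deg b) (∣ ∁ A ∣ ℕₚ.≟ deg c)

shuffle : Basis → Basis → List Basis
shuffle b c = concatMap (shuffleAt b c) (allSubsets (deg b ℕ.+ deg c))

code-subst : ∀ {m n} (e : m ≡ n) (P : Comp m) → code (n , subst Comp e P) ≡ code (m , P)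
code-subst refl P = refl

map-uncollapse : ∀ {n} (A : Subset n) (P : Comp ∣ A ∣) →
  map Vec.toList (map (uncollapse A) (blocks P)) ≡ map (unsub (Vec.toList A)) (code (∣ A ∣ , P))
map-uncollapse A P = trans (sym (Listₚ.map-∘ (blocks P)))
  (trans (Listₚ.map-cong (toList-uncollapse A) (blocks P)) (Listₚ.map-∘ (blocks P)))

code-shuffleTerm : ∀ b c A e e′ →
  code (theGen (shuffleTerm b c A (yes e) (yes e′))) ≡ merge (Vec.toList A) (code b) (code c)
code-shuffleTerm (p , P) (q , Q) A e e′ =
  trans (Listₚ.map-++ Vec.toList (map (uncollapse A) (blocks P′)) _) (cong₂ _++_
    (trans (map-uncollapse A P′) (cong (map (unsub (Vec.toList A))) (code-subst (sym e) P)))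
    (trans (map-uncollapse (∁ A) Q′)
      (cong₂ (λ B → map (unsub B)) (toList-∁ A) (code-subst (sym e′) Q))))
  where
  P′ : Comp ∣ A ∣
  P′ = subst Comp (sym e) P
  Q′ : Comp ∣ ∁ A ∣
  Q′ = subst Comp (sym e′) Q

∑-shuffle : ∀ b c (f : List Bits → ℤ) →
  ∑ℤ (shuffle b c) (f ∘ code) ≡ ∑-paths (deg b) (deg c) (λ A → f (merge A (code b) (code c)))
∑-shuffle b c f = trans (∑ℤ-concatMap (shuffleAt b c) (allSubsets n) (f ∘ code))
  (trans (∑ℤ-ext (allSubsets n) λ A → term A (∣ A ∣ ℕₚ.≟ deg b) (∣ ∁ A ∣ ℕₚ.≟ deg c))
  (trans (∑-allSubsets n λ A → weight (deg b) (deg c) A ℤ.* f (merge A (code b) (code c)))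
    (∑-paths-weight n (deg b) (deg c) _ refl)))
  where
  n : ℕ
  n = deg b ℕ.+ deg c
  term : ∀ A d d′ → ∑ℤ (shuffleTerms b c A d d′) (f ∘ code) ≡
         weight (deg b) (deg c) (Vec.toList A) ℤ.* f (merge (Vec.toList A) (code b) (code c))
  term A d d′ rewrite card-toList A | card-∁ A = lemma d d′
    where
    lemma : ∀ d d′ → ∑ℤ (shuffleTerms b c A d d′) (f ∘ code) ≡
      (𝟙[ ∣ A ∣ ℕₚ.≟ deg b ] ℤ.* 𝟙[ ∣ ∁ A ∣ ℕₚ.≟ deg c ]) ℤ.* f (merge (Vec.toList A) (code b)
          (code c))
    lemma (yes e) (yes e′) rewrite 𝟙-yes (∣ A ∣ ℕₚ.≟ deg b) e | 𝟙-yes (∣ ∁ A ∣ ℕₚ.≟ deg c) e′ =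
      trans (ℤₚ.+-identityʳ _) (trans (cong f (code-shuffleTerm b c A e e′))
          (sym (ℤₚ.*-identityˡ _)))
    lemma (no ¬e) (yes _) rewrite 𝟙-no (∣ A ∣ ℕₚ.≟ deg b) ¬e = refl
    lemma (no ¬e) (no _) rewrite 𝟙-no (∣ A ∣ ℕₚ.≟ deg b) ¬e = refl
    lemma (yes _) (no ¬e) rewrite 𝟙-no (∣ ∁ A ∣ ℕₚ.≟ deg c) ¬e | ℤₚ.*-zeroʳ 𝟙[ ∣ A ∣ ℕₚ.≟ deg b ] = refl

shuffle-deg : ∀ b c x → x ∈ˡ shuffle b c → deg x ≡ deg b ℕ.+ deg c
shuffle-deg b c x x∈ with Any.satisfied (∈-concatMap⁻ (shuffleAt b c) {xs = allSubsets _} x∈)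
... | A , x∈A = term (∣ A ∣ ℕₚ.≟ deg b) (∣ ∁ A ∣ ℕₚ.≟ deg c) x∈A
  where
  term : ∀ d d′ → x ∈ˡ shuffleTerms b c A d d′ → deg x ≡ deg b ℕ.+ deg c
  term (yes _) (yes _) (here refl) = refl
  term (no _)  (yes _) ()
  term (no _)  (no _)  ()
  term (yes _) (no _)  ()

prefix suffix : ℕ → List Bits → List Bits
prefix i Xs = dropEmpty (map (take i) Xs)
suffix i Xs = dropEmpty (map (drop i) Xs)

cutAt : Basis → ℕ → Basis × Basis
cutAt b i = unshuffleTerm b (initial (deg b) i)

cut : Basis → List (Basis × Basis)
cut b = map (cutAt b) (upTo (suc (deg b)))

cut-deg : ∀ b x y → (x , y) ∈ˡ cut b → deg x ℕ.+ deg y ≡ deg b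
cut-deg b x y xy∈ with ∈-map⁻ (cutAt b) {xs = upTo (suc (deg b))} xy∈
... | i , _ , refl = ∣A∣+∣∁A∣ (initial (deg b) i)

toList-initial : ∀ i j → Vec.toList (initial (i ℕ.+ j) i) ≡ trues i ++ falses j
toList-initial zero    zero    = refl
toList-initial zero    (suc j) = cong (false ∷_) (toList-initial 0 j)
toList-initial (suc i) j       = cong (true ∷_) (toList-initial i j)

compl-initial : ∀ i j → compl (trues i ++ falses j) ≡ falses i ++ trues j
compl-initial i j = trans (Listₚ.map-++ not (trues i) _) (cong₂ _++_ (compl-trues i)
    (compl-falses j))

sub-none : ∀ j X → sub (falses j) X ≡ []
sub-none zero    X       = refl
sub-none (suc j) []      = refl
sub-none (suc j) (x ∷ X) = sub-none j X

sub-initial : ∀ i j X → sub (trues i ++ falses j) X ≡ take i X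
sub-initial zero    j X       = sub-none j X
sub-initial (suc i) j []      = refl
sub-initial (suc i) j (x ∷ X) = cong (x ∷_) (sub-initial i j X)

sub-final : ∀ i j X → length X ≡ i ℕ.+ j → sub (falses i ++ trues j) X ≡ drop i X
sub-final zero    j X       refl = sub-trues X
sub-final (suc i) j (x ∷ X) e    = sub-final i j X (ℕₚ.suc-injective e)

card-initial : ∀ i j → card (trues i ++ falses j) ≡ i
card-initial i j = trans (card-++ (trues i) _)
  (trans (cong₂ ℕ._+_ (card-trues i) (card-falses j)) (ℕₚ.+-identityʳ i))

card-final : ∀ i j → card (falses i ++ trues j) ≡ j
card-final i j = trans (card-++ (falses i) _) (cong₂ ℕ._+_ (card-falses i) (card-trues j))

∑-cut-sizes : ∀ b (f : ℕ → ℕ → List Bits → List Bits → ℤ) →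
  ∑ℤ (cut b) (λ (x , y) → f (deg x) (deg y) (code x) (code y)) ≡
  ∑-pairs (deg b) (λ i j → f i j (prefix i (code b)) (suffix i (code b)))
∑-cut-sizes b@(n , P) f = trans (∑ℤ-map (cutAt b) (upTo (suc n)) F)
  (trans (∑-upTo n id (F ∘ cutAt b)) (∑-pairs-cong n term))
  where
  F : Basis × Basis → ℤ
  F (x , y) = f (deg x) (deg y) (code x) (code y)
  g : Bits → ℤ
  g A = f (card A) (card (compl A)) (restrict A (code b)) (restrict (compl A) (code b))
  toBits : ∀ (A : Subset n) →
    f ∣ A ∣ ∣ ∁ A ∣ (code (∣ A ∣ , P ∣ A)) (code (∣ ∁ A ∣ , P ∣ ∁ A)) ≡ g (Vec.toList A)
  toBits A rewrite code-∣ P A | code-∣ P (∁ A) | toList-∁ A | card-toList A | card-∁ A = refl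
  term : ∀ i j → i ℕ.+ j ≡ n → let A = initial n i in
    f ∣ A ∣ ∣ ∁ A ∣ (code (∣ A ∣ , P ∣ A)) (code (∣ ∁ A ∣ , P ∣ ∁ A)) ≡
    f i j (prefix i (code b)) (suffix i (code b))
  term i j refl = trans (toBits (initial n i)) (trans (cong g (toList-initial i j)) split)
    where
    split : g (trues i ++ falses j) ≡ f i j (prefix i (code b)) (suffix i (code b))
    split rewrite compl-initial i j | card-initial i j | card-final i j = cong₂ (f i j)
      (cong dropEmpty (Listₚ.map-cong (sub-initial i j) (code b)))
      (cong dropEmpty (map-cong-local (All.map (λ {X} → sub-final i j X) (code-length b))))

∑-cut : ∀ b (f : List Bits → List Bits → ℤ) →
  ∑ℤ (cut b) (λ (x , y) → f (code x) (code y)) ≡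
  ∑-pairs (deg b) (λ i _ → f (prefix i (code b)) (suffix i (code b)))
∑-cut b f = ∑-cut-sizes b (λ _ _ → f)

unsub-trues : ∀ X → unsub (trues (length X)) X ≡ X
unsub-trues []      = refl
unsub-trues (x ∷ X) = cong (x ∷_) (unsub-trues X)

or-unsub : ∀ A X → length X ≡ card A → or (unsub A X) ≡ or X
or-unsub []          []      _ = refl
or-unsub (true  ∷ A) (x ∷ X) e = cong (x ∨_) (or-unsub A X (ℕₚ.suc-injective e))
or-unsub (false ∷ A) X       e = or-unsub A X e

card-unsub : ∀ A X → length X ≡ card A → card (unsub A X) ≡ card X
card-unsub []          []          _ = refl
card-unsub (true  ∷ A) (true  ∷ X) e = cong suc (card-unsub A X (ℕₚ.suc-injective e))
card-unsub (true  ∷ A) (false ∷ X) e = card-unsub A X (ℕₚ.suc-injective e)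
card-unsub (false ∷ A) X           e = card-unsub A X e

unsub-unsub : ∀ A A′ X → unsub A (unsub A′ X) ≡ unsub (unsub A A′) X
unsub-unsub []          A′           X       = refl
unsub-unsub (true  ∷ A) (true  ∷ A′) (x ∷ X) = cong (x ∷_) (unsub-unsub A A′ X)
unsub-unsub (true  ∷ A) (true  ∷ A′) []      = cong (false ∷_) (unsub-unsub A A′ [])
unsub-unsub (true  ∷ A) (false ∷ A′) X       = cong (false ∷_) (unsub-unsub A A′ X)
unsub-unsub (true  ∷ A) []           X       = cong (false ∷_) (unsub-unsub A [] X)
unsub-unsub (false ∷ A) A′           X       = cong (false ∷_) (unsub-unsub A A′ X)

-- The first `i` places of `unsub A X` consume one entry of `X` for each element of `A` among them.
take-unsub : ∀ i A X → take i (unsub A X) ≡ unsub (take i A) (take (card (take i A)) X)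
take-unsub zero    A           X       = refl
take-unsub (suc i) []          X       = refl
take-unsub (suc i) (true  ∷ A) (x ∷ X) = cong (x ∷_) (take-unsub i A X)
take-unsub (suc i) (true  ∷ A) []      =
  cong (false ∷_) (trans (take-unsub i A []) (cong (unsub (take i A)) (take-[] (card (take i A)))))
  where
  take-[] : ∀ n → take n [] ≡ [] {A = Bool}
  take-[] zero    = refl
  take-[] (suc n) = refl
take-unsub (suc i) (false ∷ A) X       = cong (false ∷_) (take-unsub i A X)

drop-unsub : ∀ i A X → drop i (unsub A X) ≡ unsub (drop i A) (drop (card (take i A)) X)
drop-unsub zero    A           X       = refl
drop-unsub (suc i) []          X       = refl
drop-unsub (suc i) (true  ∷ A) (x ∷ X) = drop-unsub i A X
drop-unsub (suc i) (true  ∷ A) []      =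
  trans (drop-unsub i A []) (cong (unsub (drop i A)) (drop-[] (card (take i A))))
  where
  drop-[] : ∀ n → drop n [] ≡ [] {A = Bool}
  drop-[] zero    = refl
  drop-[] (suc n) = refl
drop-unsub (suc i) (false ∷ A) X       = drop-unsub i A X

card-take-drop : ∀ i A → card (take i A) ℕ.+ card (drop i A) ≡ card A
card-take-drop i A = trans (sym (card-++ (take i A) _)) (cong card (Listₚ.take++drop≡id i A))

or-take : ∀ i X → or X ≡ false → or (take i X) ≡ false
or-take zero    X           e = refl
or-take (suc i) []          e = refl
or-take (suc i) (false ∷ X) e = or-take i X e

or-drop : ∀ i X → or X ≡ false → or (drop i X) ≡ false
or-drop zero    X           e = e
or-drop (suc i) []          e = refl
or-drop (suc i) (false ∷ X) e = or-drop i X e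

dropEmpty-merge : ∀ B Xs Ys → AllLength (card B) Xs → AllLength (card (compl B)) Ys →
                  dropEmpty (merge B Xs Ys) ≡ merge B (dropEmpty Xs) (dropEmpty Ys)
dropEmpty-merge B Xs Ys lx ly = trans (dropEmpty-++ (map (unsub B) Xs) _) (cong₂ _++_
  (dropEmpty-map (unsub B) (All.map (λ {X} → or-unsub B X) lx))
  (dropEmpty-map (unsub (compl B)) (All.map (λ {X} → or-unsub (compl B) X) ly)))

-- Up to the cut, `A` has taken `card B` places from the first factor and `card (compl B)` from the
-- second, which locates the cuts of the factors. The length hypotheses ensure that `unsub` loses no
-- entries, so that a block and its image are empty together.
prefix-merge : ∀ i A Xs Ys → AllLength (card A) Xs → AllLength (card (compl A)) Ys →
  let B = take i A in
  prefix i (merge A Xs Ys) ≡ merge B (prefix (card B) Xs) (prefix (card (compl B)) Ys)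
prefix-merge i A Xs Ys lx ly = trans (cong dropEmpty (trans
    (Listₚ.map-++ (take i) (map (unsub A) Xs) _) (cong₂ _++_ left right)))
  (dropEmpty-merge B (map (take (card B)) Xs) (map (take (card (compl B))) Ys)
    (Allₚ.map⁺ (All.map (λ {X} → len {A} {X}) lx))
    (Allₚ.map⁺ (All.map (λ {Y} e → trans (cong (λ C → length (take (card C) Y)) compl-take)
      (trans (len {compl A} {Y} e) (cong card (sym compl-take)))) ly)))
  where
  B : Bits
  B = take i A
  compl-take : compl B ≡ take i (compl A)
  compl-take = sym (Listₚ.take-map i A)
  left : map (take i) (map (unsub A) Xs) ≡ map (unsub B) (map (take (card B)) Xs)
  left = trans (sym (Listₚ.map-∘ Xs)) (trans (Listₚ.map-cong (take-unsub i A) Xs) (Listₚ.map-∘ Xs))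
  right : map (take i) (map (unsub (compl A)) Ys) ≡ map (unsub (compl B))
      (map (take (card (compl B))) Ys)
  right = trans (sym (Listₚ.map-∘ Ys)) (trans (Listₚ.map-cong (λ Y → trans (take-unsub i (compl A) Y)
    (cong (λ C → unsub C (take (card C) Y)) (sym compl-take))) Ys) (Listₚ.map-∘ Ys))
  len : ∀ {A X} → length X ≡ card A → length (take (card (take i A)) X) ≡ card (take i A)
  len {A} {X} e = trans (Listₚ.length-take (card (take i A)) X) (ℕₚ.m≤n⇒m⊓n≡m
    (ℕₚ.≤-trans (ℕₚ.m≤m+n _ _) (ℕₚ.≤-reflexive (trans (card-take-drop i A) (sym e)))))

suffix-merge : ∀ i A Xs Ys → AllLength (card A) Xs → AllLength (card (compl A)) Ys →
  let B = take i A ; C = drop i A in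
  suffix i (merge A Xs Ys) ≡ merge C (suffix (card B) Xs) (suffix (card (compl B)) Ys)
suffix-merge i A Xs Ys lx ly = trans (cong dropEmpty (trans
    (Listₚ.map-++ (drop i) (map (unsub A) Xs) _) (cong₂ _++_ left right)))
  (dropEmpty-merge C (map (drop (card B)) Xs) (map (drop (card (compl B))) Ys)
    (Allₚ.map⁺ (All.map (λ {X} → len {A} {X}) lx))
    (Allₚ.map⁺ (All.map (λ {Y} e → trans (cong (λ D → length (drop (card D) Y)) compl-take)
      (trans (len {compl A} {Y} e) (cong card (sym compl-drop)))) ly)))
  where
  B C : Bits
  B = take i A
  C = drop i A
  compl-take : compl B ≡ take i (compl A)
  compl-take = sym (Listₚ.take-map i A)
  compl-drop : compl C ≡ drop i (compl A)
  compl-drop = sym (Listₚ.drop-map i A)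
  left : map (drop i) (map (unsub A) Xs) ≡ map (unsub C) (map (drop (card B)) Xs)
  left = trans (sym (Listₚ.map-∘ Xs)) (trans (Listₚ.map-cong (drop-unsub i A) Xs) (Listₚ.map-∘ Xs))
  right : map (drop i) (map (unsub (compl A)) Ys) ≡ map (unsub (compl C))
      (map (drop (card (compl B))) Ys)
  right = trans (sym (Listₚ.map-∘ Ys)) (trans (Listₚ.map-cong (λ Y → trans (drop-unsub i (compl A) Y)
    (cong₂ (λ D E → unsub D (drop (card E) Y)) (sym compl-drop) (sym compl-take))) Ys)
        (Listₚ.map-∘ Ys))
  len : ∀ {A X} → length X ≡ card A → length (drop (card (take i A)) X) ≡ card (drop i A)
  len {A} {X} e = trans (Listₚ.length-drop (card (take i A)) X)
    (trans (cong (ℕ._∸ card (take i A)) (trans e (sym (card-take-drop i A))))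
      (ℕₚ.m+n∸m≡n (card (take i A)) _))

-- The common form of a suffix of a prefix and of a prefix of a suffix.
middle : ℕ → ℕ → List Bits → List Bits
middle a b Xs = dropEmpty (map (take b ∘ drop a) Xs)

prefix-prefix : ∀ a b Xs → prefix a (prefix (a ℕ.+ b) Xs) ≡ prefix a Xs
prefix-prefix a b Xs = trans (dropEmpty-map-dropEmpty (take a) (or-take a) (map (take (a ℕ.+ b)) Xs))
  (cong dropEmpty (trans (sym (Listₚ.map-∘ Xs)) (Listₚ.map-cong (lemma a) Xs)))
  where
  lemma : ∀ a (X : Bits) → take a (take (a ℕ.+ b) X) ≡ take a X
  lemma zero    X       = refl
  lemma (suc a) []      = refl
  lemma (suc a) (x ∷ X) = cong (x ∷_) (lemma a X)

suffix-prefix : ∀ a b Xs → suffix a (prefix (a ℕ.+ b) Xs) ≡ middle a b Xs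
suffix-prefix a b Xs = trans (dropEmpty-map-dropEmpty (drop a) (or-drop a) (map (take (a ℕ.+ b)) Xs))
  (cong dropEmpty (trans (sym (Listₚ.map-∘ Xs)) (Listₚ.map-cong (lemma a) Xs)))
  where
  lemma : ∀ a (X : Bits) → drop a (take (a ℕ.+ b) X) ≡ take b (drop a X)
  lemma zero    X       = refl
  lemma (suc a) []      = sym (Listₚ.take-[] b)
  lemma (suc a) (x ∷ X) = lemma a X

prefix-suffix : ∀ a b Xs → prefix b (suffix a Xs) ≡ middle a b Xs
prefix-suffix a b Xs = trans (dropEmpty-map-dropEmpty (take b) (or-take b) (map (drop a) Xs))
  (cong dropEmpty (sym (Listₚ.map-∘ Xs)))

suffix-suffix : ∀ a b Xs → suffix b (suffix a Xs) ≡ suffix (a ℕ.+ b) Xs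
suffix-suffix a b Xs = trans (dropEmpty-map-dropEmpty (drop b) (or-drop b) (map (drop a) Xs))
  (cong dropEmpty (trans (sym (Listₚ.map-∘ Xs)) (Listₚ.map-cong (lemma a) Xs)))
  where
  lemma : ∀ a (X : Bits) → drop b (drop a X) ≡ drop (a ℕ.+ b) X
  lemma zero    X       = refl
  lemma (suc a) []      = Listₚ.drop-[] b
  lemma (suc a) (x ∷ X) = lemma a X

prefix-all : ∀ b → prefix (deg b) (code b) ≡ code b
prefix-all b = trans (cong dropEmpty (map-id-local
  (All.map (λ { {X} refl → Listₚ.take-all (length X) X ℕₚ.≤-refl }) (code-length b))))
      (code-nonempty b)

suffix-none : ∀ b → suffix 0 (code b) ≡ code b
suffix-none b = trans (cong dropEmpty (Listₚ.map-id (code b))) (code-nonempty b)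

-- Two cuts leave a prefix, a middle piece and a suffix; the order of the cuts corresponds to the
-- two ways in which `∑-triples` groups their lengths.
cut-coassoc : ∀ b (f : List Bits → List Bits → List Bits → ℤ) →
  ∑ℤ (cut b) (λ (x , y) → ∑ℤ (cut x) λ (u , v) → f (code u) (code v) (code y)) ≡
  ∑ℤ (cut b) (λ (x , y) → ∑ℤ (cut y) λ (u , v) → f (code x) (code u) (code v))
cut-coassoc b f = begin
  ∑ℤ (cut b) (λ (x , y) → ∑ℤ (cut x) λ (u , v) → f (code u) (code v) (code y))
    ≡⟨ ∑ℤ-ext (cut b) (λ (x , y) → ∑-cut x (λ u v → f u v (code y))) ⟩
  ∑ℤ (cut b) (λ (x , y) → leftOf (deg x) (deg y) (code x) (code y))
    ≡⟨ ∑-cut-sizes b leftOf ⟩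
  ∑-pairs (deg b) (λ i k → ∑-pairs i λ a _ →
    f (prefix a (prefix i X)) (suffix a (prefix i X)) (suffix i X))
    ≡⟨ ∑-pairs-cong (deg b) (λ i k _ → ∑-pairs-cong i λ { a c refl →
         cong₂ (λ u v → f u v (suffix i X)) (prefix-prefix a c X) (suffix-prefix a c X) }) ⟩
  ∑-pairs (deg b) (λ i k → ∑-pairs i λ a c → f (prefix a X) (middle a c X) (suffix i X))
    -- With `i = a + c` substituted, the summand depends on the triple alone.
    ≡⟨ ∑-pairs-cong (deg b) (λ i k _ → ∑-pairs-cong i λ { a c refl → refl }) ⟩
  ∑-pairs (deg b) (λ i k → ∑-pairs i λ a c → g a c k)
    ≡⟨ ∑-triples (deg b) g ⟩
  ∑-pairs (deg b) (λ a k → ∑-pairs k λ c d → g a c d)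
    ≡⟨ ∑-pairs-cong (deg b) (λ a k _ → ∑-pairs-cong k λ c d _ →
         cong₂ (f (prefix a X)) (prefix-suffix a c X) (suffix-suffix a c X)) ⟨
  ∑-pairs (deg b) (λ a k → rightOf a k (prefix a X) (suffix a X))
    ≡⟨ ∑-cut-sizes b rightOf ⟨
  ∑ℤ (cut b) (λ (x , y) → rightOf (deg x) (deg y) (code x) (code y))
    ≡⟨ ∑ℤ-ext (cut b) (λ (x , y) → ∑-cut y (f (code x))) ⟨
  ∑ℤ (cut b) (λ (x , y) → ∑ℤ (cut y) λ (u , v) → f (code x) (code u) (code v)) ∎
  where
  open ≡-Reasoning
  X : List Bits
  X = code b
  g : ℕ → ℕ → ℕ → ℤ
  g a c _ = f (prefix a X) (middle a c X) (suffix (a ℕ.+ c) X)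
  leftOf rightOf : ℕ → ℕ → List Bits → List Bits → ℤ
  leftOf p q U V = ∑-pairs p λ a _ → f (prefix a U) (suffix a U) V
  rightOf p q U V = ∑-pairs q λ a _ → f U (prefix a V) (suffix a V)

-- Since card C + card D = card A, the conditions on C and D already force card A = p + q.
∑-paths-nested : ∀ n p q r (g : Bits → Bits → Bits → ℤ) → n ≡ (p ℕ.+ q) ℕ.+ r →
  ∑-paths (p ℕ.+ q) r (λ A → ∑-paths p q λ A′ → g (unsub A A′) (unsub A (compl A′)) (compl A)) ≡
  ∑ℤ (allBits n) (λ A → ∑ℤ (allBits (card A)) λ A′ →
    let C = unsub A A′ ; D = unsub A (compl A′) ; E = compl A in
    𝟙[ card C ℕₚ.≟ p ] ℤ.* (𝟙[ card D ℕₚ.≟ q ] ℤ.* (𝟙[ card E ℕₚ.≟ r ] ℤ.* g C D E)))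
∑-paths-nested n p q r g e = trans
  (sym (∑-paths-weight n (p ℕ.+ q) r (λ A → ∑-paths p q (h A)) e))
  (∑ℤ-ext (allBits n) λ A → term A (card A ℕₚ.≟ p ℕ.+ q))
  where
  h : Bits → Bits → ℤ
  h A A′ = g (unsub A A′) (unsub A (compl A′)) (compl A)
  term : ∀ A → Dec (card A ≡ p ℕ.+ q) → weight (p ℕ.+ q) r A ℤ.* ∑-paths p q (h A) ≡
    ∑ℤ (allBits (card A)) λ A′ → let C = unsub A A′ ; D = unsub A (compl A′) ; E = compl A in
      𝟙[ card C ℕₚ.≟ p ] ℤ.* (𝟙[ card D ℕₚ.≟ q ] ℤ.* (𝟙[ card E ℕₚ.≟ r ] ℤ.* g C D E))
  term A (no ≢) rewrite 𝟙-no (card A ℕₚ.≟ p ℕ.+ q) ≢ = sym (∑ℤ-zero (allBits (card A)) vanish)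
    where
    vanish : ∀ A′ → A′ ∈ˡ allBits (card A) → let C = unsub A A′ ; D = unsub A (compl A′) ; E = compl A in
      𝟙[ card C ℕₚ.≟ p ] ℤ.* (𝟙[ card D ℕₚ.≟ q ] ℤ.* (𝟙[ card E ℕₚ.≟ r ] ℤ.* g C D E)) ≡ 0ℤ
    vanish A′ A′∈ with card (unsub A A′) ℕₚ.≟ p | card (unsub A (compl A′)) ℕₚ.≟ q
    ... | no ≢p | _ rewrite 𝟙-no (card (unsub A A′) ℕₚ.≟ p) ≢p = refl
    ... | yes _ | no ≢q rewrite 𝟙-no (card (unsub A (compl A′)) ℕₚ.≟ q) ≢q = ℤₚ.*-zeroʳ 𝟙[ card
        (unsub A A′) ℕₚ.≟ p ]
    ... | yes refl | yes refl = contradiction (sym (trans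
      (cong₂ ℕ._+_ (card-unsub A A′ len) (card-unsub A (compl A′) (trans (Listₚ.length-map not A′) len)))
      (trans (card-compl A′) len))) ≢
      where
      len : length A′ ≡ card A
      len = length-allBits (card A) A′ A′∈
  term A (yes eq) rewrite 𝟙-yes (card A ℕₚ.≟ p ℕ.+ q) eq = begin
    (1ℤ ℤ.* 𝟙r) ℤ.* ∑-paths p q (h A)
      ≡⟨ cong₂ ℤ._*_ (ℤₚ.*-identityˡ 𝟙r) (sym (∑-paths-weight (card A) p q (h A) eq)) ⟩
    𝟙r ℤ.* ∑ℤ (allBits (card A)) (λ A′ → weight p q A′ ℤ.* h A A′)
      ≡⟨ ∑ℤ-*ˡ 𝟙r (allBits (card A)) _ ⟩
    ∑ℤ (allBits (card A)) (λ A′ → 𝟙r ℤ.* (weight p q A′ ℤ.* h A A′))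
      ≡⟨ ∑ℤ-cong (allBits (card A)) (λ A′ A′∈ → rearrange A′ (length-allBits (card A) A′ A′∈)) ⟩
    ∑ℤ (allBits (card A)) (λ A′ → let C = unsub A A′ ; D = unsub A (compl A′) ; E = compl A in
      𝟙[ card C ℕₚ.≟ p ] ℤ.* (𝟙[ card D ℕₚ.≟ q ] ℤ.* (𝟙[ card E ℕₚ.≟ r ] ℤ.* g C D E))) ∎
    where
    open ≡-Reasoning
    𝟙r : ℤ
    𝟙r = 𝟙[ card (compl A) ℕₚ.≟ r ]
    rearrange : ∀ A′ → length A′ ≡ card A → 𝟙r ℤ.* (weight p q A′ ℤ.* h A A′) ≡
      𝟙[ card (unsub A A′) ℕₚ.≟ p ] ℤ.* (𝟙[ card (unsub A (compl A′)) ℕₚ.≟ q ] ℤ.* (𝟙r ℤ.* h A A′))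
    rearrange A′ len rewrite card-unsub A A′ len | card-unsub A (compl A′)
        (trans (Listₚ.length-map not A′) len) =
      trans (sym (ℤₚ.*-assoc 𝟙r (weight p q A′) _)) (trans (cong (ℤ._* h A A′) (ℤₚ.*-comm 𝟙r
          (weight p q A′)))
        (trans (ℤₚ.*-assoc (weight p q A′) 𝟙r _) (ℤₚ.*-assoc 𝟙[ card A′ ℕₚ.≟ p ] _ _)))

∑-paths-compl : ∀ p q (f : Bits → ℤ) → ∑-paths p q f ≡ ∑-paths q p (f ∘ compl)
∑-paths-compl zero    zero    f = refl
∑-paths-compl zero    (suc q) f = ∑-paths-compl zero q _
∑-paths-compl (suc p) zero    f = ∑-paths-compl p zero _
∑-paths-compl (suc p) (suc q) f = trans (ℤₚ.+-comm (∑-paths p (suc q) (f ∘ (true ∷_))) _)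
  (cong₂ ℤ._+_ (∑-paths-compl (suc p) q _) (∑-paths-compl p (suc q) _))

∑-paths-swap : ∀ p q p′ q′ (f : Bits → Bits → ℤ) →
  ∑-paths p q (λ A → ∑-paths p′ q′ (f A)) ≡ ∑-paths p′ q′ (λ B → ∑-paths p q λ A → f A B)
∑-paths-swap zero    zero    p′ q′ f = refl
∑-paths-swap zero    (suc q) p′ q′ f = ∑-paths-swap zero q p′ q′ _
∑-paths-swap (suc p) zero    p′ q′ f = ∑-paths-swap p zero p′ q′ _
∑-paths-swap (suc p) (suc q) p′ q′ f = trans
  (cong₂ ℤ._+_ (∑-paths-swap p (suc q) p′ q′ _) (∑-paths-swap (suc p) q p′ q′ _))
  (sym (∑-paths-+ p′ q′ _ _))

-- With the sizes expressed by indicators, the sums run over all ordered three-part partitions and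
-- `∑-threeParts` applies. Complementing the outer set turns the right nesting into a left nesting
-- with sizes `q`, `r`, `p`, so that `∑-paths-nested` serves for both sides.
∑-paths-assoc : ∀ p q r (g : Bits → Bits → Bits → ℤ) →
  ∑-paths (p ℕ.+ q) r (λ A → ∑-paths p q λ A′ → g (unsub A A′) (unsub A (compl A′)) (compl A)) ≡
  ∑-paths p (q ℕ.+ r) (λ A → ∑-paths q r λ B → g A (unsub (compl A) B) (unsub (compl A) (compl B)))
∑-paths-assoc p q r g = begin
  ∑-paths (p ℕ.+ q) r (λ A → ∑-paths p q λ A′ → g (unsub A A′) (unsub A (compl A′)) (compl A))
    ≡⟨ ∑-paths-nested n p q r g refl ⟩
  ∑ℤ (allBits n) (λ A → ∑ℤ (allBits (card A)) λ A′ → g₁ (unsub A A′) (unsub A (compl A′)) (compl A))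
    ≡⟨ ∑-threeParts n g₁ ⟩
  ∑ℤ (allBits n) (λ A → ∑ℤ (allBits (card (compl A))) λ B →
    g₁ A (unsub (compl A) B) (unsub (compl A) (compl B)))
    ≡⟨ ∑-compl n (λ A A° → ∑ℤ (allBits (card A°)) λ B → g₁ A (unsub A° B) (unsub A° (compl B))) ⟩
  ∑ℤ (allBits n) (λ A → ∑ℤ (allBits (card A)) λ B → g₁ (compl A) (unsub A B) (unsub A (compl B)))
    ≡⟨ ∑ℤ-ext (allBits n) (λ A → ∑ℤ-ext (allBits (card A)) λ B → rotate
         𝟙[ card (compl A) ℕₚ.≟ p ] 𝟙[ card (unsub A B) ℕₚ.≟ q ] 𝟙[ card (unsub A (compl B)) ℕₚ.≟
             r ] _) ⟩
  ∑ℤ (allBits n) (λ A → ∑ℤ (allBits (card A)) λ B → g₂ (unsub A B) (unsub A (compl B)) (compl A))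
    ≡⟨ ∑-paths-nested n q r p (λ D E C → g C D E)
         (trans (ℕₚ.+-assoc p q r) (ℕₚ.+-comm p (q ℕ.+ r))) ⟨
  ∑-paths (q ℕ.+ r) p (λ A → ∑-paths q r λ B → g (compl A) (unsub A B) (unsub A (compl B)))
    ≡⟨ ∑-paths-cong (q ℕ.+ r) p (λ A _ _ →
         cong (λ C → ∑-paths q r λ B → g (compl A) (unsub C B) (unsub C (compl B)))
             (compl-compl A)) ⟨
  ∑-paths (q ℕ.+ r) p (λ A → ∑-paths q r λ B →
    g (compl A) (unsub (compl (compl A)) B) (unsub (compl (compl A)) (compl B)))
    ≡⟨ ∑-paths-compl p (q ℕ.+ r) (λ A → ∑-paths q r λ B →
         g A (unsub (compl A) B) (unsub (compl A) (compl B))) ⟨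
  ∑-paths p (q ℕ.+ r) (λ A → ∑-paths q r λ B → g A (unsub (compl A) B) (unsub (compl A)
      (compl B))) ∎
  where
  open ≡-Reasoning
  n : ℕ
  n = (p ℕ.+ q) ℕ.+ r
  g₁ g₂ : Bits → Bits → Bits → ℤ
  g₁ C D E = 𝟙[ card C ℕₚ.≟ p ] ℤ.* (𝟙[ card D ℕₚ.≟ q ] ℤ.* (𝟙[ card E ℕₚ.≟ r ] ℤ.* g C D E))
  g₂ D E C = 𝟙[ card D ℕₚ.≟ q ] ℤ.* (𝟙[ card E ℕₚ.≟ r ] ℤ.* (𝟙[ card C ℕₚ.≟ p ] ℤ.* g C D E))
  rotate : ∀ x y z w → x ℤ.* (y ℤ.* (z ℤ.* w)) ≡ y ℤ.* (z ℤ.* (x ℤ.* w))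
  rotate x y z w = trans (Mod.*ₗ-exchange ℤᴹ x y (z ℤ.* w)) (cong (y ℤ.*_) (Mod.*ₗ-exchange ℤᴹ x z w))

merge-assoc : ∀ A A′ Xs Ys Zs → merge A (merge A′ Xs Ys) Zs ≡
  map (unsub (unsub A A′)) Xs ++ map (unsub (unsub A (compl A′))) Ys ++ map (unsub (compl A)) Zs
merge-assoc A A′ Xs Ys Zs = trans
  (cong (_++ map (unsub (compl A)) Zs) (trans (Listₚ.map-++ (unsub A) (map (unsub A′) Xs) _)
    (cong₂ _++_ (fuse A′ Xs) (fuse (compl A′) Ys))))
  (Listₚ.++-assoc (map (unsub (unsub A A′)) Xs) _ _)
  where
  fuse : ∀ B Us → map (unsub A) (map (unsub B) Us) ≡ map (unsub (unsub A B)) Us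
  fuse B Us = trans (sym (Listₚ.map-∘ Us)) (Listₚ.map-cong (unsub-unsub A B) Us)

merge-assocʳ : ∀ A B Xs Ys Zs → merge A Xs (merge B Ys Zs) ≡
  map (unsub A) Xs ++ map (unsub (unsub (compl A) B)) Ys ++ map
      (unsub (unsub (compl A) (compl B))) Zs
merge-assocʳ A B Xs Ys Zs = cong (map (unsub A) Xs ++_)
  (trans (Listₚ.map-++ (unsub (compl A)) (map (unsub B) Ys) _) (cong₂ _++_ (fuse B Ys)
      (fuse (compl B) Zs)))
  where
  fuse : ∀ B Us → map (unsub (compl A)) (map (unsub B) Us) ≡ map (unsub (unsub (compl A) B)) Us
  fuse B Us = trans (sym (Listₚ.map-∘ Us)) (Listₚ.map-cong (unsub-unsub (compl A) B) Us)

shuffle-assoc : ∀ a b c (f : List Bits → ℤ) →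
  ∑ℤ (shuffle a b) (λ x → ∑ℤ (shuffle x c) (f ∘ code)) ≡
  ∑ℤ (shuffle b c) (λ x → ∑ℤ (shuffle a x) (f ∘ code))
shuffle-assoc a b c f = begin
  ∑ℤ (shuffle a b) (λ x → ∑ℤ (shuffle x c) (f ∘ code))
    ≡⟨ ∑ℤ-cong (shuffle a b) (λ x x∈ → trans (∑-shuffle x c f)
         (cong (λ n → ∑-paths n r λ A → f (merge A (code x) Z)) (shuffle-deg a b x x∈))) ⟩
  ∑ℤ (shuffle a b) (λ x → ∑-paths (p ℕ.+ q) r λ A → f (merge A (code x) Z))
    ≡⟨ ∑-shuffle a b (λ U → ∑-paths (p ℕ.+ q) r λ A → f (merge A U Z)) ⟩
  ∑-paths p q (λ A′ → ∑-paths (p ℕ.+ q) r λ A → f (merge A (merge A′ X Y) Z))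
    ≡⟨ ∑-paths-swap p q (p ℕ.+ q) r _ ⟩
  ∑-paths (p ℕ.+ q) r (λ A → ∑-paths p q λ A′ → f (merge A (merge A′ X Y) Z))
    ≡⟨ ∑-paths-cong (p ℕ.+ q) r (λ A _ _ → ∑-paths-cong p q λ A′ _ _ → cong f (merge-assoc A A′ X Y Z)) ⟩
  ∑-paths (p ℕ.+ q) r (λ A → ∑-paths p q λ A′ → g (unsub A A′) (unsub A (compl A′)) (compl A))
    ≡⟨ ∑-paths-assoc p q r g ⟩
  ∑-paths p (q ℕ.+ r) (λ A → ∑-paths q r λ B → g A (unsub (compl A) B) (unsub (compl A) (compl B)))
    ≡⟨ ∑-paths-cong p (q ℕ.+ r) (λ A _ _ → ∑-paths-cong q r λ B _ _ → cong f (merge-assocʳ A B X Y Z)) ⟨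
  ∑-paths p (q ℕ.+ r) (λ A → ∑-paths q r λ B → f (merge A X (merge B Y Z)))
    ≡⟨ ∑-paths-swap q r p (q ℕ.+ r) (λ B A → f (merge A X (merge B Y Z))) ⟨
  ∑-paths q r (λ B → ∑-paths p (q ℕ.+ r) λ A → f (merge A X (merge B Y Z)))
    ≡⟨ ∑-shuffle b c (λ U → ∑-paths p (q ℕ.+ r) λ A → f (merge A X U)) ⟨
  ∑ℤ (shuffle b c) (λ x → ∑-paths p (q ℕ.+ r) λ A → f (merge A X (code x)))
    ≡⟨ ∑ℤ-cong (shuffle b c) (λ x x∈ → trans (∑-shuffle a x f)
         (cong (λ n → ∑-paths p n λ A → f (merge A X (code x))) (shuffle-deg b c x x∈))) ⟨
  ∑ℤ (shuffle b c) (λ x → ∑ℤ (shuffle a x) (f ∘ code)) ∎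
  where
  open ≡-Reasoning
  p q r : ℕ
  p = deg a
  q = deg b
  r = deg c
  X Y Z : List Bits
  X = code a
  Y = code b
  Z = code c
  g : Bits → Bits → Bits → ℤ
  g C D E = f (map (unsub C) X ++ map (unsub D) Y ++ map (unsub E) Z)

shuffle-𝟏ˡ : ∀ b (f : List Bits → ℤ) → ∑ℤ (shuffle 𝟏 b) (f ∘ code) ≡ f (code b)
shuffle-𝟏ˡ b f = trans (∑-shuffle 𝟏 b f) (trans (∑-paths-0ˡ (deg b) _)
  (cong f (trans (cong (λ C → map (unsub C) (code b)) (compl-falses (deg b)))
    (map-id-local (All.map (λ { {X} refl → unsub-trues X }) (code-length b))))))

shuffle-𝟏ʳ : ∀ b (f : List Bits → ℤ) → ∑ℤ (shuffle b 𝟏) (f ∘ code) ≡ f (code b)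
shuffle-𝟏ʳ b f = trans (∑-shuffle b 𝟏 f) (trans (∑-paths-0ʳ (deg b) _)
  (cong f (trans (Listₚ.++-identityʳ _)
    (map-id-local (All.map (λ { {X} refl → unsub-trues X }) (code-length b))))))

-- Cutting a shuffle amounts to cutting its path: the pieces are shuffles, along the two halves of
-- the path, of the pieces of the factors. By `∑-cut-paths` the two halves can be summed
-- independently.
cut-shuffle : ∀ a b (f : List Bits → List Bits → ℤ) →
  ∑ℤ (shuffle a b) (λ x → ∑ℤ (cut x) λ (u , v) → f (code u) (code v)) ≡
  ∑ℤ (cut a) λ (a₁ , a₂) → ∑ℤ (cut b) λ (b₁ , b₂) →
    ∑ℤ (shuffle a₁ b₁) λ u → ∑ℤ (shuffle a₂ b₂) λ v → f (code u) (code v)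
cut-shuffle a b f = begin
  ∑ℤ (shuffle a b) (λ x → ∑ℤ (cut x) λ (u , v) → f (code u) (code v))
    ≡⟨ ∑ℤ-cong (shuffle a b) (λ x x∈ → trans (∑-cut x f)
         (cong (λ n → ∑-pairs n λ i _ → f (prefix i (code x)) (suffix i (code x)))
             (shuffle-deg a b x x∈))) ⟩
  ∑ℤ (shuffle a b) (λ x → ∑-pairs (p ℕ.+ q) λ i _ → f (prefix i (code x)) (suffix i (code x)))
    ≡⟨ ∑-shuffle a b (λ U → ∑-pairs (p ℕ.+ q) λ i _ → f (prefix i U) (suffix i U)) ⟩
  ∑-paths p q (λ A → ∑-pairs (p ℕ.+ q) λ i _ → f (prefix i (merge A X Y)) (suffix i (merge A X Y)))
    ≡⟨ ∑-paths-cong p q (λ A A≡p A°≡q → trans (∑-pairs-cong (p ℕ.+ q) λ i _ _ →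
           cong₂ f (prefix-merge i A X Y (resize A≡p (code-length a)) (resize A°≡q (code-length b)))
                   (suffix-merge i A X Y (resize A≡p (code-length a)) (resize A°≡q
                       (code-length b))))
         (trans (cong (λ n → ∑-pairs n λ i _ → g (take i A) (drop i A))
             (trans (sym (cong₂ ℕ._+_ A≡p A°≡q)) (card-compl A)))
           (∑-splits-pairs A g))) ⟩
  ∑-paths p q (λ A → ∑-splits A g)
    ≡⟨ ∑-cut-paths p q g ⟩
  ∑-pairs p (λ p₁ p₂ → ∑-pairs q λ q₁ q₂ → ∑-paths p₁ q₁ λ A₁ → ∑-paths p₂ q₂ (g A₁))
    -- For a first half with `p₁` true and `q₁` false steps, the cut points that `g` reads off it
    -- are `p₁` and `q₁`.
    ≡⟨ ∑-pairs-cong p (λ p₁ p₂ _ → ∑-pairs-cong q λ q₁ q₂ _ → ∑-paths-cong p₁ q₁ λ { A₁ refl refl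
        → refl }) ⟩
  ∑-pairs p (λ p₁ p₂ → ∑-pairs q λ q₁ q₂ →
    k p₁ p₂ (prefix p₁ X) (suffix p₁ X) q₁ q₂ (prefix q₁ Y) (suffix q₁ Y))
    ≡⟨ ∑-pairs-cong p (λ p₁ p₂ _ → ∑-cut-sizes b (k p₁ p₂ (prefix p₁ X) (suffix p₁ X))) ⟨
  ∑-pairs p (λ p₁ p₂ → k′ p₁ p₂ (prefix p₁ X) (suffix p₁ X))
    ≡⟨ ∑-cut-sizes a k′ ⟨
  ∑ℤ (cut a) (λ (a₁ , a₂) → k′ (deg a₁) (deg a₂) (code a₁) (code a₂))
    ≡⟨ ∑ℤ-ext (cut a) (λ (a₁ , a₂) → ∑ℤ-ext (cut b) λ (b₁ , b₂) → trans
         (∑ℤ-ext (shuffle a₁ b₁) λ u → ∑-shuffle a₂ b₂ (f (code u)))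
         (∑-shuffle a₁ b₁ λ U → ∑-paths (deg a₂) (deg b₂) λ A₂ → f U (merge A₂ (code a₂)
             (code b₂)))) ⟨
  ∑ℤ (cut a) (λ (a₁ , a₂) → ∑ℤ (cut b) λ (b₁ , b₂) →
    ∑ℤ (shuffle a₁ b₁) λ u → ∑ℤ (shuffle a₂ b₂) λ v → f (code u) (code v)) ∎
  where
  open ≡-Reasoning
  p q : ℕ
  p = deg a
  q = deg b
  X Y : List Bits
  X = code a
  Y = code b
  resize : ∀ {m n Us} → m ≡ n → AllLength n Us → AllLength m Us
  resize refl l = l
  g : Bits → Bits → ℤ
  g B C = f (merge B (prefix (card B) X) (prefix (card (compl B)) Y))
            (merge C (suffix (card B) X) (suffix (card (compl B)) Y))
  k : ℕ → ℕ → List Bits → List Bits → ℕ → ℕ → List Bits → List Bits → ℤ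
  k p₁ p₂ X₁ X₂ q₁ q₂ Y₁ Y₂ = ∑-paths p₁ q₁ λ A₁ → ∑-paths p₂ q₂ λ A₂ →
    f (merge A₁ X₁ Y₁) (merge A₂ X₂ Y₂)
  k′ : ℕ → ℕ → List Bits → List Bits → ℤ
  k′ p₁ p₂ X₁ X₂ = ∑ℤ (cut b) λ (b₁ , b₂) →
    k p₁ p₂ X₁ X₂ (deg b₁) (deg b₂) (code b₁) (code b₂)

shuffleBialgebra : Combinatorial
shuffleBialgebra = record
  { mul       = shuffle
  ; comul     = cut
  ; mul-deg   = shuffle-deg
  ; comul-deg = cut-deg
  ; unitˡ     = shuffle-𝟏ˡ
  ; unitʳ     = shuffle-𝟏ʳ
  ; assoc     = shuffle-assoc
  ; counitˡ   = λ b f → trans (∑ℤ-ext (cut b) λ (x , y) →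
        cong (ℤ._* f (code y)) (projection₀-isZero x))
      (trans (∑-cut-sizes b λ p q X Y → isZero p ℤ.* f Y)
      (trans (∑-pairs-isZeroˡ (deg b) (λ i _ → f (suffix i (code b)))) (cong f (suffix-none b))))
  ; counitʳ   = λ b f → trans (∑ℤ-ext (cut b) λ (x , y) →
        cong (ℤ._* f (code x)) (projection₀-isZero y))
      (trans (∑-cut-sizes b λ p q X Y → isZero q ℤ.* f X)
      (trans (∑-pairs-isZeroʳ (deg b) (λ i _ → f (prefix i (code b)))) (cong f (prefix-all b))))
  ; coassoc   = cut-coassoc
  ; comul-𝟏   = λ f → ∑ℤ-single (λ (x , y) → f (code x) (code y)) (𝟏 , 𝟏)
  ; compat    = cut-shuffle
  }

-- Packed words

module _ {A : Set} {_≺_ : A → A → Set} where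

  AllPairs-trichotomy : ∀ {xs x y} → AllPairs _≺_ xs → x ∈ˡ xs → y ∈ˡ xs → x ≡ y ⊎ x ≺ y ⊎ y ≺ x
  AllPairs-trichotomy _        (here refl) (here refl) = inj₁ refl
  AllPairs-trichotomy (h ∷ _)  (here refl) (there y∈)  = inj₂ (inj₁ (All.lookup h y∈))
  AllPairs-trichotomy (h ∷ _)  (there x∈)  (here refl) = inj₂ (inj₂ (All.lookup h x∈))
  AllPairs-trichotomy (_ ∷ hs) (there x∈)  (there y∈)  = AllPairs-trichotomy hs x∈ y∈

  -- Asymmetry is asked for on `P` only: the relation `Increasing`, to which this is applied, holds
  -- vacuously as soon as one of the sets is empty.
  sorted-unique : ∀ {P : A → Set} → (∀ {x y} → P x → P y → x ≺ y → y ≺ x → Absurd) →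
    ∀ {xs ys} → All P xs → AllPairs _≺_ xs → AllPairs _≺_ ys →
    (∀ {z} → z ∈ˡ xs → z ∈ˡ ys) → (∀ {z} → z ∈ˡ ys → z ∈ˡ xs) → xs ≡ ys
  sorted-unique asym {[]}     {[]}     _ _ _ _ _ = refl
  sorted-unique asym {[]}     {y ∷ ys} _ _ _ _ ⊇ = case ⊇ (here refl) of λ ()
  sorted-unique asym {x ∷ xs} {[]}     _ _ _ ⊆ _ = case ⊆ (here refl) of λ ()
  sorted-unique {P} asym {x ∷ xs} {y ∷ ys} (px ∷ pxs) (x≺ ∷ sx) (y≺ ∷ sy) ⊆ ⊇ =
    cong₂ _∷_ x≡y (sorted-unique asym pxs sx sy ⊆′ ⊇′)
    where
    heads : x ∈ˡ (y ∷ ys) → y ∈ˡ (x ∷ xs) → x ≡ y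
    heads (here e)  _         = e
    heads (there _) (here e)  = sym e
    heads (there p) (there q) =
      ⊥-elim (asym px (All.lookup pxs q) (All.lookup x≺ q) (All.lookup y≺ p))
    x≡y : x ≡ y
    x≡y = heads (⊆ (here refl)) (⊇ (here refl))
    ⊆′ : ∀ {z} → z ∈ˡ xs → z ∈ˡ ys
    ⊆′ z∈ with ⊆ (there z∈)
    ... | there z∈ys = z∈ys
    ... | here refl  with x≡y
    ... | refl = ⊥-elim (asym px px (All.lookup x≺ z∈) (All.lookup x≺ z∈))
    ⊇′ : ∀ {z} → z ∈ˡ ys → z ∈ˡ xs
    ⊇′ z∈ with ⊇ (there z∈)
    ... | there z∈xs = z∈xs
    ... | here refl  with x≡y
    ... | refl = ⊥-elim (asym px px (All.lookup y≺ z∈) (All.lookup y≺ z∈))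

levelSet : ∀ {n} → (Fin n → ℕ) → ℕ → Subset n
levelSet i v = Vec.tabulate (λ j → does (i j ℕₚ.≟ v))

-- The bound `K` is a parameter so that a word and its prefixes and suffixes can be treated with a
-- common one.
levelBlocks : ∀ {n} → (Fin n → ℕ) → ℕ → List (Subset n)
levelBlocks i K = filter nonempty? (map (levelSet i) (upTo K))

module _ {n} (i : Fin n → ℕ) where

  ∈-levelSet⁺ : ∀ {v} j → i j ≡ v → j ∈ levelSet i v
  ∈-levelSet⁺ {v} j e = Vecₚ.lookup⇒[]= j _ (trans (Vecₚ.lookup∘tabulate _ j)
      (does-yes (i j ℕₚ.≟ v)))
    where
    does-yes : (d : Dec (i j ≡ v)) → does d ≡ true
    does-yes (yes _) = refl
    does-yes (no ≢)  = contradiction e ≢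

  ∈-levelSet⁻ : ∀ {v} j → j ∈ levelSet i v → i j ≡ v
  ∈-levelSet⁻ {v} j j∈ = does-yes (i j ℕₚ.≟ v) (trans (sym (Vecₚ.lookup∘tabulate _ j))
      (Vecₚ.[]=⇒lookup j∈))
    where
    does-yes : (d : Dec (i j ≡ v)) → does d ≡ true → i j ≡ v
    does-yes (yes e) _ = e

  module _ {K} (bound : ∀ j → i j < K) where

    ∈-levelBlocks⁺ : ∀ j → levelSet i (i j) ∈ˡ levelBlocks i K
    ∈-levelBlocks⁺ j = ∈-filter⁺ nonempty? (∈-map⁺ (levelSet i) (∈-upTo⁺ (bound j)))
                                 (j , ∈-levelSet⁺ j refl)

  ∈-levelBlocks⁻ : ∀ {K X} → X ∈ˡ levelBlocks i K → ∃[ v ] X ≡ levelSet i v × Nonempty X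
  ∈-levelBlocks⁻ {K} X∈ with ∈-filter⁻ nonempty? {xs = map (levelSet i) (upTo K)} X∈
  ... | X∈map , ne with ∈-map⁻ (levelSet i) X∈map
  ... | v , _ , e = v , e , ne

  levelBlocks-pairs : ∀ {R : Subset n → Subset n → Set} K →
    (∀ {u v} → u < v → R (levelSet i u) (levelSet i v)) → AllPairs R (levelBlocks i K)
  levelBlocks-pairs K h = AllPairsₚ.filter⁺ nonempty?
    (AllPairsₚ.map⁺ (AllPairsₚ.applyUpTo⁺₁ id K λ u<v _ → h u<v))

  levelSet-disjoint : ∀ {u v} → u < v → Disjoint (levelSet i u) (levelSet i v)
  levelSet-disjoint {u} {v} u<v = Empty-unique λ (j , j∈) →
    let p , q = x∈p∩q⁻ (levelSet i u) (levelSet i v) j∈ in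
    ℕₚ.<-irrefl (trans (sym (∈-levelSet⁻ j p)) (∈-levelSet⁻ j q)) u<v

packed : ∀ {n} (i : Fin n → ℕ) K → (∀ j → i j < K) → Comp n
packed i K bound = composition (levelBlocks i K)
  (Allₚ.all-filter nonempty? (map (levelSet i) (upTo K)))
  (levelBlocks-pairs i K (levelSet-disjoint i))
  (⊆-antisym (λ _ → ∈⊤) λ {j} _ →
    All.lookup (⋃-upper (levelBlocks i K)) (∈-levelBlocks⁺ i bound j) j (∈-levelSet⁺ i j refl))

∈-⋃⁻ : ∀ {n j} (Xs : List (Subset n)) → j ∈ ⋃ Xs → ∃[ X ] X ∈ˡ Xs × j ∈ X
∈-⋃⁻ []       j∈ = ⊥-elim (∉⊥ j∈)
∈-⋃⁻ (X ∷ Xs) j∈ with x∈p∪q⁻ X (⋃ Xs) j∈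
... | inj₁ j∈X  = X , here refl , j∈X
... | inj₂ j∈Xs with ∈-⋃⁻ Xs j∈Xs
... | Y , Y∈ , j∈Y = Y , there Y∈ , j∈Y

module _ {n} (P : Comp n) where

  blocks-nonempty : All Nonempty (blocks P)
  blocks-nonempty = go P
    where
    go : (P : Comp n) → All Nonempty (blocks P)
    go (composition Xs ne _ _) = recompute (All.all? nonempty? Xs) ne

  _≟ˢ_ : (X Y : Subset n) → Dec (X ≡ Y)
  _≟ˢ_ = Vecₚ.≡-dec Boolₚ._≟_

  blocks-disjoint : AllPairs Disjoint (blocks P)
  blocks-disjoint = go P
    where
    go : (P : Comp n) → AllPairs Disjoint (blocks P)
    go (composition Xs _ dj _) = recompute (AllPairs.allPairs? (λ X Y → (X ∩ Y) ≟ˢ ⊥) Xs) dj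

  blocks-cover : ∀ j → ∃[ X ] X ∈ˡ blocks P × j ∈ X
  blocks-cover j = ∈-⋃⁻ (blocks P) (subst (j ∈_) (sym (go P)) ∈⊤)
    where
    go : (P : Comp n) → ⋃ (blocks P) ≡ ⊤
    go (composition Xs _ _ cv) = recompute (⋃ Xs ≟ˢ ⊤) cv

  module _ {i : Fin n → ℕ} where

    -- Both lists are sorted by `Increasing`, and they have the same members: a block is the level
    -- set of the value of `i` at any of its elements.
    admissible⇒levels : Admissible P i → ∀ K → (∀ j → i j < K) → blocks P ≡ levelBlocks i K
    admissible⇒levels (same , increasing) K bound = sorted-unique {_≺_ = Increasing P i}
        {P = Nonempty}
      (λ (j , j∈X) (j′ , j′∈Y) X≺Y Y≺X → ℕₚ.<-asym (X≺Y j j′ j∈X j′∈Y) (Y≺X j′ j j′∈Y j∈X))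
      blocks-nonempty increasing
      (levelBlocks-pairs i K λ u<v j j′ j∈ j′∈ →
        subst₂ _<_ (sym (∈-levelSet⁻ i j j∈)) (sym (∈-levelSet⁻ i j′ j′∈)) u<v)
      (λ {X} X∈ → let j , j∈X = All.lookup blocks-nonempty X∈ in
        subst (_∈ˡ levelBlocks i K) (sym (isLevel X∈ j∈X)) (∈-levelBlocks⁺ i bound j))
      λ {Y} Y∈ → case ∈-levelBlocks⁻ i {K} Y∈ of λ { (v , refl , j , j∈Y) →
        case blocks-cover j of λ (X , X∈ , j∈X) →
          subst (_∈ˡ blocks P) (trans (isLevel X∈ j∈X) (cong (levelSet i) (∈-levelSet⁻ i j j∈Y))) X∈ }
      where
      isLevel : ∀ {X j} → X ∈ˡ blocks P → j ∈ X → X ≡ levelSet i (i j)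
      isLevel {X} {j} X∈ j∈X = ⊆-antisym
        (λ {j′} j′∈X → ∈-levelSet⁺ i j′ (proj₂ (same j′ j) (lose X∈ (j′∈X , j∈X))))
        (λ {j′} j′∈ → fromSame j′ (find (proj₁ (same j′ j) (∈-levelSet⁻ i j′ j′∈))))
        where
        fromSame : ∀ j′ → ∃[ Y ] Y ∈ˡ blocks P × (j′ ∈ Y × j ∈ Y) → j′ ∈ X
        -- Two distinct blocks would be comparable, which gives `i j < i j` for their common element
        -- `j`.
        fromSame j′ (Y , Y∈ , j′∈Y , j∈Y) with AllPairs-trichotomy increasing X∈ Y∈
        ... | inj₁ refl       = j′∈Y
        ... | inj₂ (inj₁ X≺Y) = ⊥-elim (ℕₚ.<-irrefl refl (X≺Y j j j∈X j∈Y))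
        ... | inj₂ (inj₂ Y≺X) = ⊥-elim (ℕₚ.<-irrefl refl (Y≺X j j j∈Y j∈X))

    levels⇒admissible : ∀ K → (∀ j → i j < K) → blocks P ≡ levelBlocks i K → Admissible P i
    levels⇒admissible K bound e =
      (λ j j′ →
        (λ ij≡ij′ → subst (Any _) (sym e)
          (lose (∈-levelBlocks⁺ i bound j) (∈-levelSet⁺ i j refl , ∈-levelSet⁺ i j′
              (sym ij≡ij′)))) ,
        (λ sameBlock → case find (subst (Any _) e sameBlock) of λ (X , X∈ , j∈ , j′∈) →
          case ∈-levelBlocks⁻ i {K} X∈ of λ { (v , refl , _) →
            trans (∈-levelSet⁻ i j j∈) (sym (∈-levelSet⁻ i j′ j′∈)) })) ,
      subst (AllPairs _) (sym e) (levelBlocks-pairs i K λ u<v j j′ j∈ j′∈ →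
        subst₂ _<_ (sym (∈-levelSet⁻ i j j∈)) (sym (∈-levelSet⁻ i j′ j′∈)) u<v)

letterBound : List ℕ → ℕ
letterBound w = suc (foldr ℕ._⊔_ 0 w)

lookup-bound : ∀ w j → lookup w j < letterBound w
lookup-bound (v ∷ w) Fin.zero    = s≤s (ℕₚ.m≤m⊔n v _)
lookup-bound (v ∷ w) (Fin.suc j) = ℕₚ.≤-trans (lookup-bound w j) (s≤s (ℕₚ.m≤n⊔m v _))

pack : List ℕ → Basis
pack w = length w , packed (lookup w) (letterBound w) (lookup-bound w)

level : List ℕ → ℕ → Bits
level w v = map (λ c → does (c ℕₚ.≟ v)) w

toList-levelSet : ∀ w v → Vec.toList (levelSet (lookup w) v) ≡ level w v
toList-levelSet []      v = refl
toList-levelSet (c ∷ w) v = cong (does (c ℕₚ.≟ v) ∷_) (toList-levelSet w v)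

levels : ℕ → List ℕ → List Bits
levels K w = dropEmpty (map (level w) (upTo K))

toList-levelBlocks : ∀ w K → map Vec.toList (levelBlocks (lookup w) K) ≡ levels K w
toList-levelBlocks w K = trans (toList-filter (map (levelSet (lookup w)) (upTo K)))
  (cong dropEmpty (trans (sym (Listₚ.map-∘ (upTo K))) (Listₚ.map-cong (toList-levelSet w)
      (upTo K))))

-- The word is admissible for its own packing, and admissibility does not mention a bound; hence
-- every bound on the letters yields the same blocks.
code-pack : ∀ w K → (∀ j → lookup w j < K) → code (pack w) ≡ levels K w
code-pack w K bound = trans (cong (map Vec.toList) (admissible⇒levels (proj₂ (pack w))
    (levels⇒admissible (proj₂ (pack w)) (letterBound w) (lookup-bound w) refl) K bound))
  (toList-levelBlocks w K)

lookup-take : ∀ i (w : List ℕ) {K} → (∀ j → lookup w j < K) → ∀ j → lookup (take i w) j < K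
lookup-take (suc i) (v ∷ w) h Fin.zero    = h Fin.zero
lookup-take (suc i) (v ∷ w) h (Fin.suc j) = lookup-take i w (h ∘ Fin.suc) j

lookup-drop : ∀ i (w : List ℕ) {K} → (∀ j → lookup w j < K) → ∀ j → lookup (drop i w) j < K
lookup-drop zero    w       h = h
lookup-drop (suc i) (v ∷ w) h = lookup-drop i w (h ∘ Fin.suc)

-- The bound of the whole word also serves for the prefix. Letters missing from the prefix have
-- empty level sets there, which `dropEmpty` removes on both sides.
code-pack-take : ∀ i w → code (pack (take i w)) ≡ prefix i (code (pack w))
code-pack-take i w = trans (code-pack (take i w) K (lookup-take i w (lookup-bound w))) (sym (trans
  (cong (prefix i) (code-pack w K (lookup-bound w)))
  (trans (dropEmpty-map-dropEmpty (take i) (or-take i) (map (level w) (upTo K)))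
    (cong dropEmpty (trans (sym (Listₚ.map-∘ (upTo K)))
      (Listₚ.map-cong (λ v → Listₚ.take-map i w) (upTo K)))))))
  where
  K : ℕ
  K = letterBound w

code-pack-drop : ∀ i w → code (pack (drop i w)) ≡ suffix i (code (pack w))
code-pack-drop i w = trans (code-pack (drop i w) K (lookup-drop i w (lookup-bound w))) (sym (trans
  (cong (suffix i) (code-pack w K (lookup-bound w)))
  (trans (dropEmpty-map-dropEmpty (drop i) (or-drop i) (map (level w) (upTo K)))
    (cong dropEmpty (trans (sym (Listₚ.map-∘ (upTo K)))
      (Listₚ.map-cong (λ v → Listₚ.drop-map i w) (upTo K)))))))
  where
  K : ℕ
  K = letterBound w

levelBlocks-ext : ∀ {n} {i i′ : Fin n → ℕ} → (∀ j → i j ≡ i′ j) → ∀ K → levelBlocks i K ≡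
    levelBlocks i′ K
levelBlocks-ext {i = i} {i′} e K = cong (filter nonempty?)
  (Listₚ.map-cong (λ v → Vecₚ.tabulate-cong λ j → cong (λ c → does (c ℕₚ.≟ v)) (e j)) (upTo K))

M-pack : ∀ b w → M (proj₂ b) w ≡ 𝟙[ b ≟ pack w ]
M-pack (n , P) w with length w ℕₚ.≟ n
... | no ≢     = sym (𝟙-no ((n , P) ≟ pack w) λ e → ≢ (sym (cong deg e)))
... | yes refl = 𝟙-⇔ (admissible? P (lookup w ∘ Fin.cast refl)) ((n , P) ≟ pack w)
  (λ adm → cong (n ,_) (comp-≡ (trans (admissible⇒levels P adm K bound) (levelBlocks-ext cast K))))
  (λ e → levels⇒admissible P K bound (trans (samePart e) (levelBlocks-ext (sym ∘ cast) K)))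
  where
  K : ℕ
  K = letterBound w
  -- `Fin.cast refl` does not reduce on a variable, so the word that `M` reads agrees with `w` only
  -- pointwise.
  cast : ∀ j → lookup w (Fin.cast refl j) ≡ lookup w j
  cast j = cong (lookup w) (Finₚ.cast-is-id refl j)
  bound : ∀ j → lookup w (Fin.cast refl j) < K
  bound j = subst (_< K) (sym (cast j)) (lookup-bound w j)
  samePart : (n , P) ≡ pack w → blocks P ≡ levelBlocks (lookup w) K
  samePart e = Listₚ.map-injective toList-inj (cong code e)

-- An element outside all blocks receives the number of blocks; in a set composition this does not
-- occur.
blockIndex : ∀ {n} → List (Subset n) → Fin n → ℕ
blockIndex []       j = 0
blockIndex (X ∷ Xs) j = if Vec.lookup X j then 0 else suc (blockIndex Xs j)

module _ {n : ℕ} where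

  blockIndex-here : ∀ {X : Subset n} {Xs j} → j ∈ X → blockIndex (X ∷ Xs) j ≡ 0
  blockIndex-here j∈X rewrite Vecₚ.[]=⇒lookup j∈X = refl

  blockIndex-there : ∀ {X : Subset n} {Xs j} → ¬ j ∈ X → blockIndex (X ∷ Xs) j ≡
      suc (blockIndex Xs j)
  blockIndex-there {X} {j = j} j∉X with Vec.lookup X j in eq
  ... | true  = contradiction (Vecₚ.lookup⇒[]= j X eq) j∉X
  ... | false = refl

  disjoint-∉ : ∀ {X Y : Subset n} {j} → Disjoint X Y → j ∈ Y → ¬ j ∈ X
  disjoint-∉ {j = j} d j∈Y j∈X = ∉⊥ (subst (j ∈_) d (x∈p∩q⁺ (j∈X , j∈Y)))

  blockIndex-lookup : ∀ {Xs : List (Subset n)} → AllPairs Disjoint Xs →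
                      ∀ k {j} → j ∈ lookup Xs k → blockIndex Xs j ≡ Fin.toℕ k
  blockIndex-lookup {X ∷ Xs} _       Fin.zero    j∈ = blockIndex-here {Xs = Xs} j∈
  blockIndex-lookup {X ∷ Xs} (d ∷ ds) (Fin.suc k) j∈ =
    trans (blockIndex-there {Xs = Xs} (disjoint-∉ (All.lookup d (∈-lookup k)) j∈))
      (cong suc (blockIndex-lookup ds k j∈))

  same⇒blockIndex : ∀ {Xs : List (Subset n)} → AllPairs Disjoint Xs → ∀ {j j′} →
                    Any (λ X → j ∈ X × j′ ∈ X) Xs → blockIndex Xs j ≡ blockIndex Xs j′
  same⇒blockIndex ds {j} {j′} p = trans
    (blockIndex-lookup ds (Any.index p) {j} (proj₁ (Anyₚ.lookup-index p)))
    (sym (blockIndex-lookup ds (Any.index p) {j′} (proj₂ (Anyₚ.lookup-index p))))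

  blockIndex⇒same : ∀ (Xs : List (Subset n)) {j j′} → j ∈ ⋃ Xs → j′ ∈ ⋃ Xs →
                    blockIndex Xs j ≡ blockIndex Xs j′ → Any (λ X → j ∈ X × j′ ∈ X) Xs
  blockIndex⇒same []       j∈ _ _ = ⊥-elim (∉⊥ j∈)
  blockIndex⇒same (X ∷ Xs) {j} {j′} j∈ j′∈ e with Vec.lookup X j in p | Vec.lookup X j′ in q
  ... | true  | true  = here (Vecₚ.lookup⇒[]= j X p , Vecₚ.lookup⇒[]= j′ X q)
  ... | false | false = there (blockIndex⇒same Xs (later p j∈) (later q j′∈) (ℕₚ.suc-injective e))
    where
    later : ∀ {j} → Vec.lookup X j ≡ false → j ∈ ⋃ (X ∷ Xs) → j ∈ ⋃ Xs
    later p j∈ with x∈p∪q⁻ X (⋃ Xs) j∈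
    ... | inj₁ j∈X = case trans (sym p) (Vecₚ.[]=⇒lookup j∈X) of λ ()
    ... | inj₂ j∈Xs = j∈Xs

  blockIndex-< : ∀ (Xs : List (Subset n)) {j} → j ∈ ⋃ Xs → blockIndex Xs j < length Xs
  blockIndex-< []       j∈ = ⊥-elim (∉⊥ j∈)
  blockIndex-< (X ∷ Xs) {j} j∈ with Vec.lookup X j in p
  ... | true  = s≤s z≤n
  ... | false with x∈p∪q⁻ X (⋃ Xs) j∈
  ... | inj₁ j∈X = case trans (sym p) (Vecₚ.[]=⇒lookup j∈X) of λ ()
  ... | inj₂ j∈Xs = s≤s (blockIndex-< Xs j∈Xs)

  Ascending : (Fin n → ℕ) → Subset n → Subset n → Set
  Ascending i X Y = ∀ j j′ → j ∈ X → j′ ∈ Y → i j < i j′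

  blockIndex-ascending : ∀ {Xs : List (Subset n)} → AllPairs Disjoint Xs →
                         AllPairs (Ascending (blockIndex Xs)) Xs
  blockIndex-ascending []                     = []
  blockIndex-ascending {X ∷ Xs} (d ∷ ds) =
    All.map (λ X∩Y j j′ j∈ j′∈ → subst₂ _<_ (sym (blockIndex-here {Xs = Xs} j∈))
      (sym (blockIndex-there {Xs = Xs} (disjoint-∉ X∩Y j′∈))) (s≤s z≤n)) d ∷
    raise d (blockIndex-ascending ds)
    where
    raise : ∀ {Ys} → All (Disjoint X) Ys → AllPairs (Ascending (blockIndex Xs)) Ys →
            AllPairs (Ascending (blockIndex (X ∷ Xs))) Ys
    raise []       []       = []
    raise (e ∷ es) (a ∷ as) = All.zipWith (λ (e′ , asc) j j′ j∈ j′∈ →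
        subst₂ _<_ (sym (blockIndex-there {Xs = Xs} (disjoint-∉ e j∈)))
          (sym (blockIndex-there {Xs = Xs} (disjoint-∉ e′ j′∈))) (s≤s (asc j j′ j∈ j′∈))) (es , a) ∷
      raise es as

∈-cover : ∀ {n} (P : Comp n) j → j ∈ ⋃ (blocks P)
∈-cover P j = let X , X∈ , j∈X = blocks-cover P j in All.lookup (⋃-upper (blocks P)) X∈ j j∈X

blockIndex-admissible : ∀ {n} (P : Comp n) → Admissible P (blockIndex (blocks P))
blockIndex-admissible P =
  (λ j j′ → blockIndex⇒same (blocks P) (∈-cover P j) (∈-cover P j′) ,
            same⇒blockIndex (blocks-disjoint P)) ,
  blockIndex-ascending (blocks-disjoint P)

word : Basis → List ℕ
word (n , P) = tabulate (blockIndex (blocks P))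

length-word : ∀ b → length (word b) ≡ deg b
length-word (n , P) = Listₚ.length-tabulate (blockIndex (blocks P))

M-word : ∀ b → M (proj₂ b) (word b) ≡ 1ℤ
M-word b@(n , P) with length (word b) ℕₚ.≟ n
... | no ≢  = contradiction (length-word b) ≢
... | yes e = 𝟙-yes (admissible? P i) (levels⇒admissible P K bound
  (trans (admissible⇒levels P (blockIndex-admissible P) K λ j → subst (_< K) (i≡ j) (bound j))
    (levelBlocks-ext (sym ∘ i≡) K)))
  where
  i : Fin n → ℕ
  i = lookup (word b) ∘ Fin.cast (sym e)
  K : ℕ
  K = letterBound (word b)
  i≡ : ∀ j → i j ≡ blockIndex (blocks P) j
  i≡ = Listₚ.lookup-tabulate (blockIndex (blocks P))
  bound : ∀ j → i j < K
  bound j = lookup-bound (word b) (Fin.cast (sym e) j)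

-- The coefficient of `word b` in `M (proj₂ b)` is 1, and by `M-pack` it is the indicator of
-- `b ≡ pack (word b)`.
pack-word : ∀ b → pack (word b) ≡ b
pack-word b = sym (𝟙-yes⁻ (b ≟ pack (word b)) (trans (sym (M-pack b (word b))) (M-word b)))
  where
  𝟙-yes⁻ : ∀ {P : Set} (d : Dec P) → 𝟙[ d ] ≡ 1ℤ → P
  𝟙-yes⁻ (yes p) _ = p

-- One element is chosen from each block; its block index recovers the block, so the choice is
-- injective. This bounds the letters of `word`.
∣blocks∣≤n : ∀ {n} (P : Comp n) → length (blocks P) ≤ n
∣blocks∣≤n {n} P = Finₚ.injective⇒≤ {f = element} λ {k} {l} e → Finₚ.toℕ-injective
  (trans (sym (blockIndex-lookup (blocks-disjoint P) k (element∈ k)))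
    (trans (cong (blockIndex (blocks P)) e) (blockIndex-lookup (blocks-disjoint P) l (element∈ l))))
  where
  element : Fin (length (blocks P)) → Fin n
  element k = proj₁ (All.lookup (blocks-nonempty P) (∈-lookup k))
  element∈ : ∀ k → element k ∈ lookup (blocks P) k
  element∈ k = proj₂ (All.lookup (blocks-nonempty P) (∈-lookup k))

boundedWords : ℕ → ℕ → List (List ℕ)
boundedWords N zero    = [] ∷ []
boundedWords N (suc n) = [] ∷ concatMap (λ v → map (v ∷_) (boundedWords N n)) (upTo N)

∈-boundedWords : ∀ N n {w} → length w ≤ n → All (_< N) w → w ∈ˡ boundedWords N n
∈-boundedWords N zero    {[]}    _ _ = here refl
∈-boundedWords N (suc n) {[]}    _ _ = here refl
∈-boundedWords N (suc n) {v ∷ w} (s≤s l) (v< ∷ w<) = there (∈-concatMap⁺ _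
  (lose (∈-upTo⁺ v<) (∈-map⁺ (v ∷_) (∈-boundedWords N n l w<))))

-- A set composition of degree at most `N` is the packing of its word, which has length at most `N`
-- and letters below `N`. This finite range is what turns products of monomials and expansions of
-- functionals into finite sums.
basisUpTo : ℕ → List Basis
basisUpTo N = deduplicate _≟_ (map pack (boundedWords N N))

basisUpTo-unique : ∀ N → Unique (basisUpTo N)
basisUpTo-unique N = UniqueDec.deduplicate-! _≟_ (map pack (boundedWords N N))

∈-basisUpTo : ∀ {N} b → deg b ≤ N → b ∈ˡ basisUpTo N
∈-basisUpTo {N} b@(n , P) n≤N = ∈-deduplicate⁺ _≟_ (subst (_∈ˡ _) (pack-word b)
  (∈-map⁺ pack (∈-boundedWords N N (ℕₚ.≤-trans (ℕₚ.≤-reflexive (length-word b)) n≤N)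
    (Allₚ.tabulate⁺ λ j → ℕₚ.<-≤-trans (blockIndex-< (blocks P) (∈-cover P j))
      (ℕₚ.≤-trans (∣blocks∣≤n P) n≤N)))))

∑-⋆ : ∀ b c w → (M (proj₂ b) ⋆ M (proj₂ c)) w ≡
      ∑ℤ (cut (pack w)) (λ (x , y) → 𝟙[ b ≟ x ] ℤ.* 𝟙[ c ≟ y ])
∑-⋆ b c w = begin
  (M (proj₂ b) ⋆ M (proj₂ c)) w
    ≡⟨ ∑ℤ-≡ (upTo (suc (length w))) {term} ⟩
  ∑ℤ (upTo (suc (length w))) term
    ≡⟨ ∑-upTo (length w) id term ⟩
  ∑-pairs (length w) (λ i _ → M (proj₂ b) (take i w) ℤ.* M (proj₂ c) (drop i w))
    ≡⟨ ∑-pairs-cong (length w) (λ i _ _ → cong₂ ℤ._*_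
         (trans (M-pack b (take i w)) (cong (λ U → 𝟙[ code b ≟ᶜ U ]) (code-pack-take i w)))
         (trans (M-pack c (drop i w)) (cong (λ U → 𝟙[ code c ≟ᶜ U ]) (code-pack-drop i w)))) ⟩
  ∑-pairs (length w) (λ i _ →
    𝟙[ code b ≟ᶜ prefix i (code (pack w)) ] ℤ.* 𝟙[ code c ≟ᶜ suffix i (code (pack w)) ])
    ≡⟨ ∑-cut (pack w) (λ U V → 𝟙[ code b ≟ᶜ U ] ℤ.* 𝟙[ code c ≟ᶜ V ]) ⟨
  ∑ℤ (cut (pack w)) (λ (x , y) → 𝟙[ b ≟ x ] ℤ.* 𝟙[ c ≟ y ]) ∎
  where
  open ≡-Reasoning
  term : ℕ → ℤ
  term i = M (proj₂ b) (take i w) ℤ.* M (proj₂ c) (drop i w)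

-- Duality of structure constants

agree : {X : Set} (d : DecidableEquality X) (xs ys : List X) →
        (∀ x → ∑ℤ xs (λ y → 𝟙[ d x y ]) ≡ ∑ℤ ys (λ y → 𝟙[ d x y ])) →
        ∀ f → ∑ℤ xs f ≡ ∑ℤ ys f
agree d xs ys h f = trans (sym (∑ℤ-≡ xs {f}))
  (trans (Separation.sums-agree d ℤᴹ f xs ys {gen} {gen} h) (∑ℤ-≡ ys {f}))

flatten : {A B X : Set} (as : List A) (bs : A → List B) (h : A → B → X) → List X
flatten as bs h = concatMap (λ a → map (h a) (bs a)) as

∑ℤ-flatten : {A B X : Set} (as : List A) (bs : A → List B) (h : A → B → X) (f : X → ℤ) →
             ∑ℤ (flatten as bs h) f ≡ ∑ℤ as (λ a → ∑ℤ (bs a) (f ∘ h a))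
∑ℤ-flatten as bs h f = trans (∑ℤ-concatMap _ as f) (∑ℤ-ext as λ a → ∑ℤ-map (h a) (bs a) f)

agree₂ : {X A B C D : Set} (d : DecidableEquality X)
  (as : List A) (bs : A → List B) (h : A → B → X) (cs : List C) (ds : C → List D) (k : C → D → X) →
  (∀ x → ∑ℤ as (λ a → ∑ℤ (bs a) λ b → 𝟙[ d x (h a b) ]) ≡
         ∑ℤ cs (λ c → ∑ℤ (ds c) λ e → 𝟙[ d x (k c e) ])) →
  ∀ f → ∑ℤ as (λ a → ∑ℤ (bs a) (f ∘ h a)) ≡ ∑ℤ cs (λ c → ∑ℤ (ds c) (f ∘ k c))
agree₂ d as bs h cs ds k e f = trans (sym (∑ℤ-flatten as bs h f))
  (trans (agree d (flatten as bs h) (flatten cs ds k)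
      (λ x → trans (∑ℤ-flatten as bs h _) (trans (e x) (sym (∑ℤ-flatten cs ds k _)))) f)
    (∑ℤ-flatten cs ds k f))

𝟙-sym : ∀ a b → 𝟙[ a ≟ b ] ≡ 𝟙[ b ≟ a ]
𝟙-sym a b = 𝟙-⇔ (a ≟ b) (b ≟ a) sym sym

𝟙-pairwise : {X Y : Set} (d : DecidableEquality X) (d′ : DecidableEquality Y) → ∀ x y u v →
             𝟙[ pairwise d d′ (x , y) (u , v) ] ≡ 𝟙[ d x u ] ℤ.* 𝟙[ d′ y v ]
𝟙-pairwise d d′ x y u v with d x u | d′ y v
... | yes _ | yes _ = refl
... | yes _ | no _  = refl
... | no _  | yes _ = refl
... | no _  | no _  = refl

projection₀-𝟙 : ∀ b → projection₀ b ≡ 𝟙[ 𝟏 ≟ b ]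
projection₀-𝟙 b with deg b ℕₚ.≟ 0
... | yes b≡0 = trans (projection₀-0 b b≡0) (sym (𝟙-yes (𝟏 ≟ b) (sym (deg-0 b b≡0))))
... | no b≢0  = trans (projection₀-≢0 b b≢0) (sym (𝟙-no (𝟏 ≟ b) λ e → b≢0 (sym (cong deg e))))

module Duality (C : Combinatorial) where
  open Combinatorial C

  -- The relation ⟨ab, c⟩ = ⟨a ⊗ b, Δc⟩ between dual bases, in terms of multiplicities.
  IsDualMul : (Basis → Basis → List Basis) → Set
  IsDualMul mul° = ∀ a b c →
    ∑ℤ (mul° a b) (λ r → 𝟙[ c ≟ r ]) ≡ ∑ℤ (comul c) (λ (x , y) → 𝟙[ a ≟ x ] ℤ.* 𝟙[ b ≟ y ])

  IsDualComul : (Basis → List (Basis × Basis)) → Set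
  IsDualComul comul° = ∀ a b c →
    ∑ℤ (comul° c) (λ (x , y) → 𝟙[ a ≟ x ] ℤ.* 𝟙[ b ≟ y ]) ≡ ∑ℤ (mul a b) (λ r → 𝟙[ c ≟ r ])

  module _ {mul° comul°} (dm : IsDualMul mul°) (dc : IsDualComul comul°) where
    private
      pair≡ : ∀ a b c → ∑ℤ (comul° c) (λ p → 𝟙[ pairwise _≟_ _≟_ (a , b) p ]) ≡ ∑ℤ (mul a b)
          (λ r → 𝟙[ c ≟ r ])
      pair≡ a b c = trans (∑ℤ-ext (comul° c) λ (x , y) → 𝟙-pairwise _≟_ _≟_ a b x y) (dc a b c)

    dual-unitˡ : ∀ b (f : List Bits → ℤ) → ∑ℤ (mul° 𝟏 b) (f ∘ code) ≡ f (code b)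
    dual-unitˡ b f = trans (agree _≟_ (mul° 𝟏 b) (b ∷ []) (λ c → begin
      ∑ℤ (mul° 𝟏 b) (λ r → 𝟙[ c ≟ r ])                       ≡⟨ dm 𝟏 b c ⟩
      ∑ℤ (comul c) (λ (x , y) → 𝟙[ 𝟏 ≟ x ] ℤ.* 𝟙[ b ≟ y ])
        ≡⟨ ∑ℤ-ext (comul c) (λ (x , y) → cong (ℤ._* 𝟙[ b ≟ y ]) (projection₀-𝟙 x)) ⟨
      ∑ℤ (comul c) (λ (x , y) → projection₀ x ℤ.* 𝟙[ b ≟ y ]) ≡⟨ counitˡ c (λ U → 𝟙[ code b ≟ᶜ U ]) ⟩
      𝟙[ b ≟ c ]                                              ≡⟨ 𝟙-sym b c ⟩
      𝟙[ c ≟ b ]                                              ≡⟨ ℤₚ.+-identityʳ _ ⟨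
      𝟙[ c ≟ b ] ℤ.+ 0ℤ                                       ∎) (f ∘ code)) (ℤₚ.+-identityʳ _)
      where open ≡-Reasoning

    dual-unitʳ : ∀ b (f : List Bits → ℤ) → ∑ℤ (mul° b 𝟏) (f ∘ code) ≡ f (code b)
    dual-unitʳ b f = trans (agree _≟_ (mul° b 𝟏) (b ∷ []) (λ c → begin
      ∑ℤ (mul° b 𝟏) (λ r → 𝟙[ c ≟ r ])                       ≡⟨ dm b 𝟏 c ⟩
      ∑ℤ (comul c) (λ (x , y) → 𝟙[ b ≟ x ] ℤ.* 𝟙[ 𝟏 ≟ y ])
        ≡⟨ ∑ℤ-ext (comul c) (λ (x , y) → trans (cong (ℤ._* 𝟙[ b ≟ x ]) (projection₀-𝟙 y))
             (ℤₚ.*-comm 𝟙[ 𝟏 ≟ y ] 𝟙[ b ≟ x ])) ⟨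
      ∑ℤ (comul c) (λ (x , y) → projection₀ y ℤ.* 𝟙[ b ≟ x ]) ≡⟨ counitʳ c (λ U → 𝟙[ code b ≟ᶜ U ]) ⟩
      𝟙[ b ≟ c ]                                              ≡⟨ 𝟙-sym b c ⟩
      𝟙[ c ≟ b ]                                              ≡⟨ ℤₚ.+-identityʳ _ ⟨
      𝟙[ c ≟ b ] ℤ.+ 0ℤ                                       ∎) (f ∘ code)) (ℤₚ.+-identityʳ _)
      where open ≡-Reasoning

    -- Rewriting products by `dm` leaves iterated coproducts of `r`, tested at the triple `a`, `b`,
    -- `c`; the claim is then coassociativity of `comul`.
    dual-assoc : ∀ a b c (f : List Bits → ℤ) →
      ∑ℤ (mul° a b) (λ x → ∑ℤ (mul° x c) (f ∘ code)) ≡ ∑ℤ (mul° b c) (λ x → ∑ℤ (mul° a x)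
          (f ∘ code))
    dual-assoc a b c f = agree₂ _≟_ (mul° a b) (λ x → mul° x c) (λ _ → id) (mul° b c) (mul° a)
        (λ _ → id)
      (λ r → begin
        ∑ℤ (mul° a b) (λ x → ∑ℤ (mul° x c) λ y → 𝟙[ r ≟ y ])
          ≡⟨ ∑ℤ-ext (mul° a b) (λ x → dm x c r) ⟩
        ∑ℤ (mul° a b) (λ x → ∑ℤ (comul r) λ (s , t) → 𝟙[ x ≟ s ] ℤ.* 𝟙[ c ≟ t ])
          ≡⟨ ∑ℤ-swap (mul° a b) (comul r) _ ⟩
        ∑ℤ (comul r) (λ (s , t) → ∑ℤ (mul° a b) λ x → 𝟙[ x ≟ s ] ℤ.* 𝟙[ c ≟ t ])
          ≡⟨ ∑ℤ-ext (comul r) (λ (s , t) → trans (sym (∑ℤ-*ʳ 𝟙[ c ≟ t ] (mul° a b) _))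
               (trans (cong (ℤ._* 𝟙[ c ≟ t ]) (trans (∑ℤ-ext (mul° a b) λ x → 𝟙-sym x s)
                   (dm a b s)))
                 (∑ℤ-*ʳ 𝟙[ c ≟ t ] (comul s) _))) ⟩
        ∑ℤ (comul r) (λ (s , t) → ∑ℤ (comul s) λ (u , v) → (𝟙[ a ≟ u ] ℤ.* 𝟙[ b ≟ v ]) ℤ.*
            𝟙[ c ≟ t ])
          ≡⟨ coassoc r (λ U V W → (𝟙[ code a ≟ᶜ U ] ℤ.* 𝟙[ code b ≟ᶜ V ]) ℤ.* 𝟙[ code c ≟ᶜ W ]) ⟩
        ∑ℤ (comul r) (λ (s , t) → ∑ℤ (comul t) λ (u , v) → (𝟙[ a ≟ s ] ℤ.* 𝟙[ b ≟ u ]) ℤ.*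
            𝟙[ c ≟ v ])
          ≡⟨ ∑ℤ-ext (comul r) (λ (s , t) → trans
               (∑ℤ-ext (comul t) λ (u , v) → ℤₚ.*-assoc 𝟙[ a ≟ s ] 𝟙[ b ≟ u ] 𝟙[ c ≟ v ])
               (trans (sym (∑ℤ-*ˡ 𝟙[ a ≟ s ] (comul t) _))
                 (trans (cong (λ z → 𝟙[ a ≟ s ] ℤ.* z)
                     (trans (sym (dm b c t)) (∑ℤ-ext (mul° b c) λ x → 𝟙-sym t x)))
                   (∑ℤ-*ˡ 𝟙[ a ≟ s ] (mul° b c) _)))) ⟩
        ∑ℤ (comul r) (λ (s , t) → ∑ℤ (mul° b c) λ x → 𝟙[ a ≟ s ] ℤ.* 𝟙[ x ≟ t ])
          ≡⟨ ∑ℤ-swap (mul° b c) (comul r) _ ⟨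
        ∑ℤ (mul° b c) (λ x → ∑ℤ (comul r) λ (s , t) → 𝟙[ a ≟ s ] ℤ.* 𝟙[ x ≟ t ])
          ≡⟨ ∑ℤ-ext (mul° b c) (λ x → dm a x r) ⟨
        ∑ℤ (mul° b c) (λ x → ∑ℤ (mul° a x) λ y → 𝟙[ r ≟ y ]) ∎) (f ∘ code)
      where open ≡-Reasoning

    dual-counitˡ : ∀ c (f : List Bits → ℤ) →
      ∑ℤ (comul° c) (λ (x , y) → projection₀ x ℤ.* f (code y)) ≡ f (code c)
    dual-counitˡ c f = trans (sym (∑ℤ-≡ (comul° c))) (trans
      (Separation.sums-agree _≟_ ℤᴹ (f ∘ code) (comul° c) (c ∷ []) {λ (x , y) → projection₀ x ·
          gen y} {gen}
        λ b → begin
          ∑ℤ (comul° c) (λ (x , y) → projection₀ x ℤ.* 𝟙[ b ≟ y ])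
            ≡⟨ ∑ℤ-ext (comul° c) (λ (x , y) → cong (ℤ._* 𝟙[ b ≟ y ]) (projection₀-𝟙 x)) ⟩
          ∑ℤ (comul° c) (λ (x , y) → 𝟙[ 𝟏 ≟ x ] ℤ.* 𝟙[ b ≟ y ])   ≡⟨ dc 𝟏 b c ⟩
          ∑ℤ (mul 𝟏 b) (λ r → 𝟙[ c ≟ r ])                          ≡⟨ unitˡ b (λ U → 𝟙[ code c ≟ᶜ U ]) ⟩
          𝟙[ c ≟ b ]                                               ≡⟨ 𝟙-sym c b ⟩
          𝟙[ b ≟ c ]                                               ≡⟨ ℤₚ.+-identityʳ _ ⟨
          𝟙[ b ≟ c ] ℤ.+ 0ℤ                                        ∎)
      (ℤₚ.+-identityʳ (f (code c))))
      where open ≡-Reasoning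

    dual-counitʳ : ∀ c (f : List Bits → ℤ) →
      ∑ℤ (comul° c) (λ (x , y) → projection₀ y ℤ.* f (code x)) ≡ f (code c)
    dual-counitʳ c f = trans (sym (∑ℤ-≡ (comul° c))) (trans
      (Separation.sums-agree _≟_ ℤᴹ (f ∘ code) (comul° c) (c ∷ []) {λ (x , y) → projection₀ y ·
          gen x} {gen}
        λ b → begin
          ∑ℤ (comul° c) (λ (x , y) → projection₀ y ℤ.* 𝟙[ b ≟ x ])
            ≡⟨ ∑ℤ-ext (comul° c) (λ (x , y) → trans (cong (ℤ._* 𝟙[ b ≟ x ]) (projection₀-𝟙 y))
                 (ℤₚ.*-comm 𝟙[ 𝟏 ≟ y ] 𝟙[ b ≟ x ])) ⟩
          ∑ℤ (comul° c) (λ (x , y) → 𝟙[ b ≟ x ] ℤ.* 𝟙[ 𝟏 ≟ y ])   ≡⟨ dc b 𝟏 c ⟩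
          ∑ℤ (mul b 𝟏) (λ r → 𝟙[ c ≟ r ])                          ≡⟨ unitʳ b (λ U → 𝟙[ code c ≟ᶜ U ]) ⟩
          𝟙[ c ≟ b ]                                               ≡⟨ 𝟙-sym c b ⟩
          𝟙[ b ≟ c ]                                               ≡⟨ ℤₚ.+-identityʳ _ ⟨
          𝟙[ b ≟ c ] ℤ.+ 0ℤ                                        ∎)
      (ℤₚ.+-identityʳ (f (code c))))
      where open ≡-Reasoning

    dual-coassoc : ∀ r (f : List Bits → List Bits → List Bits → ℤ) →
      ∑ℤ (comul° r) (λ (x , y) → ∑ℤ (comul° x) λ (u , v) → f (code u) (code v) (code y)) ≡
      ∑ℤ (comul° r) (λ (x , y) → ∑ℤ (comul° y) λ (u , v) → f (code x) (code u) (code v))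
    dual-coassoc r f = agree₂ (pairwise _≟_ (pairwise _≟_ _≟_))
      (comul° r) (λ (x , y) → comul° x) (λ (x , y) (u , v) → u , v , y)
      (comul° r) (λ (x , y) → comul° y) (λ (x , y) (u , v) → x , u , v)
      (λ (a , b , c) → begin
        ∑ℤ (comul° r) (λ (x , y) → ∑ℤ (comul° x) λ (u , v) →
          𝟙[ pairwise _≟_ (pairwise _≟_ _≟_) (a , b , c) (u , v , y) ])
          ≡⟨ ∑ℤ-ext (comul° r) (λ (x , y) → trans (∑ℤ-ext (comul° x) λ (u , v) → split a b c u v y)
               (trans (sym (∑ℤ-*ʳ 𝟙[ c ≟ y ] (comul° x) _))
                 (trans (cong (ℤ._* 𝟙[ c ≟ y ]) (trans (dc a b x) (∑ℤ-ext (mul a b) λ m →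
                     𝟙-sym x m)))
                   (∑ℤ-*ʳ 𝟙[ c ≟ y ] (mul a b) _)))) ⟩
        ∑ℤ (comul° r) (λ (x , y) → ∑ℤ (mul a b) λ m → 𝟙[ m ≟ x ] ℤ.* 𝟙[ c ≟ y ])
          ≡⟨ ∑ℤ-swap (comul° r) (mul a b) _ ⟩
        ∑ℤ (mul a b) (λ m → ∑ℤ (comul° r) λ (x , y) → 𝟙[ m ≟ x ] ℤ.* 𝟙[ c ≟ y ])
          ≡⟨ ∑ℤ-ext (mul a b) (λ m → dc m c r) ⟩
        ∑ℤ (mul a b) (λ m → ∑ℤ (mul m c) λ n → 𝟙[ r ≟ n ])
          ≡⟨ assoc a b c (λ U → 𝟙[ code r ≟ᶜ U ]) ⟩
        ∑ℤ (mul b c) (λ m → ∑ℤ (mul a m) λ n → 𝟙[ r ≟ n ])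
          ≡⟨ ∑ℤ-ext (mul b c) (λ m → dc a m r) ⟨
        ∑ℤ (mul b c) (λ m → ∑ℤ (comul° r) λ (x , y) → 𝟙[ a ≟ x ] ℤ.* 𝟙[ m ≟ y ])
          ≡⟨ ∑ℤ-swap (comul° r) (mul b c) _ ⟨
        ∑ℤ (comul° r) (λ (x , y) → ∑ℤ (mul b c) λ m → 𝟙[ a ≟ x ] ℤ.* 𝟙[ m ≟ y ])
          ≡⟨ ∑ℤ-ext (comul° r) (λ (x , y) → trans (∑ℤ-ext (comul° y) λ (u , v) →
                 trans (𝟙-pairwise _≟_ (pairwise _≟_ _≟_) a (b , c) x (u , v))
                   (cong (λ z → 𝟙[ a ≟ x ] ℤ.* z) (𝟙-pairwise _≟_ _≟_ b c u v)))
               (trans (sym (∑ℤ-*ˡ 𝟙[ a ≟ x ] (comul° y) _))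
                 (trans (cong (λ z → 𝟙[ a ≟ x ] ℤ.* z) (trans (dc b c y) (∑ℤ-ext (mul b c) λ m →
                     𝟙-sym y m)))
                   (∑ℤ-*ˡ 𝟙[ a ≟ x ] (mul b c) _)))) ⟨
        ∑ℤ (comul° r) (λ (x , y) → ∑ℤ (comul° y) λ (u , v) →
          𝟙[ pairwise _≟_ (pairwise _≟_ _≟_) (a , b , c) (x , u , v) ]) ∎)
      (λ (x , y , z) → f (code x) (code y) (code z))
      where
      open ≡-Reasoning
      split : ∀ a b c u v y → 𝟙[ pairwise _≟_ (pairwise _≟_ _≟_) (a , b , c) (u , v , y) ] ≡
              (𝟙[ a ≟ u ] ℤ.* 𝟙[ b ≟ v ]) ℤ.* 𝟙[ c ≟ y ]
      split a b c u v y = trans (𝟙-pairwise _≟_ (pairwise _≟_ _≟_) a (b , c) u (v , y))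
        (trans (cong (λ z → 𝟙[ a ≟ u ] ℤ.* z) (𝟙-pairwise _≟_ _≟_ b c v y))
          (sym (ℤₚ.*-assoc 𝟙[ a ≟ u ] 𝟙[ b ≟ v ] 𝟙[ c ≟ y ])))

    private
      products : Basis → Basis → List (Basis × Basis)
      products a b = concatMap (λ (a₁ , a₂) → concatMap (λ (b₁ , b₂) →
        flatten (mul° a₁ b₁) (λ _ → mul° a₂ b₂) _,_) (comul° b)) (comul° a)

      ∑ℤ-products : ∀ a b (f : Basis × Basis → ℤ) → ∑ℤ (products a b) f ≡
        ∑ℤ (comul° a) λ (a₁ , a₂) → ∑ℤ (comul° b) λ (b₁ , b₂) →
          ∑ℤ (mul° a₁ b₁) λ u → ∑ℤ (mul° a₂ b₂) λ v → f (u , v)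
      ∑ℤ-products a b f = trans (∑ℤ-concatMap _ (comul° a) f) (∑ℤ-ext (comul° a) λ (a₁ , a₂) →
        trans (∑ℤ-concatMap _ (comul° b) f) (∑ℤ-ext (comul° b) λ (b₁ , b₂) →
          ∑ℤ-flatten (mul° a₁ b₁) (λ _ → mul° a₂ b₂) _,_ f))

      ∑ℤ-*∑ℤ : {A B : Set} (as : List A) (bs : List B) (f : A → ℤ) (g : B → ℤ) →
               ∑ℤ as (λ a → ∑ℤ bs λ b → f a ℤ.* g b) ≡ ∑ℤ as f ℤ.* ∑ℤ bs g
      ∑ℤ-*∑ℤ as bs f g = trans (∑ℤ-ext as λ a → sym (∑ℤ-*ˡ (f a) bs g)) (sym (∑ℤ-*ʳ (∑ℤ bs g) as f))

      -- The counterpart, for multiplicities, of interchanging the two middle factors in the product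
      -- on `H ⊗ H`.
      ∑ℤ-exchange : {A B C D : Set} (as : List A) (bs : List B) (cs : List C) (ds : List D)
        (f : A → C → ℤ) (g : B → C → ℤ) (h : A → D → ℤ) (k : B → D → ℤ) →
        ∑ℤ as (λ a → ∑ℤ bs λ b → ∑ℤ cs (λ c → f a c ℤ.* g b c) ℤ.* ∑ℤ ds (λ d → h a d ℤ.* k b d)) ≡
        ∑ℤ cs (λ c → ∑ℤ ds λ d → ∑ℤ as (λ a → f a c ℤ.* h a d) ℤ.* ∑ℤ bs (λ b → g b c ℤ.* k b d))
      ∑ℤ-exchange as bs cs ds f g h k = begin
        ∑ℤ as (λ a → ∑ℤ bs λ b → ∑ℤ cs (λ c → f a c ℤ.* g b c) ℤ.* ∑ℤ ds (λ d → h a d ℤ.* k b d))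
          ≡⟨ ∑ℤ-ext as (λ a → ∑ℤ-ext bs λ b → ∑ℤ-*∑ℤ cs ds _ _) ⟨
        ∑ℤ as (λ a → ∑ℤ bs λ b → ∑ℤ cs λ c → ∑ℤ ds λ d → (f a c ℤ.* g b c) ℤ.* (h a d ℤ.* k b d))
          ≡⟨ ∑ℤ-ext as (λ a → trans (∑ℤ-swap bs cs _) (∑ℤ-ext cs λ c → ∑ℤ-swap bs ds _)) ⟩
        ∑ℤ as (λ a → ∑ℤ cs λ c → ∑ℤ ds λ d → ∑ℤ bs λ b → (f a c ℤ.* g b c) ℤ.* (h a d ℤ.* k b d))
          ≡⟨ trans (∑ℤ-swap as cs _) (∑ℤ-ext cs λ c → ∑ℤ-swap as ds _) ⟩
        ∑ℤ cs (λ c → ∑ℤ ds λ d → ∑ℤ as λ a → ∑ℤ bs λ b → (f a c ℤ.* g b c) ℤ.* (h a d ℤ.* k b d))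
          ≡⟨ ∑ℤ-ext cs (λ c → ∑ℤ-ext ds λ d → trans
               (∑ℤ-ext as λ a → ∑ℤ-ext bs λ b → *-interchange (f a c) (g b c) (h a d) (k b d))
               (∑ℤ-*∑ℤ as bs _ _)) ⟩
        ∑ℤ cs (λ c → ∑ℤ ds λ d → ∑ℤ as (λ a → f a c ℤ.* h a d) ℤ.* ∑ℤ bs (λ b → g b c ℤ.* k b d)) ∎
        where
        open ≡-Reasoning
        *-interchange : ∀ w x y z → (w ℤ.* x) ℤ.* (y ℤ.* z) ≡ (w ℤ.* y) ℤ.* (x ℤ.* z)
        *-interchange w x y z = trans (ℤₚ.*-assoc w x _)
          (trans (cong (w ℤ.*_) (Mod.*ₗ-exchange ℤᴹ x y z)) (sym (ℤₚ.*-assoc w y _)))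

    -- Compatibility is self-dual. Taken at `(u , v)`, the claim becomes `compat u v` with the
    -- indicators of `a` and `b` as test functions; `∑ℤ-exchange` regroups the resulting sums.
    dual-compat : ∀ a b (f : List Bits → List Bits → ℤ) →
      ∑ℤ (mul° a b) (λ x → ∑ℤ (comul° x) λ (u , v) → f (code u) (code v)) ≡
      ∑ℤ (comul° a) λ (a₁ , a₂) → ∑ℤ (comul° b) λ (b₁ , b₂) →
        ∑ℤ (mul° a₁ b₁) λ u → ∑ℤ (mul° a₂ b₂) λ v → f (code u) (code v)
    dual-compat a b f = trans (sym (∑ℤ-flatten (mul° a b) comul° (λ _ → id) _))
      (trans (agree (pairwise _≟_ _≟_) (flatten (mul° a b) comul° (λ _ → id)) (products a b)
        (λ (u , v) → begin
          ∑ℤ (flatten (mul° a b) comul° (λ _ → id)) (λ p → 𝟙[ pairwise _≟_ _≟_ (u , v) p ])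
            ≡⟨ ∑ℤ-flatten (mul° a b) comul° (λ _ → id) _ ⟩
          ∑ℤ (mul° a b) (λ x → ∑ℤ (comul° x) λ p → 𝟙[ pairwise _≟_ _≟_ (u , v) p ])
            ≡⟨ ∑ℤ-ext (mul° a b) (λ x → pair≡ u v x) ⟩
          ∑ℤ (mul° a b) (λ x → ∑ℤ (mul u v) λ r → 𝟙[ x ≟ r ])
            ≡⟨ ∑ℤ-swap (mul° a b) (mul u v) _ ⟩
          ∑ℤ (mul u v) (λ r → ∑ℤ (mul° a b) λ x → 𝟙[ x ≟ r ])
            ≡⟨ ∑ℤ-ext (mul u v) (λ r → trans (∑ℤ-ext (mul° a b) λ x → 𝟙-sym x r) (dm a b r)) ⟩
          ∑ℤ (mul u v) (λ r → ∑ℤ (comul r) λ (s , t) → 𝟙[ a ≟ s ] ℤ.* 𝟙[ b ≟ t ])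
            ≡⟨ compat u v (λ U V → 𝟙[ code a ≟ᶜ U ] ℤ.* 𝟙[ code b ≟ᶜ V ]) ⟩
          ∑ℤ (comul u) (λ (u₁ , u₂) → ∑ℤ (comul v) λ (v₁ , v₂) →
            ∑ℤ (mul u₁ v₁) λ s → ∑ℤ (mul u₂ v₂) λ t → 𝟙[ a ≟ s ] ℤ.* 𝟙[ b ≟ t ])
            ≡⟨ ∑ℤ-ext (comul u) (λ (u₁ , u₂) → ∑ℤ-ext (comul v) λ (v₁ , v₂) → trans
                 (∑ℤ-*∑ℤ (mul u₁ v₁) (mul u₂ v₂) _ _)
                 (cong₂ ℤ._*_ (fold a u₁ v₁) (fold b u₂ v₂))) ⟩
          ∑ℤ (comul u) (λ (u₁ , u₂) → ∑ℤ (comul v) λ (v₁ , v₂) →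
            ∑ℤ (comul° a) (λ (a₁ , a₂) → 𝟙[ a₁ ≟ u₁ ] ℤ.* 𝟙[ a₂ ≟ v₁ ]) ℤ.*
            ∑ℤ (comul° b) (λ (b₁ , b₂) → 𝟙[ b₁ ≟ u₂ ] ℤ.* 𝟙[ b₂ ≟ v₂ ]))
            ≡⟨ ∑ℤ-exchange (comul° a) (comul° b) (comul u) (comul v)
                 (λ (a₁ , _) (u₁ , _) → 𝟙[ a₁ ≟ u₁ ]) (λ (b₁ , _) (_ , u₂) → 𝟙[ b₁ ≟ u₂ ])
                 (λ (_ , a₂) (v₁ , _) → 𝟙[ a₂ ≟ v₁ ]) (λ (_ , b₂) (_ , v₂) → 𝟙[ b₂ ≟ v₂ ]) ⟨
          ∑ℤ (comul° a) (λ (a₁ , a₂) → ∑ℤ (comul° b) λ (b₁ , b₂) →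
            ∑ℤ (comul u) (λ (u₁ , u₂) → 𝟙[ a₁ ≟ u₁ ] ℤ.* 𝟙[ b₁ ≟ u₂ ]) ℤ.*
            ∑ℤ (comul v) (λ (v₁ , v₂) → 𝟙[ a₂ ≟ v₁ ] ℤ.* 𝟙[ b₂ ≟ v₂ ]))
            ≡⟨ ∑ℤ-ext (comul° a) (λ (a₁ , a₂) → ∑ℤ-ext (comul° b) λ (b₁ , b₂) → trans
                 (∑ℤ-ext (mul° a₁ b₁) λ s → ∑ℤ-ext (mul° a₂ b₂) λ t → 𝟙-pairwise _≟_ _≟_ u v s t)
                 (trans (∑ℤ-*∑ℤ (mul° a₁ b₁) (mul° a₂ b₂) _ _)
                   (cong₂ ℤ._*_ (dm a₁ b₁ u) (dm a₂ b₂ v)))) ⟨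
          ∑ℤ (comul° a) (λ (a₁ , a₂) → ∑ℤ (comul° b) λ (b₁ , b₂) →
            ∑ℤ (mul° a₁ b₁) λ s → ∑ℤ (mul° a₂ b₂) λ t → 𝟙[ pairwise _≟_ _≟_ (u , v) (s , t) ])
            ≡⟨ ∑ℤ-products a b _ ⟨
          ∑ℤ (products a b) (λ p → 𝟙[ pairwise _≟_ _≟_ (u , v) p ]) ∎)
        (λ (u , v) → f (code u) (code v)))
        (∑ℤ-products a b _))
      where
      open ≡-Reasoning
      fold : ∀ c x y → ∑ℤ (mul x y) (λ s → 𝟙[ c ≟ s ]) ≡
             ∑ℤ (comul° c) (λ (c₁ , c₂) → 𝟙[ c₁ ≟ x ] ℤ.* 𝟙[ c₂ ≟ y ])
      fold c x y = trans (sym (dc x y c))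
        (∑ℤ-ext (comul° c) λ (c₁ , c₂) → cong₂ ℤ._*_ (𝟙-sym x c₁) (𝟙-sym y c₂))

-- Products and deconcatenations of monomials

-- `r` is listed once for every cut of `r` into `(a , b)`, which is the multiplicity that duality
-- demands. Candidates of degree below `deg a + deg b` have no such cut.
monomialProduct : Basis → Basis → List Basis
monomialProduct a b = concatMap
  (λ r → map (λ _ → r) (filter (pairwise _≟_ _≟_ (a , b)) (cut r))) (basisUpTo (deg a ℕ.+ deg b))

∑-filter : {A : Set} {P : A → Set} (P? : ∀ a → Dec (P a)) (as : List A) (c : ℤ) →
           ∑ℤ (filter P? as) (λ _ → c) ≡ ∑ℤ as (λ a → 𝟙[ P? a ]) ℤ.* c
∑-filter P? []       c = refl
∑-filter P? (a ∷ as) c with P? a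
... | yes _ = trans (cong (λ z → c ℤ.+ z) (∑-filter P? as c))
  (sym (trans (ℤₚ.*-distribʳ-+ c 1ℤ (∑ℤ as λ a → 𝟙[ P? a ]))
    (cong (ℤ._+ ∑ℤ as (λ a → 𝟙[ P? a ]) ℤ.* c) (ℤₚ.*-identityˡ c))))
... | no _  = trans (∑-filter P? as c)
  (cong (ℤ._* c) (sym (ℤₚ.+-identityˡ (∑ℤ as λ a → 𝟙[ P? a ]))))

∑-monomialProduct : ∀ a b (f : Basis → ℤ) → ∑ℤ (monomialProduct a b) f ≡
  ∑ℤ (basisUpTo (deg a ℕ.+ deg b)) (λ r → ∑ℤ (cut r) (λ (x , y) → 𝟙[ a ≟ x ] ℤ.* 𝟙[ b ≟ y ]) ℤ.* f r)
∑-monomialProduct a b f = trans (∑ℤ-concatMap _ (basisUpTo (deg a ℕ.+ deg b)) f)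
  (∑ℤ-ext (basisUpTo (deg a ℕ.+ deg b)) λ r → trans (∑ℤ-map (λ _ → r) (filter (pairwise _≟_ _≟_
      (a , b)) (cut r)) f)
    (trans (∑-filter (pairwise _≟_ _≟_ (a , b)) (cut r) (f r))
      (cong (ℤ._* f r) (∑ℤ-ext (cut r) λ (x , y) → 𝟙-pairwise _≟_ _≟_ a b x y))))

open Duality shuffleBialgebra using (IsDualMul; IsDualComul)

monomialProduct-dual : IsDualMul monomialProduct
monomialProduct-dual a b c = trans (∑-monomialProduct a b (λ r → 𝟙[ c ≟ r ]))
    (main (deg c ℕₚ.≟ deg a ℕ.+ deg b))
  where
  N : ℕ
  N = deg a ℕ.+ deg b
  coeff : Basis → ℤ
  coeff r = ∑ℤ (cut r) (λ (x , y) → 𝟙[ a ≟ x ] ℤ.* 𝟙[ b ≟ y ])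
  coeff-0 : deg c ≢ N → coeff c ≡ 0ℤ
  coeff-0 ≢ = ∑ℤ-zero (cut c) λ (x , y) xy∈ → vanish x y (cut-deg c x y xy∈) (a ≟ x) (b ≟ y)
    where
    vanish : ∀ x y → deg x ℕ.+ deg y ≡ deg c → (d : Dec (a ≡ x)) (d′ : Dec (b ≡ y)) → 𝟙[ d ] ℤ.*
        𝟙[ d′ ] ≡ 0ℤ
    vanish x y e (yes refl) (yes refl) = contradiction (sym e) ≢
    vanish x y e (yes _)    (no _)     = refl
    vanish x y e (no _)     _          = refl
  other : ∀ r → r ≢ c → coeff r ℤ.* 𝟙[ c ≟ r ] ≡ 0ℤ
  other r r≢c = trans (cong (λ z → coeff r ℤ.* z) (𝟙-no (c ≟ r) (r≢c ∘ sym))) (ℤₚ.*-zeroʳ (coeff r))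
  main : Dec (deg c ≡ N) → ∑ℤ (basisUpTo N) (λ r → coeff r ℤ.* 𝟙[ c ≟ r ]) ≡ coeff c
  main (yes e) = trans (∑ℤ-pick (basisUpTo-unique N) (∈-basisUpTo c (ℕₚ.≤-reflexive e)) other)
    (trans (cong (λ z → coeff c ℤ.* z) (𝟙-yes (c ≟ c) refl)) (ℤₚ.*-identityʳ (coeff c)))
  -- Here `c` may still be in the list, with a degree below `N`; its coefficient vanishes because
  -- the degrees of a cut add up to `deg c`.
  main (no ≢)  = trans (∑ℤ-zero (basisUpTo N) λ r _ → each r (r ≟ c)) (sym (coeff-0 ≢))
    where
    each : ∀ r → Dec (r ≡ c) → coeff r ℤ.* 𝟙[ c ≟ r ] ≡ 0ℤ
    each r (yes refl) = cong (ℤ._* 𝟙[ c ≟ c ]) (coeff-0 ≢)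
    each r (no r≢c)   = other r r≢c

monomialProduct-deg : ∀ a b x → x ∈ˡ monomialProduct a b → deg x ≡ deg a ℕ.+ deg b
monomialProduct-deg a b x x∈
  with Any.satisfied (∈-concatMap⁻ (λ r → map (λ _ → r) (filter (pairwise _≟_ _≟_ (a , b)) (cut r)))
                                   {xs = basisUpTo (deg a ℕ.+ deg b)} x∈)
... | r , x∈r with ∈-map⁻ (λ _ → r) x∈r
... | p , p∈ , refl with ∈-filter⁻ (pairwise _≟_ _≟_ (a , b)) {xs = cut x} p∈
... | p∈cut , refl = sym (cut-deg x a b p∈cut)

deconcatenateAt : Basis → ℕ → Basis × Basis
deconcatenateAt (n , P) i = (_ , is (takeBlocks i P)) , (_ , is (dropBlocks i P))

deconcatenate : Basis → List (Basis × Basis)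
deconcatenate b@(n , P) = map (deconcatenateAt b) (upTo (suc (length (blocks P))))

module _ {A : Set} {R : A → A → Set} where

  AllPairs-++⁻ : ∀ xs {ys} → AllPairs R (xs ++ ys) → ∀ {x y} → x ∈ˡ xs → y ∈ˡ ys → R x y
  AllPairs-++⁻ (x ∷ xs) (h ∷ hs) (here refl) y∈ = All.lookup h (∈-++⁺ʳ xs y∈)
  AllPairs-++⁻ (x ∷ xs) (h ∷ hs) (there x∈)  y∈ = AllPairs-++⁻ xs hs x∈ y∈

-- The second factor of a deconcatenation is standardized from its own union, that of a shuffle is
-- placed on a complement; disjointness and covering identify the two ground sets.
⋃-take-drop : ∀ {n} (P : Comp n) i → ⋃ (drop i (blocks P)) ≡ ∁ (⋃ (take i (blocks P)))
⋃-take-drop P i = ⊆-antisym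
  (λ {j} j∈D → x∉p⇒x∈∁p λ j∈T →
    let X , X∈ , j∈X = ∈-⋃⁻ Us j∈T
        Y , Y∈ , j∈Y = ∈-⋃⁻ Vs j∈D in
    disjoint-∉ (AllPairs-++⁻ Us (subst (AllPairs Disjoint) (sym (Listₚ.take++drop≡id i (blocks P)))
      (blocks-disjoint P)) X∈ Y∈) j∈Y j∈X)
  (λ {j} j∈∁T → case x∈p∪q⁻ (⋃ Us) (⋃ Vs) (subst (j ∈_)
      (trans (cong ⋃ (sym (Listₚ.take++drop≡id i (blocks P)))) (⋃-++ Us Vs)) (∈-cover P j)) of λ
    { (inj₁ j∈T) → contradiction j∈T (x∈∁p⇒x∉p j∈∁T)
    ; (inj₂ j∈D) → j∈D })
  where
  Us = take i (blocks P)
  Vs = drop i (blocks P)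

deconcatenate-deg : ∀ b x y → (x , y) ∈ˡ deconcatenate b → deg x ℕ.+ deg y ≡ deg b
deconcatenate-deg b@(n , P) x y xy∈ with ∈-map⁻ (deconcatenateAt b) {xs = upTo _} xy∈
... | i , _ , refl = trans (cong (λ D → ∣ ⋃ (take i (blocks P)) ∣ ℕ.+ ∣ D ∣) (⋃-take-drop P i))
  (∣A∣+∣∁A∣ (⋃ (take i (blocks P))))

sub-unsub : ∀ A X → length X ≡ card A → sub A (unsub A X) ≡ X
sub-unsub []          []      _ = refl
sub-unsub (true  ∷ A) (x ∷ X) e = cong (x ∷_) (sub-unsub A X (ℕₚ.suc-injective e))
sub-unsub (false ∷ A) X       e = sub-unsub A X e

uncollapse-collapse : ∀ {n} (A X : Subset n) → X ⊑ A → uncollapse A (collapse A X) ≡ X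
uncollapse-collapse Vec.[]            Vec.[]            _ = refl
uncollapse-collapse (inside  Vec.∷ A) (x       Vec.∷ X) h = cong (x Vec.∷_)
  (uncollapse-collapse A X λ j j∈ → case h (Fin.suc j) (Vec.there j∈) of λ { (Vec.there p) → p })
uncollapse-collapse (outside Vec.∷ A) (outside Vec.∷ X) h = cong (outside Vec.∷_)
  (uncollapse-collapse A X λ j j∈ → case h (Fin.suc j) (Vec.there j∈) of λ { (Vec.there p) → p })
uncollapse-collapse (outside Vec.∷ A) (inside  Vec.∷ X) h = case h Fin.zero Vec.here of λ ()

∑-allSubsets-pick : ∀ n (f : Subset n → ℤ) (A : Subset n) → (∀ B → B ≢ A → f B ≡ 0ℤ) →
                    ∑ℤ (allSubsets n) f ≡ f A
∑-allSubsets-pick zero    f Vec.[]      h = ℤₚ.+-identityʳ _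
∑-allSubsets-pick (suc n) f (a Vec.∷ A) h = trans (∑ℤ-++ (map (inside Vec.∷_) (allSubsets n)) _ f)
  (trans (cong₂ ℤ._+_ (∑ℤ-map _ (allSubsets n) f) (∑ℤ-map _ (allSubsets n) f)) (halves a h))
  where
  vanish : ∀ b → (∀ B → f (b Vec.∷ B) ≡ 0ℤ) → ∑ℤ (allSubsets n) (f ∘ (b Vec.∷_)) ≡ 0ℤ
  vanish b z = ∑ℤ-zero (allSubsets n) λ B _ → z B
  halves : ∀ a → (∀ B → B ≢ a Vec.∷ A → f B ≡ 0ℤ) →
    ∑ℤ (allSubsets n) (f ∘ (inside Vec.∷_)) ℤ.+ ∑ℤ (allSubsets n) (f ∘ (outside Vec.∷_)) ≡
        f (a Vec.∷ A)
  halves inside  h = trans (cong₂ ℤ._+_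
    (∑-allSubsets-pick n _ A λ B B≢ → h _ λ e → B≢ (Vecₚ.∷-injectiveʳ e))
    (vanish outside λ B → h _ λ ())) (ℤₚ.+-identityʳ _)
  halves outside h = trans (cong₂ ℤ._+_ (vanish inside λ B → h _ λ ())
    (∑-allSubsets-pick n _ A λ B B≢ → h _ λ e → B≢ (Vecₚ.∷-injectiveʳ e))) (ℤₚ.+-identityˡ _)

take-length-++ : {A : Set} (xs ys : List A) → take (length xs) (xs ++ ys) ≡ xs
take-length-++ []       ys = refl
take-length-++ (x ∷ xs) ys = cong (x ∷_) (take-length-++ xs ys)

drop-length-++ : {A : Set} (xs ys : List A) → drop (length xs) (xs ++ ys) ≡ ys
drop-length-++ []       ys = refl
drop-length-++ (x ∷ xs) ys = drop-length-++ xs ys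

module _ {n} (C : Comp n) (a b : Basis) where

  private
    l : ℕ
    l = length (code a)
    c : Basis
    c = n , C
    S₀ : Subset n
    S₀ = ⋃ (take l (blocks C))
    x° y° : ℕ → Basis
    x° i = proj₁ (deconcatenateAt c i)
    y° i = proj₂ (deconcatenateAt c i)

  Splits : Bits → Set
  Splits S = (card S ≡ deg a × card (compl S) ≡ deg b) × code c ≡ merge S (code a) (code b)

  splits? : ∀ S → Dec (Splits S)
  splits? S = ((card S ℕₚ.≟ deg a) ×-dec (card (compl S) ℕₚ.≟ deg b)) ×-dec (code c ≟ᶜ merge S
      (code a) (code b))

  private
    take-merge : ∀ S → code c ≡ merge S (code a) (code b) → take l (code c) ≡ map (unsub S) (code a)
    take-merge S e = trans (cong₂ take (sym (Listₚ.length-map (unsub S) (code a))) e)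
      (take-length-++ (map (unsub S) (code a)) _)

    drop-merge : ∀ S → code c ≡ merge S (code a) (code b) → drop l (code c) ≡
        map (unsub (compl S)) (code b)
    drop-merge S e = trans (cong₂ drop (sym (Listₚ.length-map (unsub S) (code a))) e)
      (drop-length-++ (map (unsub S) (code a)) _)

    -- The first `l` blocks of `C` are the images of the blocks of `a` inside `S`; since the blocks
    -- of `a` cover `[deg a]`, the union of these images is `S`.
    splits⇒⋃ : ∀ S → Splits (Vec.toList S) → S ≡ S₀
    splits⇒⋃ S ((card≡ , _) , e) = sym (lemma a (sym (trans (sym (card-toList S)) card≡))
        (trans (sym (Listₚ.take-map l (blocks C))) (take-merge (Vec.toList S) e)))
      where
      lemma : ∀ a → deg a ≡ ∣ S ∣ →
              map Vec.toList (take l (blocks C)) ≡ map (unsub (Vec.toList S)) (code a) → S₀ ≡ S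
      lemma (_ , A) refl e = trans
        (cong ⋃ (Listₚ.map-injective toList-inj (trans e (sym (map-uncollapse S A)))))
        (trans (relabel-⋃ (uncollapse-isRelabelling S) (blocks A))
          (trans (cong (uncollapse S) (⊆-antisym ⊆⊤ λ {j} _ → ∈-cover A j))
            (IsRelabelling.h-S (uncollapse-isRelabelling S))))

    code-x° : ∀ i → code (x° i) ≡ map (sub (Vec.toList (⋃ (take i (blocks C))))) (take i (code c))
    code-x° i = trans (sym (Listₚ.map-∘ (take i (blocks C)))) (trans
      (Listₚ.map-cong (toList-collapse (⋃ (take i (blocks C)))) (take i (blocks C)))
      (trans (Listₚ.map-∘ (take i (blocks C))) (cong (map _) (sym (Listₚ.take-map i (blocks C))))))

    code-y° : ∀ i → code (y° i) ≡ map (sub (compl (Vec.toList (⋃ (take i (blocks C))))))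
        (drop i (code c))
    code-y° i = trans (sym (Listₚ.map-∘ (drop i (blocks C)))) (trans
      (Listₚ.map-cong (λ X → trans (toList-collapse (⋃ (drop i (blocks C))) X)
        (cong (λ D → sub D (Vec.toList X)) (trans (cong Vec.toList (⋃-take-drop C i))
            (toList-∁ (⋃ (take i (blocks C)))))))
        (drop i (blocks C)))
      (trans (Listₚ.map-∘ (drop i (blocks C))) (cong (map _) (sym (Listₚ.drop-map i (blocks C))))))

    map-sub-unsub : ∀ S d → card S ≡ deg d → map (sub S) (map (unsub S) (code d)) ≡ code d
    map-sub-unsub S d e = trans (sym (Listₚ.map-∘ (code d)))
      (map-id-local (All.map (λ {X} l≡ → sub-unsub S X (trans l≡ (sym e))) (code-length d)))

    splits⇒factors : Splits (Vec.toList S₀) → a ≡ x° l × b ≡ y° l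
    splits⇒factors ((card≡ , card°≡) , e) =
      code-injective {a} {x° l} (sym (trans (code-x° l) (trans (cong (map _) (take-merge _ e))
          (map-sub-unsub _ a card≡)))) ,
      code-injective {b} {y° l} (sym (trans (code-y° l) (trans (cong (map _) (drop-merge _ e))
          (map-sub-unsub _ b card°≡))))

    restore : ∀ (Us : List (Subset n)) → map (unsub (Vec.toList (⋃ Us))) (map Vec.toList
        (map (collapse (⋃ Us)) Us)) ≡
              map Vec.toList Us
    restore Us = trans (sym (Listₚ.map-∘ (map (collapse (⋃ Us)) Us))) (trans
      (Listₚ.map-cong (λ X → sym (toList-uncollapse (⋃ Us) X)) (map (collapse (⋃ Us)) Us))
      (trans (sym (Listₚ.map-∘ Us)) (map-cong-local (All.map (λ {X} X⊑ → cong Vec.toList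
        (uncollapse-collapse (⋃ Us) X X⊑)) (⋃-upper Us)))))

    factors⇒splits : a ≡ x° l × b ≡ y° l → Splits (Vec.toList S₀)
    factors⇒splits (ea , eb) =
      (trans (card-toList S₀) (sym (cong deg ea)) ,
       trans (card-∁ S₀) (trans (cong ∣_∣ (sym (⋃-take-drop C l))) (sym (cong deg eb)))) ,
      sym (trans (cong₂ _++_
          (trans (cong (map (unsub (Vec.toList S₀))) (cong code ea)) (restore (take l (blocks C))))
          (trans (cong₂ (λ D → map (unsub D))
              (sym (trans (cong Vec.toList (⋃-take-drop C l)) (toList-∁ S₀))) (cong code eb))
            (restore (drop l (blocks C)))))
        (trans (sym (Listₚ.map-++ Vec.toList (take l (blocks C)) (drop l (blocks C))))
          (cong (map Vec.toList) (Listₚ.take++drop≡id l (blocks C)))))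

    length-x° : ∀ i → length (code (x° i)) ≡ i ℕ.⊓ length (blocks C)
    length-x° i = trans (Listₚ.length-map Vec.toList (map (collapse (⋃ (take i (blocks C))))
        (take i (blocks C))))
      (trans (Listₚ.length-map (collapse (⋃ (take i (blocks C)))) (take i (blocks C)))
          (Listₚ.length-take i (blocks C)))

    factor : ℕ → ℤ
    factor i = 𝟙[ a ≟ x° i ] ℤ.* 𝟙[ b ≟ y° i ]

    factor-0 : ∀ i → a ≢ x° i → factor i ≡ 0ℤ
    factor-0 i ≢ = cong (ℤ._* 𝟙[ b ≟ y° i ]) (𝟙-no (a ≟ x° i) ≢)

    ∑-factors : ∑ℤ (deconcatenate c) (λ (x , y) → 𝟙[ a ≟ x ] ℤ.* 𝟙[ b ≟ y ]) ≡ factor l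
    ∑-factors = trans (∑ℤ-map (deconcatenateAt c) (upTo (suc k)) λ (x , y) → 𝟙[ a ≟ x ] ℤ.*
        𝟙[ b ≟ y ]) (cases (l ℕₚ.≤? k))
      where
      k : ℕ
      k = length (blocks C)
      onlyl : ∀ i → i ≤ k → a ≡ x° i → i ≡ l
      onlyl i i≤k e = trans (sym (ℕₚ.m≤n⇒m⊓n≡m i≤k)) (trans (sym (length-x° i))
          (cong (length ∘ code) (sym e)))
      cases : Dec (l ≤ k) → ∑ℤ (upTo (suc k)) factor ≡ factor l
      cases (yes l≤k) = trans (∑ℤ-cong (upTo (suc k)) λ i i∈ → restricted i
          (ℕₚ.≤-pred (∈-upTo⁻ i∈)) (i ℕₚ.≟ l))
        (trans (∑ℤ-pick (Uniqueₚ.upTo⁺ (suc k)) (∈-upTo⁺ (s≤s l≤k)) λ i i≢l →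
            cong (ℤ._* factor i) (𝟙-no (i ℕₚ.≟ l) i≢l))
          (trans (cong (ℤ._* factor l) (𝟙-yes (l ℕₚ.≟ l) refl)) (ℤₚ.*-identityˡ _)))
        where
        restricted : ∀ i → i ≤ k → (d : Dec (i ≡ l)) → factor i ≡ 𝟙[ d ] ℤ.* factor i
        restricted i i≤k (yes _)  = sym (ℤₚ.*-identityˡ _)
        restricted i i≤k (no i≢l) = factor-0 i λ e → i≢l (onlyl i i≤k e)
      -- If `a` has more blocks than `C`, no cut produces `a`; `factor l` vanishes as well, since
      -- `take l` yields at most `k` blocks.
      cases (no l≰k) = trans
        (∑ℤ-zero (upTo (suc k)) λ i i∈ → let i≤k = ℕₚ.≤-pred (∈-upTo⁻ i∈) in
          factor-0 i λ e → l≰k (subst (_≤ k) (onlyl i i≤k e) i≤k))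
        (sym (factor-0 l λ e → l≰k (subst (_≤ k)
          (sym (trans (cong (length ∘ code) e) (length-x° l))) (ℕₚ.m⊓n≤n l k))))

    T : Bits → ℤ
    T S = weight (deg a) (deg b) S ℤ.* 𝟙[ code c ≟ᶜ merge S (code a) (code b) ]

    T-𝟙 : ∀ S → T S ≡ 𝟙[ splits? S ]
    T-𝟙 S = go (card S ℕₚ.≟ deg a) (card (compl S) ℕₚ.≟ deg b) (code c ≟ᶜ merge S (code a) (code b))
      where
      go : ∀ {P Q R : Set} (d : Dec P) (d′ : Dec Q) (d″ : Dec R) →
           (𝟙[ d ] ℤ.* 𝟙[ d′ ]) ℤ.* 𝟙[ d″ ] ≡ 𝟙[ (d ×-dec d′) ×-dec d″ ]
      go (yes _) (yes _) (yes _) = refl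
      go (yes _) (yes _) (no _)  = refl
      go (yes _) (no _)  _       = refl
      go (no _)  (yes _) _       = refl
      go (no _)  (no _)  _       = refl

  -- Each side has at most one nonzero term. A deconcatenation with first factor `a` must cut after
  -- `l` blocks, the number of blocks of `a`, and a shuffle equal to `C` must place `a` on the union
  -- `S₀` of those blocks. The two terms are nonzero under the same condition.
  ∑-deconcatenate : ∑ℤ (deconcatenate c) (λ (x , y) → 𝟙[ a ≟ x ] ℤ.* 𝟙[ b ≟ y ]) ≡
                    ∑ℤ (shuffle a b) (λ r → 𝟙[ c ≟ r ])
  ∑-deconcatenate = trans ∑-factors (sym (cases (n ℕₚ.≟ deg a ℕ.+ deg b)))
    where
    cases : Dec (n ≡ deg a ℕ.+ deg b) → ∑ℤ (shuffle a b) (λ r → 𝟙[ c ≟ r ]) ≡ factor l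
    cases (yes e) = trans (∑-shuffle a b (λ U → 𝟙[ code c ≟ᶜ U ]))
      (trans (sym (∑-paths-weight n (deg a) (deg b) _ e))
      (trans (sym (∑-allSubsets n T))
      (trans (∑-allSubsets-pick n (T ∘ Vec.toList) S₀ λ S S≢ →
          trans (T-𝟙 (Vec.toList S)) (𝟙-no (splits? (Vec.toList S)) λ s → S≢ (splits⇒⋃ S s)))
      (trans (T-𝟙 (Vec.toList S₀))
      (trans (𝟙-⇔ (splits? (Vec.toList S₀)) (pairwise _≟_ _≟_ (a , b) (x° l , y° l))
          (λ s → let p , q = splits⇒factors s in cong₂ _,_ p q)
          (λ e → factors⇒splits (cong proj₁ e , cong proj₂ e)))
        (𝟙-pairwise _≟_ _≟_ a b (x° l) (y° l)))))))
    cases (no ≢) = trans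
      (∑ℤ-zero (shuffle a b) λ r r∈ → 𝟙-no (c ≟ r) λ { refl → ≢ (shuffle-deg a b r r∈) })
      (sym (trans (sym (𝟙-pairwise _≟_ _≟_ a b (x° l) (y° l)))
        (𝟙-no (pairwise _≟_ _≟_ (a , b) (x° l , y° l)) λ { e → ≢ (sym (trans
          (cong₂ (λ x y → deg x ℕ.+ deg y) (cong proj₁ e) (cong proj₂ e))
          (trans (cong (λ D → ∣ S₀ ∣ ℕ.+ ∣ D ∣) (⋃-take-drop C l)) (∣A∣+∣∁A∣ S₀)))) })))

deconcatenate-dual : IsDualComul deconcatenate
deconcatenate-dual a b (n , C) = ∑-deconcatenate C a b

monomialBialgebra : Combinatorial
monomialBialgebra = record
  { mul       = monomialProduct
  ; comul     = deconcatenate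
  ; mul-deg   = monomialProduct-deg
  ; comul-deg = deconcatenate-deg
  ; unitˡ     = dual-unitˡ {monomialProduct} {deconcatenate} monomialProduct-dual deconcatenate-dual
  ; unitʳ     = dual-unitʳ {monomialProduct} {deconcatenate} monomialProduct-dual deconcatenate-dual
  ; assoc     = dual-assoc {monomialProduct} {deconcatenate} monomialProduct-dual deconcatenate-dual
  ; counitˡ   = dual-counitˡ {monomialProduct} {deconcatenate} monomialProduct-dual
      deconcatenate-dual
  ; counitʳ   = dual-counitʳ {monomialProduct} {deconcatenate} monomialProduct-dual
      deconcatenate-dual
  ; coassoc   = dual-coassoc {monomialProduct} {deconcatenate} monomialProduct-dual
      deconcatenate-dual
  ; comul-𝟏   = λ f → ∑ℤ-single (λ (x , y) → f (code x) (code y)) (𝟏 , 𝟏)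
  ; compat    = dual-compat {monomialProduct} {deconcatenate} monomialProduct-dual
      deconcatenate-dual
  }
  where open Duality shuffleBialgebra

-- The Hopf algebras

∑ₗ : ∀ {M N} {A : Set} → List A → (A → M ⟶ N) → M ⟶ N
∑ₗ {M} {N} as f = lin (λ x → ∑ N as (λ a → to (f a) x)) record
  { ≈-homo = λ e → ∑-ext N as λ a → Hom.≈-homo (f a) e
  ; +-homo = λ x y → ≈ᴹ-trans (∑-ext N as λ a → Hom.+-homo (f a) x y) (∑-+ N as _ _)
  ; ·-homo = λ r x → ≈ᴹ-trans (∑-ext N as λ a → Hom.·-homo (f a) r x)
                              (≈ᴹ-sym (∑-hom (r ·ₗ idₗ {N}) as _))
  }
  where open Mod N

∑-bilinear : ∀ {M N L} {A : Set} (as : List A) {β : A → ∣ M ∣ᴹ → ∣ N ∣ᴹ → ∣ L ∣ᴹ} →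
             (∀ a → IsBilinear M N L (β a)) → IsBilinear M N L (λ x y → ∑ L as (λ a → β a x y))
∑-bilinear as b = record
  { linˡ = λ y → Hom.isLinear (∑ₗ as λ a → IsBilinear._ˡ (b a) y)
  ; linʳ = λ x → Hom.isLinear (∑ₗ as λ a → IsBilinear._ʳ (b a) x)
  }

bilinear-ext : ∀ {G} (B : Based G) {M β β′} →
  IsBilinear (G ᴹ) (G ᴹ) M β → IsBilinear (G ᴹ) (G ᴹ) M β′ →
  (∀ b c → Module._≈ᴹ_ M (β (Based.e B b) (Based.e B c)) (β′ (Based.e B b) (Based.e B c))) →
  ∀ x y → Module._≈ᴹ_ M (β x y) (β′ x y)
bilinear-ext B b b′ h x y = basis-ext (y b.ˡ) (y b′.ˡ) (λ c →
  basis-ext (e c b.ʳ) (e c b′.ʳ) (h c) y) x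
  where
  open Based B
  module b = IsBilinear b
  module b′ = IsBilinear b′

bilinearExtend-bilinear : ∀ {G H : Set} L (f : G → H → ∣ L ∣ᴹ) →
                          IsBilinear (free G) (free H) L (bilinearExtend L f)
bilinearExtend-bilinear {G} {H} L f = bilinear-flip (extend-bilinear {G} {free H} {L} {NoRelation}
  (λ t g → extend L (f g) t) (λ _ ()) (λ g → Hom.isLinear (freeₗ L (f g))))

pairing-bilinear : ∀ {M N} (f : M ⟶ ℤᴹ) (g : N ⟶ ℤᴹ) → IsBilinear M N ℤᴹ (λ x y → to f x ℤ.* to g y)
pairing-bilinear f g = bilinear-∘ {M = ℤᴹ} {ℤᴹ} {ℤᴹ} idₗ (*ₗ-bilinear ℤᴹ) f g

module _ {G : GradedModule} (B : Based G) (C : Combinatorial) where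
  open Based B
  open Combinatorial C

  private
    mulₗ : Basis → Basis → Lin Basis
    mulₗ b c = ∑ 𝒯ᴹ (mul b c) gen

    comulₗ : 𝒯ᴹ ⟶ (G ᴹ ⊗ᴹ G ᴹ)
    comulₗ = freeₗ (G ᴹ ⊗ᴹ G ᴹ) (λ b → ∑ (G ᴹ ⊗ᴹ G ᴹ) (comul b) λ (x , y) → e x ⊗ e y)

    counitₗ : 𝒯ᴹ ⟶ ℤᴹ
    counitₗ = freeₗ ℤᴹ projection₀

  -- For `NCQsym` this produces the product inside the span from the start. That the span is closed
  -- under `⋆` then follows from `isNCQsym`, which identifies the underlying series.
  operations : HopfOperations G
  operations = record
    { _∙_ = λ x y → to eₗ (bilinearExtend 𝒯ᴹ mulₗ (expand x) (expand y))
    ; 1#  = e 𝟏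
    ; δ   = to (comulₗ ∘ₗ expandₗ)
    ; ε   = to (counitₗ ∘ₗ expandₗ)
    }

  operations-realize : Realizes B C operations
  operations-realize = record
    { ∙-bilinear = bilinear-∘ eₗ (bilinearExtend-bilinear 𝒯ᴹ mulₗ) expandₗ expandₗ
    ; ∙-e        = λ b c → Module.≈ᴹ-trans (G ᴹ)
        (Hom.≈-homo eₗ (IsBilinear.cong₂′ (bilinearExtend-bilinear 𝒯ᴹ mulₗ) (expand-e b)
            (expand-e c)))
        (∑-hom eₗ (mul b c) gen)
    ; 1-e        = Module.≈ᴹ-refl (G ᴹ)
    ; δ-linear   = Hom.isLinear (comulₗ ∘ₗ expandₗ)
    ; δ-e        = λ b → Hom.≈-homo comulₗ (expand-e b)
    ; ε-linear   = Hom.isLinear (counitₗ ∘ₗ expandₗ)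
    ; ε-e        = λ b → Hom.≈-homo counitₗ (expand-e b)
    }

𝒯-based : Based 𝒯
𝒯-based = record
  { e          = gen
  ; coord      = coef
  ; coord-e    = λ b c → refl
  ; expand     = id
  ; expand-≈   = presented-ext (idₗ {𝒯ᴹ}) (freeₗ 𝒯ᴹ gen) (λ _ → ≈-refl)
  ; deg-closed = λ n → span-closed 𝒯ᴹ _
  ; deg-e      = λ (n , P) → span-gen (P , refl)
  ; deg-coord  = λ x∈ b b≢n → vanish b b≢n x∈
  }
  where
  vanish : ∀ {n} b → deg b ≢ n → ∀ {x} → GradedModule.Deg 𝒯 n x → to (coef b) x ≡ 0ℤ
  vanish b b≢n (span-gen (P , refl)) = 𝟙-no (b ≟ (_ , P)) λ { refl → b≢n refl }
  vanish b b≢n span-0                = refl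
  vanish b b≢n (span-+ p q)          = cong₂ ℤ._+_ (vanish b b≢n p) (vanish b b≢n q)
  vanish b b≢n (span-· r p)          = trans (cong (λ z → r ℤ.* z) (vanish b b≢n p)) (ℤₚ.*-zeroʳ r)
  vanish b b≢n (span-resp x≈y p)     = trans (sym (Hom.≈-homo (coef b) x≈y)) (vanish b b≢n p)

𝒯²ᴹ : ℤ-Module
𝒯²ᴹ = 𝒯ᴹ ⊗ᴹ 𝒯ᴹ

concat-realizes : Realizes 𝒯-based concatBialgebra 𝒯-concat
concat-realizes = record
  { ∙-bilinear = bilinearExtend-bilinear 𝒯ᴹ _∗̄_
  ; ∙-e        = λ b c → ≈-sym (Module.+ᴹ-identityʳ 𝒯ᴹ (b ∗̄ c))
  ; 1-e        = ≈-refl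
  ; δ-linear   = Hom.isLinear (freeₗ 𝒯²ᴹ δ̂)
  ; δ-e        = λ b → ≈-sym (∑-map 𝒯²ᴹ (unshuffleTerm b) (allSubsets (deg b)) _)
  ; ε-linear   = Hom.isLinear (freeₗ ℤᴹ projection₀)
  ; ε-e        = λ b → refl
  }

shuffleTerms-sum : ∀ b c A d d′ →
  Module._≈ᴹ_ 𝒯ᴹ (shuffleTerm b c A d d′) (∑ 𝒯ᴹ (shuffleTerms b c A d d′) gen)
shuffleTerms-sum b c A (yes _) (yes _) = ≈-sym (Module.+ᴹ-identityʳ 𝒯ᴹ _)
shuffleTerms-sum b c A (yes _) (no _)  = ≈-refl
shuffleTerms-sum b c A (no _)  (yes _) = ≈-refl
shuffleTerms-sum b c A (no _)  (no _)  = ≈-refl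

shuffle-realizes : Realizes 𝒯-based shuffleBialgebra 𝒯-shuffle
shuffle-realizes = record
  { ∙-bilinear = bilinearExtend-bilinear 𝒯ᴹ _∗̂_
  ; ∙-e        = λ b c → ≈-trans
      (∑-ext 𝒯ᴹ (allSubsets (deg b ℕ.+ deg c)) λ A →
        shuffleTerms-sum b c A (∣ A ∣ ℕₚ.≟ deg b) (∣ ∁ A ∣ ℕₚ.≟ deg c))
      (≈-sym (∑-concatMap 𝒯ᴹ (shuffleAt b c) (allSubsets (deg b ℕ.+ deg c)) gen))
  ; 1-e        = ≈-refl
  ; δ-linear   = Hom.isLinear (freeₗ 𝒯²ᴹ δ̄)
  ; δ-e        = λ b → ≈-sym (∑-map 𝒯²ᴹ (cutAt b) (upTo (suc (deg b))) _)
  ; ε-linear   = Hom.isLinear (freeₗ ℤᴹ projection₀)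
  ; ε-e        = λ b → refl
  }

-- Passing to complements permutes the subsets of `[n]` and swaps the two tensor factors.
concat-cocommutative : IsCocommutative 𝒯-concat
concat-cocommutative = Based.basis-ext 𝒯-based (swapₗ ∘ₗ freeₗ 𝒯²ᴹ δ̂) (freeₗ 𝒯²ᴹ δ̂) λ b →
  ≈-trans (Hom.≈-homo swapₗ (Realizes.δ-e concat-realizes b))
  (≈-trans (∑-hom swapₗ (unshuffle b) (λ (x , y) → gen x ⊗ gen y))
  (≈-trans (Separation.sums-agree (pairwise _≟_ _≟_) 𝒯²ᴹ (λ (x , y) → gen x ⊗ gen y)
      (unshuffle b) (unshuffle b) {λ (x , y) → gen (y , x)} {gen} (exchange b))
    (≈-sym (Realizes.δ-e concat-realizes b))))
  where
  swapₗ : 𝒯²ᴹ ⟶ 𝒯²ᴹ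
  swapₗ = IsBilinear.⊗-elim (bilinear-flip (⊗-bilinear 𝒯ᴹ 𝒯ᴹ))
  exchange : ∀ b (p : Basis × Basis) →
    ∑ℤ (unshuffle b) (λ (x , y) → 𝟙[ pairwise _≟_ _≟_ p (y , x) ]) ≡
    ∑ℤ (unshuffle b) (λ (x , y) → 𝟙[ pairwise _≟_ _≟_ p (x , y) ])
  exchange b (p , q) = trans (∑-unshuffle b (λ U V → kronecker V U))
    (trans (∑-compl (deg b) λ A B → kronecker (restrict B (code b)) (restrict A (code b)))
      (sym (∑-unshuffle b kronecker)))
    where
    kronecker : List Bits → List Bits → ℤ
    kronecker U V = 𝟙[ (code p ≟ᶜ U) ×-dec (code q ≟ᶜ V) ]

-- The Hopf algebra of quasi-symmetric functions in non-commuting variables and its graded dual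

evaluate : List ℕ → seriesModule ⟶ ℤᴹ
evaluate w = lin (λ f → f w) record { ≈-homo = λ e → e w ; +-homo = λ _ _ → refl ; ·-homo =
    λ _ _ → refl }

underlying : NCQsymᴹ ⟶ seriesModule
underlying = lin proj₁ record { ≈-homo = id ; +-homo = λ _ _ _ → refl ; ·-homo = λ _ _ _ → refl }

M-word-𝟙 : ∀ b c → M (proj₂ c) (word b) ≡ 𝟙[ b ≟ c ]
M-word-𝟙 b c = trans (M-pack c (word b)) (trans (cong (λ d → 𝟙[ c ≟ d ]) (pack-word b)) (𝟙-sym c b))

NCQsym-based : Based NCQsym
NCQsym-based = record
  { e          = monomial
  ; coord      = λ b → evaluate (word b) ∘ₗ underlying
  ; coord-e    = M-word-𝟙
  ; expand     = λ (f , p) → expand p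
  ; expand-≈   = λ (f , p) → expand-≈ p
  ; deg-closed = λ n → record
    { ≈-in = λ e p → span-resp e p ; 0-in = span-0
    ; +-in = λ p q → span-+ p q ; ·-in = λ r p → span-· r p }
  ; deg-e      = λ (n , P) → span-gen (P , refl)
  ; deg-coord  = λ x∈ b b≢n → vanish b b≢n x∈
  }
  where
  -- An element of the span carries a derivation, from which a combination of monomials is read off.
  -- Two derivations of the same series give congruent combinations by `expandₗ`.
  expand : ∀ {f} → Span seriesModule IsMonomial f → Lin Basis
  expand (span-gen (n , P , _)) = gen (n , P)
  expand span-0                 = 𝟎
  expand (span-+ p q)           = expand p ⊞ expand q
  expand (span-· r p)           = r · expand p
  expand (span-resp _ p)        = expand p

  expand-≈ : ∀ {f} (p : Span seriesModule IsMonomial f) →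
             ∀ w → f w ≡ proj₁ (extend NCQsymᴹ monomial (expand p)) w
  expand-≈ (span-gen (n , P , refl)) w = refl
  expand-≈ span-0                    w = refl
  expand-≈ (span-+ p q)              w = cong₂ ℤ._+_ (expand-≈ p w) (expand-≈ q w)
  expand-≈ (span-· r p)              w = cong (λ z → r ℤ.* z) (expand-≈ p w)
  expand-≈ (span-resp e p)           w = trans (sym (e w)) (expand-≈ p w)

  vanish : ∀ {n} b → deg b ≢ n → ∀ {f} →
           Span seriesModule (λ g → Σ[ P ∈ Comp n ] g ≡ M P) f → f (word b) ≡ 0ℤ
  vanish b b≢n (span-gen (P , refl)) = trans (M-word-𝟙 b (_ , P)) (𝟙-no (b ≟ (_ , P)) λ { refl →
      b≢n refl })
  vanish b b≢n span-0                = refl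
  vanish b b≢n (span-+ p q)          = cong₂ ℤ._+_ (vanish b b≢n p) (vanish b b≢n q)
  vanish b b≢n (span-· r p)          = trans (cong (λ z → r ℤ.* z) (vanish b b≢n p)) (ℤₚ.*-zeroʳ r)
  vanish b b≢n (span-resp e p)       = trans (sym (e (word b))) (vanish b b≢n p)

module N where
  open Based NCQsym-based public

opaque
  -- Opaque: from here on the operations are known through `NCQsym-realizes` only.
  NCQsym-operations : HopfOperations NCQsym
  NCQsym-operations = operations NCQsym-based monomialBialgebra

  NCQsym-realizes : Realizes NCQsym-based monomialBialgebra NCQsym-operations
  NCQsym-realizes = operations-realize NCQsym-based monomialBialgebra

⋆-bilinear : IsBilinear seriesModule seriesModule seriesModule _⋆_
⋆-bilinear = record
  { linˡ = λ g → record
    { ≈-homo = λ e w → IsLinear.≈-homo (linˡ g w) e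
    ; +-homo = λ f f′ w → IsLinear.+-homo (linˡ g w) f f′
    ; ·-homo = λ r f w → IsLinear.·-homo (linˡ g w) r f }
  ; linʳ = λ f → record
    { ≈-homo = λ e w → IsLinear.≈-homo (linʳ f w) e
    ; +-homo = λ g g′ w → IsLinear.+-homo (linʳ f w) g g′
    ; ·-homo = λ r g w → IsLinear.·-homo (linʳ f w) r g }
  }
  where
  coefficient : ∀ w → IsBilinear seriesModule seriesModule ℤᴹ (λ f g → (f ⋆ g) w)
  coefficient w = ∑-bilinear (upTo (suc (length w))) λ i →
    pairing-bilinear (evaluate (take i w)) (evaluate (drop i w))
  linˡ : ∀ g w → IsLinear seriesModule ℤᴹ (λ f → (f ⋆ g) w)
  linˡ g w = IsBilinear.linˡ (coefficient w) g
  linʳ : ∀ f w → IsLinear seriesModule ℤᴹ (λ g → (f ⋆ g) w)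
  linʳ f w = IsBilinear.linʳ (coefficient w) f

isNCQsym : IsNCQsym NCQsym-operations
isNCQsym = record
  { product   = bilinear-ext NCQsym-based
      (bilinear-∘ underlying (Realizes.∙-bilinear NCQsym-realizes) idₗ idₗ)
      (bilinear-∘ idₗ ⋆-bilinear underlying underlying) onBasis
  ; coproduct = λ {n} P → ≈-trans (Realizes.δ-e NCQsym-realizes (n , P))
      (∑-map (NCQsymᴹ ⊗ᴹ NCQsymᴹ) (deconcatenateAt (n , P)) (upTo (suc (length (blocks P))))
        λ (x , y) → monomial x ⊗ monomial y)
  }
  where
  open HopfOperations NCQsym-operations
  onBasis : ∀ b c w → proj₁ (monomial b ∙ monomial c) w ≡ (M (proj₂ b) ⋆ M (proj₂ c)) w
  onBasis b c w = begin
    proj₁ (monomial b ∙ monomial c) w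
      ≡⟨ Realizes.∙-e NCQsym-realizes b c w ⟩
    proj₁ (∑ NCQsymᴹ (monomialProduct b c) monomial) w
      ≡⟨ ∑ℤ-hom (evaluate w ∘ₗ underlying) (monomialProduct b c) monomial ⟩
    ∑ℤ (monomialProduct b c) (λ r → M (proj₂ r) w)
      ≡⟨ ∑ℤ-ext (monomialProduct b c) (λ r → trans (M-pack r w) (𝟙-sym r (pack w))) ⟩
    ∑ℤ (monomialProduct b c) (λ r → 𝟙[ pack w ≟ r ])
      ≡⟨ monomialProduct-dual b c (pack w) ⟩
    ∑ℤ (cut (pack w)) (λ (x , y) → 𝟙[ b ≟ x ] ℤ.* 𝟙[ c ≟ y ])
      ≡⟨ ∑-⋆ b c w ⟨
    (M (proj₂ b) ⋆ M (proj₂ c)) w ∎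
    where open ≡-Reasoning

Dual : GradedModule
Dual = gradedDual NCQsym

Dualᴹ : ℤ-Module
Dualᴹ = dualModule NCQsym

W : Basis → Functional NCQsym
W b = functional (to (N.coord b)) (Hom.linear (N.coord b))
  -- `W b` takes the value 1 in degree `deg b`, so vanishing can be claimed only from the next
  -- degree on.
  (suc (deg b) , λ n b<n x x∈ → N.deg-coord {n} {x} x∈ b (ℕₚ.<⇒≢ b<n))

applyₗ : Functional NCQsym → NCQsymᴹ ⟶ ℤᴹ
applyₗ φ = lin (φ ⟨_⟩) (fromLinear NCQsymᴹ ℤᴹ (Functional.isLinear φ))

evaluateAt : ∣ NCQsymᴹ ∣ᴹ → Dualᴹ ⟶ ℤᴹ
evaluateAt x = lin (_⟨ x ⟩) record { ≈-homo = λ e → e x ; +-homo = λ _ _ → refl ; ·-homo = λ _ _ → refl }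

Dual-based : Based Dual
Dual-based = record
  { e          = W
  ; coord      = λ b → evaluateAt (monomial b)
  ; coord-e    = λ b c → trans (M-word-𝟙 c b) (𝟙-sym c b)
  ; expand     = expand
  ; expand-≈   = λ φ → N.basis-ext (applyₗ φ) (applyₗ (extend Dualᴹ W (expand φ))) (onBasis φ)
  ; deg-closed = λ n → record
    { ≈-in = λ e p m m≢n x x∈ → trans (sym (e x)) (p m m≢n x x∈)
    ; 0-in = λ _ _ _ _ → refl
    ; +-in = λ p q m m≢n x x∈ → cong₂ ℤ._+_ (p m m≢n x x∈) (q m m≢n x x∈)
    ; ·-in = λ r p m m≢n x x∈ → trans (cong (λ z → r ℤ.* z) (p m m≢n x x∈)) (ℤₚ.*-zeroʳ r)
    }
  ; deg-e      = λ b m m≢b x x∈ → N.deg-coord {m} {x} x∈ b (m≢b ∘ sym)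
  ; deg-coord  = λ φ∈ b b≢n → φ∈ (deg b) b≢n (monomial b) (N.deg-e b)
  }
  where
  -- The bound of `φ` makes the sum finite: monomials missing from the list have a degree in which
  -- `φ` vanishes.
  expand : Functional NCQsym → Lin Basis
  expand φ = ∑ 𝒯ᴹ (basisUpTo (proj₁ (Functional.bounded φ))) (λ b → φ ⟨ monomial b ⟩ · gen b)

  onBasis : ∀ φ c → φ ⟨ monomial c ⟩ ≡ extend Dualᴹ W (expand φ) ⟨ monomial c ⟩
  onBasis φ c = sym (trans
    (∑ℤ-hom (evaluateAt (monomial c) ∘ₗ freeₗ Dualᴹ W) (basisUpTo N) (λ b → φ ⟨ monomial b ⟩ · gen b))
    (trans (∑ℤ-ext (basisUpTo N) λ b → cong (λ z → φ ⟨ monomial b ⟩ ℤ.* z) (M-word-𝟙 b c))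
      (cases (N ℕₚ.≤? deg c))))
    where
    N : ℕ
    N = proj₁ (Functional.bounded φ)
    other : ∀ b → b ≢ c → φ ⟨ monomial b ⟩ ℤ.* 𝟙[ b ≟ c ] ≡ 0ℤ
    other b b≢c = trans (cong (λ z → φ ⟨ monomial b ⟩ ℤ.* z) (𝟙-no (b ≟ c) b≢c))
        (ℤₚ.*-zeroʳ (φ ⟨ monomial b ⟩))
    cases : Dec (N ≤ deg c) → ∑ℤ (basisUpTo N) (λ b → φ ⟨ monomial b ⟩ ℤ.* 𝟙[ b ≟ c ]) ≡
        φ ⟨ monomial c ⟩
    cases (yes N≤) = trans (∑ℤ-zero (basisUpTo N) λ b _ → each b (b ≟ c)) (sym vanish)
      where
      vanish : φ ⟨ monomial c ⟩ ≡ 0ℤ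
      vanish = proj₂ (Functional.bounded φ) (deg c) N≤ (monomial c) (N.deg-e c)
      -- `basisUpTo N` includes degree `N`, so `c` may be listed; its coefficient is 0.
      each : ∀ b → Dec (b ≡ c) → φ ⟨ monomial b ⟩ ℤ.* 𝟙[ b ≟ c ] ≡ 0ℤ
      each b (yes refl) = cong (ℤ._* 𝟙[ c ≟ c ]) vanish
      each b (no b≢c)   = other b b≢c
    cases (no N≰) = trans (∑ℤ-pick (basisUpTo-unique N) (∈-basisUpTo c (ℕₚ.<⇒≤ (ℕₚ.≰⇒> N≰))) other)
      (trans (cong (λ z → φ ⟨ monomial c ⟩ ℤ.* z) (𝟙-yes (c ≟ c) refl)) (ℤₚ.*-identityʳ _))

opaque
  -- The dual receives the structure constants of `(∗̂ , δ̄)` outright; that they are the transposes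
  -- of those of `NCQsym` is `isGradedDual`. The isomorphism with `𝒯` then only has to match bases.
  Dual-operations : HopfOperations Dual
  Dual-operations = operations Dual-based shuffleBialgebra

  Dual-realizes : Realizes Dual-based shuffleBialgebra Dual-operations
  Dual-realizes = operations-realize Dual-based shuffleBialgebra

-- Transposed operations and the isomorphism

module _ {G : GradedModule} {B : Based G} {C : Combinatorial}
         {A : HopfOperations G} (R : Realizes B C A)
         {G° : GradedModule} {B° : Based G°} {C° : Combinatorial}
         {A° : HopfOperations G°} (R° : Realizes B° C° A°)
         {⟪_,_⟫ : ∣ G° ᴹ ∣ᴹ → ∣ G ᴹ ∣ᴹ → ℤ} (pairing : IsBilinear (G° ᴹ) (G ᴹ) ℤᴹ ⟪_,_⟫)
         (dual-bases : ∀ b c → ⟪ Based.e B° b , Based.e B c ⟫ ≡ 𝟙[ b ≟ c ])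
         where
  private
    module A = HopfOperations A
    module A° = HopfOperations A°
    module B = Based B
    module B° = Based B°
    module C = Combinatorial C
    module C° = Combinatorial C°
    module R = Realizes R
    module R° = Realizes R°
    module HA = HopfAlgebra R
    module HA° = HopfAlgebra R°
    module P = IsBilinear pairing

  1-transpose : ∀ x → ⟪ A°.1# , x ⟫ ≡ A.ε x
  1-transpose = B.basis-ext (A°.1# P.ʳ) HA.εₗ λ b → trans (Hom.≈-homo (B.e b P.ˡ) R°.1-e)
    (trans (dual-bases 𝟏 b) (sym (trans (R.ε-e b) (projection₀-𝟙 b))))

  ε-transpose : ∀ φ → A°.ε φ ≡ ⟪ φ , A.1# ⟫
  ε-transpose = B°.basis-ext HA°.εₗ (A.1# P.ˡ) λ b → trans (R°.ε-e b) (trans (projection₀-𝟙 b)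
    (trans (𝟙-sym 𝟏 b) (sym (trans (Hom.≈-homo (B°.e b P.ʳ) R.1-e) (dual-bases b 𝟏)))))

  module _ (dc : ∀ a b c → ∑ℤ (C.comul c) (λ (x , y) → 𝟙[ a ≟ x ] ℤ.* 𝟙[ b ≟ y ]) ≡
                           ∑ℤ (C°.mul a b) (λ r → 𝟙[ c ≟ r ])) where

    private
      -- Both sides are bilinear in `φ` and `ψ`, so basis elements suffice; on these the pairing
      -- yields indicators, and `dc` compares the multiplicities.
      product-pairing : ∀ c φ ψ → ⟪ φ A°.∙ ψ , B.e c ⟫ ≡
        ∑ ℤᴹ (C.comul c) (λ (x , y) → ⟪ φ , B.e x ⟫ ℤ.* ⟪ ψ , B.e y ⟫)
      product-pairing c = bilinear-ext B°
        (bilinear-∘ (B.e c P.ˡ) R°.∙-bilinear idₗ idₗ)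
        (∑-bilinear (C.comul c) λ (x , y) → pairing-bilinear (B.e x P.ˡ) (B.e y P.ˡ)) λ a b → begin
        ⟪ B°.e a A°.∙ B°.e b , B.e c ⟫
          ≡⟨ Hom.≈-homo (B.e c P.ˡ) (R°.∙-e a b) ⟩
        ⟪ ∑ (G° ᴹ) (C°.mul a b) B°.e , B.e c ⟫
          ≡⟨ ∑ℤ-hom (B.e c P.ˡ) (C°.mul a b) B°.e ⟩
        ∑ℤ (C°.mul a b) (λ r → ⟪ B°.e r , B.e c ⟫)
          ≡⟨ ∑ℤ-ext (C°.mul a b) (λ r → trans (dual-bases r c) (𝟙-sym r c)) ⟩
        ∑ℤ (C°.mul a b) (λ r → 𝟙[ c ≟ r ])
          ≡⟨ dc a b c ⟨
        ∑ℤ (C.comul c) (λ (x , y) → 𝟙[ a ≟ x ] ℤ.* 𝟙[ b ≟ y ])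
          ≡⟨ ∑ℤ-ext (C.comul c) (λ (x , y) → cong₂ ℤ._*_ (dual-bases a x) (dual-bases b y)) ⟨
        ∑ℤ (C.comul c) (λ (x , y) → ⟪ B°.e a , B.e x ⟫ ℤ.* ⟪ B°.e b , B.e y ⟫)
          ≡⟨ ∑ℤ-≡ (C.comul c) {λ (x , y) → ⟪ B°.e a , B.e x ⟫ ℤ.* ⟪ B°.e b , B.e y ⟫} ⟨
        ∑ ℤᴹ (C.comul c) (λ (x , y) → ⟪ B°.e a , B.e x ⟫ ℤ.* ⟪ B°.e b , B.e y ⟫) ∎
        where open ≡-Reasoning

    ∙-transpose : ∀ φ ψ x → ⟪ φ A°.∙ ψ , x ⟫ ≡ extend ℤᴹ (λ (y , z) → ⟪ φ , y ⟫ ℤ.* ⟪ ψ , z ⟫) (A.δ x)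
    ∙-transpose φ ψ = B.basis-ext ((φ A°.∙ ψ) P.ʳ)
      (IsBilinear.⊗-elim (pairing-bilinear (φ P.ʳ) (ψ P.ʳ)) ∘ₗ HA.δₗ) λ c →
      trans (product-pairing c φ ψ) (sym (HA.⊗-elim-δ (pairing-bilinear (φ P.ʳ) (ψ P.ʳ)) c))

  module _ (dm : ∀ a b c → ∑ℤ (C.mul a b) (λ r → 𝟙[ c ≟ r ]) ≡
                           ∑ℤ (C°.comul c) (λ (x , y) → 𝟙[ a ≟ x ] ℤ.* 𝟙[ b ≟ y ])) where

    private
      coproduct-pairing : ∀ c x y →
        ∑ ℤᴹ (C°.comul c) (λ (s , t) → ⟪ B°.e s , x ⟫ ℤ.* ⟪ B°.e t , y ⟫) ≡ ⟪ B°.e c , x A.∙ y ⟫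
      coproduct-pairing c = bilinear-ext B
        (∑-bilinear (C°.comul c) λ (s , t) → pairing-bilinear (B°.e s P.ʳ) (B°.e t P.ʳ))
        (bilinear-∘ (B°.e c P.ʳ) R.∙-bilinear idₗ idₗ) λ a b → begin
        ∑ ℤᴹ (C°.comul c) (λ (s , t) → ⟪ B°.e s , B.e a ⟫ ℤ.* ⟪ B°.e t , B.e b ⟫)
          ≡⟨ ∑ℤ-≡ (C°.comul c) {λ (s , t) → ⟪ B°.e s , B.e a ⟫ ℤ.* ⟪ B°.e t , B.e b ⟫} ⟩
        ∑ℤ (C°.comul c) (λ (s , t) → ⟪ B°.e s , B.e a ⟫ ℤ.* ⟪ B°.e t , B.e b ⟫)
          ≡⟨ ∑ℤ-ext (C°.comul c) (λ (s , t) → cong₂ ℤ._*_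
               (trans (dual-bases s a) (𝟙-sym s a)) (trans (dual-bases t b) (𝟙-sym t b))) ⟩
        ∑ℤ (C°.comul c) (λ (s , t) → 𝟙[ a ≟ s ] ℤ.* 𝟙[ b ≟ t ])
          ≡⟨ dm a b c ⟨
        ∑ℤ (C.mul a b) (λ r → 𝟙[ c ≟ r ])
          ≡⟨ ∑ℤ-ext (C.mul a b) (dual-bases c) ⟨
        ∑ℤ (C.mul a b) (λ r → ⟪ B°.e c , B.e r ⟫)
          ≡⟨ ∑ℤ-hom (B°.e c P.ʳ) (C.mul a b) B.e ⟨
        ⟪ B°.e c , ∑ (G ᴹ) (C.mul a b) B.e ⟫
          ≡⟨ Hom.≈-homo (B°.e c P.ʳ) (R.∙-e a b) ⟨
        ⟪ B°.e c , B.e a A.∙ B.e b ⟫ ∎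
        where open ≡-Reasoning

    δ-transpose : ∀ φ x y →
      extend ℤᴹ (λ (ψ , χ) → ⟪ ψ , x ⟫ ℤ.* ⟪ χ , y ⟫) (A°.δ φ) ≡ ⟪ φ , x A.∙ y ⟫
    δ-transpose φ x y = B°.basis-ext
      (IsBilinear.⊗-elim (pairing-bilinear (x P.ˡ) (y P.ˡ)) ∘ₗ HA°.δₗ) ((x A.∙ y) P.ˡ) (λ c →
      trans (HA°.⊗-elim-δ (pairing-bilinear (x P.ˡ) (y P.ˡ)) c) (coproduct-pairing c x y)) φ

application-bilinear : IsBilinear Dualᴹ NCQsymᴹ ℤᴹ _⟨_⟩
application-bilinear = record
  { linˡ = λ x → Hom.isLinear (evaluateAt x) ; linʳ = λ φ → Hom.isLinear (applyₗ φ) }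

isGradedDual : IsGradedDual NCQsym-operations Dual-operations
isGradedDual = record
  { ∙-transpose = ∙-transpose NCQsym-realizes Dual-realizes application-bilinear M-word-𝟙
      deconcatenate-dual
  ; δ-transpose = δ-transpose NCQsym-realizes Dual-realizes application-bilinear M-word-𝟙
      monomialProduct-dual
  ; 1-transpose = 1-transpose NCQsym-realizes Dual-realizes application-bilinear M-word-𝟙
  ; ε-transpose = ε-transpose NCQsym-realizes Dual-realizes application-bilinear M-word-𝟙
  }

isDualBasis : IsDualBasis W
isDualBasis = (λ b → trans (M-word-𝟙 b b) (𝟙-yes (b ≟ b) refl)) ,
              (λ b c b≢c → trans (M-word-𝟙 b c) (𝟙-no (b ≟ c) b≢c))

module _ {C : Combinatorial} {A : HopfOperations 𝒯} (R : Realizes 𝒯-based C A)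
         {G : GradedModule} {B : Based G}
         {A′ : HopfOperations G} (R′ : Realizes B C A′) where
  open Combinatorial C
  private
    module R = Realizes R
    module R′ = Realizes R′
    module B = Based B
    module T = Based 𝒯-based
    module HA = HopfAlgebra R
    module HA′ = HopfAlgebra R′
    module H = Mod (G ᴹ)
    module H² = Mod (G ᴹ ⊗ᴹ G ᴹ)

    eₗ⊗eₗ : 𝒯²ᴹ ⟶ (G ᴹ ⊗ᴹ G ᴹ)
    eₗ⊗eₗ = tensorₗ {G ᴹ} {G ᴹ} {𝒯ᴹ} {𝒯ᴹ} B.eₗ B.eₗ

  -- Both sides realize the same structure constants on corresponding bases, so every homomorphism
  -- law can be compared on generators. Coordinates give injectivity and `expand` gives preimages.
  basis-isomorphism : IsHopfIsomorphism A A′ (extend (G ᴹ) B.e)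
  basis-isomorphism = record
    { isModuleIsomorphism = record
      { isModuleMonomorphism = record
        { isModuleHomomorphism = Hom.linear B.eₗ
        ; injective = λ {s} {t} p → coef-separates s t λ b →
            trans (sym (B.coord-eₗ b s)) (trans (Hom.≈-homo (B.coord b) p) (B.coord-eₗ b t))
        }
      ; surjective = λ x → B.expand x , λ s≈ → H.≈ᴹ-trans (Hom.≈-homo B.eₗ s≈)
          (H.≈ᴹ-sym (B.expand-≈ x))
      }
    ; deg-homo = λ n → T.deg-ind (B.deg-closed n) B.eₗ λ { b refl → B.deg-e b }
    ; ∙-homo   = bilinear-ext 𝒯-based
        (bilinear-∘ B.eₗ R.∙-bilinear idₗ idₗ) (bilinear-∘ idₗ R′.∙-bilinear B.eₗ B.eₗ) λ b c →
        H.≈ᴹ-trans (Hom.≈-homo B.eₗ (R.∙-e b c))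
          (H.≈ᴹ-trans (∑-hom B.eₗ (mul b c) gen) (H.≈ᴹ-sym (R′.∙-e b c)))
    ; 1-homo   = H.≈ᴹ-trans (Hom.≈-homo B.eₗ R.1-e) (H.≈ᴹ-sym R′.1-e)
    ; δ-homo   = T.basis-ext (eₗ⊗eₗ ∘ₗ HA.δₗ) (HA′.δₗ ∘ₗ B.eₗ) λ b →
        H².≈ᴹ-trans (Hom.≈-homo eₗ⊗eₗ (R.δ-e b))
          (H².≈ᴹ-trans (∑-hom eₗ⊗eₗ (comul b) (λ (x , y) → gen x ⊗ gen y)) (H².≈ᴹ-sym (R′.δ-e b)))
    ; ε-homo   = T.basis-ext (HA′.εₗ ∘ₗ B.eₗ) HA.εₗ λ b → trans (R′.ε-e b) (sym (R.ε-e b))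
    }

theorem2p8 :
    (IsGradedConnectedHopfAlgebra 𝒯-concat × IsCocommutative 𝒯-concat)
    × (IsGradedConnectedHopfAlgebra 𝒯-shuffle
      × (Σ[ N ∈ HopfOperations NCQsym ]
          (IsNCQsym N × IsGradedConnectedHopfAlgebra N
          × (Σ[ D ∈ HopfOperations (gradedDual NCQsym) ]
              (IsGradedDual N D × IsGradedConnectedHopfAlgebra D
              × (Σ[ W ∈ (Basis → Functional NCQsym) ]
                  (IsDualBasis W
                  × IsHopfIsomorphism 𝒯-shuffle D (extend (dualModule NCQsym) W))))))))
theorem2p8 =
  (HopfAlgebra.isGradedConnectedHopfAlgebra concat-realizes , concat-cocommutative) ,
  HopfAlgebra.isGradedConnectedHopfAlgebra shuffle-realizes ,
  NCQsym-operations , isNCQsym , HopfAlgebra.isGradedConnectedHopfAlgebra NCQsym-realizes ,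
  Dual-operations , isGradedDual , HopfAlgebra.isGradedConnectedHopfAlgebra Dual-realizes ,
  W , isDualBasis , basis-isomorphism shuffle-realizes Dual-realizes
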